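{- For each integer $s$ with $5 \le s \le 9$, there are no nontrivial tight $2s$-designs.
   Context: A $t$-$(v,k,\lambda)$ design (with $v\ge k\ge t$ positive integers and $\lambda\ge 0$ an integer) is a pair $(V,\mathcal B)$ where $V$ is a $v$-set and $\mathcal B$ is a collection of $k$-subsets of $V$ (blocks) such that every $t$-subset of $V$ is contained in exactly $\lambda$ blocks. For a positive integer $s$, a tight $2s$-design is a $2s$-$(v,k,\lambda)$ design with $v \ge k+s$ having exactly $\binom{v}{s}$ blocks. It is trivial if $v=k+s$ (all $k$-subsets are blocks) and nontrivial if $v>k+s$. -}

module Defs where

open import Data.Nat using (ℕ; _+_; _*_; _≤_; _<_)
open import Data.Nat.Combinatorics using (_C_)
open import Data.Fin.Subset using (Subset; _⊆_; ∣_∣)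
open import Data.Fin.Subset.Properties using (_⊆?_)
open import Data.List using (List; length; filter)
open import Data.List.Relation.Unary.All using (All)
open import Relation.Binary.PropositionalEquality using (_≡_)
open import Data.Product using (_×_)

-- The point set V is Fin v; subsets of V are 'Subset v'.
-- The block collection is a list of subsets (a multiset: repeated blocks allowed).

blocksContaining : {v : ℕ} → Subset v → List (Subset v) → ℕ
blocksContaining T ℬ = length (filter (T ⊆?_) ℬ)

record IsDesign (t v k λ' : ℕ) (ℬ : List (Subset v)) : Set where
  field
    t-pos      : 1 ≤ t
    t≤k        : t ≤ k
    k≤v        : k ≤ v
    blockSize  : All (λ B → ∣ B ∣ ≡ k) ℬ
    balanced   : (T : Subset v) → ∣ T ∣ ≡ t → blocksContaining T ℬ ≡ λ'

record IsTightDesign (s v k λ' : ℕ) (ℬ : List (Subset v)) : Set where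
  field
    s-pos     : 1 ≤ s
    design    : IsDesign (2 * s) v k λ' ℬ
    v≥k+s     : k + s ≤ v
    numBlocks : length ℬ ≡ v C s

IsNontrivialTightDesign : (s v k λ' : ℕ) → List (Subset v) → Set
IsNontrivialTightDesign s v k λ' ℬ = IsTightDesign s v k λ' ℬ × (k + s < v)

module Submission where

-- Put a = k - s, b = v - k - s, N = a + b + 1 and Q = (a+1)(b+1). Counting shows that Σ_B ŷ(d_B) g(d_B) = ŷ(0) g(0) for all g of
-- degree at most s, where d_B is the number of points of a fixed block missing from B and ŷ is an explicit polynomial of degree s.
-- With g = ŷ all distances d_B ≠ 0 are roots of ŷ; there are at least s different ones, because m < s distances would give
-- C(v,m) blocks. So ŷ has s integral roots, and comparing coefficients, N(N+1)…(N+j-1) divides C(s,j) Π_{i≤j} (a+i)(b+i).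
-- Let ϑ = Q²/(N²(N+2)). If ϑ is below a bound ϑ₀ depending on s, the divisibility conditions for j = 1, 2 leave a finite search.
-- If ϑ ≥ ϑ₀, the roots are approximately those of a Hermite polynomial, scaled by a multiple of √ϑ, around
-- a centre which differs by less than a constant for different pairs of roots: sign tests at rational points locate the half sums of
-- opposite roots in windows too narrow for the differences of the half sums to be the integers or half integers they have to be.
-- For |b - a| ≤ 1 the windows degenerate, but then divisibility alone suffices.

-- The roots move with two unbounded parameters, so nothing can be tabulated for large ϑ. Two facts
-- make that range finite. Since `ŷ` splits over ℤ, opposite signs at two rational points already
-- yield an integral root between them, without continuity. And a sign valid throughout the region
-- follows once the value is a polynomial with nonnegative integral coefficients in variables that
-- are nonnegative there, which evaluation decides.
--
-- The parameter behind the windows is ρ = 1 - 4Q/(N(N+2)) = ((b-a)² - 1)/(N(N+2)). For |b - a| = 1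
-- the polynomial is symmetric about the mean of its roots and ρ = 0; otherwise the half sums of
-- opposite roots leave the mean by amounts of order ρ that depend on the pair. All centres are
-- therefore placed at mean + cρ with numerical c: as 0 < ρ < 1, half sums in disjoint windows
-- differ by more than 0 and by less than the spread of the numbers c. For s = 6 this spread exceeds
-- one half, and the integrality of six times the mean has to help.
--
-- `ŷ` is set up for every degree m ≤ s because the count of distances uses the kernels of lower
-- degree as well.

module Rationals where
  open import Data.Nat as ℕ using (ℕ; zero; suc)
  open import Data.Integer as ℤ using (ℤ; +_)
  import Data.Integer.Properties as ℤₚ
  open import Data.Rational as ℚ using (ℚ; 0ℚ; 1ℚ; _+_; _*_; -_; _-_; _≤_; _<_)
  import Data.Rational.Properties as ℚₚ
  open import Data.Rational.Unnormalised as ℚᵘ using (mkℚᵘ; *≡*)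
  import Data.Rational.Unnormalised.Properties as ℚᵘₚ
  open import Data.Rational.Solver using (module +-*-Solver)
  open import Relation.Binary.PropositionalEquality

  abstract
    -- Opaque, so that type checking never unfolds the normalisation of the fraction by a gcd;
    -- elsewhere the embedding is known only through the lemmas of this block.
    ι : ℤ → ℚ
    ι i = i ℚ./ 1

    ι≃ : ∀ i → ℚ.toℚᵘ (ι i) ℚᵘ.≃ mkℚᵘ i 0
    ι≃ i = ℚₚ.toℚᵘ-fromℚᵘ (mkℚᵘ i 0)

    ι-+ : ∀ i j → ι (i ℤ.+ j) ≡ ι i + ι j
    ι-+ i j = ℚₚ.toℚᵘ-injective (ℚᵘₚ.≃-trans (ι≃ (i ℤ.+ j)) (ℚᵘₚ.≃-sym
      (ℚᵘₚ.≃-trans (ℚₚ.toℚᵘ-homo-+ (ι i) (ι j)) (ℚᵘₚ.≃-trans (ℚᵘₚ.+-cong (ι≃ i) (ι≃ j))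
        (*≡* (cong (ℤ._* ℤ.1ℤ) (cong₂ ℤ._+_ (ℤₚ.*-identityʳ i) (ℤₚ.*-identityʳ j))))))))

    ι-* : ∀ i j → ι (i ℤ.* j) ≡ ι i * ι j
    ι-* i j = ℚₚ.toℚᵘ-injective (ℚᵘₚ.≃-trans (ι≃ (i ℤ.* j)) (ℚᵘₚ.≃-sym
      (ℚᵘₚ.≃-trans (ℚₚ.toℚᵘ-homo-* (ι i) (ι j)) (ℚᵘₚ.≃-trans (ℚᵘₚ.*-cong (ι≃ i) (ι≃ j)) ℚᵘₚ.≃-refl))))

    ι-neg : ∀ i → ι (ℤ.- i) ≡ - ι i
    ι-neg i = ℚₚ.toℚᵘ-injective (ℚᵘₚ.≃-trans (ι≃ (ℤ.- i)) (ℚᵘₚ.≃-sym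
      (ℚᵘₚ.≃-trans (ℚₚ.toℚᵘ-homo‿- (ι i)) (ℚᵘₚ.-‿cong (ι≃ i)))))

    ι-mono-≤ : ∀ {i j} → i ℤ.≤ j → ι i ≤ ι j
    ι-mono-≤ {i} {j} p = ℚₚ.toℚᵘ-cancel-≤ (ℚᵘₚ.≤-respˡ-≃ (ℚᵘₚ.≃-sym (ι≃ i)) (ℚᵘₚ.≤-respʳ-≃ (ℚᵘₚ.≃-sym (ι≃ j))
      (ℚᵘ.*≤* (ℤₚ.*-monoʳ-≤-nonNeg ℤ.1ℤ p))))

    ι-cancel-≤ : ∀ {i j} → ι i ≤ ι j → i ℤ.≤ j
    ι-cancel-≤ {i} {j} p = ℤₚ.*-cancelʳ-≤-pos i j ℤ.1ℤ
      (ℚᵘₚ.drop-*≤* (ℚᵘₚ.≤-respˡ-≃ (ι≃ i) (ℚᵘₚ.≤-respʳ-≃ (ι≃ j) (ℚₚ.toℚᵘ-mono-≤ p))))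

    ι-cancel-< : ∀ {i j} → ι i < ι j → i ℤ.< j
    ι-cancel-< {i} {j} p = ℤₚ.≰⇒> λ q → ℚₚ.<-irrefl refl (ℚₚ.<-≤-trans p (ι-mono-≤ q))

    ι-injective : ∀ {i j} → ι i ≡ ι j → i ≡ j
    ι-injective e = ℤₚ.≤-antisym (ι-cancel-≤ (ℚₚ.≤-reflexive e)) (ι-cancel-≤ (ℚₚ.≤-reflexive (sym e)))

    ι-mono-< : ∀ {i j} → i ℤ.< j → ι i < ι j
    ι-mono-< {i} {j} p = ℚₚ.≰⇒> λ q → ℤₚ.<-irrefl refl (ℤₚ.<-≤-trans p (ι-cancel-≤ q))

    ι-0 : ι (+ 0) ≡ 0ℚ
    ι-0 = refl

    ι-1 : ι (+ 1) ≡ 1ℚ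
    ι-1 = refl

  0≤* : ∀ {p q} → 0ℚ ≤ p → 0ℚ ≤ q → 0ℚ ≤ p * q
  0≤* {p} {q} a b = subst (_≤ p * q) (ℚₚ.*-zeroʳ p) (ℚₚ.*-monoˡ-≤-nonNeg p {{ℚ.nonNegative a}} b)

  0<* : ∀ {p q} → 0ℚ < p → 0ℚ < q → 0ℚ < p * q
  0<* {p} {q} a b = subst (_< p * q) (ℚₚ.*-zeroʳ p) (ℚₚ.*-monoʳ-<-pos p {{ℚ.positive a}} b)

  0≤+ : ∀ {p q} → 0ℚ ≤ p → 0ℚ ≤ q → 0ℚ ≤ p + q
  0≤+ {p} {q} a b = subst (_≤ p + q) (ℚₚ.+-identityʳ 0ℚ) (ℚₚ.+-mono-≤ a b)

  0<+ : ∀ {p q} → 0ℚ < p → 0ℚ ≤ q → 0ℚ < p + q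
  0<+ {p} {q} a b = subst (_< p + q) (ℚₚ.+-identityʳ 0ℚ) (ℚₚ.+-mono-<-≤ a b)

  0≤+0< : ∀ {p q} → 0ℚ ≤ p → 0ℚ < q → 0ℚ < p + q
  0≤+0< {p} {q} a b = subst (_< p + q) (ℚₚ.+-identityʳ 0ℚ) (ℚₚ.+-mono-≤-< a b)

  *-mono≤ : ∀ {p q r} → 0ℚ ≤ r → p ≤ q → r * p ≤ r * q
  *-mono≤ {r = r} a = ℚₚ.*-monoˡ-≤-nonNeg r {{ℚ.nonNegative a}}

  *-mono< : ∀ {p q r} → 0ℚ < r → p < q → r * p < r * q
  *-mono< {r = r} a = ℚₚ.*-monoʳ-<-pos r {{ℚ.positive a}}

  *-cancel< : ∀ {p q r} → 0ℚ ≤ r → r * p < r * q → p < q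
  *-cancel< {r = r} a = ℚₚ.*-cancelˡ-<-nonNeg r {{ℚ.nonNegative a}}

  *-cancel≤ : ∀ {p q r} → 0ℚ < r → r * p ≤ r * q → p ≤ q
  *-cancel≤ {r = r} a = ℚₚ.*-cancelˡ-≤-pos r {{ℚ.positive a}}

  module S = +-*-Solver

  ≤⇒0≤- : ∀ {p q} → p ≤ q → 0ℚ ≤ q - p
  ≤⇒0≤- {p} {q} a = subst (_≤ q - p) (ℚₚ.+-inverseʳ p) (ℚₚ.+-monoˡ-≤ (- p) a)

  <⇒0<- : ∀ {p q} → p < q → 0ℚ < q - p
  <⇒0<- {p} {q} a = subst (_< q - p) (ℚₚ.+-inverseʳ p) (ℚₚ.+-monoˡ-< (- p) a)

  private
    cancel+ : ∀ p q → (q - p) + p ≡ q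
    cancel+ = S.solve 2 (λ p q → (q S.:- p) S.:+ p S.:= q) refl

  0≤-⇒≤ : ∀ {p q} → 0ℚ ≤ q - p → p ≤ q
  0≤-⇒≤ {p} {q} a = subst₂ _≤_ (ℚₚ.+-identityˡ p) (cancel+ p q) (ℚₚ.+-monoˡ-≤ p a)

  0<-⇒< : ∀ {p q} → 0ℚ < q - p → p < q
  0<-⇒< {p} {q} a = subst₂ _<_ (ℚₚ.+-identityˡ p) (cancel+ p q) (ℚₚ.+-monoˡ-< p a)

  abstract
    ι-2½ : ι (+ 2) * ℚ.½ ≡ 1ℚ
    ι-2½ = refl

  0<ι : ∀ n → 0ℚ < ι (+ suc n)
  0<ι n = subst (_< ι (+ suc n)) ι-0 (ι-mono-< (ℤ.+<+ (ℕ.s≤s ℕ.z≤n)))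

  0≤ι : ∀ n → 0ℚ ≤ ι (+ n)
  0≤ι n = subst (_≤ ι (+ n)) ι-0 (ι-mono-≤ (ℤ.+≤+ ℕ.z≤n))

  ι-ℕ* : ∀ m n → ι (+ (m ℕ.* n)) ≡ ι (+ m) * ι (+ n)
  ι-ℕ* m n = trans (cong ι (ℤₚ.pos-* m n)) (ι-* (+ m) (+ n))

  infix 8 _⁻¹[_]
  _⁻¹[_] : (p : ℚ) → 0ℚ < p → ℚ
  p ⁻¹[ a ] = (ℚ.1/ p) {{ℚ.>-nonZero a}}

  abstract
    ⁻¹-inverse : ∀ {p} (a : 0ℚ < p) → p * p ⁻¹[ a ] ≡ 1ℚ
    ⁻¹-inverse {p} a = ℚₚ.*-inverseʳ p {{ℚ.>-nonZero a}}

    0<⁻¹ : ∀ {p} (a : 0ℚ < p) → 0ℚ < p ⁻¹[ a ]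
    0<⁻¹ {p} a = *-cancel< (ℚₚ.<⇒≤ a) (subst₂ _<_ (sym (ℚₚ.*-zeroʳ p)) (sym (⁻¹-inverse a)) (ℚₚ.positive⁻¹ 1ℚ))

  infixr 8 _^_
  _^_ : ℚ → ℕ → ℚ
  x ^ zero  = 1ℚ
  x ^ suc n = x * x ^ n

  0<^ : ∀ {x} n → 0ℚ < x → 0ℚ < x ^ n
  0<^ zero    a = ℚₚ.positive⁻¹ 1ℚ
  0<^ (suc n) a = 0<* a (0<^ n a)

  square-cancel-< : ∀ {a b} → 0ℚ ≤ b → a * a < b * b → a < b
  square-cancel-< {a} {b} b≥0 lt = ℚₚ.≰⇒> λ b≤a → ℚₚ.<-irrefl refl (ℚₚ.<-≤-trans lt
    (ℚₚ.≤-trans (*-mono≤ b≥0 b≤a) (subst₂ _≤_ (ℚₚ.*-comm a b) refl (*-mono≤ (ℚₚ.≤-trans b≥0 b≤a) b≤a))))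

  square-cancel-≤ : ∀ {a b} → 0ℚ ≤ b → a * a ≤ b * b → a ≤ b
  square-cancel-≤ {a} {b} b≥0 le = ℚₚ.≮⇒≥ λ b<a → ℚₚ.<-irrefl refl (ℚₚ.<-≤-trans
    (ℚₚ.≤-<-trans (*-mono≤ b≥0 (ℚₚ.<⇒≤ b<a)) (subst₂ _<_ (ℚₚ.*-comm a b) refl (*-mono< (ℚₚ.≤-<-trans b≥0 b<a) b<a))) le)

  square-mono-≤ : ∀ {a b} → 0ℚ ≤ a → a ≤ b → a * a ≤ b * b
  square-mono-≤ {a} {b} a≥0 le = ℚₚ.≤-trans (*-mono≤ a≥0 le) (subst₂ _≤_ (ℚₚ.*-comm b a) refl (*-mono≤ (ℚₚ.≤-trans a≥0 le) le))

  *-mono≤ʳ : ∀ {p q r} → 0ℚ ≤ r → p ≤ q → p * r ≤ q * r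
  *-mono≤ʳ {r = r} a = ℚₚ.*-monoʳ-≤-nonNeg r {{ℚ.nonNegative a}}

-- Polynomials as coefficient lists, and one formula evaluated in several rings.

module Polynomials where
  open Rationals
  open import Data.Nat as ℕ using (ℕ; zero; suc)
  open import Data.Nat.Combinatorics using () renaming (_C_ to binom)
  open import Data.Integer as ℤ using (ℤ; -[1+_]) renaming (+_ to pos)
  open import Data.Rational using (ℚ; 0ℚ; 1ℚ; _+_; _*_; -_; _≤_; _<_)
  import Data.Rational.Properties as ℚₚ
  open import Data.List using (List; []; _∷_)
  open import Data.Bool using (Bool; true; false; _∧_)
  open import Data.Product using (_×_; _,_; proj₁; proj₂)
  open import Relation.Binary.PropositionalEquality

  -- Operations without laws. The same formula is run on nested coefficient lists, where its signs
  -- can be computed, and in ℚ, where it has its meaning; a `Hom` transports the result from the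
  -- former to the latter.
  record Raw : Set₁ where
    infixl 6 _⊕_
    infixl 7 _⊗_
    field
      C   : Set
      #_  : ℤ → C
      _⊕_ : C → C → C
      _⊗_ : C → C → C

  record Hom (R : Raw) : Set where
    open Raw R
    field
      ⟦_⟧ : C → ℚ
      ⟦#⟧ : ∀ i → ⟦ # i ⟧ ≡ ι i
      ⟦⊕⟧ : ∀ p q → ⟦ p ⊕ q ⟧ ≡ ⟦ p ⟧ + ⟦ q ⟧
      ⟦⊗⟧ : ∀ p q → ⟦ p ⊗ q ⟧ ≡ ⟦ p ⟧ * ⟦ q ⟧

  ℚ-raw : Raw
  ℚ-raw = record { C = ℚ ; #_ = ι ; _⊕_ = _+_ ; _⊗_ = _*_ }

  ℤ-raw : Raw
  ℤ-raw = record { C = ℤ ; #_ = λ i → i ; _⊕_ = ℤ._+_ ; _⊗_ = ℤ._*_ }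

  ℤ-hom : Hom ℤ-raw
  ℤ-hom = record { ⟦_⟧ = ι ; ⟦#⟧ = λ _ → refl ; ⟦⊕⟧ = ι-+ ; ⟦⊗⟧ = ι-* }

  module _ (R : Raw) where
    open Raw R

    addₗ : List C → List C → List C
    addₗ []      q       = q
    addₗ (a ∷ p) []      = a ∷ p
    addₗ (a ∷ p) (b ∷ q) = (a ⊕ b) ∷ addₗ p q

    scale : C → List C → List C
    scale c []      = []
    scale c (b ∷ q) = (c ⊗ b) ∷ scale c q

    mulₗ : List C → List C → List C
    mulₗ []          q = []
    mulₗ (a ∷ [])    q = scale a q
    mulₗ (a ∷ b ∷ p) q = addₗ (scale a q) ((# (pos 0)) ∷ mulₗ (b ∷ p) q)

    _[X] : Raw
    _[X] = record { C = List C ; #_ = λ i → (# i) ∷ [] ; _⊕_ = addₗ ; _⊗_ = mulₗ }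

  module _ {R : Raw} (h : Hom R) (v : ℚ) where
    open Raw R
    open Hom h

    evalₗ : List C → ℚ
    evalₗ []      = 0ℚ
    evalₗ (a ∷ p) = ⟦ a ⟧ + v * evalₗ p

    private
      eval-add : ∀ p q → evalₗ (addₗ R p q) ≡ evalₗ p + evalₗ q
      eval-add []      q       = sym (ℚₚ.+-identityˡ _)
      eval-add (a ∷ p) []      = sym (ℚₚ.+-identityʳ _)
      eval-add (a ∷ p) (b ∷ q) = trans (cong₂ (λ x y → x + v * y) (⟦⊕⟧ a b) (eval-add p q))
        (S.solve 5 (λ a b v p q → (a S.:+ b) S.:+ v S.:* (p S.:+ q) S.:= (a S.:+ v S.:* p) S.:+ (b S.:+ v S.:* q))
          refl ⟦ a ⟧ ⟦ b ⟧ v (evalₗ p) (evalₗ q))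

    eval-scale : ∀ c q → evalₗ (scale R c q) ≡ ⟦ c ⟧ * evalₗ q
    eval-scale c []      = sym (ℚₚ.*-zeroʳ ⟦ c ⟧)
    eval-scale c (b ∷ q) = trans (cong₂ (λ x y → x + v * y) (⟦⊗⟧ c b) (eval-scale c q))
      (S.solve 4 (λ c b v q → c S.:* b S.:+ v S.:* (c S.:* q) S.:= c S.:* (b S.:+ v S.:* q)) refl ⟦ c ⟧ ⟦ b ⟧ v (evalₗ q))

    private
      eval-mul : ∀ p q → evalₗ (mulₗ R p q) ≡ evalₗ p * evalₗ q
      eval-mul []          q = sym (ℚₚ.*-zeroˡ (evalₗ q))
      eval-mul (a ∷ [])    q = trans (eval-scale a q)
        (S.solve 3 (λ a v q → a S.:* q S.:= (a S.:+ v S.:* S.con 0ℚ) S.:* q) refl ⟦ a ⟧ v (evalₗ q))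
      eval-mul (a ∷ b ∷ p) q = trans (eval-add (scale R a q) _)
        (trans (cong₂ _+_ (eval-scale a q) (cong₂ (λ x y → x + v * y) (trans (⟦#⟧ (pos 0)) ι-0) (eval-mul (b ∷ p) q)))
        (S.solve 4 (λ a v q p → a S.:* q S.:+ (S.con 0ℚ S.:+ v S.:* (p S.:* q)) S.:= (a S.:+ v S.:* p) S.:* q)
          refl ⟦ a ⟧ v (evalₗ q) (evalₗ (b ∷ p))))

    _[X]-hom : Hom (R [X])
    _[X]-hom = record
      { ⟦_⟧ = evalₗ
      ; ⟦#⟧ = λ i → trans (cong₂ _+_ (⟦#⟧ i) (ℚₚ.*-zeroʳ v)) (ℚₚ.+-identityʳ _)
      ; ⟦⊕⟧ = eval-add
      ; ⟦⊗⟧ = eval-mul }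

    ⟦X⟧ : evalₗ ((# (pos 0)) ∷ (# (pos 1)) ∷ []) ≡ v
    ⟦X⟧ = trans (cong₂ (λ x y → x + v * (y + v * 0ℚ)) (trans (⟦#⟧ (pos 0)) ι-0) (trans (⟦#⟧ (pos 1)) ι-1))
      (S.solve 1 (λ v → S.con 0ℚ S.:+ v S.:* (S.con 1ℚ S.:+ v S.:* S.con 0ℚ) S.:= v) refl v)

    ⟦const⟧ : ∀ a → evalₗ (a ∷ []) ≡ ⟦ a ⟧
    ⟦const⟧ a = trans (cong (λ y → ⟦ a ⟧ + y) (ℚₚ.*-zeroʳ v)) (ℚₚ.+-identityʳ _)

  nonNegCoeff : ℤ → Bool
  nonNegCoeff (pos _)    = true
  nonNegCoeff -[1+ _ ] = false

  allₗ : {A : Set} → (A → Bool) → List A → Bool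
  allₗ f []      = true
  allₗ f (a ∷ p) = f a ∧ allₗ f p

  ∧-true : ∀ {a b} → a ∧ b ≡ true → (a ≡ true) × (b ≡ true)
  ∧-true {true} {true} _ = refl , refl

  nonNegCoeff-sound : ∀ i → nonNegCoeff i ≡ true → 0ℚ ≤ ι i
  nonNegCoeff-sound (pos n) _ = subst (_≤ ι (pos n)) ι-0 (ι-mono-≤ (ℤ.+≤+ ℕ.z≤n))

  -- The whole sign method. With polynomials as coefficients it descends one variable at a time, so
  -- that a pass over integers certifies a sign on an orthant of (x, z) or of (x, z, u).
  allₗ-sound : {R : Raw} (h : Hom R) {v : ℚ} → 0ℚ ≤ v → (f : Raw.C R → Bool) →
               (∀ a → f a ≡ true → 0ℚ ≤ Hom.⟦_⟧ h a) → ∀ p → allₗ f p ≡ true → 0ℚ ≤ evalₗ h v p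
  allₗ-sound h v≥0 f sound []      _ = ℚₚ.≤-refl
  allₗ-sound h v≥0 f sound (a ∷ p) e with ∧-true {f a} e
  ... | e₁ , e₂ = 0≤+ (sound a e₁) (0≤* v≥0 (allₗ-sound h v≥0 f sound p e₂))

  -- The polynomial Σⱼ (-1)ʲ C(s,j) λʲ α₀…αⱼ₋₁ (N+j)…(N+s-1) · P(P-λ)…(P-(s-j-1)λ), where αᵢ = N(G+i)+i+i²,
  -- accumulated in Horner form.
  module _ (R : Raw) where
    open Raw R

    sgn : ℕ → ℤ
    sgn zero    = pos 1
    sgn (suc j) = ℤ.- sgn j

    α : C → C → ℕ → C
    α N G j = (N ⊗ (G ⊕ (# (pos j)))) ⊕ (# (pos (j ℕ.+ j ℕ.* j)))

    hornerFrom : ℕ → C → C → C → C → ℕ → ℕ → C → C → C → C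
    hornerFrom s N G l P j zero    Y A L = Y
    hornerFrom s N G l P j (suc r) Y A L =
      hornerFrom s N G l P (suc j) r
        ((((N ⊕ (# (pos j))) ⊗ (P ⊕ ((# (ℤ.- (pos r))) ⊗ l))) ⊗ Y) ⊕ ((# (sgn (suc j) ℤ.* pos (binom s (suc j)))) ⊗ ((l ⊗ L) ⊗ (α N G j ⊗ A))))
        (α N G j ⊗ A) (l ⊗ L)

    -- The expression is homogeneous in P and λ: a rational argument p is entered as P = λp, with λ
    -- clearing its denominators.
    horner : ℕ → C → C → C → C → C
    horner s N G l P = hornerFrom s N G l P 0 s (# (pos 1)) (# (pos 1)) (# (pos 1))

  module _ {R : Raw} (h : Hom R) where
    open Raw R
    open Hom h

    α-hom : ∀ N G j → ⟦ α R N G j ⟧ ≡ α ℚ-raw ⟦ N ⟧ ⟦ G ⟧ j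
    α-hom N G j = trans (⟦⊕⟧ _ _) (cong₂ _+_ (trans (⟦⊗⟧ _ _) (cong (⟦ N ⟧ *_) (trans (⟦⊕⟧ _ _) (cong (⟦ G ⟧ +_) (⟦#⟧ _))))) (⟦#⟧ _))

    hornerFrom-hom : ∀ s N G l P j r Y A L →
      ⟦ hornerFrom R s N G l P j r Y A L ⟧ ≡ hornerFrom ℚ-raw s ⟦ N ⟧ ⟦ G ⟧ ⟦ l ⟧ ⟦ P ⟧ j r ⟦ Y ⟧ ⟦ A ⟧ ⟦ L ⟧
    hornerFrom-hom s N G l P j zero    Y A L = refl
    hornerFrom-hom s N G l P j (suc r) Y A L = trans (hornerFrom-hom s N G l P (suc j) r _ _ _)
      (trans (cong₂ (λ y a → hornerFrom ℚ-raw s ⟦ N ⟧ ⟦ G ⟧ ⟦ l ⟧ ⟦ P ⟧ (suc j) r y a ⟦ l ⊗ L ⟧) eY eA)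
             (cong (hornerFrom ℚ-raw s ⟦ N ⟧ ⟦ G ⟧ ⟦ l ⟧ ⟦ P ⟧ (suc j) r _ _) (⟦⊗⟧ l L)))
      where
      eA : ⟦ α R N G j ⊗ A ⟧ ≡ α ℚ-raw ⟦ N ⟧ ⟦ G ⟧ j * ⟦ A ⟧
      eA = trans (⟦⊗⟧ _ _) (cong (_* ⟦ A ⟧) (α-hom N G j))
      eY = trans (⟦⊕⟧ _ _) (cong₂ _+_
        (trans (⟦⊗⟧ _ _) (cong (_* ⟦ Y ⟧) (trans (⟦⊗⟧ _ _) (cong₂ _*_ (trans (⟦⊕⟧ _ _) (cong (⟦ N ⟧ +_) (⟦#⟧ _)))
          (trans (⟦⊕⟧ _ _) (cong (⟦ P ⟧ +_) (trans (⟦⊗⟧ _ _) (cong (_* ⟦ l ⟧) (⟦#⟧ _)))))))))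
        (trans (⟦⊗⟧ _ _) (cong₂ _*_ (⟦#⟧ _) (trans (⟦⊗⟧ _ _) (cong₂ _*_ (⟦⊗⟧ _ _) eA)))))

    horner-hom : ∀ s N G l P → ⟦ horner R s N G l P ⟧ ≡ horner ℚ-raw s ⟦ N ⟧ ⟦ G ⟧ ⟦ l ⟧ ⟦ P ⟧
    horner-hom s N G l P = trans (hornerFrom-hom s N G l P 0 s _ _ _) (cong (λ e → hornerFrom ℚ-raw s ⟦ N ⟧ ⟦ G ⟧ ⟦ l ⟧ ⟦ P ⟧ 0 s e e e) (⟦#⟧ (pos 1)))

  -- A polynomial in X is e(X²) + X·o(X²), with e and o given by the coefficients of even and odd index.
  evens odds : {A : Set} → List A → List A
  evens []      = []
  evens (a ∷ p) = a ∷ odds p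
  odds []      = []
  odds (a ∷ p) = evens p

  module _ {R : Raw} (h : Hom R) (t W : ℚ) (t² : t * t ≡ W) where
    open Hom h

    eval-evens-odds : ∀ p → evalₗ h t p ≡ evalₗ h W (evens p) + t * evalₗ h W (odds p)
    eval-evens-odds []      = sym (trans (cong (0ℚ +_) (ℚₚ.*-zeroʳ t)) (ℚₚ.+-identityʳ 0ℚ))
    eval-evens-odds (a ∷ p) = trans (cong (λ y → ⟦ a ⟧ + t * y) (eval-evens-odds p))
      (trans (S.solve 4 (λ a t e o → a S.:+ t S.:* (e S.:+ t S.:* o) S.:= (a S.:+ (t S.:* t) S.:* o) S.:+ t S.:* e) refl ⟦ a ⟧ t _ _)
             (cong (λ w → (⟦ a ⟧ + w * evalₗ h W (odds p)) + t * evalₗ h W (evens p)) t²))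

  -- For wd·W = wn this clears the denominators of Σ cᵢ Wⁱ.
  module _ (R : Raw) (wn wd : Raw.C (R [X])) where
    open Raw (R [X])

    clear : List (Raw.C R) → C × C
    clear []      = (# (pos 0)) , (# (pos 1))
    clear (c ∷ p) with clear p
    ... | q , d = ((d ⊗ (c ∷ [])) ⊕ (wn ⊗ q)) , (wd ⊗ d)

  module _ {R : Raw} (h : Hom R) {u : ℚ} {wn wd : List (Raw.C R)} {W : ℚ}
           (wdW : evalₗ h u wd * W ≡ evalₗ h u wn) (wd>0 : 0ℚ < evalₗ h u wd) where
    private
      H = _[X]-hom h u
    open Hom H

    clear-den>0 : ∀ p → 0ℚ < ⟦ proj₂ (clear R wn wd p) ⟧
    clear-den>0 []      = subst₂ _<_ ι-0 (sym (⟦#⟧ (pos 1))) (ι-mono-< (ℤ.+<+ (ℕ.s≤s ℕ.z≤n)))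
    clear-den>0 (c ∷ p) = subst (0ℚ <_) (sym (⟦⊗⟧ wd _)) (0<* wd>0 (clear-den>0 p))

    -- The second component is the power of `wd` whose exponent is the length of `p`, one more than
    -- the degree demands, because it starts from 1 at the empty list. This is the extra factor `wd`
    -- on the left.
    clear-correct : ∀ p → ⟦ wd ⟧ * ⟦ proj₁ (clear R wn wd p) ⟧ ≡ ⟦ proj₂ (clear R wn wd p) ⟧ * evalₗ h W p
    clear-correct []      = trans (cong (⟦ wd ⟧ *_) (trans (⟦#⟧ (pos 0)) ι-0)) (trans (ℚₚ.*-zeroʳ ⟦ wd ⟧) (sym (ℚₚ.*-zeroʳ ⟦ proj₂ (clear R wn wd []) ⟧)))
    clear-correct (c ∷ p) = begin
      ⟦ wd ⟧ * ⟦ (d ⊗′ (c ∷ [])) ⊕′ (wn ⊗′ q) ⟧ ≡⟨ cong (⟦ wd ⟧ *_) (trans (⟦⊕⟧ (d ⊗′ (c ∷ [])) (wn ⊗′ q)) (cong₂ _+_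
        (trans (⟦⊗⟧ d (c ∷ [])) (cong (⟦ d ⟧ *_) (⟦const⟧ h u c))) (trans (⟦⊗⟧ wn q) (cong (_* ⟦ q ⟧) (sym wdW))))) ⟩
      ⟦ wd ⟧ * (⟦ d ⟧ * c′ + ⟦ wd ⟧ * W * ⟦ q ⟧) ≡⟨ S.solve 5 (λ w d c W q → w S.:* (d S.:* c S.:+ w S.:* W S.:* q)
        S.:= w S.:* d S.:* c S.:+ w S.:* W S.:* (w S.:* q)) refl ⟦ wd ⟧ ⟦ d ⟧ c′ W ⟦ q ⟧ ⟩
      ⟦ wd ⟧ * ⟦ d ⟧ * c′ + ⟦ wd ⟧ * W * (⟦ wd ⟧ * ⟦ q ⟧) ≡⟨ cong (λ e → ⟦ wd ⟧ * ⟦ d ⟧ * c′ + ⟦ wd ⟧ * W * e) (clear-correct p) ⟩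
      ⟦ wd ⟧ * ⟦ d ⟧ * c′ + ⟦ wd ⟧ * W * (⟦ d ⟧ * evalₗ h W p) ≡⟨ S.solve 5 (λ w d c W q → w S.:* d S.:* c S.:+ w S.:* W S.:* (d S.:* q)
        S.:= w S.:* d S.:* (c S.:+ W S.:* q)) refl ⟦ wd ⟧ ⟦ d ⟧ c′ W (evalₗ h W p) ⟩
      ⟦ wd ⟧ * ⟦ d ⟧ * (c′ + W * evalₗ h W p) ≡⟨ cong (_* (c′ + W * evalₗ h W p)) (sym (⟦⊗⟧ wd d)) ⟩
      ⟦ wd ⊗′ d ⟧ * (c′ + W * evalₗ h W p) ∎
      where
      open ≡-Reasoning
      q = proj₁ (clear R wn wd p)
      d = proj₂ (clear R wn wd p)
      c′ = Hom.⟦_⟧ h c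
      open Raw (R [X]) using () renaming (_⊕_ to _⊕′_; _⊗_ to _⊗′_)

-- The range ϑ ≥ ϑ₀ described by nonnegative variables, and the polynomial expanded around a centre.

module Regions where
  open Rationals
  open Polynomials
  open import Data.Nat as ℕ using (ℕ)
  open import Data.Integer as ℤ using (ℤ; -[1+_]) renaming (+_ to pos)
  open import Data.Rational as ℚ using (ℚ; 0ℚ; 1ℚ; _+_; _*_; -_; _≤_; _<_)
  import Data.Rational.Properties as ℚₚ
  open import Data.List using ([]; _∷_)
  open import Relation.Binary.PropositionalEquality

  -- Polynomials in z (outer) and x (inner).
  Coef : Raw
  Coef = (ℤ-raw [X]) [X]

  Coef[X] : Raw
  Coef[X] = Coef [X]

  open Raw Coef using () renaming (C to 𝒞; #_ to #₂_; _⊕_ to _⊕₂_; _⊗_ to _⊗₂_)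
  open Raw Coef[X] using () renaming (C to 𝒫; #_ to #₃_; _⊕_ to _⊕₃_; _⊗_ to _⊗₃_)

  xₚ zₚ 1+zₚ : 𝒞
  xₚ = (pos 0 ∷ pos 1 ∷ []) ∷ []
  zₚ = (pos 0 ∷ []) ∷ (pos 1 ∷ []) ∷ []
  1+zₚ = (#₂ pos 1) ⊕₂ zₚ

  ϑₚ Gₚ Nₚ : ℕ → 𝒞
  ϑₚ ϑ₀ = (#₂ pos ϑ₀) ⊕₂ xₚ
  Gₚ ϑ₀ = (#₂ pos 4) ⊗₂ (ϑₚ ϑ₀ ⊗₂ 1+zₚ)
  Nₚ ϑ₀ = (#₂ -[1+ 1 ]) ⊕₂ ((#₂ pos 16) ⊗₂ (ϑₚ ϑ₀ ⊗₂ (1+zₚ ⊗₂ 1+zₚ)))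

  -- Common denominator of the centres: 2 for the half-integral part of the mean, 1000 for the
  -- thousandths, 1 + z for ρ.
  scaleₚ : 𝒞
  scaleₚ = (#₂ pos 2000) ⊗₂ 1+zₚ

  -- Centres are given in thousandths of ρ.
  centred : ℕ → ℕ → ℤ → 𝒫
  centred ϑ₀ s c = horner Coef[X] s (Nₚ ϑ₀ ∷ []) (Gₚ ϑ₀ ∷ []) (scaleₚ ∷ [])
    (((scaleₚ ∷ []) ⊗₃ ((Gₚ ϑ₀ ∷ []) ⊕₃ ((#₂ pos 0) ∷ (#₂ pos 1) ∷ [])))
     ⊕₃ ((((#₂ pos (1000 ℕ.* (s ℕ.∸ 1))) ⊗₂ 1+zₚ) ⊕₂ ((#₂ (pos 2 ℤ.* c)) ⊗₂ zₚ)) ∷ []))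

  -- For ϑ = Q²/(N²(N+2)) and 1 + z = N(N+2)/4Q the quantities N and G = Q/N are polynomials in x = ϑ - ϑ₀ and z,
  -- so their sign conditions follow from the signs of coefficients.
  record Region (ϑ₀ : ℕ) : Set where
    field
      x z ρ : ℚ
      x≥0   : 0ℚ ≤ x
      z>0   : 0ℚ < z
      -- So ρ = z/(1 + z) lies strictly between 0 and 1; it is 1 - 4Q/(N(N+2)) in terms of the
      -- design.
      ρ-def : ρ * (1ℚ + z) ≡ z
    ϑ G N : ℚ
    ϑ = ι (pos ϑ₀) + x
    G = ι (pos 4) * (ϑ * (1ℚ + z))
    N = ι -[1+ 1 ] + ι (pos 16) * (ϑ * ((1ℚ + z) * (1ℚ + z)))

    z≥0 : 0ℚ ≤ z
    z≥0 = ℚₚ.<⇒≤ z>0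

    1+z>0 : 0ℚ < 1ℚ + z
    1+z>0 = 0<+ (ℚₚ.positive⁻¹ 1ℚ) z≥0

  val : ℤ → ℚ
  val c = ι c * ι (pos 1000) ⁻¹[ 0<ι 999 ]

  val-den : ∀ c → ι (pos 1000) * val c ≡ ι c
  val-den c = trans (S.solve 3 (λ d n i → d S.:* (n S.:* i) S.:= n S.:* (d S.:* i)) refl (ι (pos 1000)) (ι c) (ι (pos 1000) ⁻¹[ 0<ι 999 ]))
    (trans (cong (ι c *_) (⁻¹-inverse (0<ι 999))) (ℚₚ.*-identityʳ (ι c)))

  module Eval {ϑ₀ : ℕ} (rg : Region ϑ₀) where
    open Region rg

    hom₁ : Hom (ℤ-raw [X])
    hom₁ = _[X]-hom ℤ-hom x
    hom₂ : Hom Coef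
    hom₂ = _[X]-hom hom₁ z
    open Hom hom₂

    ev : ℚ → 𝒫 → ℚ
    ev = evalₗ hom₂

    ⟦x⟧ : ⟦ xₚ ⟧ ≡ x
    ⟦x⟧ = trans (⟦const⟧ hom₁ z (pos 0 ∷ pos 1 ∷ [])) (⟦X⟧ ℤ-hom x)
    ⟦z⟧ : ⟦ zₚ ⟧ ≡ z
    ⟦z⟧ = ⟦X⟧ hom₁ z
    ⟦1+z⟧ : ⟦ 1+zₚ ⟧ ≡ 1ℚ + z
    ⟦1+z⟧ = trans (⟦⊕⟧ (#₂ pos 1) zₚ) (cong₂ _+_ (trans (⟦#⟧ (pos 1)) ι-1) ⟦z⟧)
    ⟦ϑ⟧ : ⟦ ϑₚ ϑ₀ ⟧ ≡ ϑ
    ⟦ϑ⟧ = trans (⟦⊕⟧ (#₂ pos ϑ₀) xₚ) (cong₂ _+_ (⟦#⟧ (pos ϑ₀)) ⟦x⟧)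
    ⟦G⟧ : ⟦ Gₚ ϑ₀ ⟧ ≡ G
    ⟦G⟧ = trans (⟦⊗⟧ (#₂ pos 4) (ϑₚ ϑ₀ ⊗₂ 1+zₚ)) (cong₂ _*_ (⟦#⟧ (pos 4)) (trans (⟦⊗⟧ (ϑₚ ϑ₀) 1+zₚ) (cong₂ _*_ ⟦ϑ⟧ ⟦1+z⟧)))
    ⟦N⟧ : ⟦ Nₚ ϑ₀ ⟧ ≡ N
    ⟦N⟧ = trans (⟦⊕⟧ (#₂ -[1+ 1 ]) ((#₂ pos 16) ⊗₂ (ϑₚ ϑ₀ ⊗₂ (1+zₚ ⊗₂ 1+zₚ)))) (cong₂ _+_ (⟦#⟧ -[1+ 1 ])
      (trans (⟦⊗⟧ (#₂ pos 16) (ϑₚ ϑ₀ ⊗₂ (1+zₚ ⊗₂ 1+zₚ))) (cong₂ _*_ (⟦#⟧ (pos 16))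
        (trans (⟦⊗⟧ (ϑₚ ϑ₀) (1+zₚ ⊗₂ 1+zₚ)) (cong₂ _*_ ⟦ϑ⟧ (trans (⟦⊗⟧ 1+zₚ 1+zₚ) (cong₂ _*_ ⟦1+z⟧ ⟦1+z⟧)))))))

    lam : ℚ
    lam = ι (pos 2000) * (1ℚ + z)

    lam>0 : 0ℚ < lam
    lam>0 = 0<* (0<ι 1999) 1+z>0

    -- The arithmetic mean of the s roots: the two highest coefficients of the polynomial give
    -- s(s-1)/2 + sG as their sum.
    mean : ℕ → ℚ
    mean s = ι (pos (s ℕ.∸ 1)) * ℚ.½ + G

    centre : ℕ → ℤ → ℚ
    centre s c = mean s + val c * ρ

    ⟦lam⟧ : ⟦ scaleₚ ⟧ ≡ lam
    ⟦lam⟧ = trans (⟦⊗⟧ (#₂ pos 2000) 1+zₚ) (cong₂ _*_ (⟦#⟧ (pos 2000)) ⟦1+z⟧)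

    lam-centre : ∀ s c t → lam * (centre s c + t) ≡
      lam * (G + t) + (ι (pos (1000 ℕ.* (s ℕ.∸ 1))) * (1ℚ + z) + ι (pos 2 ℤ.* c) * z)
    lam-centre s c t = begin
      lam * (centre s c + t) ≡⟨ cong (λ e → e * (1ℚ + z) * (centre s c + t)) (ι-* (pos 2) (pos 1000)) ⟩
      i2 * d * (1ℚ + z) * ((k * ℚ.½ + G) + val c * ρ + t) ≡⟨ S.solve 9 (λ i2 d w k h G v r t →
         i2 S.:* d S.:* w S.:* ((k S.:* h S.:+ G) S.:+ v S.:* r S.:+ t) S.:=
         i2 S.:* d S.:* w S.:* (G S.:+ t) S.:+ (i2 S.:* h S.:* (d S.:* k) S.:* w S.:+ i2 S.:* (d S.:* v) S.:* (r S.:* w)))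
         refl i2 d (1ℚ + z) k ℚ.½ G (val c) ρ t ⟩
      i2 * d * (1ℚ + z) * (G + t) + (i2 * ℚ.½ * (d * k) * (1ℚ + z) + i2 * (d * val c) * (ρ * (1ℚ + z)))
        ≡⟨ cong₂ (λ e f → i2 * d * (1ℚ + z) * (G + t) + (e + f))
            (cong (_* (1ℚ + z)) (trans (cong (_* (d * k)) ι-2½) (trans (ℚₚ.*-identityˡ (d * k))
               (trans (sym (ι-* (pos 1000) (pos (s ℕ.∸ 1)))) (cong ι (sym (pos-* (1000) (s ℕ.∸ 1))))))))
            (cong₂ _*_ (trans (cong (i2 *_) (val-den c)) (sym (ι-* (pos 2) (c)))) ρ-def) ⟩
      i2 * d * (1ℚ + z) * (G + t) + (ι (pos (1000 ℕ.* (s ℕ.∸ 1))) * (1ℚ + z) + ι (pos 2 ℤ.* c) * z)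
        ≡⟨ cong (λ e → e * (1ℚ + z) * (G + t) + (ι (pos (1000 ℕ.* (s ℕ.∸ 1))) * (1ℚ + z) + ι (pos 2 ℤ.* c) * z)) (sym (ι-* (pos 2) (pos 1000))) ⟩
      lam * (G + t) + (ι (pos (1000 ℕ.* (s ℕ.∸ 1))) * (1ℚ + z) + ι (pos 2 ℤ.* c) * z) ∎
      where
      open ≡-Reasoning
      open import Data.Integer.Properties using (pos-*)
      i2 = ι (pos 2)
      d = ι (pos 1000)
      k = ι (pos (s ℕ.∸ 1))

    ⟦centred⟧ : ∀ s c t → ev t (centred ϑ₀ s c) ≡ horner ℚ-raw s N G (lam) (lam * (centre s c + t))
    ⟦centred⟧ s c t = trans (horner-hom homₜ s (Nₚ ϑ₀ ∷ []) (Gₚ ϑ₀ ∷ []) (scaleₚ ∷ []) P)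
      (cong₄ (trans (⟦const⟧ hom₂ t (Nₚ ϑ₀)) ⟦N⟧) eG eλ (trans eP (sym (lam-centre s c t))))
      where
      homₜ = _[X]-hom hom₂ t
      open Hom homₜ using () renaming (⟦⊕⟧ to ⟦⊕⟧₃; ⟦⊗⟧ to ⟦⊗⟧₃)
      Xₚ : 𝒫
      Xₚ = (#₂ pos 0) ∷ (#₂ pos 1) ∷ []
      k₁ k₂ : 𝒞
      k₁ = (#₂ pos (1000 ℕ.* (s ℕ.∸ 1))) ⊗₂ 1+zₚ
      k₂ = (#₂ (pos 2 ℤ.* c)) ⊗₂ zₚ
      P : 𝒫
      P = ((scaleₚ ∷ []) ⊗₃ ((Gₚ ϑ₀ ∷ []) ⊕₃ Xₚ)) ⊕₃ ((k₁ ⊕₂ k₂) ∷ [])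
      cong₄ : ∀ {a a′ b b′ e e′ f f′} → a ≡ a′ → b ≡ b′ → e ≡ e′ → f ≡ f′ → horner ℚ-raw s a b e f ≡ horner ℚ-raw s a′ b′ e′ f′
      cong₄ refl refl refl refl = refl
      eG : ev t (Gₚ ϑ₀ ∷ []) ≡ G
      eG = trans (⟦const⟧ hom₂ t (Gₚ ϑ₀)) ⟦G⟧
      eλ : ev t (scaleₚ ∷ []) ≡ lam
      eλ = trans (⟦const⟧ hom₂ t (scaleₚ)) (⟦lam⟧)
      eP : ev t P ≡ lam * (G + t) + (ι (pos (1000 ℕ.* (s ℕ.∸ 1))) * (1ℚ + z) + ι (pos 2 ℤ.* c) * z)
      eP = trans (⟦⊕⟧₃ ((scaleₚ ∷ []) ⊗₃ ((Gₚ ϑ₀ ∷ []) ⊕₃ Xₚ)) ((k₁ ⊕₂ k₂) ∷ [])) (cong₂ _+_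
        (trans (⟦⊗⟧₃ (scaleₚ ∷ []) ((Gₚ ϑ₀ ∷ []) ⊕₃ Xₚ)) (cong₂ _*_ eλ (trans (⟦⊕⟧₃ (Gₚ ϑ₀ ∷ []) Xₚ) (cong₂ _+_ eG (⟦X⟧ hom₂ t)))))
        (trans (⟦const⟧ hom₂ t (k₁ ⊕₂ k₂)) (trans (⟦⊕⟧ k₁ k₂) (cong₂ _+_
          (trans (⟦⊗⟧ (#₂ pos (1000 ℕ.* (s ℕ.∸ 1))) 1+zₚ) (cong₂ _*_ (⟦#⟧ _) ⟦1+z⟧))
          (trans (⟦⊗⟧ (#₂ (pos 2 ℤ.* c)) zₚ) (cong₂ _*_ (⟦#⟧ _) ⟦z⟧))))))

-- Decidable sign tests near a centre, and their soundness.

module SignTests where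
  open Rationals
  open Polynomials
  open Regions
  open import Data.Nat as ℕ using (ℕ)
  import Data.Nat.Properties as ℕₚ
  open import Data.Integer as ℤ using (ℤ; -[1+_]) renaming (+_ to pos)
  open import Data.Rational as ℚ using (ℚ; 0ℚ; 1ℚ; _+_; _*_; -_; _-_; _≤_; _<_)
  import Data.Rational.Properties as ℚₚ
  open import Data.List using ([]; _∷_)
  open import Data.Bool using (Bool; true; _∧_; T)
  open import Data.Unit using (tt)
  open import Data.Product using (_×_; _,_; proj₁; proj₂)
  open import Relation.Nullary using (yes; no)
  open import Relation.Binary.PropositionalEquality

  open Raw Coef using () renaming (C to 𝒞; #_ to #₂_; _⊕_ to _⊕₂_; _⊗_ to _⊗₂_)
  open Raw Coef[X] using () renaming (C to 𝒫; #_ to #₃_; _⊕_ to _⊕₃_; _⊗_ to _⊗₃_)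

  -- Bounds for W in thousandths of ϑ.
  record Range : Set where
    constructor range
    field lower upper : ℕ

  data Parity : Set where
    odd even : Parity

  -- `at-centre` serves to locate the middle root for odd s, `in-band` to bracket a root on the
  -- right of a centre, and `reflection` to find the sign at the mirror image of such a root. The
  -- integer stands for a sign.
  data Test : Set where
    at-centre  : ℤ → Test
    in-band    : ℤ → Range → Test
    reflection : ℤ → Range → Test

  nonNeg₂ : 𝒞 → Bool
  nonNeg₂ = allₗ (allₗ nonNegCoeff)

  nonNeg₃ : 𝒫 → Bool
  nonNeg₃ = allₗ nonNeg₂

  headₗ : 𝒫 → 𝒞
  headₗ []      = #₂ pos 0
  headₗ (a ∷ _) = a

  module _ (ϑ₀ : ℕ) where

    -- The substitution W = ϑ(l + hu)/(1000(1 + u)) maps u ≥ 0 onto the whole range from l to h in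
    -- thousandths of ϑ. A sign on the range thereby becomes a sign for all u ≥ 0, to be read off
    -- from coefficients.
    cleared : ℤ → Range → 𝒫 → 𝒫
    cleared σ (range l h) p = (#₃ σ) ⊗₃ proj₁ (clear Coef
      ((ϑₚ ϑ₀ ⊗₂ (#₂ pos l)) ∷ (ϑₚ ϑ₀ ⊗₂ (#₂ pos h)) ∷ []) ((#₂ pos 1000) ∷ (#₂ pos 1000) ∷ []) p)

    -- E + κWO (odd s) and O + κE (even s) with κ = sρ/6ϑ, times 6ϑ(1+z).
    corrected : Parity → ℕ → 𝒫 → 𝒫
    corrected odd  s Y = addₗ Coef (scale Coef ((#₂ pos 6) ⊗₂ (ϑₚ ϑ₀ ⊗₂ 1+zₚ)) (evens Y))
                                   ((#₂ pos 0) ∷ scale Coef ((#₂ pos s) ⊗₂ zₚ) (odds Y))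
    corrected even s Y = addₗ Coef (scale Coef ((#₂ pos 6) ⊗₂ (ϑₚ ϑ₀ ⊗₂ 1+zₚ)) (odds Y))
                                   (scale Coef ((#₂ pos s) ⊗₂ zₚ) (evens Y))

    -- Subtracting 1 or z before asking for nonnegative coefficients makes a sign strict. The part
    -- of Y with the parity of s can afford 1. The other part is divisible by z, because z = 0 is
    -- the case of a polynomial symmetric about its mean, so tests that depend on it subtract z.
    check : Parity → ℕ → Test → 𝒫 → Bool
    check _    s (at-centre σ)      Y = nonNeg₂ (((#₂ σ) ⊗₂ headₗ Y) ⊕₂ ((#₂ -[1+ 0 ]) ⊗₂ zₚ))
    check odd  s (in-band σ r)      Y = nonNeg₃ (cleared σ r (evens Y)) ∧ nonNeg₃ (cleared σ r (odds Y) ⊕₃ (#₃ -[1+ 0 ]))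
    check even s (in-band σ r)      Y = nonNeg₃ (cleared σ r (odds Y)) ∧ nonNeg₃ (cleared σ r (evens Y) ⊕₃ (#₃ -[1+ 0 ]))
    check odd  s (reflection σ r)   Y = (s ℕ.* s ℕ.* Range.upper r ℕ.≤ᵇ 36 ℕ.* ϑ₀ ℕ.* 1000) ∧
      nonNeg₃ (cleared σ r (corrected odd s Y) ⊕₃ (((#₂ -[1+ 0 ]) ⊗₂ zₚ) ∷ []))
    -- At the mirror image of a root the value is -2tO for even s, whence the reversed sign.
    check even s (reflection σ r)   Y = (s ℕ.* s ℕ.* Range.upper r ℕ.≤ᵇ 36 ℕ.* ϑ₀ ℕ.* 1000) ∧
      nonNeg₃ (cleared (ℤ.- σ) r (corrected even s Y) ⊕₃ (((#₂ -[1+ 0 ]) ⊗₂ zₚ) ∷ []))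

  module Sound {ϑ₀ : ℕ} (rg : Region ϑ₀) (0<ϑ₀ : 0 ℕ.< ϑ₀) where
    open Region rg
    open Eval rg
    open Hom hom₂

    ϑ₀≤ϑ : ι (pos ϑ₀) ≤ ϑ
    ϑ₀≤ϑ = subst (_≤ ϑ) (ℚₚ.+-identityʳ (ι (pos ϑ₀))) (ℚₚ.+-monoʳ-≤ (ι (pos ϑ₀)) x≥0)

    ϑ>0 : 0ℚ < ϑ
    ϑ>0 = ℚₚ.<-≤-trans (subst (_< ι (pos ϑ₀)) ι-0 (ι-mono-< (ℤ.+<+ 0<ϑ₀))) ϑ₀≤ϑ

    InRange : Range → ℚ → Set
    InRange (range l h) W = (ι (pos l) * ϑ ≤ ι (pos 1000) * W) × (ι (pos 1000) * W < ι (pos h) * ϑ)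

    nonNeg₂-sound : ∀ p → nonNeg₂ p ≡ true → 0ℚ ≤ ⟦ p ⟧
    nonNeg₂-sound = allₗ-sound hom₁ z≥0 (allₗ nonNegCoeff) (allₗ-sound ℤ-hom x≥0 nonNegCoeff nonNegCoeff-sound)

    private
      p+-q : ∀ p q → p + ι -[1+ 0 ] * q ≡ p - q
      p+-q p q = trans (cong (λ e → p + e * q) (trans (ι-neg (pos 1)) (cong -_ ι-1)))
        (S.solve 2 (λ p q → p S.:+ S.con (- 1ℚ) S.:* q S.:= p S.:- q) refl p q)

    module Band (r : Range) {W : ℚ} (inR : InRange r W) where
      open Range r
      private
        l = ι (pos lower)
        h = ι (pos upper)
        q = ι (pos 1000)
        gap>0 : 0ℚ < h * ϑ - q * W
        gap>0 = <⇒0<- (proj₂ inR)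
        inv = (h * ϑ - q * W) ⁻¹[ gap>0 ]
      -- The solution of 1000(1 + u)W = ϑ(l + hu).
      u : ℚ
      u = (q * W - l * ϑ) * inv
      u≥0 : 0ℚ ≤ u
      u≥0 = 0≤* (≤⇒0≤- (proj₁ inR)) (ℚₚ.<⇒≤ (0<⁻¹ gap>0))
      wn wd : 𝒫
      wn = (ϑₚ ϑ₀ ⊗₂ (#₂ pos lower)) ∷ (ϑₚ ϑ₀ ⊗₂ (#₂ pos upper)) ∷ []
      wd = (#₂ pos 1000) ∷ (#₂ pos 1000) ∷ []
      ⟦wd⟧ : ev u wd ≡ q * (1ℚ + u)
      ⟦wd⟧ = trans (cong₂ (λ a b → a + u * (b + u * 0ℚ)) (⟦#⟧ (pos 1000)) (⟦#⟧ (pos 1000)))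
        (S.solve 2 (λ q u → q S.:+ u S.:* (q S.:+ u S.:* S.con 0ℚ) S.:= q S.:* (S.con 1ℚ S.:+ u)) refl q u)
      ⟦wn⟧ : ev u wn ≡ ϑ * (l + h * u)
      ⟦wn⟧ = trans (cong₂ (λ a b → a + u * (b + u * 0ℚ))
          (trans (⟦⊗⟧ (ϑₚ ϑ₀) (#₂ pos lower)) (cong₂ _*_ ⟦ϑ⟧ (⟦#⟧ (pos lower))))
          (trans (⟦⊗⟧ (ϑₚ ϑ₀) (#₂ pos upper)) (cong₂ _*_ ⟦ϑ⟧ (⟦#⟧ (pos upper)))))
        (S.solve 4 (λ t l h u → t S.:* l S.:+ u S.:* (t S.:* h S.:+ u S.:* S.con 0ℚ) S.:= t S.:* (l S.:+ h S.:* u)) refl ϑ l h u)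
      wdW : ev u wd * W ≡ ev u wn
      wdW = trans (cong (_* W) ⟦wd⟧) (trans (sub≡0 _ _ (trans
          (S.solve 6 (λ q W t l h i → let u = (q S.:* W S.:- l S.:* t) S.:* i in
              q S.:* (S.con 1ℚ S.:+ u) S.:* W S.:- t S.:* (l S.:+ h S.:* u) S.:=
              (q S.:* W S.:- l S.:* t) S.:* (S.con 1ℚ S.:- (h S.:* t S.:- q S.:* W) S.:* i)) refl q W ϑ l h inv)
          (trans (cong (λ e → (q * W - l * ϑ) * (1ℚ - e)) (⁻¹-inverse gap>0))
            (S.solve 1 (λ a → a S.:* (S.con 1ℚ S.:- S.con 1ℚ) S.:= S.con 0ℚ) refl (q * W - l * ϑ))))) (sym ⟦wn⟧))
        where
        sub≡0 : ∀ a b → a - b ≡ 0ℚ → a ≡ b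
        sub≡0 a b e = trans (S.solve 2 (λ a b → a S.:= (a S.:- b) S.:+ b) refl a b) (trans (cong (_+ b) e) (ℚₚ.+-identityˡ b))
      wd>0 : 0ℚ < ev u wd
      wd>0 = subst (0ℚ <_) (sym ⟦wd⟧) (0<* (0<ι 999) (0<+ (ℚₚ.positive⁻¹ 1ℚ) u≥0))

      nonNeg₃-sound : ∀ p → nonNeg₃ p ≡ true → 0ℚ ≤ ev u p
      nonNeg₃-sound = allₗ-sound hom₂ u≥0 nonNeg₂ nonNeg₂-sound

      homᵤ = _[X]-hom hom₂ u

      cleared-value : ∀ σ p → ev u (cleared ϑ₀ σ r p) ≡ ι σ * ev u (proj₁ (clear Coef wn wd p))
      cleared-value σ p = trans (Hom.⟦⊗⟧ homᵤ (#₃ σ) (proj₁ (clear Coef wn wd p))) (cong (_* ev u (proj₁ (clear Coef wn wd p))) (Hom.⟦#⟧ homᵤ σ))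

      private
        den = λ p → ev u (proj₂ (clear Coef wn wd p))

      rescale : ∀ σ p → ev u wd * (ι σ * ev u (proj₁ (clear Coef wn wd p))) ≡ den p * (ι σ * ev W p)
      rescale σ p = trans (S.solve 3 (λ a b c → a S.:* (b S.:* c) S.:= b S.:* (a S.:* c)) refl (ev u wd) (ι σ) (ev u (proj₁ (clear Coef wn wd p))))
        (trans (cong (ι σ *_) (clear-correct hom₂ wdW wd>0 p))
          (S.solve 3 (λ a b c → b S.:* (a S.:* c) S.:= a S.:* (b S.:* c)) refl (den p) (ι σ) (ev W p)))

      ≥0 : ∀ σ p → nonNeg₃ (cleared ϑ₀ σ r p) ≡ true → 0ℚ ≤ ι σ * ev W p
      ≥0 σ p e = *-cancel≤ (clear-den>0 hom₂ wdW wd>0 p) (subst₂ _≤_ (sym (ℚₚ.*-zeroʳ (den p))) (rescale σ p)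
        (0≤* (ℚₚ.<⇒≤ wd>0) (subst (0ℚ ≤_) (cleared-value σ p) (nonNeg₃-sound (cleared ϑ₀ σ r p) e))))

      >0 : ∀ σ p b → 0ℚ < b → (low : 𝒫) → ev u low ≡ - b → nonNeg₃ (cleared ϑ₀ σ r p ⊕₃ low) ≡ true → 0ℚ < ι σ * ev W p
      >0 σ p b b>0 low elow e = *-cancel< (ℚₚ.<⇒≤ (clear-den>0 hom₂ wdW wd>0 p)) (subst₂ _<_ (sym (ℚₚ.*-zeroʳ (den p))) (rescale σ p)
        (0<* wd>0 (subst (0ℚ <_) (cleared-value σ p) (ℚₚ.<-≤-trans b>0 (0≤-⇒≤
          (subst (0ℚ ≤_) (trans (Hom.⟦⊕⟧ homᵤ (cleared ϑ₀ σ r p) low) (cong (ev u (cleared ϑ₀ σ r p) +_) elow))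
            (nonNeg₃-sound (cleared ϑ₀ σ r p ⊕₃ low) e)))))))

      low-one : ev u (#₃ -[1+ 0 ]) ≡ - 1ℚ
      low-one = trans (Hom.⟦#⟧ homᵤ -[1+ 0 ]) (trans (ι-neg (pos 1)) (cong -_ ι-1))

      low-z : ev u (((#₂ -[1+ 0 ]) ⊗₂ zₚ) ∷ []) ≡ - z
      low-z = trans (⟦const⟧ hom₂ u ((#₂ -[1+ 0 ]) ⊗₂ zₚ)) (trans (⟦⊗⟧ (#₂ -[1+ 0 ]) zₚ) (trans (cong₂ _*_ (trans (⟦#⟧ -[1+ 0 ])
        (trans (ι-neg (pos 1)) (cong -_ ι-1))) ⟦z⟧) (S.solve 1 (λ z → S.con (- 1ℚ) S.:* z S.:= S.:- z) refl z)))

    Holds : Test → (ℚ → ℚ) → Set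
    Holds (at-centre σ)    H = 0ℚ < ι σ * H 0ℚ
    Holds (in-band σ r)    H = ∀ t → 0ℚ < t → InRange r (t * t) → 0ℚ < ι σ * H t
    Holds (reflection σ r) H = ∀ t → 0ℚ < t → InRange r (t * t) → H t ≡ 0ℚ → 0ℚ < ι σ * H (- t)

    private
      neg² : ∀ t → - t * - t ≡ t * t
      neg² t = S.solve 1 (λ t → S.:- t S.:* S.:- t S.:= t S.:* t) refl t

      split : ∀ Y t → ev t Y ≡ ev (t * t) (evens Y) + t * ev (t * t) (odds Y)
      split Y t = eval-evens-odds hom₂ t (t * t) refl Y

      split- : ∀ Y t → ev (- t) Y ≡ ev (t * t) (evens Y) - t * ev (t * t) (odds Y)
      split- Y t = trans (eval-evens-odds hom₂ (- t) (t * t) (neg² t) Y)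
        (S.solve 3 (λ e t o → e S.:+ S.:- t S.:* o S.:= e S.:- t S.:* o) refl (ev (t * t) (evens Y)) t (ev (t * t) (odds Y)))

      ι*[e+to] : ∀ σ e t o → ι σ * (e + t * o) ≡ ι σ * e + t * (ι σ * o)
      ι*[e+to] σ e t o = S.solve 4 (λ s e t o → s S.:* (e S.:+ t S.:* o) S.:= s S.:* e S.:+ t S.:* (s S.:* o)) refl (ι σ) e t o

      -- Since ρ < 1, this makes 1 - κt positive, the factor by which the corrected part differs
      -- from the true one on a root. Squared, it reduces to s²·h ≤ 36·1000·ϑ₀, the first condition
      -- of the test.
      st<6ϑ : ∀ s (r : Range) t → 0ℚ < t → InRange r (t * t) → (s ℕ.* s ℕ.* Range.upper r ℕ.≤ᵇ 36 ℕ.* ϑ₀ ℕ.* 1000) ≡ true →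
              ι (pos s) * t < ι (pos 6) * ϑ
      st<6ϑ s (range l h) t t>0 (_ , up) chk with s ℕ.≟ 0
      ... | yes refl = subst (_< ι (pos 6) * ϑ) (sym (trans (cong (_* t) ι-0) (ℚₚ.*-zeroˡ t))) (0<* (0<ι 5) ϑ>0)
      ... | no s≢0 = square-cancel-< (0≤* (0≤ι 6) (ℚₚ.<⇒≤ ϑ>0)) (*-cancel< (0≤ι 1000) (begin-strict
          q′ * ((s′ * t) * (s′ * t))        ≡⟨ S.solve 3 (λ q s t → q S.:* ((s S.:* t) S.:* (s S.:* t)) S.:= s S.:* s S.:* (q S.:* (t S.:* t))) refl q′ s′ t ⟩
          s′ * s′ * (q′ * (t * t))          <⟨ *-mono< (0<* s>0 s>0) up ⟩
          s′ * s′ * (ι (pos h) * ϑ)         ≡⟨ trans (sym (ℚₚ.*-assoc (s′ * s′) (ι (pos h)) ϑ)) (cong (_* ϑ) (trans (cong (_* ι (pos h)) (sym (ι-ℕ* s s))) (sym (ι-ℕ* (s ℕ.* s) h)))) ⟩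
          ι (pos (s ℕ.* s ℕ.* h)) * ϑ       ≤⟨ ℚₚ.*-monoʳ-≤-nonNeg ϑ {{ℚ.nonNegative (ℚₚ.<⇒≤ ϑ>0)}} (ι-mono-≤ (ℤ.+≤+ (ℕₚ.≤ᵇ⇒≤ _ _ (subst T (sym chk) tt)))) ⟩
          ι (pos (36 ℕ.* ϑ₀ ℕ.* 1000)) * ϑ ≡⟨ cong (_* ϑ) (trans (ι-ℕ* (36 ℕ.* ϑ₀) 1000) (cong (_* q′) (ι-ℕ* 36 ϑ₀))) ⟩
          i36 * ι (pos ϑ₀) * q′ * ϑ         ≡⟨ S.solve 4 (λ i θ q t → i S.:* θ S.:* q S.:* t S.:= i S.:* q S.:* t S.:* θ) refl i36 (ι (pos ϑ₀)) q′ ϑ ⟩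
          i36 * q′ * ϑ * ι (pos ϑ₀)         ≤⟨ *-mono≤ (0≤* (0≤* (0≤ι 36) (0≤ι 1000)) (ℚₚ.<⇒≤ ϑ>0)) ϑ₀≤ϑ ⟩
          i36 * q′ * ϑ * ϑ                  ≡⟨ cong (λ e → e * q′ * ϑ * ϑ) (ι-ℕ* 6 6) ⟩
          ι (pos 6) * ι (pos 6) * q′ * ϑ * ϑ ≡⟨ S.solve 3 (λ i q t → i S.:* i S.:* q S.:* t S.:* t S.:= q S.:* ((i S.:* t) S.:* (i S.:* t))) refl (ι (pos 6)) q′ ϑ ⟩
          q′ * ((ι (pos 6) * ϑ) * (ι (pos 6) * ϑ)) ∎))
        where
        open ℚₚ.≤-Reasoning
        s′ = ι (pos s)
        q′ = ι (pos 1000)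
        i36 = ι (pos 36)
        s>0 : 0ℚ < s′
        s>0 = subst (_< s′) ι-0 (ι-mono-< (ℤ.+<+ (ℕₚ.n≢0⇒n>0 s≢0)))

    private
      -- At a root t of Y = E + tO the two parts determine each other, so Y(-t) = E - tO is 2E as
      -- well as -2tO and its sign is that of a single part. Adding κWO to E, or κE to O, changes
      -- this part only by the factor 1 - κt.
      module Refl (s : ℕ) (r : Range) (σ : ℤ) (Y : 𝒫) (t : ℚ) (t>0 : 0ℚ < t) (inR : InRange r (t * t)) (root : ev t Y ≡ 0ℚ)
                  (s≤ : (s ℕ.* s ℕ.* Range.upper r ℕ.≤ᵇ 36 ℕ.* ϑ₀ ℕ.* 1000) ≡ true) where
        open Band r inR
        W = t * t
        e = ev W (evens Y)
        o = ev W (odds Y)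
        e+to : e + t * o ≡ 0ℚ
        e+to = trans (sym (split Y t)) root
        k6 : 𝒞
        k6 = (#₂ pos 6) ⊗₂ (ϑₚ ϑ₀ ⊗₂ 1+zₚ)
        ksz : 𝒞
        ksz = (#₂ pos s) ⊗₂ zₚ
        ⟦k6⟧ : ⟦ k6 ⟧ ≡ ι (pos 6) * (ϑ * (1ℚ + z))
        ⟦k6⟧ = trans (⟦⊗⟧ (#₂ pos 6) (ϑₚ ϑ₀ ⊗₂ 1+zₚ)) (cong₂ _*_ (⟦#⟧ (pos 6)) (trans (⟦⊗⟧ (ϑₚ ϑ₀) 1+zₚ) (cong₂ _*_ ⟦ϑ⟧ ⟦1+z⟧)))
        ⟦ksz⟧ : ⟦ ksz ⟧ ≡ ι (pos s) * z
        ⟦ksz⟧ = trans (⟦⊗⟧ (#₂ pos s) zₚ) (cong₂ _*_ (⟦#⟧ (pos s)) ⟦z⟧)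
        factor : ℚ
        factor = ι (pos 6) * (ϑ * (1ℚ + z)) - ι (pos s) * z * t
        factor>0 : 0ℚ < factor
        factor>0 = <⇒0<- (begin-strict
          ι (pos s) * z * t              ≡⟨ S.solve 3 (λ s z t → s S.:* z S.:* t S.:= z S.:* (s S.:* t)) refl (ι (pos s)) z t ⟩
          z * (ι (pos s) * t)            <⟨ *-mono< z>0 (st<6ϑ s r t t>0 inR s≤) ⟩
          z * (ι (pos 6) * ϑ)            ≤⟨ ℚₚ.*-monoʳ-≤-nonNeg (ι (pos 6) * ϑ) {{ℚ.nonNegative (0≤* (0≤ι 6) (ℚₚ.<⇒≤ ϑ>0))}}
                                              (subst (_≤ 1ℚ + z) (ℚₚ.+-identityˡ z) (ℚₚ.+-monoˡ-≤ z (ℚₚ.nonNegative⁻¹ 1ℚ))) ⟩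
          (1ℚ + z) * (ι (pos 6) * ϑ)     ≡⟨ S.solve 3 (λ w i t → w S.:* (i S.:* t) S.:= i S.:* (t S.:* w)) refl (1ℚ + z) (ι (pos 6)) ϑ ⟩
          ι (pos 6) * (ϑ * (1ℚ + z))     ∎)
          where open ℚₚ.≤-Reasoning
        hW = _[X]-hom hom₂ W
        -- on a root, tO = -E
        odd-value : ev W (corrected ϑ₀ odd s Y) ≡ factor * e
        odd-value = trans (Hom.⟦⊕⟧ hW (scale Coef k6 (evens Y)) ((#₂ pos 0) ∷ scale Coef ksz (odds Y)))
          (trans (cong₂ _+_ (trans (eval-scale hom₂ W k6 (evens Y)) (cong (_* e) ⟦k6⟧))
                            (cong₂ (λ a b → a + W * b) (trans (⟦#⟧ (pos 0)) ι-0) (trans (eval-scale hom₂ W ksz (odds Y)) (cong (_* o) ⟦ksz⟧))))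
          (trans (S.solve 5 (λ k sz t e o → k S.:* e S.:+ (S.con 0ℚ S.:+ (t S.:* t) S.:* (sz S.:* o)) S.:=
                    (k S.:- sz S.:* t) S.:* e S.:+ sz S.:* t S.:* (e S.:+ t S.:* o)) refl (ι (pos 6) * (ϑ * (1ℚ + z))) (ι (pos s) * z) t e o)
          (trans (cong (λ a → factor * e + ι (pos s) * z * t * a) e+to)
            (S.solve 2 (λ a b → a S.:+ b S.:* S.con 0ℚ S.:= a) refl (factor * e) (ι (pos s) * z * t)))))
        even-value : ev W (corrected ϑ₀ even s Y) ≡ factor * o
        even-value = trans (Hom.⟦⊕⟧ hW (scale Coef k6 (odds Y)) (scale Coef ksz (evens Y)))
          (trans (cong₂ _+_ (trans (eval-scale hom₂ W k6 (odds Y)) (cong (_* o) ⟦k6⟧)) (trans (eval-scale hom₂ W ksz (evens Y)) (cong (_* e) ⟦ksz⟧)))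
          (trans (S.solve 5 (λ k sz t e o → k S.:* o S.:+ sz S.:* e S.:= (k S.:- sz S.:* t) S.:* o S.:+ sz S.:* (e S.:+ t S.:* o))
                    refl (ι (pos 6) * (ϑ * (1ℚ + z))) (ι (pos s) * z) t e o)
          (trans (cong (λ a → factor * o + ι (pos s) * z * a) e+to)
            (S.solve 2 (λ a b → a S.:+ b S.:* S.con 0ℚ S.:= a) refl (factor * o) (ι (pos s) * z)))))
        unfactor : ∀ σ a → 0ℚ < ι σ * (factor * a) → 0ℚ < ι σ * a
        unfactor σ a lt = *-cancel< (ℚₚ.<⇒≤ factor>0) (subst₂ _<_ (sym (ℚₚ.*-zeroʳ factor))
          (S.solve 3 (λ s f a → s S.:* (f S.:* a) S.:= f S.:* (s S.:* a)) refl (ι σ) factor a) lt)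

    check-sound : ∀ par s test Y → check ϑ₀ par s test Y ≡ true → Holds test (λ t → ev t Y)
    check-sound par s (at-centre σ) Y chk = subst (λ a → 0ℚ < ι σ * a) (sym (head-value Y)) (ℚₚ.<-≤-trans z>0 (0≤-⇒≤
        (subst (0ℚ ≤_) (trans (⟦⊕⟧ ((#₂ σ) ⊗₂ headₗ Y) ((#₂ -[1+ 0 ]) ⊗₂ zₚ)) (trans (cong₂ _+_
            (trans (⟦⊗⟧ (#₂ σ) (headₗ Y)) (cong (_* ⟦ headₗ Y ⟧) (⟦#⟧ σ))) (trans (⟦⊗⟧ (#₂ -[1+ 0 ]) zₚ) (cong₂ _*_ (⟦#⟧ -[1+ 0 ]) ⟦z⟧)))
            (p+-q (ι σ * ⟦ headₗ Y ⟧) z)))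
          (nonNeg₂-sound (((#₂ σ) ⊗₂ headₗ Y) ⊕₂ ((#₂ -[1+ 0 ]) ⊗₂ zₚ)) chk))))
      where
      head-value : ∀ Y → ev 0ℚ Y ≡ ⟦ headₗ Y ⟧
      head-value []      = sym (trans (⟦#⟧ (pos 0)) ι-0)
      head-value (a ∷ p) = trans (cong (⟦ a ⟧ +_) (ℚₚ.*-zeroˡ (ev 0ℚ p))) (ℚₚ.+-identityʳ ⟦ a ⟧)
    check-sound odd s (in-band σ r) Y chk t t>0 inR with ∧-true chk
    ... | c₁ , c₂ = subst (0ℚ <_) (trans (sym (ι*[e+to] σ _ t _)) (cong (ι σ *_) (sym (split Y t))))
        (0≤+0< (≥0 σ (evens Y) c₁) (0<* t>0 (>0 σ (odds Y) 1ℚ (ℚₚ.positive⁻¹ 1ℚ) (#₃ -[1+ 0 ]) low-one c₂)))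
      where open Band r inR
    check-sound even s (in-band σ r) Y chk t t>0 inR with ∧-true chk
    ... | c₁ , c₂ = subst (0ℚ <_) (trans (sym (ι*[e+to] σ _ t _)) (cong (ι σ *_) (sym (split Y t))))
        (0<+ (>0 σ (evens Y) 1ℚ (ℚₚ.positive⁻¹ 1ℚ) (#₃ -[1+ 0 ]) low-one c₂) (0≤* (ℚₚ.<⇒≤ t>0) (≥0 σ (odds Y) c₁)))
      where open Band r inR
    check-sound odd s (reflection σ r) Y chk t t>0 inR root with ∧-true chk
    ... | c₁ , c₂ = subst (0ℚ <_) (cong (ι σ *_) (sym value)) (subst (0ℚ <_) (S.solve 3 (λ i s e → i S.:* (s S.:* e) S.:= s S.:* (i S.:* e)) refl (ι (pos 2)) (ι σ) e)
          (0<* (0<ι 1) (unfactor σ e (subst (λ a → 0ℚ < ι σ * a) odd-value (>0 σ (corrected ϑ₀ odd s Y) z z>0 (((#₂ -[1+ 0 ]) ⊗₂ zₚ) ∷ []) low-z c₂)))))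
      where
      open Refl s r σ Y t t>0 inR root c₁
      open Band r inR
      value : ev (- t) Y ≡ ι (pos 2) * e
      value = trans (split- Y t) (trans (S.solve 3 (λ e t o → e S.:- t S.:* o S.:= (e S.:+ e) S.:- (e S.:+ t S.:* o)) refl e t o)
        (trans (cong (λ a → (e + e) - a) e+to) (trans (S.solve 1 (λ e → (e S.:+ e) S.:- S.con 0ℚ S.:= (S.con 1ℚ S.:+ S.con 1ℚ) S.:* e) refl e)
          (cong (_* e) (sym (trans (ι-+ (pos 1) (pos 1)) (cong₂ _+_ ι-1 ι-1)))))))
    check-sound even s (reflection σ r) Y chk t t>0 inR root with ∧-true chk
    ... | c₁ , c₂ = subst (0ℚ <_) (cong (ι σ *_) (sym value)) (subst (0ℚ <_) eq
          (0<* (0<* (0<ι 1) t>0) (unfactor (ℤ.- σ) o (subst (λ a → 0ℚ < ι (ℤ.- σ) * a) even-value (>0 (ℤ.- σ) (corrected ϑ₀ even s Y) z z>0 (((#₂ -[1+ 0 ]) ⊗₂ zₚ) ∷ []) low-z c₂)))))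
      where
      open Refl s r σ Y t t>0 inR root c₁
      open Band r inR
      eq : ι (pos 2) * t * (ι (ℤ.- σ) * o) ≡ ι σ * (- (ι (pos 2) * (t * o)))
      eq = trans (cong (λ a → ι (pos 2) * t * (a * o)) (ι-neg σ)) (S.solve 4 (λ i t s o → i S.:* t S.:* ((S.:- s) S.:* o) S.:= s S.:* (S.:- (i S.:* (t S.:* o)))) refl (ι (pos 2)) t (ι σ) o)
      value : ev (- t) Y ≡ - (ι (pos 2) * (t * o))
      value = trans (split- Y t) (trans (S.solve 2 (λ e to → e S.:- to S.:= (e S.:+ to) S.:- (S.con 1ℚ S.:+ S.con 1ℚ) S.:* to) refl e (t * o))
        (trans (cong₂ (λ a b → a - b * (t * o)) e+to (sym (trans (ι-+ (pos 1) (pos 1)) (cong₂ _+_ ι-1 ι-1))))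
          (ℚₚ.+-identityˡ (- (ι (pos 2) * (t * o))))))

-- Integral roots between sign changes, and rational points at prescribed distances from a centre.

module RootWindows where
  open Rationals
  open Polynomials
  open Regions
  open SignTests
  open import Data.Nat as ℕ using (ℕ; zero; suc)
  import Data.Nat.Properties as ℕₚ
  open import Data.Integer as ℤ using (ℤ; -[1+_]) renaming (+_ to pos)
  import Data.Integer.Properties as ℤₚ
  open import Data.Rational as ℚ using (ℚ; 0ℚ; 1ℚ; _+_; _*_; -_; _-_; _≤_; _<_)
  import Data.Rational.Properties as ℚₚ
  import Data.Rational.Unnormalised as ℚᵘ
  import Data.Rational.Unnormalised.Properties as ℚᵘₚ
  open import Data.List using (List; []; _∷_)
  open import Data.Bool using (Bool; true; _∧_; T)
  open import Data.Unit using (tt)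
  open import Data.Empty using (⊥; ⊥-elim)
  open import Data.Product using (_×_; _,_; proj₁; proj₂; ∃-syntax)
  open import Data.Sum using (inj₁; inj₂)
  import Data.Nat.Solver as ℕSolver
  module N = ℕSolver.+-*-Solver
  open import Relation.Nullary using (yes; no; ¬_; Dec)
  open import Relation.Binary.PropositionalEquality

  roots→poly : List ℤ → ℚ → ℚ
  roots→poly []       p = 1ℚ
  roots→poly (δ ∷ δs) p = (p - ι δ) * roots→poly δs p

  private
    factor-neg : ∀ δs p q → roots→poly δs p * roots→poly δs q < 0ℚ → ∃[ δ ] (((p - ι δ) * (q - ι δ) < 0ℚ) × roots→poly δs (ι δ) ≡ 0ℚ)
    factor-neg []       p q lt = ⊥-elim (ℚₚ.<-irrefl refl (ℚₚ.<-trans lt (subst (0ℚ <_) (sym (ℚₚ.*-identityˡ 1ℚ)) (ℚₚ.positive⁻¹ 1ℚ))))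
    factor-neg (δ ∷ δs) p q lt with (p - ι δ) * (q - ι δ) ℚₚ.<? 0ℚ
    ... | yes a = δ , a , trans (cong (_* roots→poly δs (ι δ)) (ℚₚ.+-inverseʳ (ι δ))) (ℚₚ.*-zeroˡ (roots→poly δs (ι δ)))
    ... | no ¬a with roots→poly δs p * roots→poly δs q ℚₚ.<? 0ℚ
    ...   | yes b = let δ′ , x , y = factor-neg δs p q b in
                    δ′ , x , trans (cong ((ι δ′ - ι δ) *_) y) (ℚₚ.*-zeroʳ (ι δ′ - ι δ))
    ...   | no ¬b = ⊥-elim (ℚₚ.<-irrefl refl (ℚₚ.≤-<-trans (subst (0ℚ ≤_)
          (S.solve 4 (λ a b c d → (a S.:* b) S.:* (c S.:* d) S.:= (a S.:* c) S.:* (b S.:* d)) refl (p - ι δ) (q - ι δ) (roots→poly δs p) (roots→poly δs q))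
          (0≤* (ℚₚ.≮⇒≥ ¬a) (ℚₚ.≮⇒≥ ¬b))) lt))

  neg*⇒between : ∀ {p q d} → p < q → (p - d) * (q - d) < 0ℚ → (p < d) × (d < q)
  neg*⇒between {p} {q} {d} p<q lt = p<d , d<q
    where
    p<d : p < d
    p<d = ℚₚ.≰⇒> λ d≤p → ℚₚ.<-irrefl refl (ℚₚ.≤-<-trans (0≤* (≤⇒0≤- d≤p) (≤⇒0≤- (ℚₚ.≤-trans d≤p (ℚₚ.<⇒≤ p<q)))) lt)
    d<q : d < q
    d<q = ℚₚ.≰⇒> λ q≤d → ℚₚ.<-irrefl refl (ℚₚ.≤-<-trans (subst (0ℚ ≤_)
      (S.solve 3 (λ p q d → (d S.:- p) S.:* (d S.:- q) S.:= (p S.:- d) S.:* (q S.:- d)) refl p q d)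
      (0≤* (≤⇒0≤- (ℚₚ.≤-trans (ℚₚ.<⇒≤ p<q) q≤d)) (≤⇒0≤- q≤d))) lt)

  -- A product can change sign only if one of its linear factors does, and the zero of that factor
  -- is an integer; no completeness of the line enters.
  root-between : ∀ δs σ {p q} → p < q → 0ℚ < ι σ * roots→poly δs p → 0ℚ < ι (ℤ.- σ) * roots→poly δs q →
                 ∃[ δ ] ((p < ι δ) × (ι δ < q) × roots→poly δs (ι δ) ≡ 0ℚ)
  root-between δs σ {p} {q} p<q a b = let δ , lt , z = factor-neg δs p q neg in δ , proj₁ (neg*⇒between p<q lt) , proj₂ (neg*⇒between p<q lt) , z
    where
    fp = roots→poly δs p
    fq = roots→poly δs q
    σ²≥0 : 0ℚ ≤ ι σ * ι σ
    σ²≥0 with ℚₚ.≤-total 0ℚ (ι σ)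
    ... | inj₁ h = 0≤* h h
    ... | inj₂ h = subst (0ℚ ≤_) (S.solve 1 (λ s → (S.con 0ℚ S.:- s) S.:* (S.con 0ℚ S.:- s) S.:= s S.:* s) refl (ι σ)) (0≤* (≤⇒0≤- h) (≤⇒0≤- h))
    neg : fp * fq < 0ℚ
    neg = ℚₚ.≰⇒> λ h → ℚₚ.<-irrefl refl (ℚₚ.<-≤-trans (0<* a b) (0≤-⇒≤ (subst (0ℚ ≤_)
      (trans (S.solve 3 (λ s x y → (s S.:* s) S.:* (x S.:* y) S.:= S.con 0ℚ S.:- (s S.:* x) S.:* ((S.:- s) S.:* y)) refl (ι σ) fp fq)
        (cong (λ e → 0ℚ - (ι σ * fp) * (e * fq)) (sym (ι-neg σ)))) (0≤* σ²≥0 h))))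

  ceil : ∀ p → ∃[ n ] (p ≤ ι (pos n))
  ceil p = ℤ.∣ ℚ.↥ p ∣ , ceil-≤ p
    where
    abstract
      ceil-≤ : ∀ p → p ≤ ι (pos ℤ.∣ ℚ.↥ p ∣)
      ceil-≤ p@(ℚ.mkℚ _ _ _) = ℚₚ.toℚᵘ-cancel-≤ (ℚᵘₚ.≤-respʳ-≃ (ℚᵘₚ.≃-sym (ι≃ (pos ℤ.∣ ℚ.↥ p ∣)))
        (ℚᵘ.*≤* (subst₂ ℤ._≤_ (sym (ℤₚ.*-identityʳ (ℚ.↥ p))) refl (num≤ (ℚ.↥ p) (ℚ.denominator-1 p)))))
        where
        num≤ : ∀ n d → n ℤ.≤ pos ℤ.∣ n ∣ ℤ.* pos (suc d)
        num≤ (pos n) d = subst (pos n ℤ.≤_) (ℤₚ.pos-* n (suc d)) (ℤ.+≤+ (ℕₚ.m≤m*n n (suc d)))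
        num≤ -[1+ n ] d = ℤₚ.≤-trans ℤ.-≤+ (subst (pos 0 ℤ.≤_) (ℤₚ.pos-* (suc n) (suc d)) (ℤ.+≤+ ℕ.z≤n))

  last-true : (P : ℕ → Set) → (∀ n → Dec (P n)) → P 0 → ∀ K → ¬ P K → ∃[ n ] (P n × ¬ P (suc n))
  last-true P dec p0 zero    ¬pK = ⊥-elim (¬pK p0)
  last-true P dec p0 (suc K) ¬pK with dec K
  ... | yes pK = K , pK , ¬pK
  ... | no ¬p  = last-true P dec p0 K ¬p

  no-integer-between : ∀ i → 0ℚ < ι i → ι i < 1ℚ → ⊥
  no-integer-between i a b = ℤₚ.<-irrefl refl (ℤₚ.<-≤-trans (ι-cancel-< (subst (ι i <_) (sym ι-1) b))
    (ℤₚ.i<j⇒suc[i]≤j (ι-cancel-< (subst (_< ι i) (sym ι-0) a))))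

  -- 10⁶·l₀ and so on: all comparisons are made on natural numbers.

  band-check : ℕ → Range → ℕ → Bool
  band-check ϑ₀ (range l h) n₀ =
    (l ℕ.* (suc n₀ ℕ.* suc n₀) ℕ.≤ᵇ h ℕ.* (n₀ ℕ.* n₀)) ∧ (1000 ℕ.* (n₀ ℕ.* n₀) ℕ.<ᵇ h ℕ.* 4096 ℕ.* ϑ₀) ∧ (0 ℕ.<ᵇ n₀)

  -- E, E′ bound the displacement of the centre; m, m′ the relative error it causes.
  record Fit : Set where
    constructor fit
    field E m k E′ m′ k′ : ℕ

  -- Because ρ < 1, passing from centre `c₀` to `c` shortens the inner distance t₀ by at most E/1000
  -- ≤ (m/1000)t₀, and passing from `c₁` to `c` lengthens the outer distance t₁ by at most E′/1000 ≤
  -- (m′/1000)t₁. A root between the two bands thus lies at a distance between kt₀/1000 and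
  -- k′t₁/1000 from `c`. The comparisons are the squares of these statements, with ϑ replaced by its
  -- lower bound where that is safe.
  fit-check : ℕ → Range → Range → Range → ℤ → ℤ → ℤ → Fit → Bool
  fit-check ϑ₀ (range l₀ h₀) (range l₁ h₁) (range l h) c₀ c₁ c (fit E m k E′ m′ k′) =
    (c ℤ.≤ᵇ c₀ ℤ.+ pos E) ∧ (c₁ ℤ.≤ᵇ c ℤ.+ pos E′) ∧ (k ℕ.+ m ℕ.≡ᵇ 1000) ∧ (0 ℕ.<ᵇ k) ∧ (0 ℕ.<ᵇ l₀) ∧
    (E ℕ.* E ℕ.* 1000 ℕ.≤ᵇ m ℕ.* m ℕ.* l₀ ℕ.* ϑ₀) ∧ (l ℕ.* 1000000 ℕ.≤ᵇ k ℕ.* k ℕ.* l₀) ∧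
    (E′ ℕ.* E′ ℕ.* 1000 ℕ.≤ᵇ m′ ℕ.* m′ ℕ.* l₁ ℕ.* ϑ₀) ∧ (k′ ℕ.* k′ ℕ.* h₁ ℕ.≤ᵇ h ℕ.* 1000000) ∧
    (m′ ℕ.+ 1000 ℕ.≡ᵇ k′) ∧ (h₀ ℕ.≤ᵇ l₁) ∧ (c₀ ℤ.≤ᵇ c₁)

  T-≡ : ∀ {b} → b ≡ true → T b
  T-≡ refl = tt

  -- The link with designs is `form`: the homogenised polynomial is a positive multiple of the
  -- product of the p - δ, so the tests on coefficients become statements about the signs of this
  -- product.
  module Roots {ϑ₀ : ℕ} (rg : Region ϑ₀) (0<ϑ₀ : 0 ℕ.< ϑ₀) (s : ℕ) (δs : List ℤ) (κ : ℚ) (κ>0 : 0ℚ < κ)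
               (form : ∀ l p → horner ℚ-raw s (Region.N rg) (Region.G rg) l (l * p) ≡ (κ * l ^ s) * roots→poly δs p) where
    open Region rg
    open Eval rg
    open Sound rg 0<ϑ₀

    f : ℚ → ℚ
    f = roots→poly δs

    private
      K : ℚ
      K = κ * lam ^ s
      K>0 : 0ℚ < K
      K>0 = 0<* κ>0 (0<^ s lam>0)

      value : ∀ c t → ev t (centred ϑ₀ s c) ≡ K * f (centre s c + t)
      value c t = trans (⟦centred⟧ s c t) (form lam (centre s c + t))

      transfer : ∀ σ c t → 0ℚ < ι σ * ev t (centred ϑ₀ s c) → 0ℚ < ι σ * f (centre s c + t)
      transfer σ c t lt = *-cancel< (ℚₚ.<⇒≤ K>0) (subst₂ _<_ (sym (ℚₚ.*-zeroʳ K)) (trans (cong (ι σ *_) (value c t))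
        (S.solve 3 (λ s k f → s S.:* (k S.:* f) S.:= k S.:* (s S.:* f)) refl (ι σ) K (f (centre s c + t)))) lt)

    HoldsAt : ℤ → Test → Set
    HoldsAt c (at-centre σ)    = 0ℚ < ι σ * f (centre s c)
    HoldsAt c (in-band σ r)    = ∀ t → 0ℚ < t → InRange r (t * t) → 0ℚ < ι σ * f (centre s c + t)
    HoldsAt c (reflection σ r) = ∀ t → 0ℚ < t → InRange r (t * t) → f (centre s c + t) ≡ 0ℚ → 0ℚ < ι σ * f (centre s c - t)

    certified : ∀ par c test → check ϑ₀ par s test (centred ϑ₀ s c) ≡ true → HoldsAt c test
    certified par c (at-centre σ) chk = subst (λ e → 0ℚ < ι σ * f e) (ℚₚ.+-identityʳ (centre s c))
      (transfer σ c 0ℚ (check-sound par s (at-centre σ) (centred ϑ₀ s c) chk))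
    certified par c (in-band σ r) chk t t>0 inR = transfer σ c t (check-sound par s (in-band σ r) (centred ϑ₀ s c) chk t t>0 inR)
    certified par c (reflection σ r) chk t t>0 inR root = transfer σ c (- t)
      (check-sound par s (reflection σ r) (centred ϑ₀ s c) chk t t>0 inR
        (trans (value c t) (trans (cong (K *_) root) (ℚₚ.*-zeroʳ K))))

    ρ>0 : 0ℚ < ρ
    ρ>0 = *-cancel< (ℚₚ.<⇒≤ 1+z>0) (subst₂ _<_ (sym (ℚₚ.*-zeroʳ (1ℚ + z))) (trans (sym ρ-def) (ℚₚ.*-comm ρ (1ℚ + z))) z>0)

    ρ<1 : ρ < 1ℚ
    ρ<1 = *-cancel< (ℚₚ.<⇒≤ 1+z>0) (subst₂ _<_ (trans (sym ρ-def) (ℚₚ.*-comm ρ (1ℚ + z))) (sym (ℚₚ.*-identityʳ (1ℚ + z)))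
      (subst (_< 1ℚ + z) (ℚₚ.+-identityˡ z) (ℚₚ.+-monoˡ-< z (ℚₚ.positive⁻¹ 1ℚ))))

    1000>0 : 0ℚ < ι (pos 1000)
    1000>0 = 0<ι 999

    centre-< : ∀ {c c′} → c ℤ.< c′ → centre s c < centre s c′
    centre-< {c} {c′} lt = ℚₚ.+-monoʳ-< (mean s) (subst₂ _<_ (ℚₚ.*-comm ρ (val c)) (ℚₚ.*-comm ρ (val c′)) (*-mono< ρ>0
      (*-cancel< (ℚₚ.<⇒≤ 1000>0) (subst₂ _<_ (sym (val-den c)) (sym (val-den c′)) (ι-mono-< lt)))))

    -- 1000 (centre c - centre c′) = (c - c′) ρ
    centre-diff : ∀ c c′ → ι (pos 1000) * (centre s c - centre s c′) ≡ (ι c - ι c′) * ρ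
    centre-diff c c′ = trans (S.solve 5 (λ d m v v′ r → d S.:* ((m S.:+ v S.:* r) S.:- (m S.:+ v′ S.:* r)) S.:= (d S.:* v S.:- d S.:* v′) S.:* r)
        refl (ι (pos 1000)) (mean s) (val c) (val c′) ρ)
      (cong₂ (λ a b → (a - b) * ρ) (val-den c) (val-den c′))

    shift≤ : ∀ c c′ E → c ℤ.≤ c′ ℤ.+ pos E → ι (pos 1000) * (centre s c - centre s c′) ≤ ι (pos E)
    shift≤ c c′ E le = subst (_≤ ι (pos E)) (sym (centre-diff c c′)) (ℚₚ.≤-trans
      (*-mono≤ʳ {ι c - ι c′} {ι (pos E)} (ℚₚ.<⇒≤ ρ>0) (0≤-⇒≤ {ι c - ι c′} {ι (pos E)} (subst (0ℚ ≤_)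
        (trans (cong (_- ι c) (ι-+ c′ (pos E))) (S.solve 3 (λ a b e → (b S.:+ e) S.:- a S.:= e S.:- (a S.:- b)) refl (ι c) (ι c′) (ι (pos E)))) (≤⇒0≤- (ι-mono-≤ le)))))
      (subst (ι (pos E) * ρ ≤_) (ℚₚ.*-identityʳ (ι (pos E))) (*-mono≤ {ρ} {1ℚ} (0≤ι E) (ℚₚ.<⇒≤ ρ<1))))

    -- The square roots of the ends of the band are in general irrational, so a point is sought on
    -- the grid of step 1/64, whence 4096. The largest n with (n/64)² below the upper end will do:
    -- (n + 1)/64 is beyond that end, and the ratio (n + 1)²/n² does not exceed h/l.
    band-point : ∀ r n₀ → band-check ϑ₀ r n₀ ≡ true → ∃[ t ] (0ℚ < t × InRange r (t * t))
    band-point (range l h) n₀ chk with ∧-true chk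
    ... | c₁ , c₂₃ with ∧-true c₂₃
    ...   | c₂ , c₃ = t , t>0 , lower , upper
      where
      H : ℚ
      H = ι (pos h) * ι (pos 4096) * ϑ
      P : ℕ → Set
      P n = ι (pos 1000) * (ι (pos n) * ι (pos n)) < H
      open ℚₚ.≤-Reasoning
      ϑH : ι (pos h) * ι (pos 4096) * ι (pos ϑ₀) ≤ H
      ϑH = *-mono≤ (0≤* (0≤ι h) (0≤ι 4096)) ϑ₀≤ϑ
      Pn₀ : P n₀
      Pn₀ = ℚₚ.<-≤-trans (subst₂ _<_ (trans (ι-ℕ* 1000 (n₀ ℕ.* n₀)) (cong (ι (pos 1000) *_) (ι-ℕ* n₀ n₀)))
        (trans (ι-ℕ* (h ℕ.* 4096) ϑ₀) (cong (_* ι (pos ϑ₀)) (ι-ℕ* h 4096))) (ι-mono-< (ℤ.+<+ (ℕₚ.<ᵇ⇒< _ _ (T-≡ c₂))))) ϑH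
      H>0 : 0ℚ < H
      H>0 = ℚₚ.≤-<-trans (0≤* (0≤ι 1000) (0≤* (0≤ι n₀) (0≤ι n₀))) Pn₀
      P0 : P 0
      P0 = subst (_< H) (sym (trans (cong (λ e → ι (pos 1000) * (e * e)) ι-0) (S.solve 1 (λ a → a S.:* (S.con 0ℚ S.:* S.con 0ℚ) S.:= S.con 0ℚ) refl (ι (pos 1000))))) H>0
      M : ℕ
      M = proj₁ (ceil H)
      -- 1000 (M+1)² exceeds H
      M≤ : ∀ m → ι (pos m) ≤ ι (pos 1000) * (ι (pos m) * ι (pos m))
      M≤ zero = subst (_≤ ι (pos 1000) * (ι (pos 0) * ι (pos 0))) (sym ι-0) (0≤* (0≤ι 1000) (0≤* (0≤ι 0) (0≤ι 0)))
      M≤ m@(suc _) = subst (ι (pos m) ≤_) (trans (ι-ℕ* 1000 (m ℕ.* m)) (cong (ι (pos 1000) *_) (ι-ℕ* m m)))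
        (ι-mono-≤ (ℤ.+≤+ (ℕₚ.≤-trans (ℕₚ.m≤m*n m m) (ℕₚ.m≤n*m (m ℕ.* m) 1000))))
      ¬PM : ¬ P M
      ¬PM lt = ℚₚ.<-irrefl refl (ℚₚ.<-≤-trans lt (ℚₚ.≤-trans (proj₂ (ceil H)) (M≤ M)))
      found = last-true P (λ n → ι (pos 1000) * (ι (pos n) * ι (pos n)) ℚₚ.<? H) P0 M ¬PM
      n = proj₁ found
      n₀≤n : n₀ ℕ.≤ n
      n₀≤n = ℕₚ.≮⇒≥ λ n<n₀ → proj₂ (proj₂ found) (ℚₚ.≤-<-trans (*-mono≤ (0≤ι 1000)
        (square-mono-≤ (0≤ι (suc n)) (ι-mono-≤ (ℤ.+≤+ n<n₀)))) Pn₀)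
      n>0 : 0 ℕ.< n
      n>0 = ℕₚ.<-≤-trans (ℕₚ.<ᵇ⇒< 0 n₀ (T-≡ c₃)) n₀≤n
      i64 = ι (pos 64)
      inv = i64 ⁻¹[ 0<ι 63 ]
      t : ℚ
      t = ι (pos n) * inv
      t>0 : 0ℚ < t
      t>0 = 0<* (subst (_< ι (pos n)) ι-0 (ι-mono-< (ℤ.+<+ n>0))) (0<⁻¹ (0<ι 63))
      t64 : i64 * i64 * (t * t) ≡ ι (pos n) * ι (pos n)
      t64 = trans (S.solve 3 (λ a n i → a S.:* a S.:* ((n S.:* i) S.:* (n S.:* i)) S.:= (n S.:* n) S.:* ((a S.:* i) S.:* (a S.:* i))) refl i64 (ι (pos n)) inv)
        (trans (cong (λ e → ι (pos n) * ι (pos n) * (e * e)) (⁻¹-inverse (0<ι 63))) (S.solve 1 (λ n → (n S.:* n) S.:* (S.con 1ℚ S.:* S.con 1ℚ) S.:= n S.:* n) refl (ι (pos n))))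
      H′ : ∀ a → i64 * i64 * (ι a * ϑ) ≡ ι a * ι (pos 4096) * ϑ
      H′ a = trans (S.solve 3 (λ i a t → i S.:* i S.:* (a S.:* t) S.:= a S.:* (i S.:* i) S.:* t) refl i64 (ι a) ϑ) (cong (λ e → ι a * e * ϑ) (sym (ι-ℕ* 64 64)))
      i64² : 0ℚ < i64 * i64
      i64² = 0<* (0<ι 63) (0<ι 63)
      upper : ι (pos 1000) * (t * t) < ι (pos h) * ϑ
      upper = *-cancel< (ℚₚ.<⇒≤ i64²) (subst₂ _<_ (trans (cong (ι (pos 1000) *_) (sym t64))
        (S.solve 3 (λ m i t → m S.:* (i S.:* i S.:* (t S.:* t)) S.:= i S.:* i S.:* (m S.:* (t S.:* t))) refl (ι (pos 1000)) i64 t)) (sym (H′ (pos h))) (proj₁ (proj₂ found)))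
      -- l (n+1)² ≤ h n² is inherited from n₀ because (n+1)/n decreases
      ratio : l ℕ.* (suc n ℕ.* suc n) ℕ.≤ h ℕ.* (n ℕ.* n)
      ratio = ℕₚ.*-cancelʳ-≤ _ _ (n₀ ℕ.* n₀) {{ℕₚ.m*n≢0 n₀ n₀ {{n₀≢0}} {{n₀≢0}}}} (ℕₚ.≤-trans
        (ℕₚ.≤-trans (ℕₚ.≤-reflexive (N.solve 3 (λ l a b → l N.:* (a N.:* a) N.:* (b N.:* b) N.:= l N.:* ((a N.:* b) N.:* (a N.:* b))) refl l (suc n) n₀))
          (ℕₚ.*-monoʳ-≤ l (ℕₚ.*-mono-≤ cross cross)))
        (ℕₚ.≤-trans (ℕₚ.≤-reflexive (N.solve 3 (λ l a b → l N.:* ((b N.:* a) N.:* (b N.:* a)) N.:= l N.:* (a N.:* a) N.:* (b N.:* b)) refl l (suc n₀) n))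
          (ℕₚ.≤-trans (ℕₚ.*-monoˡ-≤ (n ℕ.* n) (ℕₚ.≤ᵇ⇒≤ (l ℕ.* (suc n₀ ℕ.* suc n₀)) _ (T-≡ c₁)))
            (ℕₚ.≤-reflexive (N.solve 3 (λ h a b → h N.:* (b N.:* b) N.:* (a N.:* a) N.:= h N.:* (a N.:* a) N.:* (b N.:* b)) refl h n n₀)))))
        where
        n₀≢0 : ℕ.NonZero n₀
        n₀≢0 = ℕ.>-nonZero (ℕₚ.<ᵇ⇒< 0 n₀ (T-≡ c₃))
        cross : suc n ℕ.* n₀ ℕ.≤ n ℕ.* suc n₀
        cross = subst (n₀ ℕ.+ n ℕ.* n₀ ℕ.≤_) (sym (ℕₚ.*-suc n n₀)) (ℕₚ.+-monoˡ-≤ (n ℕ.* n₀) n₀≤n)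
      lower : ι (pos l) * ϑ ≤ ι (pos 1000) * (t * t)
      lower = *-cancel≤ (0<* (0<ι 4095) (subst (_< ι (pos h)) ι-0 (ι-mono-< (ℤ.+<+ h>0)))) (begin
        ι (pos 4096) * ι (pos h) * (ι (pos l) * ϑ) ≡⟨ S.solve 4 (λ a h l t → a S.:* h S.:* (l S.:* t) S.:= l S.:* (h S.:* a S.:* t)) refl (ι (pos 4096)) (ι (pos h)) (ι (pos l)) ϑ ⟩
        ι (pos l) * H ≤⟨ *-mono≤ (0≤ι l) (ℚₚ.≮⇒≥ (proj₂ (proj₂ found))) ⟩
        ι (pos l) * (ι (pos 1000) * (ι (pos (suc n)) * ι (pos (suc n)))) ≡⟨ trans (S.solve 3 (λ l m n → l S.:* (m S.:* (n S.:* n)) S.:= m S.:* (l S.:* (n S.:* n))) refl (ι (pos l)) (ι (pos 1000)) (ι (pos (suc n))))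
            (cong (ι (pos 1000) *_) (sym (trans (ι-ℕ* l (suc n ℕ.* suc n)) (cong (ι (pos l) *_) (ι-ℕ* (suc n) (suc n)))))) ⟩
        ι (pos 1000) * ι (pos (l ℕ.* (suc n ℕ.* suc n))) ≤⟨ *-mono≤ (0≤ι 1000) (ι-mono-≤ (ℤ.+≤+ ratio)) ⟩
        ι (pos 1000) * ι (pos (h ℕ.* (n ℕ.* n))) ≡⟨ cong (ι (pos 1000) *_) (trans (ι-ℕ* h (n ℕ.* n)) (cong (ι (pos h) *_) (trans (ι-ℕ* n n) (sym t64)))) ⟩
        ι (pos 1000) * (ι (pos h) * (i64 * i64 * (t * t))) ≡⟨ cong (λ e → ι (pos 1000) * (ι (pos h) * (e * (t * t)))) (sym (ι-ℕ* 64 64)) ⟩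
        ι (pos 1000) * (ι (pos h) * (ι (pos 4096) * (t * t))) ≡⟨ S.solve 4 (λ m h a t → m S.:* (h S.:* (a S.:* (t S.:* t))) S.:= a S.:* h S.:* (m S.:* (t S.:* t))) refl (ι (pos 1000)) (ι (pos h)) (ι (pos 4096)) t ⟩
        ι (pos 4096) * ι (pos h) * (ι (pos 1000) * (t * t)) ∎)
        where
        h>0 : 0 ℕ.< h
        h>0 = ℕₚ.n≢0⇒n>0 λ { refl → ℚₚ.<-irrefl refl (subst (0ℚ <_) (trans (cong (λ e → e * ι (pos 4096) * ϑ) ι-0)
                (S.solve 2 (λ a t → S.con 0ℚ S.:* a S.:* t S.:= S.con 0ℚ) refl (ι (pos 4096)) ϑ)) H>0) }

    module _ (r₀ r₁ r : Range) (c₀ c₁ c : ℤ) (ft : Fit) (chk : fit-check ϑ₀ r₀ r₁ r c₀ c₁ c ft ≡ true)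
             {t₀ t₁ : ℚ} (t₀>0 : 0ℚ < t₀) (t₁>0 : 0ℚ < t₁) (in₀ : InRange r₀ (t₀ * t₀)) (in₁ : InRange r₁ (t₁ * t₁)) where
      private
        open Fit ft
        open Range r₀ renaming (lower to l₀; upper to h₀)
        open Range r₁ renaming (lower to l₁; upper to h₁)
        open Range r renaming (lower to l; upper to h)
        d = ι (pos 1000)
        i = λ n → ι (pos n)
        a₁ = ∧-true {c ℤ.≤ᵇ c₀ ℤ.+ pos E} chk
        a₂ = ∧-true {c₁ ℤ.≤ᵇ c ℤ.+ pos E′} (proj₂ a₁)
        a₃ = ∧-true {k ℕ.+ m ℕ.≡ᵇ 1000} (proj₂ a₂)
        a₄ = ∧-true {0 ℕ.<ᵇ k} (proj₂ a₃)
        a₅ = ∧-true {0 ℕ.<ᵇ l₀} (proj₂ a₄)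
        a₆ = ∧-true {E ℕ.* E ℕ.* 1000 ℕ.≤ᵇ m ℕ.* m ℕ.* l₀ ℕ.* ϑ₀} (proj₂ a₅)
        a₇ = ∧-true {l ℕ.* 1000000 ℕ.≤ᵇ k ℕ.* k ℕ.* l₀} (proj₂ a₆)
        a₈ = ∧-true {E′ ℕ.* E′ ℕ.* 1000 ℕ.≤ᵇ m′ ℕ.* m′ ℕ.* l₁ ℕ.* ϑ₀} (proj₂ a₇)
        a₉ = ∧-true {k′ ℕ.* k′ ℕ.* h₁ ℕ.≤ᵇ h ℕ.* 1000000} (proj₂ a₈)
        a₁₀ = ∧-true {m′ ℕ.+ 1000 ℕ.≡ᵇ k′} (proj₂ a₉)
        a₁₁ = ∧-true {h₀ ℕ.≤ᵇ l₁} {c₀ ℤ.≤ᵇ c₁} (proj₂ a₁₀)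
        ≤ᵇ : ∀ m n → (m ℕ.≤ᵇ n) ≡ true → i m ≤ i n
        ≤ᵇ m n e = ι-mono-≤ (ℤ.+≤+ (ℕₚ.≤ᵇ⇒≤ m n (T-≡ e)))
        open ℚₚ.≤-Reasoning
        k+m : i k + i m ≡ d
        k+m = trans (sym (ι-+ (pos k) (pos m))) (cong i (ℕₚ.≡ᵇ⇒≡ (k ℕ.+ m) 1000 (T-≡ (proj₁ a₃))))
        k>0 : 0ℚ < i k
        k>0 = subst (_< i k) ι-0 (ι-mono-< (ℤ.+<+ (ℕₚ.<ᵇ⇒< 0 k (T-≡ (proj₁ a₄)))))
        E≤ : i E ≤ i m * t₀
        E≤ = square-cancel-≤ (0≤* (0≤ι m) (ℚₚ.<⇒≤ t₀>0)) (*-cancel≤ 1000>0 (begin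
          d * (i E * i E)                   ≡⟨ sym (trans (ι-ℕ* (E ℕ.* E) 1000) (trans (cong (_* d) (ι-ℕ* E E)) (ℚₚ.*-comm (i E * i E) d))) ⟩
          i (E ℕ.* E ℕ.* 1000)            ≤⟨ ≤ᵇ (E ℕ.* E ℕ.* 1000) (m ℕ.* m ℕ.* l₀ ℕ.* ϑ₀) (proj₁ a₆) ⟩
          i (m ℕ.* m ℕ.* l₀ ℕ.* ϑ₀)         ≡⟨ trans (ι-ℕ* (m ℕ.* m ℕ.* l₀) ϑ₀) (cong (_* i ϑ₀) (trans (ι-ℕ* (m ℕ.* m) l₀) (cong (_* i l₀) (ι-ℕ* m m)))) ⟩
          i m * i m * i l₀ * i ϑ₀           ≤⟨ *-mono≤ (0≤* (0≤* (0≤ι m) (0≤ι m)) (0≤ι l₀)) ϑ₀≤ϑ ⟩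
          i m * i m * i l₀ * ϑ              ≡⟨ ℚₚ.*-assoc (i m * i m) (i l₀) ϑ ⟩
          i m * i m * (i l₀ * ϑ)            ≤⟨ *-mono≤ (0≤* (0≤ι m) (0≤ι m)) (proj₁ in₀) ⟩
          i m * i m * (d * (t₀ * t₀))       ≡⟨ S.solve 3 (λ m d t → m S.:* m S.:* (d S.:* (t S.:* t)) S.:= d S.:* ((m S.:* t) S.:* (m S.:* t))) refl (i m) d t₀ ⟩
          d * ((i m * t₀) * (i m * t₀))     ∎))
        E′≤ : i E′ ≤ i m′ * t₁
        E′≤ = square-cancel-≤ (0≤* (0≤ι m′) (ℚₚ.<⇒≤ t₁>0)) (*-cancel≤ 1000>0 (begin
          d * (i E′ * i E′)                 ≡⟨ sym (trans (ι-ℕ* (E′ ℕ.* E′) 1000) (trans (cong (_* d) (ι-ℕ* E′ E′)) (ℚₚ.*-comm (i E′ * i E′) d))) ⟩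
          i (E′ ℕ.* E′ ℕ.* 1000)          ≤⟨ ≤ᵇ (E′ ℕ.* E′ ℕ.* 1000) (m′ ℕ.* m′ ℕ.* l₁ ℕ.* ϑ₀) (proj₁ a₈) ⟩
          i (m′ ℕ.* m′ ℕ.* l₁ ℕ.* ϑ₀)       ≡⟨ trans (ι-ℕ* (m′ ℕ.* m′ ℕ.* l₁) ϑ₀) (cong (_* i ϑ₀) (trans (ι-ℕ* (m′ ℕ.* m′) l₁) (cong (_* i l₁) (ι-ℕ* m′ m′)))) ⟩
          i m′ * i m′ * i l₁ * i ϑ₀         ≤⟨ *-mono≤ (0≤* (0≤* (0≤ι m′) (0≤ι m′)) (0≤ι l₁)) ϑ₀≤ϑ ⟩
          i m′ * i m′ * i l₁ * ϑ            ≡⟨ ℚₚ.*-assoc (i m′ * i m′) (i l₁) ϑ ⟩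
          i m′ * i m′ * (i l₁ * ϑ)          ≤⟨ *-mono≤ (0≤* (0≤ι m′) (0≤ι m′)) (proj₁ in₁) ⟩
          i m′ * i m′ * (d * (t₁ * t₁))     ≡⟨ S.solve 3 (λ m d t → m S.:* m S.:* (d S.:* (t S.:* t)) S.:= d S.:* ((m S.:* t) S.:* (m S.:* t))) refl (i m′) d t₁ ⟩
          d * ((i m′ * t₁) * (i m′ * t₁))   ∎))
        i6 : i 1000000 ≡ d * d
        i6 = ι-ℕ* 1000 1000

      bracket-< : centre s c₀ + t₀ < centre s c₁ + t₁
      bracket-< = ℚₚ.+-mono-≤-< (centre-≤ (ℤₚ.≤ᵇ⇒≤ (T-≡ (proj₂ a₁₁)))) (square-cancel-< (ℚₚ.<⇒≤ t₁>0)
        (*-cancel< (ℚₚ.<⇒≤ 1000>0) (ℚₚ.<-≤-trans (proj₂ in₀) (ℚₚ.≤-trans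
          (*-mono≤ʳ (ℚₚ.<⇒≤ ϑ>0) (≤ᵇ h₀ l₁ (proj₁ a₁₁))) (proj₁ in₁)))))
        where
        centre-≤ : ∀ {c c′} → c ℤ.≤ c′ → centre s c ≤ centre s c′
        centre-≤ {c} {c′} le with c ℤ.≟ c′
        ... | yes refl = ℚₚ.≤-refl
        ... | no  c≢c′ = ℚₚ.<⇒≤ (centre-< (ℤₚ.≤∧≢⇒< le c≢c′))

      module _ {y : ℚ} (lo : centre s c₀ + t₀ < y) (hi : y < centre s c₁ + t₁) where
        private
          t = y - centre s c
          1000t>kt₀ : i k * t₀ < d * t
          1000t>kt₀ = begin-strict
            i k * t₀                           ≡⟨ trans (S.solve 3 (λ k m t → k S.:* t S.:= (k S.:+ m) S.:* t S.:- m S.:* t) refl (i k) (i m) t₀) (cong (λ e → e * t₀ - i m * t₀) k+m) ⟩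
            d * t₀ - i m * t₀                  ≤⟨ ℚₚ.+-monoʳ-≤ (d * t₀) (ℚₚ.neg-antimono-≤ E≤) ⟩
            d * t₀ - i E                       ≤⟨ ℚₚ.+-monoʳ-≤ (d * t₀) (ℚₚ.neg-antimono-≤ (shift≤ c c₀ E (ℤₚ.≤ᵇ⇒≤ (T-≡ (proj₁ a₁))))) ⟩
            d * t₀ - d * (centre s c - centre s c₀) ≡⟨ S.solve 4 (λ d t c c₀ → d S.:* t S.:- d S.:* (c S.:- c₀) S.:= d S.:* ((c₀ S.:+ t) S.:- c)) refl d t₀ (centre s c) (centre s c₀) ⟩
            d * ((centre s c₀ + t₀) - centre s c)   <⟨ *-mono< 1000>0 (ℚₚ.+-monoˡ-< (- centre s c) lo) ⟩
            d * t                              ∎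
          1000t<k′t₁ : d * t < (d + i m′) * t₁
          1000t<k′t₁ = begin-strict
            d * t                              <⟨ *-mono< 1000>0 (ℚₚ.+-monoˡ-< (- centre s c) hi) ⟩
            d * ((centre s c₁ + t₁) - centre s c) ≡⟨ S.solve 4 (λ d t c c₁ → d S.:* ((c₁ S.:+ t) S.:- c) S.:= d S.:* t S.:+ d S.:* (c₁ S.:- c)) refl d t₁ (centre s c) (centre s c₁) ⟩
            d * t₁ + d * (centre s c₁ - centre s c) ≤⟨ ℚₚ.+-monoʳ-≤ (d * t₁) (shift≤ c₁ c E′ (ℤₚ.≤ᵇ⇒≤ (T-≡ (proj₁ a₂)))) ⟩
            d * t₁ + i E′                      ≤⟨ ℚₚ.+-monoʳ-≤ (d * t₁) E′≤ ⟩
            d * t₁ + i m′ * t₁                 ≡⟨ sym (ℚₚ.*-distribʳ-+ t₁ d (i m′)) ⟩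
            (d + i m′) * t₁                    ∎

        offset>0 : 0ℚ < t
        offset>0 = *-cancel< (ℚₚ.<⇒≤ 1000>0) (subst (_< d * t) (sym (ℚₚ.*-zeroʳ d)) (ℚₚ.<-trans (0<* k>0 t₀>0) 1000t>kt₀))

        offset-inRange : InRange r (t * t)
        offset-inRange = *-cancel≤ (0<* 1000>0 1000>0) lower , *-cancel< (ℚₚ.<⇒≤ (0<* 1000>0 1000>0)) upper
          where
          lower : d * d * (i l * ϑ) ≤ d * d * (d * (t * t))
          lower = begin
            d * d * (i l * ϑ)                 ≡⟨ trans (cong (_* (i l * ϑ)) (sym i6)) (trans (S.solve 3 (λ m l t → m S.:* (l S.:* t) S.:= (l S.:* m) S.:* t) refl (i 1000000) (i l) ϑ) (cong (_* ϑ) (sym (ι-ℕ* l 1000000)))) ⟩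
            i (l ℕ.* 1000000) * ϑ             ≤⟨ *-mono≤ʳ (ℚₚ.<⇒≤ ϑ>0) (≤ᵇ (l ℕ.* 1000000) (k ℕ.* k ℕ.* l₀) (proj₁ a₇)) ⟩
            i (k ℕ.* k ℕ.* l₀) * ϑ            ≡⟨ trans (cong (_* ϑ) (trans (ι-ℕ* (k ℕ.* k) l₀) (cong (_* i l₀) (ι-ℕ* k k)))) (ℚₚ.*-assoc (i k * i k) (i l₀) ϑ) ⟩
            i k * i k * (i l₀ * ϑ)            ≤⟨ *-mono≤ (0≤* (0≤ι k) (0≤ι k)) (proj₁ in₀) ⟩
            i k * i k * (d * (t₀ * t₀))       ≡⟨ S.solve 3 (λ m d t → m S.:* m S.:* (d S.:* (t S.:* t)) S.:= d S.:* ((m S.:* t) S.:* (m S.:* t))) refl (i k) d t₀ ⟩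
            d * ((i k * t₀) * (i k * t₀))     ≤⟨ *-mono≤ (ℚₚ.<⇒≤ 1000>0) (square-mono-≤ (0≤* (0≤ι k) (ℚₚ.<⇒≤ t₀>0)) (ℚₚ.<⇒≤ 1000t>kt₀)) ⟩
            d * ((d * t) * (d * t))           ≡⟨ S.solve 2 (λ d t → d S.:* ((d S.:* t) S.:* (d S.:* t)) S.:= d S.:* d S.:* (d S.:* (t S.:* t))) refl d t ⟩
            d * d * (d * (t * t))             ∎
          dk′ : d + i m′ ≡ i k′
          dk′ = trans (ℚₚ.+-comm d (i m′)) (trans (sym (ι-+ (pos m′) (pos 1000))) (cong i (ℕₚ.≡ᵇ⇒≡ (m′ ℕ.+ 1000) k′ (T-≡ (proj₁ a₁₀)))))
          k′>0 : 0ℚ < i k′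
          k′>0 = subst (0ℚ <_) dk′ (0<+ 1000>0 (0≤ι m′))
          upper : d * d * (d * (t * t)) < d * d * (i h * ϑ)
          upper = begin-strict
            d * d * (d * (t * t))             ≡⟨ S.solve 2 (λ d t → d S.:* d S.:* (d S.:* (t S.:* t)) S.:= d S.:* ((d S.:* t) S.:* (d S.:* t))) refl d t ⟩
            d * ((d * t) * (d * t))           ≤⟨ *-mono≤ (ℚₚ.<⇒≤ 1000>0) (square-mono-≤ (0≤* (ℚₚ.<⇒≤ 1000>0) (ℚₚ.<⇒≤ offset>0)) (ℚₚ.<⇒≤ 1000t<k′t₁)) ⟩
            d * (((d + i m′) * t₁) * ((d + i m′) * t₁)) ≡⟨ trans (cong (λ e → d * ((e * t₁) * (e * t₁))) dk′) (S.solve 3 (λ m d t → d S.:* ((m S.:* t) S.:* (m S.:* t)) S.:= m S.:* m S.:* (d S.:* (t S.:* t))) refl (i k′) d t₁) ⟩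
            i k′ * i k′ * (d * (t₁ * t₁))     <⟨ *-mono< (0<* k′>0 k′>0) (proj₂ in₁) ⟩
            i k′ * i k′ * (i h₁ * ϑ)          ≡⟨ trans (sym (ℚₚ.*-assoc (i k′ * i k′) (i h₁) ϑ)) (cong (_* ϑ) (trans (cong (_* i h₁) (sym (ι-ℕ* k′ k′))) (sym (ι-ℕ* (k′ ℕ.* k′) h₁)))) ⟩
            i (k′ ℕ.* k′ ℕ.* h₁) * ϑ          ≤⟨ *-mono≤ʳ (ℚₚ.<⇒≤ ϑ>0) (≤ᵇ (k′ ℕ.* k′ ℕ.* h₁) (h ℕ.* 1000000) (proj₁ a₉)) ⟩
            i (h ℕ.* 1000000) * ϑ             ≡⟨ trans (cong (_* ϑ) (trans (ι-ℕ* h 1000000) (cong (i h *_) i6))) (S.solve 3 (λ h m t → (h S.:* m) S.:* t S.:= m S.:* (h S.:* t)) refl (i h) (d * d) ϑ) ⟩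
            d * d * (i h * ϑ)                 ∎

-- Half sums of opposite roots in windows, and the contradiction for ϑ ≥ ϑ₀.

module LargeCase where
  open Rationals
  open Polynomials
  open Regions
  open SignTests
  open RootWindows
  open import Data.Nat as ℕ using (ℕ)
  open import Data.Integer as ℤ using (ℤ) renaming (+_ to pos)
  import Data.Integer.Properties as ℤₚ
  import Data.Nat.Properties as ℕₚ
  open import Data.Rational using (ℚ; 0ℚ; 1ℚ; _+_; _*_; -_; _-_; _≤_; _<_)
  import Data.Rational.Properties as ℚₚ
  open import Data.List using (List)
  open import Data.Bool using (true)
  open import Data.Empty using (⊥)
  open import Data.Product using (_×_; _,_; proj₁; proj₂; ∃-syntax)
  open import Relation.Binary.PropositionalEquality

  private
    <⇒≤pred : ∀ {i j} → i ℤ.< ℤ.suc j → i ℤ.≤ j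
    <⇒≤pred {i} {j} lt = subst (i ℤ.≤_) (ℤₚ.pred-suc j) (ℤₚ.i<j⇒i≤pred[j] lt)

  -- Bands `r₀` and `r₁` carry opposite signs and enclose a root δ, which seen from either of the
  -- centres `cₗ` and `cₕ` lies in the range `r`. Its mirror images in these two centres again carry
  -- opposite signs, so a second root lies between the images, and the half sum of both roots lies
  -- between the two centres.
  record Pair (par : Parity) (ϑ₀ s : ℕ) (cₗ cₕ : ℤ) : Set where
    field
      r₀ r₁ r : Range
      c₀ c₁ σ τ : ℤ
      n₀ n₁ : ℕ
      fitₗ fitₕ : Fit
      inner  : check ϑ₀ par s (in-band σ r₀) (centred ϑ₀ s c₀) ≡ true
      outer  : check ϑ₀ par s (in-band (ℤ.- σ) r₁) (centred ϑ₀ s c₁) ≡ true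
      lowerᵣ : check ϑ₀ par s (reflection τ r) (centred ϑ₀ s cₗ) ≡ true
      upperᵣ : check ϑ₀ par s (reflection (ℤ.- τ) r) (centred ϑ₀ s cₕ) ≡ true
      band₀  : band-check ϑ₀ r₀ n₀ ≡ true
      band₁  : band-check ϑ₀ r₁ n₁ ≡ true
      okₗ    : fit-check ϑ₀ r₀ r₁ r c₀ c₁ cₗ fitₗ ≡ true
      okₕ    : fit-check ϑ₀ r₀ r₁ r c₀ c₁ cₕ fitₕ ≡ true
      cₗ<cₕ  : cₗ ℤ.< cₕ

  -- The half sum of a pair and the middle root lie in adjacent windows. Their difference is a
  -- positive multiple of one half, while `narrow` together with ρ < 1 keeps it below one half.
  record OddCert (ϑ₀ s : ℕ) : Set where
    field
      cₗ cₘ cₕ σ : ℤ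
      pair   : Pair odd ϑ₀ s cₗ cₘ
      centreₘ : check ϑ₀ odd s (at-centre (ℤ.- σ)) (centred ϑ₀ s cₘ) ≡ true
      centreₕ : check ϑ₀ odd s (at-centre σ) (centred ϑ₀ s cₕ) ≡ true
      cₘ<cₕ  : cₘ ℤ.< cₕ
      narrow : pos 2 ℤ.* (cₕ ℤ.- cₗ) ℤ.≤ pos 1000

  -- Two half sums replace the half sum and the middle root. The bound on `cₕ` - `cₗ` is kept
  -- outside the record because s = 8 satisfies it and s = 6 does not.
  record EvenCert (ϑ₀ s : ℕ) : Set where
    field
      cₗ cₘ cₕ : ℤ
      inner-pair : Pair even ϑ₀ s cₘ cₕ
      outer-pair : Pair even ϑ₀ s cₗ cₘ

  module Contradiction {ϑ₀ : ℕ} (rg : Region ϑ₀) (0<ϑ₀ : 0 ℕ.< ϑ₀) (s : ℕ) (δs : List ℤ) (κ : ℚ) (κ>0 : 0ℚ < κ)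
               (form : ∀ l p → horner ℚ-raw s (Region.N rg) (Region.G rg) l (l * p) ≡ (κ * l ^ s) * roots→poly δs p) where
    open Region rg
    open Eval rg
    open Sound rg 0<ϑ₀
    open Roots rg 0<ϑ₀ s δs κ κ>0 form

    private
     module PairSum {par : Parity} {cₗ cₕ : ℤ} (pr : Pair par ϑ₀ s cₗ cₕ) {t₀ t₁ : ℚ} (t₀>0 : 0ℚ < t₀) (t₁>0 : 0ℚ < t₁)
            (in₀ : InRange (Pair.r₀ pr) (t₀ * t₀)) (in₁ : InRange (Pair.r₁ pr) (t₁ * t₁)) where
      open Pair pr
      first : ∃[ δ ] ((centre s c₀ + t₀ < ι δ) × (ι δ < centre s c₁ + t₁) × f (ι δ) ≡ 0ℚ)
      first = root-between δs σ {centre s c₀ + t₀} {centre s c₁ + t₁} (bracket-< r₀ r₁ r c₀ c₁ cₗ fitₗ okₗ t₀>0 t₁>0 in₀ in₁)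
        (certified par c₀ (in-band σ r₀) inner t₀ t₀>0 in₀) (certified par c₁ (in-band (ℤ.- σ) r₁) outer t₁ t₁>0 in₁)
      δ = proj₁ first
      lo = proj₁ (proj₂ first)
      hi = proj₁ (proj₂ (proj₂ first))
      root = proj₂ (proj₂ (proj₂ first))
      back : ∀ c → c + (ι δ - c) ≡ ι δ
      back c = S.solve 2 (λ c d → c S.:+ (d S.:- c) S.:= d) refl c (ι δ)
      mirror : ∀ c → c - (ι δ - c) ≡ (c + c) - ι δ
      mirror c = S.solve 2 (λ c d → c S.:- (d S.:- c) S.:= (c S.:+ c) S.:- d) refl c (ι δ)
      image : ∀ ρ c ft → fit-check ϑ₀ r₀ r₁ r c₀ c₁ c ft ≡ true → check ϑ₀ par s (reflection ρ r) (centred ϑ₀ s c) ≡ true →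
              0ℚ < ι ρ * f ((centre s c + centre s c) - ι δ)
      image ρ c ft ok chk = subst (λ e → 0ℚ < ι ρ * f e) (mirror (centre s c))
        (certified par c (reflection ρ r) chk (ι δ - centre s c)
          (offset>0 r₀ r₁ r c₀ c₁ c ft ok t₀>0 t₁>0 in₀ in₁ lo hi)
          (offset-inRange r₀ r₁ r c₀ c₁ c ft ok t₀>0 t₁>0 in₀ in₁ lo hi)
          (trans (cong f (back (centre s c))) root))
      c<c : centre s cₗ < centre s cₕ
      c<c = centre-< {cₗ} {cₕ} cₗ<cₕ
      found = root-between δs τ {(centre s cₗ + centre s cₗ) - ι δ} {(centre s cₕ + centre s cₕ) - ι δ}
        (ℚₚ.+-monoˡ-< (- ι δ) (ℚₚ.+-mono-< c<c c<c)) (image τ cₗ fitₗ okₗ lowerᵣ) (image (ℤ.- τ) cₕ fitₕ okₕ upperᵣ)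
      δ′ = proj₁ found
      restore : ∀ a → (a - ι δ) + ι δ ≡ a
      restore a = S.solve 2 (λ a d → (a S.:- d) S.:+ d S.:= a) refl a (ι δ)
      below : centre s cₗ + centre s cₗ < ι δ + ι δ′
      below = subst₂ _<_ (restore (centre s cₗ + centre s cₗ)) (ℚₚ.+-comm (ι δ′) (ι δ)) (ℚₚ.+-monoˡ-< (ι δ) (proj₁ (proj₂ found)))
      above : ι δ + ι δ′ < centre s cₕ + centre s cₕ
      above = subst₂ _<_ (ℚₚ.+-comm (ι δ′) (ι δ)) (restore (centre s cₕ + centre s cₕ)) (ℚₚ.+-monoˡ-< (ι δ) (proj₁ (proj₂ (proj₂ found))))
      sum : ∃[ n ] ((centre s cₗ + centre s cₗ < ι n) × (ι n < centre s cₕ + centre s cₕ))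
      sum = δ ℤ.+ δ′ , subst (centre s cₗ + centre s cₗ <_) (sym (ι-+ δ δ′)) below , subst (_< centre s cₕ + centre s cₕ) (sym (ι-+ δ δ′)) above

    pair-sum : ∀ {par cₗ cₕ} → Pair par ϑ₀ s cₗ cₕ →
               ∃[ n ] ((centre s cₗ + centre s cₗ < ι n) × (ι n < centre s cₕ + centre s cₕ))
    pair-sum {par} {cₗ} {cₕ} pr = PairSum.sum pr (proj₁ (proj₂ b₀)) (proj₁ (proj₂ b₁)) (proj₂ (proj₂ b₀)) (proj₂ (proj₂ b₁))
      where
      b₀ = band-point (Pair.r₀ pr) (Pair.n₀ pr) (Pair.band₀ pr)
      b₁ = band-point (Pair.r₁ pr) (Pair.n₁ pr) (Pair.band₁ pr)

    -- For two half-sums of roots in the windows of cₗ<cₘ<cₕ: the difference D satisfies 0 < 1000 D < 2(cₕ-cₗ).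
    window : ∀ {A B cₗ cₘ cₕ} k → pos 2 ℤ.* (cₕ ℤ.- cₗ) ℤ.≤ pos 1000 ℤ.* k → 0ℚ < ι k →
             centre s cₘ + centre s cₘ < A → A < centre s cₕ + centre s cₕ →
             centre s cₗ + centre s cₗ < B → B < centre s cₘ + centre s cₘ → (0ℚ < A - B) × (A - B < ι k)
    window {A} {B} {cₗ} {cₘ} {cₕ} k le k>0 a₁ a₂ b₁ b₂ = <⇒0<- (ℚₚ.<-trans b₂ a₁) , *-cancel< {r = ι (pos 1000)} (ℚₚ.<⇒≤ 1000>0) (begin-strict
      d * (A - B)                                        <⟨ *-mono< 1000>0 (ℚₚ.+-mono-< a₂ (ℚₚ.neg-antimono-< b₁)) ⟩
      d * ((centre s cₕ + centre s cₕ) - (centre s cₗ + centre s cₗ)) ≡⟨ S.solve 3 (λ d h l → d S.:* ((h S.:+ h) S.:- (l S.:+ l)) S.:= (S.con 1ℚ S.:+ S.con 1ℚ) S.:* (d S.:* (h S.:- l))) refl d (centre s cₕ) (centre s cₗ) ⟩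
      (1ℚ + 1ℚ) * (d * (centre s cₕ - centre s cₗ))     ≡⟨ cong₂ _*_ (sym (trans (ι-+ (pos 1) (pos 1)) (cong₂ _+_ ι-1 ι-1))) (trans (centre-diff cₕ cₗ)
                                                            (cong (_* ρ) (sym (trans (ι-+ cₕ (ℤ.- cₗ)) (cong (ι cₕ +_) (ι-neg cₗ)))))) ⟩
      ι (pos 2) * (ι (cₕ ℤ.- cₗ) * ρ)                   ≡⟨ trans (sym (ℚₚ.*-assoc (ι (pos 2)) (ι (cₕ ℤ.- cₗ)) ρ)) (cong (_* ρ) (sym (ι-* (pos 2) (cₕ ℤ.- cₗ)))) ⟩
      ι (pos 2 ℤ.* (cₕ ℤ.- cₗ)) * ρ                     ≤⟨ *-mono≤ʳ (ℚₚ.<⇒≤ ρ>0) (ι-mono-≤ le) ⟩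
      ι (pos 1000 ℤ.* k) * ρ                             <⟨ subst (ι (pos 1000 ℤ.* k) * ρ <_) (ℚₚ.*-identityʳ (ι (pos 1000 ℤ.* k))) (*-mono< {ρ} {1ℚ} (subst (0ℚ <_) (sym (ι-* (pos 1000) k)) (0<* 1000>0 k>0)) ρ<1) ⟩
      ι (pos 1000 ℤ.* k)                                 ≡⟨ ι-* (pos 1000) k ⟩
      d * ι k                                            ∎)
      where
      open ℚₚ.≤-Reasoning
      d = ι (pos 1000)

    private
      ι-sub : ∀ i j → ι (i ℤ.- j) ≡ ι i - ι j
      ι-sub i j = trans (ι-+ i (ℤ.- j)) (cong (ι i +_) (ι-neg j))

    odd-⊥ : OddCert ϑ₀ s → ⊥
    odd-⊥ cert = no-integer-between (δ ℤ.+ δ ℤ.- n) (subst (0ℚ <_) eq (proj₁ w)) (subst₂ _<_ eq ι-1 (proj₂ w))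
      where
      open OddCert cert
      half : ∃[ n ] ((centre s cₗ + centre s cₗ < ι n) × (ι n < centre s cₘ + centre s cₘ))
      half = pair-sum pair
      n = proj₁ half
      mid : ∃[ δ ] ((centre s cₘ < ι δ) × (ι δ < centre s cₕ) × f (ι δ) ≡ 0ℚ)
      mid = root-between δs (ℤ.- σ) {centre s cₘ} {centre s cₕ} (centre-< {cₘ} {cₕ} cₘ<cₕ) (certified odd cₘ (at-centre (ℤ.- σ)) centreₘ)
          (subst (λ e → 0ℚ < ι e * f (centre s cₕ)) (sym (ℤₚ.neg-involutive σ)) (certified odd cₕ (at-centre σ) centreₕ))
      δ = proj₁ mid
      d₁ = proj₁ (proj₂ mid)
      d₂ = proj₁ (proj₂ (proj₂ mid))
      w : (0ℚ < (ι δ + ι δ) - ι n) × ((ι δ + ι δ) - ι n < ι (pos 1))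
      w = window {ι δ + ι δ} {ι n} {cₗ} {cₘ} {cₕ} (pos 1) narrow (0<ι 0) (ℚₚ.+-mono-< d₁ d₁) (ℚₚ.+-mono-< d₂ d₂) (proj₁ (proj₂ half)) (proj₂ (proj₂ half))
      eq : (ι δ + ι δ) - ι n ≡ ι (δ ℤ.+ δ ℤ.- n)
      eq = sym (trans (ι-sub (δ ℤ.+ δ) n) (cong (_- ι n) (ι-+ δ δ)))

    private
     module EvenPairs (cert : EvenCert ϑ₀ s) where
      open EvenCert cert public
      sum₁ : ∃[ n ] ((centre s cₘ + centre s cₘ < ι n) × (ι n < centre s cₕ + centre s cₕ))
      sum₁ = pair-sum inner-pair
      sum₂ : ∃[ n ] ((centre s cₗ + centre s cₗ < ι n) × (ι n < centre s cₘ + centre s cₘ))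
      sum₂ = pair-sum outer-pair
      n n′ : ℤ
      n = proj₁ sum₁
      n′ = proj₁ sum₂
      difference : ∀ k → pos 2 ℤ.* (cₕ ℤ.- cₗ) ℤ.≤ pos 1000 ℤ.* k → 0ℚ < ι k → (0ℚ < ι (n ℤ.- n′)) × (ι (n ℤ.- n′) < ι k)
      difference k le k>0 = subst (λ e → (0ℚ < e) × (e < ι k)) (sym (ι-sub n n′))
        (window {ι n} {ι n′} {cₗ} {cₘ} {cₕ} k le k>0 (proj₁ (proj₂ sum₁)) (proj₂ (proj₂ sum₁)) (proj₁ (proj₂ sum₂)) (proj₂ (proj₂ sum₂)))

    even-⊥ : (cert : EvenCert ϑ₀ s) → pos 2 ℤ.* (EvenCert.cₕ cert ℤ.- EvenCert.cₗ cert) ℤ.≤ pos 1000 → ⊥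
    even-⊥ cert narrow = no-integer-between (n ℤ.- n′) (proj₁ d) (subst (ι (n ℤ.- n′) <_) ι-1 (proj₂ d))
      where
      open EvenPairs cert
      d = difference (pos 1) narrow (0<ι 0)

    -- s = 6: the difference can only be 1; then 3n - 6m is an integer in (3 , 4.71 ρ), i.e. 4, and ρ is bounded on both sides.
    six-⊥ : (cert : EvenCert ϑ₀ s) → EvenCert.cₗ cert ≡ pos 197 → EvenCert.cₕ cert ≡ pos 785 → ∀ e → ι (pos 6) * mean s ≡ ι e → ⊥
    six-⊥ cert eₗ eₕ e em = ℚₚ.<-irrefl refl (ℚₚ.<-trans lt₁ (ℚₚ.<-trans lt₂ lt₃))
      where
      open EvenPairs cert
      d = difference (pos 2) (subst₂ (λ l h → pos 2 ℤ.* (h ℤ.- l) ℤ.≤ pos 2000) (sym eₗ) (sym eₕ) (ℤ.+≤+ (ℕₚ.≤ᵇ⇒≤ 1176 2000 _))) (0<ι 1)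
      n₂ : ι n < centre s (pos 785) + centre s (pos 785)
      n₂ = subst (λ c → ι n < centre s c + centre s c) eₕ (proj₂ (proj₂ sum₁))
      n′₁ : centre s (pos 197) + centre s (pos 197) < ι n′
      n′₁ = subst (λ c → centre s c + centre s c < ι n′) eₗ (proj₁ (proj₂ sum₂))
      open ℚₚ.≤-Reasoning
      i = λ n → ι (pos n)
      D A : ℤ
      D = n ℤ.- n′
      A = pos 3 ℤ.* n ℤ.- e
      D≡1 : D ≡ pos 1
      D≡1 = ℤₚ.≤-antisym (<⇒≤pred (ι-cancel-< (proj₂ d)))
                         (ℤₚ.i<j⇒suc[i]≤j (ι-cancel-< (subst (_< ι D) (sym ι-0) (proj₁ d))))
      m = mean s
      A-value : ι A ≡ i 3 * ι n - i 6 * m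
      A-value = trans (ι-sub (pos 3 ℤ.* n) e) (cong₂ _-_ (ι-* (pos 3) n) (sym em))
      i6 : i 6 ≡ i 3 * (1ℚ + 1ℚ)
      i6 = trans (ι-ℕ* 3 2) (cong (i 3 *_) (trans (ι-+ (pos 1) (pos 1)) (cong₂ _+_ ι-1 ι-1)))
      scaled : ∀ c → i 1000 * (i 3 * (centre s c + centre s c) - i 6 * m) ≡ i 6 * ι c * ρ
      scaled c = trans (cong (λ e → i 1000 * (i 3 * (centre s c + centre s c) - e * m)) i6)
        (trans (S.solve 5 (λ k t m v r → k S.:* (t S.:* ((m S.:+ v S.:* r) S.:+ (m S.:+ v S.:* r)) S.:- t S.:* (S.con 1ℚ S.:+ S.con 1ℚ) S.:* m)
           S.:= t S.:* (S.con 1ℚ S.:+ S.con 1ℚ) S.:* (k S.:* v) S.:* r) refl (i 1000) (i 3) m (val c) ρ)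
         (cong₂ (λ a b → a * b * ρ) (sym i6) (val-den c)))
      upper : i 1000 * ι A < i 6 * i 785 * ρ
      upper = begin-strict
        i 1000 * ι A                                            ≡⟨ cong (i 1000 *_) A-value ⟩
        i 1000 * (i 3 * ι n - i 6 * m)                          <⟨ *-mono< 1000>0 (ℚₚ.+-monoˡ-< (- (i 6 * m)) (*-mono< (0<ι 2) n₂)) ⟩
        i 1000 * (i 3 * (centre s (pos 785) + centre s (pos 785)) - i 6 * m) ≡⟨ scaled (pos 785) ⟩
        i 6 * i 785 * ρ                                         ∎
      n′≡ : ι n′ ≡ ι n - 1ℚ
      n′≡ = trans (S.solve 2 (λ a b → b S.:= a S.:- (a S.:- b)) refl (ι n) (ι n′)) (cong (λ e → ι n - e) (trans (sym (ι-sub n n′)) (trans (cong ι D≡1) ι-1)))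
      lower : i 6 * i 197 * ρ < i 1000 * (ι A - i 3)
      lower = begin-strict
        i 6 * i 197 * ρ                                         ≡⟨ sym (scaled (pos 197)) ⟩
        i 1000 * (i 3 * (centre s (pos 197) + centre s (pos 197)) - i 6 * m) <⟨ *-mono< 1000>0 (ℚₚ.+-monoˡ-< (- (i 6 * m)) (*-mono< (0<ι 2) n′₁)) ⟩
        i 1000 * (i 3 * ι n′ - i 6 * m)                         ≡⟨ cong (λ e → i 1000 * (i 3 * e - i 6 * m)) n′≡ ⟩
        i 1000 * (i 3 * (ι n - 1ℚ) - i 6 * m)                   ≡⟨ cong (i 1000 *_) (S.solve 3 (λ t n b → t S.:* (n S.:- S.con 1ℚ) S.:- b S.:= (t S.:* n S.:- b) S.:- t) refl (i 3) (ι n) (i 6 * m)) ⟩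
        i 1000 * ((i 3 * ι n - i 6 * m) - i 3)                  ≡⟨ cong (λ e → i 1000 * (e - i 3)) (sym A-value) ⟩
        i 1000 * (ι A - i 3)                                    ∎
      A≥4 : pos 4 ℤ.≤ A
      A≥4 = ℤₚ.i<j⇒suc[i]≤j (ι-cancel-< (0<-⇒< (*-cancel< {r = i 1000} (ℚₚ.<⇒≤ 1000>0) (subst (_< i 1000 * (ι A - i 3)) (sym (ℚₚ.*-zeroʳ (i 1000)))
        (ℚₚ.≤-<-trans (0≤* (0≤* (0≤ι 6) (0≤ι 197)) (ℚₚ.<⇒≤ ρ>0)) lower)))))
      A≤4 : A ℤ.≤ pos 4
      A≤4 = <⇒≤pred (ι-cancel-< (*-cancel< {r = i 1000} (ℚₚ.<⇒≤ 1000>0) (ℚₚ.<-trans upper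
        (ℚₚ.<-≤-trans (subst (i 6 * i 785 * ρ <_) (ℚₚ.*-identityʳ (i 6 * i 785)) (*-mono< {ρ} {1ℚ} (0<* (0<ι 5) (0<ι 784)) ρ<1))
          (subst₂ _≤_ (ι-ℕ* 6 785) (ι-ℕ* 1000 5) (ι-mono-≤ (ℤ.+≤+ (ℕₚ.≤ᵇ⇒≤ 4710 5000 _))))))))
      A≡4 : ι A ≡ i 4
      A≡4 = cong ι (ℤₚ.≤-antisym A≤4 A≥4)
      -- 4000 < 4710 ρ ≤ 4 · 1182 ρ < 4000
      lt₁ : i 1000 * i 4 < i 6 * i 785 * ρ
      lt₁ = subst (λ e → i 1000 * e < i 6 * i 785 * ρ) A≡4 upper
      lt₂ : i 6 * i 785 * ρ < i 4 * (i 6 * i 197 * ρ)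
      lt₂ = subst₂ _<_ (cong (_* ρ) (ι-ℕ* 6 785)) (trans (cong (_* ρ) (trans (ι-ℕ* 4 (6 ℕ.* 197)) (cong (i 4 *_) (ι-ℕ* 6 197)))) (ℚₚ.*-assoc (i 4) (i 6 * i 197) ρ))
        (subst₂ _<_ (ℚₚ.*-comm ρ (i 4710)) (ℚₚ.*-comm ρ (i 4728)) (*-mono< ρ>0 (ι-mono-< (ℤ.+<+ (ℕₚ.<ᵇ⇒< 4710 4728 _)))))
      lt₃ : i 4 * (i 6 * i 197 * ρ) < i 1000 * i 4
      lt₃ = subst (i 4 * (i 6 * i 197 * ρ) <_) (trans (cong (λ e → i 4 * (i 1000 * (e - i 3))) A≡4)
          (trans (cong (λ e → i 4 * (i 1000 * e)) (trans (sym (ι-sub (pos 4) (pos 3))) ι-1)) (S.solve 2 (λ a b → a S.:* (b S.:* S.con 1ℚ) S.:= b S.:* a) refl (i 4) (i 1000))))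
        (*-mono< (0<ι 3) lower)

-- Numerical windows for each s.

module Certificates where
  open Rationals
  open Polynomials
  open Regions
  open SignTests
  open RootWindows
  open LargeCase
  open import Data.Integer as ℤ using (-[1+_]) renaming (+_ to pos)
  import Data.Nat.Properties as ℕₚ
  open import Relation.Binary.PropositionalEquality

  -- For large ϑ the distances of the roots from their mean, divided by √ϑ, approach the roots of
  -- the Hermite polynomial He with leading coefficient 1. In each certificate the bands isolate
  -- squares of these roots: about 1.84 for s = 5, 0.38 and 3.57 for s = 6, 1.33 for s = 7, 0.29 and
  -- 2.68 for s = 8, 1.05 for s = 9. They belong to the pairs nearest the centre: one pair for odd
  -- s, two for even s.
  pair5 : Pair odd 20 5 (pos 220) (pos 570)
  pair5 = record
    { r₀ = (range 1150 1750) ; r₁ = (range 2000 2200) ; r = (range 860 2560) ; c₀ = (pos 0) ; c₁ = (pos 700) ; σ = (pos 1) ; τ = (pos 1)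
    ; n₀ = 5 ; n₁ = 21 ; fitₗ = fit 220 46 954 480 76 1076 ; fitₕ = fit 570 119 881 130 21 1021
    ; inner = refl ; outer = refl ; lowerᵣ = refl ; upperᵣ = refl
    ; band₀ = refl ; band₁ = refl ; okₗ = refl ; okₕ = refl ; cₗ<cₕ = ℤ.+<+ (ℕₚ.<ᵇ⇒< 220 570 _) }

  cert5 : OddCert 20 5
  cert5 = record
    { cₗ = (pos 220) ; cₘ = (pos 570) ; cₕ = (pos 700) ; σ = (pos 1) ; pair = pair5 ; centreₘ = refl ; centreₕ = refl
    ; cₘ<cₕ = ℤ.+<+ (ℕₚ.<ᵇ⇒< 570 700 _) ; narrow = ℤ.+≤+ (ℕₚ.≤ᵇ⇒≤ 960 1000 _) }

  inner6 : Pair even 30 6 (pos 580) (pos 785)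
  inner6 = record
    { r₀ = (range 330 375) ; r₁ = (range 500 800) ; r = (range 300 985) ; c₀ = (pos 700) ; c₁ = (pos 1000) ; σ = -[1+ 0 ] ; τ = (pos 1)
    ; n₀ = 16 ; n₁ = 4 ; fitₗ = fit 0 0 1000 420 109 1109 ; fitₕ = fit 85 28 972 215 56 1056
    ; inner = refl ; outer = refl ; lowerᵣ = refl ; upperᵣ = refl
    ; band₀ = refl ; band₁ = refl ; okₗ = refl ; okₕ = refl ; cₗ<cₕ = ℤ.+<+ (ℕₚ.<ᵇ⇒< 580 785 _) }

  outer6 : Pair even 30 6 (pos 197) (pos 580)
  outer6 = record
    { r₀ = (range 2850 3150) ; r₁ = (range 3670 3739) ; r = (range 2200 3815) ; c₀ = -[1+ 499 ] ; c₁ = (pos 300) ; σ = (pos 1) ; τ = -[1+ 0 ]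
    ; n₀ = 20 ; n₁ = 107 ; fitₗ = fit 697 76 924 103 10 1010 ; fitₕ = fit 1080 117 883 0 0 1000
    ; inner = refl ; outer = refl ; lowerᵣ = refl ; upperᵣ = refl
    ; band₀ = refl ; band₁ = refl ; okₗ = refl ; okₕ = refl ; cₗ<cₕ = ℤ.+<+ (ℕₚ.<ᵇ⇒< 197 580 _) }

  -- Here 2(785 - 197) = 1176 exceeds 1000, and a difference 1 of the two sums has to be refuted
  -- separately. That refutation rests on 785 < 4 · 197 = 788, so both ends of the windows have to
  -- be this sharp.
  cert6 : EvenCert 30 6
  cert6 = record { cₗ = (pos 197) ; cₘ = (pos 580) ; cₕ = (pos 785) ; inner-pair = inner6 ; outer-pair = outer6 }

  pair7 : Pair odd 20 7 (pos 580) (pos 920)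
  pair7 = record
    { r₀ = (range 950 1200) ; r₁ = (range 1450 1700) ; r = (range 690 2000) ; c₀ = (pos 300) ; c₁ = (pos 1030) ; σ = -[1+ 0 ] ; τ = -[1+ 0 ]
    ; n₀ = 9 ; n₁ = 13 ; fitₗ = fit 280 65 935 450 84 1084 ; fitₕ = fit 620 143 857 110 21 1021
    ; inner = refl ; outer = refl ; lowerᵣ = refl ; upperᵣ = refl
    ; band₀ = refl ; band₁ = refl ; okₗ = refl ; okₕ = refl ; cₗ<cₕ = ℤ.+<+ (ℕₚ.<ᵇ⇒< 580 920 _) }

  cert7 : OddCert 20 7
  cert7 = record
    { cₗ = (pos 580) ; cₘ = (pos 920) ; cₕ = (pos 1030) ; σ = -[1+ 0 ] ; pair = pair7 ; centreₘ = refl ; centreₕ = refl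
    ; cₘ<cₕ = ℤ.+<+ (ℕₚ.<ᵇ⇒< 920 1030 _) ; narrow = ℤ.+≤+ (ℕₚ.≤ᵇ⇒≤ 900 1000 _) }

  inner8 : Pair even 25 8 (pos 950) (pos 1130)
  inner8 = record
    { r₀ = (range 270 290) ; r₁ = (range 400 550) ; r = (range 240 760) ; c₀ = (pos 1000) ; c₁ = (pos 1500) ; σ = (pos 1) ; τ = -[1+ 0 ]
    ; n₀ = 28 ; n₁ = 6 ; fitₗ = fit 0 0 1000 550 174 1174 ; fitₕ = fit 130 51 949 370 118 1118
    ; inner = refl ; outer = refl ; lowerᵣ = refl ; upperᵣ = refl
    ; band₀ = refl ; band₁ = refl ; okₗ = refl ; okₕ = refl ; cₗ<cₕ = ℤ.+<+ (ℕₚ.<ᵇ⇒< 950 1130 _) }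

  outer8 : Pair even 25 8 (pos 635) (pos 950)
  outer8 = record
    { r₀ = (range 2300 2450) ; r₁ = (range 2820 2878) ; r = (range 1900 3030) ; c₀ = (pos 300) ; c₁ = (pos 850) ; σ = -[1+ 0 ] ; τ = (pos 1)
    ; n₀ = 32 ; n₁ = 98 ; fitₗ = fit 335 45 955 215 26 1026 ; fitₕ = fit 650 86 914 0 0 1000
    ; inner = refl ; outer = refl ; lowerᵣ = refl ; upperᵣ = refl
    ; band₀ = refl ; band₁ = refl ; okₗ = refl ; okₕ = refl ; cₗ<cₕ = ℤ.+<+ (ℕₚ.<ᵇ⇒< 635 950 _) }

  cert8 : EvenCert 25 8
  cert8 = record { cₗ = (pos 635) ; cₘ = (pos 950) ; cₕ = (pos 1130) ; inner-pair = inner8 ; outer-pair = outer8 }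

  pair9 : Pair odd 20 9 (pos 920) (pos 1230)
  pair9 = record
    { r₀ = (range 850 1030) ; r₁ = (range 1200 1400) ; r = (range 720 1690) ; c₀ = (pos 950) ; c₁ = (pos 1400) ; σ = (pos 1) ; τ = (pos 1)
    ; n₀ = 10 ; n₁ = 13 ; fitₗ = fit 0 0 1000 480 98 1098 ; fitₕ = fit 280 68 932 170 35 1035
    ; inner = refl ; outer = refl ; lowerᵣ = refl ; upperᵣ = refl
    ; band₀ = refl ; band₁ = refl ; okₗ = refl ; okₕ = refl ; cₗ<cₕ = ℤ.+<+ (ℕₚ.<ᵇ⇒< 920 1230 _) }

  cert9 : OddCert 20 9
  cert9 = record
    { cₗ = (pos 920) ; cₘ = (pos 1230) ; cₕ = (pos 1400) ; σ = (pos 1) ; pair = pair9 ; centreₘ = refl ; centreₕ = refl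
    ; cₘ<cₕ = ℤ.+<+ (ℕₚ.<ᵇ⇒< 1230 1400 _) ; narrow = ℤ.+≤+ (ℕₚ.≤ᵇ⇒≤ 960 1000 _) }

-- The finite search for ϑ < ϑ₀, divided at 8a = N.

module SmallCase where
  open import Data.Nat
  open import Data.Nat.Properties
  open import Data.Nat.DivMod using (_/_; _%_; m*n/n≡m; /-monoˡ-≤)
  open import Data.Nat.Divisibility using (_∣_; divides; _∣?_; n∣m⇒m%n≡0; ∣m∣n⇒∣m+n; ∣m+n∣m⇒∣n; ∣n⇒∣m*n; m∣m*n; *-monoˡ-∣)
  open import Data.Nat.Combinatorics using (_C_)
  open import Data.Integer as ℤ using (ℤ; -[1+_]) renaming (+_ to pos)
  import Data.Integer.Properties as ℤₚ
  import Data.Integer.Solver as ℤSolver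
  import Data.Nat.Solver as ℕSolver
  open import Data.Bool using (Bool; true; false; _∧_; _∨_; not; if_then_else_; T)
  open import Data.Empty using (⊥; ⊥-elim)
  open import Data.Product using (_×_; _,_; proj₁; proj₂; ∃-syntax)
  open import Data.Sum using (inj₁; inj₂)
  open import Data.Unit using (tt)
  open import Relation.Nullary using (does; ¬_)
  open import Relation.Binary.Definitions using (tri<; tri≈; tri>)
  open import Relation.Nullary.Decidable using (dec-true)
  open import Relation.Binary.PropositionalEquality
  module Nₛ = ℕSolver.+-*-Solver
  module Zₛ = ℤSolver.+-*-Solver

  allBelow : ℕ → (ℕ → Bool) → Bool
  allBelow zero    f = true
  allBelow (suc n) f = f n ∧ allBelow n f

  private
    ∧-true : ∀ {a b} → a ∧ b ≡ true → (a ≡ true) × (b ≡ true)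
    ∧-true {true} {true} _ = refl , refl

    true≢false : true ≢ false
    true≢false ()

    T→≡ : ∀ {b} → T b → b ≡ true
    T→≡ {true} _ = refl

    ≡→T : ∀ {b} → b ≡ true → T b
    ≡→T refl = tt

  allBelow-sound : ∀ n f → allBelow n f ≡ true → ∀ {i} → i < n → f i ≡ true
  allBelow-sound (suc n) f e {i} i<1+n with ∧-true {f n} e
  ... | e₁ , e₂ with m≤n⇒m<n∨m≡n (s≤s⁻¹ i<1+n)
  ...   | inj₁ i<n  = allBelow-sound n f e₂ i<n
  ...   | inj₂ refl = e₁

  allBelow-complete : ∀ n f → (∀ {i} → i < n → f i ≡ true) → allBelow n f ≡ true
  allBelow-complete zero    f h = refl
  allBelow-complete (suc n) f h = cong₂ _∧_ (h ≤-refl) (allBelow-complete n f λ i<n → h (m≤n⇒m≤1+n i<n))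

  rise : ℕ → ℕ → ℕ
  rise N zero    = 1
  rise N (suc j) = rise N j * (N + j)

  pairs : ℕ → ℕ → ℕ → ℕ
  pairs a b zero    = 1
  pairs a b (suc j) = pairs a b j * ((a + suc j) * (b + suc j))

  Integral : ℕ → ℕ → ℕ → Set
  Integral s a b = ∀ j → j ≤ s → rise (suc (a + b)) j ∣ (s C j) * pairs a b j

  integral? : ℕ → ℕ → ℕ → Bool
  integral? s a b = allBelow (suc s) λ j → does (rise (suc (a + b)) j ∣? (s C j) * pairs a b j)

  integral?-complete : ∀ s a b → Integral s a b → integral? s a b ≡ true
  integral?-complete s a b int = allBelow-complete (suc s) _ λ {j} j<1+s → dec-true (rise (suc (a + b)) j ∣? (s C j) * pairs a b j) (int j (s≤s⁻¹ j<1+s))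

  IsSmall : ℕ → ℕ → ℕ → Set
  IsSmall ϑ₀ a b = let N = suc (a + b); Q = suc a * suc b in Q * Q < ϑ₀ * (N * N * (N + 2))

  -- n is N - 1
  dense-test : ℕ → ℕ → ℕ → ℕ → Bool
  dense-test s ϑ₀ n a = let N = suc n; b = n ∸ a; Q = suc a * suc b in
    (8 * a <ᵇ N) ∨ (not ((s * Q) % N ≡ᵇ 0) ∨ (not (Q * Q <ᵇ ϑ₀ * (N * N * (N + 2))) ∨ not (integral? s a b)))

  -- If a ≤ b and N ≤ 8a, then 64Q ≥ 7N², and Q² < ϑ₀N²(N+2) leaves 49N² < 4096ϑ₀(N+2). As 4096/49 <
  -- 84, this bounds N by 84ϑ₀ + 2.
  dense-search : ℕ → ℕ → Bool
  dense-search s ϑ₀ = allBelow (84 * ϑ₀ + 2) λ n → allBelow (suc (n / 2)) (dense-test s ϑ₀ n)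

  private
    ∨-false : ∀ {a b} → a ∨ b ≡ true → a ≡ false → b ≡ true
    ∨-false e refl = e

    not-false : ∀ {b} → not b ≡ true → b ≡ true → ⊥
    not-false e refl = true≢false (sym e)

    <ᵇ-false : ∀ {m n} → ¬ m < n → (m <ᵇ n) ≡ false
    <ᵇ-false {m} {n} h with m <ᵇ n in eq
    ... | false = refl
    ... | true  = ⊥-elim (h (<ᵇ⇒< m n (≡→T eq)))

    ≡ᵇ-true : ∀ {m n} → m ≡ n → (m ≡ᵇ n) ≡ true
    ≡ᵇ-true {m} {n} e = T→≡ (≡⇒≡ᵇ m n e)

    <ᵇ-true : ∀ {m n} → m < n → (m <ᵇ n) ≡ true
    <ᵇ-true h = T→≡ (<⇒<ᵇ h)

  integral-1 : ∀ s a b → 1 ≤ s → Integral s a b → suc (a + b) ∣ s * (suc a * suc b)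
  integral-1 s a b 1≤s int = subst₂ _∣_ (trans (*-identityˡ _) (+-identityʳ _))
    (cong₂ _*_ (nC1≡n s) (trans (*-identityˡ _) (cong₂ _*_ (+-comm a 1) (+-comm b 1)))) (int 1 1≤s)
    where open import Data.Nat.Combinatorics using (nC1≡n)

  module Dense (s ϑ₀ a b : ℕ) (1≤s : 1 ≤ s) (a≤b : a ≤ b) (int : Integral s a b) (small : IsSmall ϑ₀ a b)
               (search : dense-search s ϑ₀ ≡ true) (N≤8a : suc (a + b) ≤ 8 * a) where
    private
      n = a + b
      N = suc n
      Q = suc a * suc b
      -- 64·a(N-a) ≥ 7N² because N ≤ 8a and a ≤ N/2
      7N²≤64Q : 7 * (N * N) ≤ 64 * Q
      7N²≤64Q = ≤-trans (m≤m+n _ (e * f)) (≤-trans (≤-reflexive eq) (*-monoʳ-≤ 64 (*-monoˡ-≤ (suc b) (n≤1+n a))))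
        where
        e = 8 * a ∸ N
        -- f = 7N - 8a
        f = 7 * suc b ∸ a
        e-eq : 8 * a ≡ e + N
        e-eq = sym (m∸n+n≡m N≤8a)
        f-eq : 7 * suc b ≡ f + a
        f-eq = sym (m∸n+n≡m (≤-trans a≤b (≤-trans (n≤1+n b) (m≤n*m (suc b) 7))))
        -- The difference 64a(N - a) - 7N² factors as (8a - N)(7N - 8a), both factors being
        -- nonnegative here.
        eq : 7 * (N * N) + e * f ≡ 64 * (a * suc b)
        eq = ℤₚ.+-injective (begin
          pos (7 * (N * N) + e * f) ≡⟨ trans (ℤₚ.pos-+ (7 * (N * N)) (e * f)) (cong₂ ℤ._+_ (trans (ℤₚ.pos-* 7 (N * N)) (cong (pos 7 ℤ.*_) (ℤₚ.pos-* N N))) (ℤₚ.pos-* e f)) ⟩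
          pos 7 ℤ.* (pos N ℤ.* pos N) ℤ.+ pos e ℤ.* pos f ≡⟨ cong₂ (λ x y → pos 7 ℤ.* (x ℤ.* x) ℤ.+ y ℤ.* pos f) N≡ (trans e≡ (cong (λ x → pos 8 ℤ.* A ℤ.- x) N≡)) ⟩
          pos 7 ℤ.* ((A ℤ.+ B) ℤ.* (A ℤ.+ B)) ℤ.+ (pos 8 ℤ.* A ℤ.- (A ℤ.+ B)) ℤ.* pos f ≡⟨ cong (λ y → pos 7 ℤ.* ((A ℤ.+ B) ℤ.* (A ℤ.+ B)) ℤ.+ (pos 8 ℤ.* A ℤ.- (A ℤ.+ B)) ℤ.* y) f≡ ⟩
          pos 7 ℤ.* ((A ℤ.+ B) ℤ.* (A ℤ.+ B)) ℤ.+ (pos 8 ℤ.* A ℤ.- (A ℤ.+ B)) ℤ.* (pos 7 ℤ.* B ℤ.- A)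
            ≡⟨ Zₛ.solve 2 (λ A B → Zₛ.con (pos 7) Zₛ.:* ((A Zₛ.:+ B) Zₛ.:* (A Zₛ.:+ B)) Zₛ.:+ (Zₛ.con (pos 8) Zₛ.:* A Zₛ.:- (A Zₛ.:+ B)) Zₛ.:* (Zₛ.con (pos 7) Zₛ.:* B Zₛ.:- A)
               Zₛ.:= Zₛ.con (pos 64) Zₛ.:* (A Zₛ.:* B)) refl A B ⟩
          pos 64 ℤ.* (A ℤ.* B) ≡⟨ sym (trans (ℤₚ.pos-* 64 (a * suc b)) (cong (pos 64 ℤ.*_) (ℤₚ.pos-* a (suc b)))) ⟩
          pos (64 * (a * suc b)) ∎)
          where
          open ≡-Reasoning
          A = pos a
          B = pos (suc b)
          N≡ : pos N ≡ A ℤ.+ B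
          N≡ = trans (cong pos (sym (+-suc a b))) (ℤₚ.pos-+ a (suc b))
          e≡ : pos e ≡ pos 8 ℤ.* A ℤ.- pos N
          e≡ = trans (Zₛ.solve 2 (λ e n → e Zₛ.:= (e Zₛ.:+ n) Zₛ.:- n) refl (pos e) (pos N)) (cong (ℤ._- pos N) (trans (sym (ℤₚ.pos-+ e N)) (trans (cong pos (sym e-eq)) (ℤₚ.pos-* 8 a))))
          f≡ : pos f ≡ pos 7 ℤ.* B ℤ.- A
          f≡ = trans (Zₛ.solve 2 (λ e n → e Zₛ.:= (e Zₛ.:+ n) Zₛ.:- n) refl (pos f) A) (cong (ℤ._- A) (trans (sym (ℤₚ.pos-+ f a)) (trans (cong pos (sym f-eq)) (ℤₚ.pos-* 7 (suc b)))))
      -- 49 N⁴ ≤ 4096 Q² < 4096 ϑ₀ N² (N+2)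
      49N²< : 49 * (N * N) < 4096 * ϑ₀ * (N + 2)
      49N²< = *-cancelʳ-< (N * N) (49 * (N * N)) (4096 * ϑ₀ * (N + 2)) (begin-strict
        49 * (N * N) * (N * N)          ≡⟨ Nₛ.solve 1 (λ n → Nₛ.con 49 Nₛ.:* n Nₛ.:* n Nₛ.:= (Nₛ.con 7 Nₛ.:* n) Nₛ.:* (Nₛ.con 7 Nₛ.:* n)) refl (N * N) ⟩
        (7 * (N * N)) * (7 * (N * N))   ≤⟨ *-mono-≤ 7N²≤64Q 7N²≤64Q ⟩
        (64 * Q) * (64 * Q)             ≡⟨ Nₛ.solve 1 (λ q → (Nₛ.con 64 Nₛ.:* q) Nₛ.:* (Nₛ.con 64 Nₛ.:* q) Nₛ.:= Nₛ.con 4096 Nₛ.:* (q Nₛ.:* q)) refl Q ⟩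
        4096 * (Q * Q)                  <⟨ *-monoʳ-< 4096 small ⟩
        4096 * (ϑ₀ * (N * N * (N + 2))) ≡⟨ Nₛ.solve 3 (λ t n m → Nₛ.con 4096 Nₛ.:* (t Nₛ.:* (n Nₛ.:* m)) Nₛ.:= Nₛ.con 4096 Nₛ.:* t Nₛ.:* m Nₛ.:* n) refl ϑ₀ (N * N) (N + 2) ⟩
        4096 * ϑ₀ * (N + 2) * (N * N)   ∎)
        where open ≤-Reasoning
      N≤ : N ≤ 84 * ϑ₀ + 2
      N≤ = ≮⇒≥ λ N> → <-irrefl refl (<-≤-trans 49N²< (begin
        4096 * ϑ₀ * (N + 2)        ≤⟨ *-monoˡ-≤ (N + 2) (*-monoˡ-≤ ϑ₀ (≤ᵇ⇒≤ 4096 4116 tt)) ⟩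
        4116 * ϑ₀ * (N + 2)        ≡⟨ Nₛ.solve 2 (λ t n → Nₛ.con 4116 Nₛ.:* t Nₛ.:* n Nₛ.:= Nₛ.con 49 Nₛ.:* ((Nₛ.con 84 Nₛ.:* t) Nₛ.:* n)) refl ϑ₀ (N + 2) ⟩
        49 * ((84 * ϑ₀) * (N + 2)) ≤⟨ *-monoʳ-≤ 49 (begin
          (84 * ϑ₀) * (N + 2)      ≡⟨ *-distribˡ-+ (84 * ϑ₀) N 2 ⟩
          84 * ϑ₀ * N + 84 * ϑ₀ * 2 ≤⟨ +-monoʳ-≤ (84 * ϑ₀ * N) (≤-trans (≤-reflexive (*-comm (84 * ϑ₀) 2)) (*-monoʳ-≤ 2 (≤-trans (m≤m+n (84 * ϑ₀) 2) (<⇒≤ N>)))) ⟩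
          84 * ϑ₀ * N + 2 * N      ≡⟨ sym (*-distribʳ-+ N (84 * ϑ₀) 2) ⟩
          (84 * ϑ₀ + 2) * N        ≤⟨ *-monoˡ-≤ N (<⇒≤ N>) ⟩
          N * N                    ∎) ⟩
        49 * (N * N)               ∎))
        where open ≤-Reasoning

    contradiction : ⊥
    contradiction = not-false (∨-false (∨-false (∨-false hit (<ᵇ-false (≤⇒≯ N≤8a))) (cong not q₁)) (cong not q₂)) q₃
      where
      a≤n/2 : a ≤ n / 2
      a≤n/2 = subst (_≤ n / 2) (m*n/n≡m a 2) (/-monoˡ-≤ 2 (subst (_≤ n) (trans (cong (a +_) (sym (+-identityʳ a))) (*-comm 2 a)) (+-monoʳ-≤ a a≤b)))
      b≡ : n ∸ a ≡ b
      b≡ = m+n∸m≡n a b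
      hit : dense-test s ϑ₀ n a ≡ true
      hit = allBelow-sound (suc (n / 2)) (dense-test s ϑ₀ n)
        (allBelow-sound (84 * ϑ₀ + 2) (λ n → allBelow (suc (n / 2)) (dense-test s ϑ₀ n)) search N≤) (s≤s a≤n/2)
      q₁ : ((s * (suc a * suc (n ∸ a))) % N ≡ᵇ 0) ≡ true
      q₁ = subst (λ b → ((s * (suc a * suc b)) % N ≡ᵇ 0) ≡ true) (sym b≡) (≡ᵇ-true (n∣m⇒m%n≡0 _ N (integral-1 s a b 1≤s int)))
      q₂ : ((suc a * suc (n ∸ a)) * (suc a * suc (n ∸ a)) <ᵇ ϑ₀ * (N * N * (N + 2))) ≡ true
      q₂ = subst (λ b → ((suc a * suc b) * (suc a * suc b) <ᵇ ϑ₀ * (N * N * (N + 2))) ≡ true) (sym b≡) (<ᵇ-true small)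
      q₃ : integral? s a (n ∸ a) ≡ true
      q₃ = subst (λ b → integral? s a b ≡ true) (sym b≡) (integral?-complete s a b int)

  -- For M N = s a(a+1) and K (N+1) = (s-1) M (2s(a+1) - M) the integer a solves lhs s M K a ≡ rhs s M a.
  lhs : ℕ → ℕ → ℕ → ℕ → ℕ
  lhs s M K a = K * (s * (a * suc a)) + (K * M + (s ∸ 1) * M * M * M)

  top : ℕ → ℕ → ℕ
  top s M = 2 * (s ∸ 1) * M * M

  rhs : ℕ → ℕ → ℕ → ℕ
  rhs s M a = top s M * (s * suc a)

  -- One step of a fixed-point iteration: dividing the equation by s(a+1) gives Ka = 2(s-1)M² - (KM
  -- + (s-1)M³)/(s(a+1)). The successor of a truncated predecessor only makes the divisor visibly
  -- nonzero.
  refine : ℕ → ℕ → ℕ → ℕ → ℕ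
  refine s M κ a = (top s M ∸ (suc κ * M + (s ∸ 1) * M * M * M) / suc (s * suc a ∸ 1)) / suc κ

  adjust : ℕ → ℕ → ℕ → ℕ → ℕ
  adjust s M K a = if rhs s M a <ᵇ lhs s M K a then a ∸ 1 else (if lhs s M K (suc a) ≤ᵇ rhs s M (suc a) then suc a else a)

  -- A guess for the integral part of the larger root. Nothing is proved about it: the test checks
  -- afterwards that it brackets the root, so a bad guess could only make the search fail.
  candidate : ℕ → ℕ → ℕ → ℕ
  candidate s M κ = adj (adj (adj (ref (ref (ref (top s M / suc κ))))))
    where
    adj = adjust s M (suc κ)
    ref = refine s M κ

  not-integral-at : ℕ → ℕ → ℕ → Bool
  not-integral-at s m a = let q = s * (a * suc a) in not (integral? s a ((q / suc m) ∸ suc a))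

  -- The first three conditions put the change of sign of lhs - rhs between a and a + 1, beyond the
  -- vertex of the quadratic; so a is the only candidate for an integral solution there. The last
  -- condition rules it out: either the equation fails, or the b computed from MN = sa(a+1) violates
  -- a divisibility.
  sparse-test′ : ℕ → ℕ → ℕ → ℕ → Bool
  sparse-test′ s m κ a = (lhs s M K a ≤ᵇ rhs s M a) ∧ (rhs s M (suc a) <ᵇ lhs s M K (suc a)) ∧ (top s M <ᵇ 2 * (K * suc a)) ∧
    (not (lhs s M K a ≡ᵇ rhs s M a) ∨ not-integral-at s m a)
    where
    M = suc m
    K = suc κ

  -- A cheap filter stands in front. Since a(a+1) is even, 2s divides all terms of the equation that
  -- contain a, hence also KM + (s-1)M³.
  sparse-test : ℕ → ℕ → ℕ → Bool
  sparse-test s m κ = not ((suc κ * suc m + (s ∸ 1) * suc m * suc m * suc m) % suc (2 * s ∸ 1) ≡ᵇ 0) ∨ sparse-test′ s m κ (candidate s (suc m) κ)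

  -- The equation implies K·sa ≤ s·top. Here sa is at least s, and at least 8M - s because 8M <
  -- s(a+1); the divisor is the larger of these lower bounds.
  K-bound : ℕ → ℕ → ℕ
  K-bound s M = (s * top s M) / suc ((8 * M ∸ suc s) ⊔ (s ∸ 1))

  sparse-search : ℕ → ℕ → Bool
  sparse-search s ϑ₀ = allBelow (64 * ϑ₀ * s / 49) λ m → allBelow (K-bound s (suc m)) (sparse-test s m)

  private
    -- The difference lhs - rhs is increasing from a on.
    module Monotone (s M K : ℕ) (s>0 : 0 < s) where
      step : ∀ a → top s M < 2 * (K * suc a) → rhs s M a ≤ lhs s M K a → rhs s M (suc a) < lhs s M K (suc a)
      step a slope le = begin-strict
        rhs s M (suc a)                  ≡⟨ Nₛ.solve 3 (λ t s a → t Nₛ.:* (s Nₛ.:* (Nₛ.con 2 Nₛ.:+ a)) Nₛ.:= t Nₛ.:* (s Nₛ.:* (Nₛ.con 1 Nₛ.:+ a)) Nₛ.:+ t Nₛ.:* s) refl (top s M) s a ⟩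
        rhs s M a + top s M * s          <⟨ +-mono-≤-< le (*-monoˡ-< s {{>-nonZero s>0}} slope) ⟩
        lhs s M K a + 2 * (K * suc a) * s ≡⟨ Nₛ.solve 4 (λ k s a c → k Nₛ.:* (s Nₛ.:* (a Nₛ.:* (Nₛ.con 1 Nₛ.:+ a))) Nₛ.:+ c Nₛ.:+ Nₛ.con 2 Nₛ.:* (k Nₛ.:* (Nₛ.con 1 Nₛ.:+ a)) Nₛ.:* s Nₛ.:=
             k Nₛ.:* (s Nₛ.:* ((Nₛ.con 1 Nₛ.:+ a) Nₛ.:* (Nₛ.con 2 Nₛ.:+ a))) Nₛ.:+ c) refl K s a (K * M + (s ∸ 1) * M * M * M) ⟩
        lhs s M K (suc a)                ∎
        where open ≤-Reasoning

      slope-mono : ∀ {a a′} → a ≤ a′ → top s M < 2 * (K * suc a) → top s M < 2 * (K * suc a′)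
      slope-mono le h = <-≤-trans h (*-monoʳ-≤ 2 (*-monoʳ-≤ K (s≤s le)))

      above : ∀ a d → top s M < 2 * (K * suc a) → rhs s M a ≤ lhs s M K a → rhs s M (suc d + a) < lhs s M K (suc d + a)
      above a zero    slope le = step a slope le
      above a (suc d) slope le = step (suc d + a) (slope-mono (m≤n+m a (suc d)) slope) (<⇒≤ (above a d slope le))

    unique : ∀ s M K a a₀ → 0 < s → lhs s M K a ≡ rhs s M a → top s M < 2 * (K * suc a) →
             lhs s M K a₀ ≤ rhs s M a₀ → rhs s M (suc a₀) < lhs s M K (suc a₀) → top s M < 2 * (K * suc a₀) → a ≡ a₀
    unique s M K a a₀ s>0 eq slope le lt slope₀ with <-cmp a a₀
    ... | tri≈ _ e _ = e
    ... | tri< a<a₀ _ _ = ⊥-elim (<⇒≱ (subst (λ x → rhs s M x < lhs s M K x) (d+ a<a₀) (above a (a₀ ∸ suc a) slope (≤-reflexive (sym eq)))) le)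
      where
      open Monotone s M K s>0
      d+ : a < a₀ → suc (a₀ ∸ suc a) + a ≡ a₀
      d+ h = trans (sym (+-suc (a₀ ∸ suc a) a)) (m∸n+n≡m h)
    ... | tri> _ _ a₀<a with m≤n⇒m<n∨m≡n a₀<a
    ...   | inj₂ refl = ⊥-elim (<-irrefl (sym eq) lt)
    ...   | inj₁ h = ⊥-elim (<-irrefl (sym eq) (subst (λ x → rhs s M x < lhs s M K x) d+ (above (suc a₀) (a ∸ suc (suc a₀)) (slope-mono (n≤1+n a₀) slope₀) (<⇒≤ lt))))
      where
      open Monotone s M K s>0
      d+ : suc (a ∸ suc (suc a₀)) + suc a₀ ≡ a
      d+ = trans (sym (+-suc (a ∸ suc (suc a₀)) (suc a₀))) (m∸n+n≡m h)

  -- For 8a < N a bound on ϑ does not bound N, but it bounds a²/N and with it the quotient M of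
  -- sa(a+1) by N. The divisibility for j = 2 supplies a second quotient K, again bounded, and the
  -- pair (M, K) determines a through a quadratic equation and then b.
  module Sparse (s ϑ₀ a b : ℕ) (2≤s : 2 ≤ s) (C2 : 2 * (s C 2) ≡ s * (s ∸ 1)) (1≤a : 1 ≤ a) (int : Integral s a b) (small : IsSmall ϑ₀ a b)
                (search : sparse-search s ϑ₀ ≡ true) (8a<N : 8 * a < suc (a + b)) where
    private
      n N Q s₁ : ℕ
      n = a + b
      N = suc n
      Q = suc a * suc b
      s₁ = s ∸ 1
      instance
        s≢0 : NonZero s
        s≢0 = >-nonZero (≤-trans (s≤s z≤n) 2≤s)
        a≢0 : NonZero a
        a≢0 = >-nonZero 1≤a
      sQ+ : s * Q + s * (a * suc a) ≡ (s * suc a) * N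
      sQ+ = Nₛ.solve 3 (λ s a b → s Nₛ.:* ((Nₛ.con 1 Nₛ.:+ a) Nₛ.:* (Nₛ.con 1 Nₛ.:+ b)) Nₛ.:+ s Nₛ.:* (a Nₛ.:* (Nₛ.con 1 Nₛ.:+ a))
              Nₛ.:= (s Nₛ.:* (Nₛ.con 1 Nₛ.:+ a)) Nₛ.:* (Nₛ.con 1 Nₛ.:+ (a Nₛ.:+ b))) refl s a b
      div₁ : N ∣ s * Q
      div₁ = integral-1 s a b (≤-trans (s≤s z≤n) 2≤s) int
      -- Q = (a+1)(N - a), so sQ is congruent to -sa(a+1) modulo N.
      divM : N ∣ s * (a * suc a)
      divM = ∣m+n∣m⇒∣n (divides (s * suc a) sQ+) div₁
      e₁ M : ℕ
      e₁ = _∣_.quotient div₁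
      M = _∣_.quotient divM
      e₁-def : s * Q ≡ e₁ * N
      e₁-def = _∣_.equality div₁
      M-def : s * (a * suc a) ≡ M * N
      M-def = _∣_.equality divM
      e₁+M : e₁ + M ≡ s * suc a
      e₁+M = *-cancelʳ-≡ (e₁ + M) (s * suc a) N (trans (*-distribʳ-+ N e₁ M) (trans (cong₂ _+_ (sym e₁-def) (sym M-def)) sQ+))
      M>0 : 0 < M
      M>0 = n≢0⇒n>0 λ M≡0 → <-irrefl refl (<-≤-trans (m*n>0 s (a * suc a)) (≤-reflexive (trans M-def (cong (_* N) M≡0))))
        where
        m*n>0 : ∀ s a → .{{NonZero s}} → .{{NonZero a}} → 0 < s * a
        m*n>0 s a = >-nonZero⁻¹ (s * a) {{m*n≢0 s a}}
        instance
          aa≢0 : NonZero (a * suc a)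
          aa≢0 = m*n≢0 a (suc a)
      8M< : 8 * M < s * suc a
      8M< = *-cancelʳ-< a (8 * M) (s * suc a) (begin-strict
        8 * M * a       ≡⟨ Nₛ.solve 2 (λ m a → Nₛ.con 8 Nₛ.:* m Nₛ.:* a Nₛ.:= m Nₛ.:* (Nₛ.con 8 Nₛ.:* a)) refl M a ⟩
        M * (8 * a)     <⟨ *-monoʳ-< M {{>-nonZero M>0}} 8a<N ⟩
        M * N           ≡⟨ sym M-def ⟩
        s * (a * suc a) ≡⟨ Nₛ.solve 3 (λ s a c → s Nₛ.:* (a Nₛ.:* c) Nₛ.:= s Nₛ.:* c Nₛ.:* a) refl s a (suc a) ⟩
        s * suc a * a   ∎)
        where open ≤-Reasoning

      -- The quotient e₁ = sQ/N equals s(a+1) - M, which is at least 7/8 of s(a+1), whereas ϑ < ϑ₀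
      -- says e₁² < s²ϑ₀(N+2). Thus (a+1)² is at most a multiple of N + 2, and MN = sa(a+1) passes
      -- the bound on to M.
      M-bound : M * 49 < 64 * ϑ₀ * s
      M-bound = *-cancelʳ-< (suc a * suc a * s) (M * 49) (64 * ϑ₀ * s) (begin-strict
        M * 49 * (suc a * suc a * s)             ≡⟨ Nₛ.solve 3 (λ m a s → m Nₛ.:* Nₛ.con 49 Nₛ.:* (a Nₛ.:* a Nₛ.:* s) Nₛ.:= m Nₛ.:* (Nₛ.con 49 Nₛ.:* (a Nₛ.:* a)) Nₛ.:* s) refl M (suc a) s ⟩
        M * (49 * (suc a * suc a)) * s           <⟨ *-monoˡ-< s (*-monoʳ-< M {{>-nonZero M>0}} 49a²<) ⟩
        M * (64 * (ϑ₀ * (N + 2))) * s            ≡⟨ cong (_* s) (Nₛ.solve 3 (λ m t n → m Nₛ.:* (Nₛ.con 64 Nₛ.:* (t Nₛ.:* (n Nₛ.:+ Nₛ.con 2))) Nₛ.:= Nₛ.con 64 Nₛ.:* t Nₛ.:* (m Nₛ.:* n Nₛ.:+ Nₛ.con 2 Nₛ.:* m)) refl M ϑ₀ N) ⟩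
        64 * ϑ₀ * (M * N + 2 * M) * s            ≤⟨ *-monoˡ-≤ s (*-monoʳ-≤ (64 * ϑ₀) MN+2M) ⟩
        64 * ϑ₀ * (s * (suc a * suc a)) * s      ≡⟨ Nₛ.solve 3 (λ t s a → t Nₛ.:* (s Nₛ.:* (a Nₛ.:* a)) Nₛ.:* s Nₛ.:= t Nₛ.:* s Nₛ.:* (a Nₛ.:* a Nₛ.:* s)) refl (64 * ϑ₀) s (suc a) ⟩
        64 * ϑ₀ * s * (suc a * suc a * s)        ∎)
        where
        open ≤-Reasoning
        MN+2M : M * N + 2 * M ≤ s * (suc a * suc a)
        MN+2M = ≤-trans (+-mono-≤ (≤-reflexive (sym M-def)) (≤-trans (*-monoˡ-≤ M (≤ᵇ⇒≤ 2 8 tt)) (<⇒≤ 8M<)))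
          (≤-reflexive (Nₛ.solve 2 (λ s a → s Nₛ.:* (a Nₛ.:* (Nₛ.con 1 Nₛ.:+ a)) Nₛ.:+ s Nₛ.:* (Nₛ.con 1 Nₛ.:+ a) Nₛ.:= s Nₛ.:* ((Nₛ.con 1 Nₛ.:+ a) Nₛ.:* (Nₛ.con 1 Nₛ.:+ a))) refl s a))
        7≤8e₁ : 7 * (s * suc a) ≤ 8 * e₁
        7≤8e₁ = +-cancelʳ-≤ (8 * M) (7 * (s * suc a)) (8 * e₁) (begin
          7 * (s * suc a) + 8 * M         ≤⟨ +-monoʳ-≤ (7 * (s * suc a)) (<⇒≤ 8M<) ⟩
          7 * (s * suc a) + s * suc a     ≡⟨ Nₛ.solve 1 (λ x → Nₛ.con 7 Nₛ.:* x Nₛ.:+ x Nₛ.:= Nₛ.con 8 Nₛ.:* x) refl (s * suc a) ⟩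
          8 * (s * suc a)                 ≡⟨ cong (8 *_) (sym e₁+M) ⟩
          8 * (e₁ + M)                    ≡⟨ *-distribˡ-+ 8 e₁ M ⟩
          8 * e₁ + 8 * M                  ∎)
        e₁²< : e₁ * e₁ < s * s * (ϑ₀ * (N + 2))
        e₁²< = *-cancelʳ-< (N * N) (e₁ * e₁) (s * s * (ϑ₀ * (N + 2))) (begin-strict
          e₁ * e₁ * (N * N)               ≡⟨ Nₛ.solve 2 (λ e n → e Nₛ.:* e Nₛ.:* (n Nₛ.:* n) Nₛ.:= (e Nₛ.:* n) Nₛ.:* (e Nₛ.:* n)) refl e₁ N ⟩
          (e₁ * N) * (e₁ * N)             ≡⟨ sym (cong₂ _*_ e₁-def e₁-def) ⟩
          (s * Q) * (s * Q)               ≡⟨ Nₛ.solve 2 (λ s q → (s Nₛ.:* q) Nₛ.:* (s Nₛ.:* q) Nₛ.:= (s Nₛ.:* s) Nₛ.:* (q Nₛ.:* q)) refl s Q ⟩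
          (s * s) * (Q * Q)               <⟨ *-monoʳ-< (s * s) {{m*n≢0 s s}} small ⟩
          (s * s) * (ϑ₀ * (N * N * (N + 2))) ≡⟨ Nₛ.solve 4 (λ s t n m → s Nₛ.:* (t Nₛ.:* (n Nₛ.:* m)) Nₛ.:= s Nₛ.:* (t Nₛ.:* m) Nₛ.:* n) refl (s * s) ϑ₀ (N * N) (N + 2) ⟩
          s * s * (ϑ₀ * (N + 2)) * (N * N) ∎)
        49a²< : 49 * (suc a * suc a) < 64 * (ϑ₀ * (N + 2))
        49a²< = *-cancelʳ-< (s * s) (49 * (suc a * suc a)) (64 * (ϑ₀ * (N + 2))) (begin-strict
          49 * (suc a * suc a) * (s * s)     ≡⟨ Nₛ.solve 2 (λ a s → Nₛ.con 49 Nₛ.:* (a Nₛ.:* a) Nₛ.:* (s Nₛ.:* s) Nₛ.:= (Nₛ.con 7 Nₛ.:* (s Nₛ.:* a)) Nₛ.:* (Nₛ.con 7 Nₛ.:* (s Nₛ.:* a))) refl (suc a) s ⟩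
          (7 * (s * suc a)) * (7 * (s * suc a)) ≤⟨ *-mono-≤ 7≤8e₁ 7≤8e₁ ⟩
          (8 * e₁) * (8 * e₁)                ≡⟨ Nₛ.solve 1 (λ e → (Nₛ.con 8 Nₛ.:* e) Nₛ.:* (Nₛ.con 8 Nₛ.:* e) Nₛ.:= Nₛ.con 64 Nₛ.:* (e Nₛ.:* e)) refl e₁ ⟩
          64 * (e₁ * e₁)                     <⟨ *-monoʳ-< 64 e₁²< ⟩
          64 * (s * s * (ϑ₀ * (N + 2)))      ≡⟨ Nₛ.solve 2 (λ s t → Nₛ.con 64 Nₛ.:* (s Nₛ.:* t) Nₛ.:= Nₛ.con 64 Nₛ.:* t Nₛ.:* s) refl (s * s) (ϑ₀ * (N + 2)) ⟩
          64 * (ϑ₀ * (N + 2)) * (s * s)      ∎)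

      div₂ : rise N 2 ∣ (s C 2) * pairs a b 2
      div₂ = int 2 2≤s
      e₂ : ℕ
      e₂ = _∣_.quotient div₂
      r : ℕ
      r = 2 * (s * suc a) ∸ M
      r+M : r + M ≡ 2 * (s * suc a)
      r+M = m∸n+n≡m (≤-trans (m≤n*m M 8) (≤-trans (<⇒≤ 8M<) (m≤n*m (s * suc a) 2)))

      -- (N+1) divides (s-1) M (2s(a+1) - M); everything modulo N+1
      z : ℤ
      z = pos s₁ ℤ.* pos s ℤ.* pos M ℤ.+ pos s ℤ.* (pos 2 ℤ.* pos e₂ ℤ.- pos s₁ ℤ.* pos e₁) ℤ.- pos s₁ ℤ.* pos e₁ ℤ.* pos e₁
      z-eq : (pos 1 ℤ.+ pos N) ℤ.* z ≡ pos (s₁ * (M * r))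
      z-eq = begin
        (pos 1 ℤ.+ N′) ℤ.* z ≡⟨ Zₛ.solve 6 (λ N M s t e₁ e₂ → (Zₛ.con (pos 1) Zₛ.:+ N) Zₛ.:* (t Zₛ.:* s Zₛ.:* M Zₛ.:+ s Zₛ.:* (Zₛ.con (pos 2) Zₛ.:* e₂ Zₛ.:- t Zₛ.:* e₁) Zₛ.:- t Zₛ.:* e₁ Zₛ.:* e₁)
             Zₛ.:= t Zₛ.:* s Zₛ.:* M Zₛ.:* (Zₛ.con (pos 1) Zₛ.:+ N) Zₛ.:+ s Zₛ.:* (Zₛ.con (pos 2) Zₛ.:* (Zₛ.con (pos 1) Zₛ.:+ N) Zₛ.:* e₂) Zₛ.:- s Zₛ.:* t Zₛ.:* e₁ Zₛ.:* (Zₛ.con (pos 1) Zₛ.:+ N) Zₛ.:- t Zₛ.:* e₁ Zₛ.:* e₁ Zₛ.:* (Zₛ.con (pos 1) Zₛ.:+ N))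
             refl N′ M′ s′ t′ e₁′ (pos e₂) ⟩
        t′ ℤ.* s′ ℤ.* M′ ℤ.* (pos 1 ℤ.+ N′) ℤ.+ s′ ℤ.* (pos 2 ℤ.* (pos 1 ℤ.+ N′) ℤ.* pos e₂) ℤ.- s′ ℤ.* t′ ℤ.* e₁′ ℤ.* (pos 1 ℤ.+ N′) ℤ.- t′ ℤ.* e₁′ ℤ.* e₁′ ℤ.* (pos 1 ℤ.+ N′)
          ≡⟨ cong (λ x → t′ ℤ.* s′ ℤ.* M′ ℤ.* (pos 1 ℤ.+ N′) ℤ.+ s′ ℤ.* x ℤ.- s′ ℤ.* t′ ℤ.* e₁′ ℤ.* (pos 1 ℤ.+ N′) ℤ.- t′ ℤ.* e₁′ ℤ.* e₁′ ℤ.* (pos 1 ℤ.+ N′)) e₂-eq ⟩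
        t′ ℤ.* s′ ℤ.* M′ ℤ.* (pos 1 ℤ.+ N′) ℤ.+ s′ ℤ.* (t′ ℤ.* e₁′ ℤ.* (Q′ ℤ.+ N′ ℤ.+ pos 2)) ℤ.- s′ ℤ.* t′ ℤ.* e₁′ ℤ.* (pos 1 ℤ.+ N′) ℤ.- t′ ℤ.* e₁′ ℤ.* e₁′ ℤ.* (pos 1 ℤ.+ N′)
          ≡⟨ Zₛ.solve 6 (λ N M s t e₁ Q → t Zₛ.:* s Zₛ.:* M Zₛ.:* (Zₛ.con (pos 1) Zₛ.:+ N) Zₛ.:+ s Zₛ.:* (t Zₛ.:* e₁ Zₛ.:* (Q Zₛ.:+ N Zₛ.:+ Zₛ.con (pos 2))) Zₛ.:- s Zₛ.:* t Zₛ.:* e₁ Zₛ.:* (Zₛ.con (pos 1) Zₛ.:+ N) Zₛ.:- t Zₛ.:* e₁ Zₛ.:* e₁ Zₛ.:* (Zₛ.con (pos 1) Zₛ.:+ N)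
             Zₛ.:= t Zₛ.:* (s Zₛ.:* (M Zₛ.:* N) Zₛ.:+ s Zₛ.:* M Zₛ.:+ e₁ Zₛ.:* (s Zₛ.:* Q) Zₛ.:+ s Zₛ.:* e₁ Zₛ.:- e₁ Zₛ.:* e₁ Zₛ.:* (Zₛ.con (pos 1) Zₛ.:+ N))) refl N′ M′ s′ t′ e₁′ Q′ ⟩
        t′ ℤ.* (s′ ℤ.* (M′ ℤ.* N′) ℤ.+ s′ ℤ.* M′ ℤ.+ e₁′ ℤ.* (s′ ℤ.* Q′) ℤ.+ s′ ℤ.* e₁′ ℤ.- e₁′ ℤ.* e₁′ ℤ.* (pos 1 ℤ.+ N′))
          ≡⟨ cong₂ (λ x y → t′ ℤ.* (s′ ℤ.* x ℤ.+ s′ ℤ.* M′ ℤ.+ e₁′ ℤ.* y ℤ.+ s′ ℤ.* e₁′ ℤ.- e₁′ ℤ.* e₁′ ℤ.* (pos 1 ℤ.+ N′))) M-eq Q-eq ⟩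
        t′ ℤ.* (s′ ℤ.* (s′ ℤ.* (a′ ℤ.* A′)) ℤ.+ s′ ℤ.* M′ ℤ.+ e₁′ ℤ.* (e₁′ ℤ.* N′) ℤ.+ s′ ℤ.* e₁′ ℤ.- e₁′ ℤ.* e₁′ ℤ.* (pos 1 ℤ.+ N′))
          ≡⟨ cong (λ e → t′ ℤ.* (s′ ℤ.* (s′ ℤ.* (a′ ℤ.* A′)) ℤ.+ s′ ℤ.* M′ ℤ.+ e ℤ.* (e ℤ.* N′) ℤ.+ s′ ℤ.* e ℤ.- e ℤ.* e ℤ.* (pos 1 ℤ.+ N′))) e₁-eq ⟩
        t′ ℤ.* (s′ ℤ.* (s′ ℤ.* (a′ ℤ.* A′)) ℤ.+ s′ ℤ.* M′ ℤ.+ (s′ ℤ.* A′ ℤ.- M′) ℤ.* ((s′ ℤ.* A′ ℤ.- M′) ℤ.* N′) ℤ.+ s′ ℤ.* (s′ ℤ.* A′ ℤ.- M′) ℤ.- (s′ ℤ.* A′ ℤ.- M′) ℤ.* (s′ ℤ.* A′ ℤ.- M′) ℤ.* (pos 1 ℤ.+ N′))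
          ≡⟨ cong (λ A → t′ ℤ.* (s′ ℤ.* (s′ ℤ.* (a′ ℤ.* A)) ℤ.+ s′ ℤ.* M′ ℤ.+ (s′ ℤ.* A ℤ.- M′) ℤ.* ((s′ ℤ.* A ℤ.- M′) ℤ.* N′) ℤ.+ s′ ℤ.* (s′ ℤ.* A ℤ.- M′) ℤ.- (s′ ℤ.* A ℤ.- M′) ℤ.* (s′ ℤ.* A ℤ.- M′) ℤ.* (pos 1 ℤ.+ N′))) A-eq ⟩
        _ ≡⟨ Zₛ.solve 5 (λ N M s t a → let A = Zₛ.con (pos 1) Zₛ.:+ a; e = s Zₛ.:* A Zₛ.:- M in
               t Zₛ.:* (s Zₛ.:* (s Zₛ.:* (a Zₛ.:* A)) Zₛ.:+ s Zₛ.:* M Zₛ.:+ e Zₛ.:* (e Zₛ.:* N) Zₛ.:+ s Zₛ.:* e Zₛ.:- e Zₛ.:* e Zₛ.:* (Zₛ.con (pos 1) Zₛ.:+ N))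
               Zₛ.:= t Zₛ.:* (M Zₛ.:* (Zₛ.con (pos 2) Zₛ.:* (s Zₛ.:* A) Zₛ.:- M))) refl N′ M′ s′ t′ a′ ⟩
        t′ ℤ.* (M′ ℤ.* (pos 2 ℤ.* (s′ ℤ.* (pos 1 ℤ.+ a′)) ℤ.- M′)) ≡⟨ cong (λ x → t′ ℤ.* (M′ ℤ.* x)) r-eq ⟩
        t′ ℤ.* (M′ ℤ.* pos r) ≡⟨ sym (trans (ℤₚ.pos-* s₁ (M * r)) (cong (t′ ℤ.*_) (ℤₚ.pos-* M r))) ⟩
        pos (s₁ * (M * r)) ∎
        where
        open ≡-Reasoning
        N′ = pos N
        M′ = pos M
        s′ = pos s
        t′ = pos s₁
        e₁′ = pos e₁
        Q′ = pos Q
        a′ = pos a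
        A′ = pos (suc a)
        A-eq : A′ ≡ pos 1 ℤ.+ a′
        A-eq = refl
        Q-eq : s′ ℤ.* Q′ ≡ e₁′ ℤ.* N′
        Q-eq = trans (sym (ℤₚ.pos-* s Q)) (trans (cong pos e₁-def) (ℤₚ.pos-* e₁ N))
        M-eq : M′ ℤ.* N′ ≡ s′ ℤ.* (a′ ℤ.* A′)
        M-eq = trans (sym (ℤₚ.pos-* M N)) (trans (cong pos (sym M-def)) (trans (ℤₚ.pos-* s (a * suc a)) (cong (s′ ℤ.*_) (ℤₚ.pos-* a (suc a)))))
        e₁-eq : e₁′ ≡ s′ ℤ.* A′ ℤ.- M′
        e₁-eq = trans (Zₛ.solve 2 (λ e m → e Zₛ.:= (e Zₛ.:+ m) Zₛ.:- m) refl e₁′ M′) (cong (ℤ._- M′) (trans (sym (ℤₚ.pos-+ e₁ M)) (trans (cong pos e₁+M) (ℤₚ.pos-* s (suc a)))))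
        r-eq : pos 2 ℤ.* (s′ ℤ.* (pos 1 ℤ.+ a′)) ℤ.- M′ ≡ pos r
        r-eq = sym (trans (Zₛ.solve 2 (λ e m → e Zₛ.:= (e Zₛ.:+ m) Zₛ.:- m) refl (pos r) M′) (cong (ℤ._- M′)
          (trans (sym (ℤₚ.pos-+ r M)) (trans (cong pos r+M) (trans (ℤₚ.pos-* 2 (s * suc a)) (cong (pos 2 ℤ.*_) (ℤₚ.pos-* s (suc a))))))))
        -- Uses (a+2)(b+2) = Q + N + 2 and 2C(s,2) = s(s-1); one factor N cancels against sQ = e₁N.
        nat : 2 * suc N * e₂ ≡ s₁ * e₁ * (Q + N + 2)
        nat = *-cancelʳ-≡ (2 * suc N * e₂) (s₁ * e₁ * (Q + N + 2)) N (begin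
          2 * suc N * e₂ * N                   ≡⟨ Nₛ.solve 2 (λ n e → Nₛ.con 2 Nₛ.:* (Nₛ.con 1 Nₛ.:+ n) Nₛ.:* e Nₛ.:* n Nₛ.:= Nₛ.con 2 Nₛ.:* (e Nₛ.:* (Nₛ.con 1 Nₛ.:* (n Nₛ.:+ Nₛ.con 0) Nₛ.:* (n Nₛ.:+ Nₛ.con 1)))) refl N e₂ ⟩
          2 * (e₂ * rise N 2)                  ≡⟨ cong (2 *_) (sym (_∣_.equality div₂)) ⟩
          2 * ((s C 2) * pairs a b 2)          ≡⟨ sym (*-assoc 2 (s C 2) (pairs a b 2)) ⟩
          2 * (s C 2) * pairs a b 2            ≡⟨ cong (_* pairs a b 2) C2 ⟩
          s * s₁ * pairs a b 2                 ≡⟨ Nₛ.solve 4 (λ s t a b → s Nₛ.:* t Nₛ.:* (Nₛ.con 1 Nₛ.:* ((a Nₛ.:+ Nₛ.con 1) Nₛ.:* (b Nₛ.:+ Nₛ.con 1)) Nₛ.:* ((a Nₛ.:+ Nₛ.con 2) Nₛ.:* (b Nₛ.:+ Nₛ.con 2)))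
                Nₛ.:= t Nₛ.:* (s Nₛ.:* ((Nₛ.con 1 Nₛ.:+ a) Nₛ.:* (Nₛ.con 1 Nₛ.:+ b))) Nₛ.:* ((Nₛ.con 1 Nₛ.:+ a) Nₛ.:* (Nₛ.con 1 Nₛ.:+ b) Nₛ.:+ (Nₛ.con 1 Nₛ.:+ (a Nₛ.:+ b)) Nₛ.:+ Nₛ.con 2)) refl s s₁ a b ⟩
          s₁ * (s * Q) * (Q + N + 2)           ≡⟨ cong (λ x → s₁ * x * (Q + N + 2)) e₁-def ⟩
          s₁ * (e₁ * N) * (Q + N + 2)          ≡⟨ Nₛ.solve 4 (λ t e n q → t Nₛ.:* (e Nₛ.:* n) Nₛ.:* q Nₛ.:= t Nₛ.:* e Nₛ.:* q Nₛ.:* n) refl s₁ e₁ N (Q + N + 2) ⟩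
          s₁ * e₁ * (Q + N + 2) * N            ∎)
        e₂-eq : pos 2 ℤ.* (pos 1 ℤ.+ N′) ℤ.* pos e₂ ≡ t′ ℤ.* e₁′ ℤ.* (Q′ ℤ.+ N′ ℤ.+ pos 2)
        e₂-eq = trans (sym (trans (ℤₚ.pos-* (2 * suc N) e₂) (cong (ℤ._* pos e₂) (ℤₚ.pos-* 2 (suc N))))) (trans (cong pos nat)
          (trans (ℤₚ.pos-* (s₁ * e₁) (Q + N + 2)) (cong₂ ℤ._*_ (ℤₚ.pos-* s₁ e₁) (trans (ℤₚ.pos-+ (Q + N) 2) (cong (ℤ._+ pos 2) (ℤₚ.pos-+ Q N))))))

      s₁Mr>0 : 0 < s₁ * (M * r)
      s₁Mr>0 = >-nonZero⁻¹ _ {{m*n≢0 s₁ (M * r) {{>-nonZero (m<n⇒0<n∸m 2≤s)}} {{m*n≢0 M r {{>-nonZero M>0}} {{>-nonZero r>0}}}}}}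
        where
        r>0 : 0 < r
        r>0 = m<n⇒0<n∸m (≤-<-trans (m≤n*m M 8) (<-≤-trans 8M< (m≤n*m (s * suc a) 2)))

      K-exists : ∃[ κ ] (suc N * suc κ ≡ s₁ * (M * r))
      K-exists = from z z-eq
        where
        from : ∀ z → (pos 1 ℤ.+ pos N) ℤ.* z ≡ pos (s₁ * (M * r)) → ∃[ κ ] (suc N * suc κ ≡ s₁ * (M * r))
        from (pos zero)    e = ⊥-elim (<-irrefl (ℤₚ.+-injective (trans (sym (ℤₚ.*-zeroʳ (pos (suc N)))) e)) s₁Mr>0)
        from (pos (suc κ)) e = κ , ℤₚ.+-injective (trans (ℤₚ.pos-* (suc N) (suc κ)) e)
        from -[1+ κ ]      ()
      κ K : ℕ
      κ = proj₁ K-exists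
      K = suc κ

      equation : lhs s M K a ≡ rhs s M a
      equation = begin
        K * (s * (a * suc a)) + (K * M + s₁ * M * M * M)  ≡⟨ cong (λ x → K * x + (K * M + s₁ * M * M * M)) M-def ⟩
        K * (M * N) + (K * M + s₁ * M * M * M)            ≡⟨ Nₛ.solve 4 (λ k m n t → k Nₛ.:* (m Nₛ.:* n) Nₛ.:+ (k Nₛ.:* m Nₛ.:+ t Nₛ.:* m Nₛ.:* m Nₛ.:* m) Nₛ.:= m Nₛ.:* ((Nₛ.con 1 Nₛ.:+ n) Nₛ.:* k) Nₛ.:+ t Nₛ.:* m Nₛ.:* m Nₛ.:* m) refl K M N s₁ ⟩
        M * (suc N * K) + s₁ * M * M * M                  ≡⟨ cong (λ x → M * x + s₁ * M * M * M) (proj₂ K-exists) ⟩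
        M * (s₁ * (M * r)) + s₁ * M * M * M               ≡⟨ Nₛ.solve 3 (λ m t r → m Nₛ.:* (t Nₛ.:* (m Nₛ.:* r)) Nₛ.:+ t Nₛ.:* m Nₛ.:* m Nₛ.:* m Nₛ.:= t Nₛ.:* m Nₛ.:* m Nₛ.:* (r Nₛ.:+ m)) refl M s₁ r ⟩
        s₁ * M * M * (r + M)                              ≡⟨ cong (s₁ * M * M *_) r+M ⟩
        s₁ * M * M * (2 * (s * suc a))                    ≡⟨ Nₛ.solve 3 (λ t m x → t Nₛ.:* m Nₛ.:* m Nₛ.:* (Nₛ.con 2 Nₛ.:* x) Nₛ.:= Nₛ.con 2 Nₛ.:* t Nₛ.:* m Nₛ.:* m Nₛ.:* x) refl s₁ M (s * suc a) ⟩
        rhs s M a                                         ∎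
        where open ≡-Reasoning

      Tₘ : ℕ
      Tₘ = top s M

      -- Places a beyond the vertex of the quadratic, where lhs - rhs increases and `unique`
      -- applies. It is the smallness of M, in the form 8M < s(a+1), that prevents a from being the
      -- smaller root.
      slope : Tₘ < 2 * (K * suc a)
      slope = *-cancelˡ-< 15 Tₘ (2 * (K * suc a)) (≤-<-trans 15T≤ (begin-strict
        16 * (K * suc a)        <⟨ *-monoˡ-< (K * suc a) {{m*n≢0 K (suc a)}} (<ᵇ⇒< 16 30 tt) ⟩
        30 * (K * suc a)        ≡⟨ Nₛ.solve 1 (λ x → Nₛ.con 30 Nₛ.:* x Nₛ.:= Nₛ.con 15 Nₛ.:* (Nₛ.con 2 Nₛ.:* x)) refl (K * suc a) ⟩
        15 * (2 * (K * suc a))  ∎))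
        where
        open ≤-Reasoning
        S = s * suc a
        instance
          S≢0 : NonZero S
          S≢0 = m*n≢0 s (suc a)
        15T≤ : 15 * Tₘ ≤ 16 * (K * suc a)
        15T≤ = *-cancelʳ-≤ (15 * Tₘ) (16 * (K * suc a)) S (+-cancelʳ-≤ (Tₘ * S) (15 * Tₘ * S) (16 * (K * suc a) * S) (begin
          15 * Tₘ * S + Tₘ * S                               ≡⟨ Nₛ.solve 2 (λ t s → Nₛ.con 15 Nₛ.:* t Nₛ.:* s Nₛ.:+ t Nₛ.:* s Nₛ.:= Nₛ.con 16 Nₛ.:* (t Nₛ.:* s)) refl Tₘ S ⟩
          16 * rhs s M a                                   ≡⟨ cong (16 *_) (sym equation) ⟩
          16 * (K * (s * (a * suc a)) + (K * M + s₁ * M * M * M)) ≡⟨ Nₛ.solve 5 (λ k s a m t → Nₛ.con 16 Nₛ.:* (k Nₛ.:* (s Nₛ.:* (a Nₛ.:* (Nₛ.con 1 Nₛ.:+ a))) Nₛ.:+ (k Nₛ.:* m Nₛ.:+ t Nₛ.:* m Nₛ.:* m Nₛ.:* m))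
               Nₛ.:= Nₛ.con 16 Nₛ.:* (k Nₛ.:* a) Nₛ.:* (s Nₛ.:* (Nₛ.con 1 Nₛ.:+ a)) Nₛ.:+ (Nₛ.con 2 Nₛ.:* k Nₛ.:+ Nₛ.con 2 Nₛ.:* t Nₛ.:* m Nₛ.:* m) Nₛ.:* (Nₛ.con 8 Nₛ.:* m)) refl K s a M s₁ ⟩
          16 * (K * a) * S + (2 * K + Tₘ) * (8 * M)         ≤⟨ +-monoʳ-≤ (16 * (K * a) * S) (*-monoʳ-≤ (2 * K + Tₘ) (<⇒≤ 8M<)) ⟩
          16 * (K * a) * S + (2 * K + Tₘ) * S               ≤⟨ +-monoʳ-≤ (16 * (K * a) * S) (*-monoˡ-≤ S (+-monoˡ-≤ Tₘ (*-monoˡ-≤ K (≤ᵇ⇒≤ 2 16 tt)))) ⟩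
          16 * (K * a) * S + (16 * K + Tₘ) * S              ≡⟨ Nₛ.solve 4 (λ k a t s → Nₛ.con 16 Nₛ.:* (k Nₛ.:* a) Nₛ.:* s Nₛ.:+ (Nₛ.con 16 Nₛ.:* k Nₛ.:+ t) Nₛ.:* s Nₛ.:= Nₛ.con 16 Nₛ.:* (k Nₛ.:* (Nₛ.con 1 Nₛ.:+ a)) Nₛ.:* s Nₛ.:+ t Nₛ.:* s) refl K a Tₘ S ⟩
          16 * (K * suc a) * S + Tₘ * S                     ∎))

      K≤ : K ≤ K-bound s M
      K≤ = subst (_≤ K-bound s M) (m*n/n≡m K D) (/-monoˡ-≤ D K*D≤)
        where
        open ≤-Reasoning
        D = suc ((8 * M ∸ suc s) ⊔ (s ∸ 1))
        D≤ : D ≤ s * a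
        D≤ = ⊔-lub′ (8 * M ∸ suc s) (s ∸ 1) (≤-trans (s≤s (≤-trans (∸-monoˡ-≤ (suc s) (<⇒≤ 8M<)) (≤-reflexive (trans (cong (_∸ suc s) (*-suc s a)) (trans (cong (s + s * a ∸_) (+-comm 1 s)) (trans (sym (∸-+-assoc (s + s * a) s 1)) (cong (_∸ 1) (m+n∸m≡n s (s * a)))))))))
                 (≤-reflexive (m+[n∸m]≡n (≤-trans (≤-trans (s≤s z≤n) 2≤s) (m≤m*n s a)))))
               (≤-trans (≤-reflexive (m+[n∸m]≡n (≤-trans (s≤s z≤n) 2≤s))) (m≤m*n s a))
          where
          ⊔-lub′ : ∀ x y {z} → suc x ≤ z → suc y ≤ z → suc (x ⊔ y) ≤ z
          ⊔-lub′ x y p q = ⊔-lub p q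
        K*D≤ : K * D ≤ s * Tₘ
        K*D≤ = *-cancelʳ-≤ (K * D) (s * Tₘ) (suc a) (begin
          K * D * suc a              ≤⟨ *-monoˡ-≤ (suc a) (*-monoʳ-≤ K D≤) ⟩
          K * (s * a) * suc a        ≡⟨ Nₛ.solve 4 (λ k s a b → k Nₛ.:* (s Nₛ.:* a) Nₛ.:* b Nₛ.:= k Nₛ.:* (s Nₛ.:* (a Nₛ.:* b))) refl K s a (suc a) ⟩
          K * (s * (a * suc a))      ≤⟨ m≤m+n _ _ ⟩
          lhs s M K a                ≡⟨ equation ⟩
          rhs s M a                  ≡⟨ Nₛ.solve 3 (λ t s a → t Nₛ.:* (s Nₛ.:* a) Nₛ.:= s Nₛ.:* t Nₛ.:* a) refl Tₘ s (suc a) ⟩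
          s * Tₘ * suc a              ∎)

      M≤ : M ≤ 64 * ϑ₀ * s / 49
      M≤ = subst (_≤ 64 * ϑ₀ * s / 49) (m*n/n≡m M 49) (/-monoˡ-≤ 49 (<⇒≤ M-bound))

    private
      finish : ∀ m → M ≡ suc m → ⊥
      finish m M≡ = not-false (∨-false t₄ (cong not (≡ᵇ-true eq₀))) integral
        where
        hit₀ : sparse-test s m κ ≡ true
        hit₀ = allBelow-sound (K-bound s (suc m)) (sparse-test s m)
          (allBelow-sound (64 * ϑ₀ * s / 49) (λ m → allBelow (K-bound s (suc m)) (sparse-test s m)) search (subst (_≤ 64 * ϑ₀ * s / 49) M≡ M≤))
          (subst (λ x → K ≤ K-bound s x) M≡ K≤)
        hit : sparse-test′ s m κ (candidate s (suc m) κ) ≡ true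
        hit = ∨-false {not ((K * suc m + (s ∸ 1) * suc m * suc m * suc m) % suc (2 * s ∸ 1) ≡ᵇ 0)} hit₀ (cong not (≡ᵇ-true (n∣m⇒m%n≡0 _ (suc (2 * s ∸ 1))
          (subst₂ (λ x M → x ∣ K * M + (s ∸ 1) * M * M * M) (sym (m+[n∸m]≡n {1} {2 * s} (≤-trans (≤-trans (s≤s z≤n) 2≤s) (m≤n*m s 2)))) M≡ 2s∣))))
          where
          2∣a[1+a] : ∀ a → 2 ∣ a * suc a
          2∣a[1+a] zero    = divides 0 refl
          2∣a[1+a] (suc a) = subst (2 ∣_) (Nₛ.solve 1 (λ a → a Nₛ.:* (Nₛ.con 1 Nₛ.:+ a) Nₛ.:+ Nₛ.con 2 Nₛ.:* (Nₛ.con 1 Nₛ.:+ a) Nₛ.:= (Nₛ.con 1 Nₛ.:+ a) Nₛ.:* (Nₛ.con 2 Nₛ.:+ a)) refl a)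
            (∣m∣n⇒∣m+n (2∣a[1+a] a) (m∣m*n (suc a)))
          2s∣ : 2 * s ∣ K * M + (s ∸ 1) * M * M * M
          2s∣ = ∣m+n∣m⇒∣n (divides (K′ * suc a) (trans equation (Nₛ.solve 4 (λ s₁ s M a → Nₛ.con 2 Nₛ.:* s₁ Nₛ.:* M Nₛ.:* M Nₛ.:* (s Nₛ.:* a) Nₛ.:= s₁ Nₛ.:* M Nₛ.:* M Nₛ.:* a Nₛ.:* (Nₛ.con 2 Nₛ.:* s)) refl (s ∸ 1) s M (suc a))))
            (subst (2 * s ∣_) (Nₛ.solve 3 (λ k s x → k Nₛ.:* (x Nₛ.:* s) Nₛ.:= k Nₛ.:* (s Nₛ.:* x)) refl K s (a * suc a))
              (∣n⇒∣m*n K (*-monoˡ-∣ s (2∣a[1+a] a))))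
            where K′ = (s ∸ 1) * M * M
        a₀ = candidate s (suc m) κ
        p₁ = ∧-true {lhs s (suc m) K a₀ ≤ᵇ rhs s (suc m) a₀} hit
        p₂ = ∧-true {rhs s (suc m) (suc a₀) <ᵇ lhs s (suc m) K (suc a₀)} (proj₂ p₁)
        p₃ = ∧-true {top s (suc m) <ᵇ 2 * (K * suc a₀)} (proj₂ p₂)
        a≡a₀ : a ≡ a₀
        a≡a₀ = unique s (suc m) K a a₀ (≤-trans (s≤s z≤n) 2≤s) (subst (λ M → lhs s M K a ≡ rhs s M a) M≡ equation) (subst (λ M → top s M < 2 * (K * suc a)) M≡ slope)
          (≤ᵇ⇒≤ (lhs s (suc m) K a₀) (rhs s (suc m) a₀) (≡→T (proj₁ p₁)))
          (<ᵇ⇒< (rhs s (suc m) (suc a₀)) (lhs s (suc m) K (suc a₀)) (≡→T (proj₁ p₂)))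
          (<ᵇ⇒< (top s (suc m)) (2 * (K * suc a₀)) (≡→T (proj₁ p₃)))
        t₄ : not (lhs s (suc m) K a ≡ᵇ rhs s (suc m) a) ∨ not-integral-at s m a ≡ true
        t₄ = subst (λ x → not (lhs s (suc m) K x ≡ᵇ rhs s (suc m) x) ∨ not-integral-at s m x ≡ true) (sym a≡a₀) (proj₂ p₃)
        eq₀ : lhs s (suc m) K a ≡ rhs s (suc m) a
        eq₀ = subst (λ M → lhs s M K a ≡ rhs s M a) M≡ equation
        b≡ : (s * (a * suc a)) / suc m ∸ suc a ≡ b
        b≡ = trans (cong (_∸ suc a) (trans (cong (_/ suc m) (trans M-def (trans (cong (_* N) M≡) (*-comm (suc m) N)))) (m*n/n≡m N (suc m)))) (m+n∸m≡n a b)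
        integral : integral? s a ((s * (a * suc a)) / suc m ∸ suc a) ≡ true
        integral = subst (λ b → integral? s a b ≡ true) (sym b≡) (integral?-complete s a b int)

    contradiction : ⊥
    contradiction = finish (M ∸ 1) (sym (m+[n∸m]≡n M>0))

-- The searches, settled by evaluation.

module Searches where
  open SmallCase
  open import Data.Bool using (true)
  open import Relation.Binary.PropositionalEquality
  dense-5 : dense-search 5 20 ≡ true
  dense-5 = refl
  sparse-5 : sparse-search 5 20 ≡ true
  sparse-5 = refl
  dense-6 : dense-search 6 30 ≡ true
  dense-6 = refl
  sparse-6 : sparse-search 6 30 ≡ true
  sparse-6 = refl
  dense-7 : dense-search 7 20 ≡ true
  dense-7 = refl
  sparse-7 : sparse-search 7 20 ≡ true
  sparse-7 = refl
  dense-8 : dense-search 8 25 ≡ true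
  dense-8 = refl
  sparse-8 : sparse-search 8 25 ≡ true
  sparse-8 = refl
  dense-9 : dense-search 9 20 ≡ true
  dense-9 = refl
  sparse-9 : sparse-search 9 20 ≡ true
  sparse-9 = refl

-- Counting in a design: blocks through a set, and factorial moments of intersection sizes.

module DesignCounts where
  open import Defs
  open Rationals
  open import Data.Nat as ℕ using (ℕ; zero; suc)
  import Data.Nat.Properties as ℕₚ
  open import Data.Integer as ℤ using () renaming (+_ to pos)
  open import Data.Rational using (ℚ; 0ℚ; 1ℚ; _+_; _*_; -_; _-_; _≤_)
  import Data.Rational.Properties as ℚₚ
  open import Data.Fin as Fin using (Fin)
  open import Data.Fin.Subset using (Subset; _⊆_; ∣_∣)
  open import Data.Fin.Subset.Properties using (_⊆?_; drop-∷-⊆; out⊆; in⊆in)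
  open import Data.Vec using ([]; _∷_; here)
  open import Data.Bool using (Bool; true; false; _∧_; not)
  open import Data.List as List using (List; []; _∷_; length)
  open import Data.List.Relation.Unary.All using (All; []; _∷_)
  open import Data.Product using (_×_; _,_)
  open import Data.Sum using (_⊎_; inj₁; inj₂)
  open import Data.Empty using (⊥-elim)
  open import Relation.Nullary using (yes; no; ¬_)
  open import Relation.Binary.PropositionalEquality

  fall : ℚ → ℕ → ℚ
  fall x zero    = 1ℚ
  fall x (suc j) = x * fall (x - 1ℚ) j

  ι-suc : ∀ n → ι (pos (suc n)) ≡ 1ℚ + ι (pos n)
  ι-suc n = trans (ι-+ (pos 1) (pos n)) (cong (_+ ι (pos n)) ι-1)

  ΣL : {A : Set} → (A → ℚ) → List A → ℚ
  ΣL f []       = 0ℚ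
  ΣL f (x ∷ xs) = f x + ΣL f xs

  ΣL-cong : {A : Set} {f g : A → ℚ} → (∀ x → f x ≡ g x) → ∀ xs → ΣL f xs ≡ ΣL g xs
  ΣL-cong h []       = refl
  ΣL-cong h (x ∷ xs) = cong₂ _+_ (h x) (ΣL-cong h xs)

  ΣL-All : {A : Set} {P : A → Set} {f g : A → ℚ} → (∀ x → P x → f x ≡ g x) → ∀ {xs} → All P xs → ΣL f xs ≡ ΣL g xs
  ΣL-All h []       = refl
  ΣL-All h (p ∷ ps) = cong₂ _+_ (h _ p) (ΣL-All h ps)

  ΣL-+ : {A : Set} (f g : A → ℚ) → ∀ xs → ΣL (λ x → f x + g x) xs ≡ ΣL f xs + ΣL g xs
  ΣL-+ f g []       = sym (ℚₚ.+-identityʳ 0ℚ)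
  ΣL-+ f g (x ∷ xs) = trans (cong (f x + g x +_) (ΣL-+ f g xs))
    (S.solve 4 (λ a b c d → (a S.:+ b) S.:+ (c S.:+ d) S.:= (a S.:+ c) S.:+ (b S.:+ d)) refl (f x) (g x) (ΣL f xs) (ΣL g xs))

  ΣL-* : {A : Set} (c : ℚ) (f : A → ℚ) → ∀ xs → ΣL (λ x → c * f x) xs ≡ c * ΣL f xs
  ΣL-* c f []       = sym (ℚₚ.*-zeroʳ c)
  ΣL-* c f (x ∷ xs) = trans (cong (c * f x +_) (ΣL-* c f xs)) (sym (ℚₚ.*-distribˡ-+ c (f x) (ΣL f xs)))

  ΣL-map : {A B : Set} (g : A → B) (f : B → ℚ) → ∀ xs → ΣL f (List.map g xs) ≡ ΣL (λ x → f (g x)) xs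
  ΣL-map g f []       = refl
  ΣL-map g f (x ∷ xs) = cong (f (g x) +_) (ΣL-map g f xs)

  ΣF : ∀ {n} → (Fin n → ℚ) → ℚ
  ΣF {zero}  f = 0ℚ
  ΣF {suc n} f = f Fin.zero + ΣF (λ p → f (Fin.suc p))

  ΣF-cong : ∀ {n} {f g : Fin n → ℚ} → (∀ p → f p ≡ g p) → ΣF f ≡ ΣF g
  ΣF-cong {zero}  h = refl
  ΣF-cong {suc n} h = cong₂ _+_ (h Fin.zero) (ΣF-cong λ p → h (Fin.suc p))

  ΣF-zero : ∀ {n} {f : Fin n → ℚ} → (∀ p → f p ≡ 0ℚ) → ΣF f ≡ 0ℚ
  ΣF-zero {zero}  h = refl
  ΣF-zero {suc n} h = trans (cong₂ _+_ (h Fin.zero) (ΣF-zero λ p → h (Fin.suc p))) (ℚₚ.+-identityʳ 0ℚ)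

  ΣF-*ʳ : ∀ {n} (f : Fin n → ℚ) c → ΣF (λ p → f p * c) ≡ ΣF f * c
  ΣF-*ʳ {zero}  f c = sym (ℚₚ.*-zeroˡ c)
  ΣF-*ʳ {suc n} f c = trans (cong (f Fin.zero * c +_) (ΣF-*ʳ (λ p → f (Fin.suc p)) c)) (sym (ℚₚ.*-distribʳ-+ c (f Fin.zero) _))

  ΣL-ΣF : ∀ {A : Set} {n} (f : A → Fin n → ℚ) xs → ΣL (λ x → ΣF (f x)) xs ≡ ΣF (λ p → ΣL (λ x → f x p) xs)
  ΣL-ΣF {n = n} f []       = sym (ΣF-zero {n} {λ _ → 0ℚ} λ _ → refl)
  ΣL-ΣF f (x ∷ xs) = trans (cong (ΣF (f x) +_) (ΣL-ΣF f xs)) (sym (ΣF-+ (f x) (λ p → ΣL (λ x → f x p) xs)))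
    where
    ΣF-+ : ∀ {n} (f g : Fin n → ℚ) → ΣF (λ p → f p + g p) ≡ ΣF f + ΣF g
    ΣF-+ {zero}  f g = sym (ℚₚ.+-identityʳ 0ℚ)
    ΣF-+ {suc n} f g = trans (cong (f Fin.zero + g Fin.zero +_) (ΣF-+ (λ p → f (Fin.suc p)) (λ p → g (Fin.suc p))))
      (S.solve 4 (λ a b c d → (a S.:+ b) S.:+ (c S.:+ d) S.:= (a S.:+ c) S.:+ (b S.:+ d)) refl (f Fin.zero) (g Fin.zero) _ _)

  -- Recursive on the vectors instead of read off from the decision procedure, so that sums over
  -- added points can be treated point by point.
  χ : ∀ {n} → Subset n → Subset n → ℚ
  χ []          []          = 1ℚ
  χ (true ∷ S)  (true ∷ B)  = χ S B
  χ (true ∷ S)  (false ∷ B) = 0ℚ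
  χ (false ∷ S) (_ ∷ B)     = χ S B

  χ-dec : ∀ {n} (S B : Subset n) → (S ⊆ B × χ S B ≡ 1ℚ) ⊎ (¬ S ⊆ B × χ S B ≡ 0ℚ)
  χ-dec []          []          = inj₁ ((λ ()) , refl)
  χ-dec (true ∷ S)  (true ∷ B)  with χ-dec S B
  ... | inj₁ (s , e) = inj₁ (in⊆in s , e)
  ... | inj₂ (s , e) = inj₂ ((λ h → s (drop-∷-⊆ h)) , e)
  χ-dec (true ∷ S)  (false ∷ B) = inj₂ ((λ h → absurd (h here)) , refl)
    where
    absurd : ∀ {n} {B : Subset n} → ¬ (Data.Vec._[_]=_ (false ∷ B) Fin.zero true)
    absurd ()
  χ-dec (false ∷ S) (_ ∷ B)     with χ-dec S B
  ... | inj₁ (s , e) = inj₁ (out⊆ s , e)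
  ... | inj₂ (s , e) = inj₂ ((λ h → s (drop-∷-⊆ h)) , e)

  blocks-ΣL : ∀ {v} (S : Subset v) ℬ → ι (pos (blocksContaining S ℬ)) ≡ ΣL (χ S) ℬ
  blocks-ΣL S []      = ι-0
  blocks-ΣL S (B ∷ ℬ) with S ⊆? B | χ-dec S B
  ... | yes _ | inj₁ (_ , e) = trans (ι-suc _) (cong₂ _+_ (sym e) (blocks-ΣL S ℬ))
  ... | no  _ | inj₂ (_ , e) = trans (blocks-ΣL S ℬ) (sym (trans (cong (_+ ΣL (χ S) ℬ) e) (ℚₚ.+-identityˡ _)))
  ... | yes s | inj₂ (s̸ , _) = ⊥-elim (s̸ s)
  ... | no s̸ | inj₁ (s , _) = ⊥-elim (s̸ s)

  bit : Bool → ℚ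
  bit true  = 1ℚ
  bit false = 0ℚ

  meet : ∀ {n} → Subset n → Subset n → ℚ
  meet []      []      = 0ℚ
  meet (b ∷ B) (t ∷ T) = bit (b ∧ t) + meet B T

  card : ∀ {n} → Subset n → ℚ
  card S = ι (pos ∣ S ∣)

  card-∷ : ∀ {n} b (S : Subset n) → card (b ∷ S) ≡ bit b + card S
  card-∷ true  S = ι-suc ∣ S ∣
  card-∷ false S = sym (ℚₚ.+-identityˡ (card S))

  ins : ∀ {n} → Fin n → Subset n → Subset n
  ins Fin.zero    (_ ∷ S) = true ∷ S
  ins (Fin.suc p) (s ∷ S) = s ∷ ins p S

  -- Indicator of the points of T outside S. As a weight it turns a sum over these points into a sum
  -- over all of `Fin n`.
  new : ∀ {n} → Subset n → Subset n → Fin n → ℚ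
  new (t ∷ T) (s ∷ S) Fin.zero    = bit (t ∧ not s)
  new (t ∷ T) (s ∷ S) (Fin.suc p) = new T S p

  data _≼_ : ∀ {n} → Subset n → Subset n → Set where
    []    : [] ≼ []
    outₗ  : ∀ {n t} {S T : Subset n} → S ≼ T → (false ∷ S) ≼ (t ∷ T)
    both  : ∀ {n} {S T : Subset n} → S ≼ T → (true ∷ S) ≼ (true ∷ T)

  -- If B contains S, the extensions of S by one point of T that still lie in B correspond to the
  -- points of B ∩ T outside S; if B does not contain S, both sides vanish.
  Σ-new-χ : ∀ {n} {S T : Subset n} → S ≼ T → ∀ B → ΣF (λ p → new T S p * χ (ins p S) B) ≡ χ S B * (meet B T - card S)
  Σ-new-χ [] [] = trans (sym (ℚₚ.*-zeroʳ 1ℚ)) (cong (λ e → 1ℚ * (0ℚ - e)) (sym ι-0))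
  Σ-new-χ {S = _ ∷ S} {T = t ∷ T} (outₗ h) (b ∷ B) = trans (cong (bit (t ∧ true) * χ (true ∷ S) (b ∷ B) +_) (Σ-new-χ h B)) (eq t b)
    where
    x = χ S B
    m = meet B T
    c = card S
    eq : ∀ t b → bit (t ∧ true) * χ (true ∷ S) (b ∷ B) + x * (m - c) ≡ x * ((bit (b ∧ t) + m) - c)
    eq true  true  = S.solve 3 (λ x m c → S.con 1ℚ S.:* x S.:+ x S.:* (m S.:- c) S.:= x S.:* ((S.con 1ℚ S.:+ m) S.:- c)) refl x m c
    eq true  false = S.solve 3 (λ x m c → S.con 1ℚ S.:* S.con 0ℚ S.:+ x S.:* (m S.:- c) S.:= x S.:* ((S.con 0ℚ S.:+ m) S.:- c)) refl x m c
    eq false true  = S.solve 3 (λ x m c → S.con 0ℚ S.:* x S.:+ x S.:* (m S.:- c) S.:= x S.:* ((S.con 0ℚ S.:+ m) S.:- c)) refl x m c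
    eq false false = S.solve 3 (λ x m c → S.con 0ℚ S.:* S.con 0ℚ S.:+ x S.:* (m S.:- c) S.:= x S.:* ((S.con 0ℚ S.:+ m) S.:- c)) refl x m c
  Σ-new-χ {S = _ ∷ S} {T = _ ∷ T} (both h) (true ∷ B) = trans (cong (0ℚ * χ S B +_) (Σ-new-χ h B))
    (trans (S.solve 3 (λ x m c → S.con 0ℚ S.:* x S.:+ x S.:* (m S.:- c) S.:= x S.:* ((S.con 1ℚ S.:+ m) S.:- (S.con 1ℚ S.:+ c))) refl (χ S B) (meet B T) (card S))
           (cong (λ e → χ S B * ((1ℚ + meet B T) - e)) (sym (card-∷ true S))))
  Σ-new-χ {S = _ ∷ S} {T = _ ∷ T} (both h) (false ∷ B) = trans (ΣF-zero zero-terms) (sym (ℚₚ.*-zeroˡ ((0ℚ + meet B T) - card (true ∷ S))))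
    where
    zero-terms : ∀ p → new (true ∷ T) (true ∷ S) p * χ (ins p (true ∷ S)) (false ∷ B) ≡ 0ℚ
    zero-terms Fin.zero    = ℚₚ.*-zeroʳ 0ℚ
    zero-terms (Fin.suc p) = ℚₚ.*-zeroʳ (new T S p)

  Σ-new : ∀ {n} {S T : Subset n} → S ≼ T → ΣF (new T S) ≡ card T - card S
  Σ-new [] = sym (ℚₚ.+-inverseʳ (ι (pos 0)))
  Σ-new {S = _ ∷ S} {T = true ∷ T} (outₗ h) = trans (cong (1ℚ +_) (Σ-new h))
    (trans (S.solve 2 (λ t s → S.con 1ℚ S.:+ (t S.:- s) S.:= (S.con 1ℚ S.:+ t) S.:- s) refl (card T) (card S)) (cong (_- card S) (sym (card-∷ true T))))
  Σ-new {S = _ ∷ S} {T = false ∷ T} (outₗ h) = trans (cong (0ℚ +_) (Σ-new h)) (ℚₚ.+-identityˡ _)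
  Σ-new {S = _ ∷ S} {T = _ ∷ T} (both h) = trans (cong (0ℚ +_) (Σ-new h))
    (trans (S.solve 2 (λ t s → S.con 0ℚ S.:+ (t S.:- s) S.:= (S.con 1ℚ S.:+ t) S.:- (S.con 1ℚ S.:+ s)) refl (card T) (card S))
           (sym (cong₂ _-_ (card-∷ true T) (card-∷ true S))))

  new-cases : ∀ {n} {S T : Subset n} → S ≼ T → ∀ p → new T S p ≡ 0ℚ ⊎ (ins p S ≼ T × ∣ ins p S ∣ ≡ suc ∣ S ∣)
  new-cases {T = true ∷ T}  (outₗ h) Fin.zero    = inj₂ (both h , refl)
  new-cases {T = false ∷ T} (outₗ h) Fin.zero    = inj₁ refl
  new-cases (both h)                  Fin.zero    = inj₁ refl
  new-cases (outₗ h) (Fin.suc p) with new-cases h p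
  ... | inj₁ e       = inj₁ e
  ... | inj₂ (l , e) = inj₂ (outₗ l , e)
  new-cases (both h) (Fin.suc p) with new-cases h p
  ... | inj₁ e       = inj₁ e
  ... | inj₂ (l , e) = inj₂ (both l , cong suc e)

  Σ-new-const : ∀ {n} {S T : Subset n} → S ≼ T → ∀ (F : Fin n → ℚ) K → (∀ p → ins p S ≼ T → ∣ ins p S ∣ ≡ suc ∣ S ∣ → F p ≡ K) →
                ΣF (λ p → new T S p * F p) ≡ (card T - card S) * K
  Σ-new-const {S = S} {T} h F K hyp = trans (ΣF-cong pointwise) (trans (ΣF-*ʳ (new T S) K) (cong (_* K) (Σ-new h)))
    where
    pointwise : ∀ p → new T S p * F p ≡ new T S p * K
    pointwise p with new-cases h p
    ... | inj₁ e       = trans (cong (_* F p) e) (trans (ℚₚ.*-zeroˡ (F p)) (sym (trans (cong (_* K) e) (ℚₚ.*-zeroˡ K))))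
    ... | inj₂ (l , e) = cong (new T S p *_) (hyp p l e)

  full empty : ∀ n → Subset n
  full zero     = []
  full (suc n)  = true ∷ full n
  empty zero    = []
  empty (suc n) = false ∷ empty n

  ≼-full : ∀ {n} (S : Subset n) → S ≼ full n
  ≼-full []          = []
  ≼-full (true ∷ S)  = both (≼-full S)
  ≼-full (false ∷ S) = outₗ (≼-full S)

  empty-≼ : ∀ {n} (T : Subset n) → empty n ≼ T
  empty-≼ []      = []
  empty-≼ (_ ∷ T) = outₗ (empty-≼ T)

  ∣full∣ : ∀ n → ∣ full n ∣ ≡ n
  ∣full∣ zero    = refl
  ∣full∣ (suc n) = cong suc (∣full∣ n)

  ∣empty∣ : ∀ n → ∣ empty n ∣ ≡ 0
  ∣empty∣ zero    = refl
  ∣empty∣ (suc n) = ∣empty∣ n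

  χ-empty : ∀ {n} (B : Subset n) → χ (empty n) B ≡ 1ℚ
  χ-empty []      = refl
  χ-empty (_ ∷ B) = χ-empty B

  meet-full : ∀ {n} (B : Subset n) → meet B (full n) ≡ card B
  meet-full []          = sym ι-0
  meet-full (true ∷ B)  = trans (cong (1ℚ +_) (meet-full B)) (sym (card-∷ true B))
  meet-full (false ∷ B) = trans (cong (0ℚ +_) (meet-full B)) (ℚₚ.+-identityˡ (card B))

  initial : ∀ v → ℕ → Subset v
  initial zero    i       = []
  initial (suc v) zero    = false ∷ initial v zero
  initial (suc v) (suc i) = true ∷ initial v i

  ∣initial∣ : ∀ {v i} → i ℕ.≤ v → ∣ initial v i ∣ ≡ i
  ∣initial∣ {zero}  {zero}  _         = refl
  ∣initial∣ {suc v} {zero}  _         = ∣initial∣ {v} {zero} ℕ.z≤n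
  ∣initial∣ {suc v} {suc i} (ℕ.s≤s h) = cong suc (∣initial∣ h)

  misses : ∀ {n} → Subset n → Subset n → ℕ
  misses []      []          = 0
  misses (b ∷ B) (true ∷ T)  = (if′ b) ℕ.+ misses B T
    where
    if′ : Bool → ℕ
    if′ true  = 0
    if′ false = 1
  misses (_ ∷ B) (false ∷ T) = misses B T

  meet-misses : ∀ {n} (B T : Subset n) → meet B T ≡ card T - ι (pos (misses B T))
  meet-misses [] [] = sym (ℚₚ.+-inverseʳ (ι (pos 0)))
  meet-misses (true ∷ B) (true ∷ T) = trans (cong (1ℚ +_) (meet-misses B T)) (trans (S.solve 2 (λ t m → S.con 1ℚ S.:+ (t S.:- m) S.:= (S.con 1ℚ S.:+ t) S.:- m) refl (card T) (ι (pos (misses B T))))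
    (cong (_- ι (pos (misses B T))) (sym (card-∷ true T))))
  meet-misses (false ∷ B) (true ∷ T) = trans (cong (0ℚ +_) (meet-misses B T)) (trans (S.solve 2 (λ t m → S.con 0ℚ S.:+ (t S.:- m) S.:= (S.con 1ℚ S.:+ t) S.:- (S.con 1ℚ S.:+ m)) refl (card T) (ι (pos (misses B T))))
    (sym (cong₂ _-_ (card-∷ true T) (ι-suc (misses B T)))))
  meet-misses (true ∷ B) (false ∷ T) = trans (cong (0ℚ +_) (meet-misses B T)) (ℚₚ.+-identityˡ _)
  meet-misses (false ∷ B) (false ∷ T) = trans (cong (0ℚ +_) (meet-misses B T)) (ℚₚ.+-identityˡ _)

  misses-self : ∀ {n} (T : Subset n) → misses T T ≡ 0
  misses-self []          = refl
  misses-self (true ∷ T)  = misses-self T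
  misses-self (false ∷ T) = misses-self T

  module Counts {t v k λ' : ℕ} {ℬ : List (Subset v)} (D : IsDesign t v k λ' ℬ) where
    open IsDesign D
    private
      k′ v′ : ℚ
      k′ = ι (pos k)
      v′ = ι (pos v)

    Λ : ℕ → ℚ
    Λ i = ΣL (χ (initial v i)) ℬ

    private
      t≤v : t ℕ.≤ v
      t≤v = ℕₚ.≤-trans t≤k k≤v

      -- Double counting of pairs of a further point and a block containing it together with S. The
      -- right side does not depend on S, so after cancelling k - i the number of blocks through an
      -- i-set is constant as well; this carries constancy down from t.
      extend : ∀ i → i ℕ.< t → (∀ S → ∣ S ∣ ≡ suc i → ΣL (χ S) ℬ ≡ Λ (suc i)) → ∀ S → ∣ S ∣ ≡ i → (k′ - ι (pos i)) * ΣL (χ S) ℬ ≡ (v′ - ι (pos i)) * Λ (suc i)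
      extend i i<t hyp S ∣S∣ = begin
        (k′ - ι (pos i)) * ΣL (χ S) ℬ                                ≡⟨ sym (ΣL-* (k′ - ι (pos i)) (χ S) ℬ) ⟩
        ΣL (λ B → (k′ - ι (pos i)) * χ S B) ℬ                        ≡⟨ ΣL-All (λ B ∣B∣ → trans (cong₂ (λ a b → (ι (pos a) - ι (pos b)) * χ S B) (sym ∣B∣) (sym ∣S∣))
                                                                           (trans (cong (λ e → (e - card S) * χ S B) (sym (meet-full B))) (ℚₚ.*-comm (meet B (full v) - card S) (χ S B)))) blockSize ⟩
        ΣL (λ B → χ S B * (meet B (full v) - card S)) ℬ              ≡⟨ ΣL-cong (λ B → sym (Σ-new-χ (≼-full S) B)) ℬ ⟩
        ΣL (λ B → ΣF (λ p → new (full v) S p * χ (ins p S) B)) ℬ     ≡⟨ ΣL-ΣF (λ B p → new (full v) S p * χ (ins p S) B) ℬ ⟩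
        ΣF (λ p → ΣL (λ B → new (full v) S p * χ (ins p S) B) ℬ)     ≡⟨ ΣF-cong (λ p → ΣL-* (new (full v) S p) (χ (ins p S)) ℬ) ⟩
        ΣF (λ p → new (full v) S p * ΣL (χ (ins p S)) ℬ)             ≡⟨ Σ-new-const (≼-full S) (λ p → ΣL (χ (ins p S)) ℬ) (Λ (suc i)) (λ p _ e → hyp (ins p S) (trans e (cong suc ∣S∣))) ⟩
        (card (full v) - card S) * Λ (suc i)                         ≡⟨ cong₂ (λ a b → (ι (pos a) - ι (pos b)) * Λ (suc i)) (∣full∣ v) ∣S∣ ⟩
        (v′ - ι (pos i)) * Λ (suc i)                                 ∎
        where open ≡-Reasoning

      constant : ∀ d i → i ℕ.+ d ≡ t → ∀ S → ∣ S ∣ ≡ i → ΣL (χ S) ℬ ≡ Λ i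
      constant zero i e S ∣S∣ = trans (at S (trans ∣S∣ i≡t)) (sym (at (initial v i) (trans (∣initial∣ (subst (ℕ._≤ v) (sym i≡t) t≤v)) i≡t)))
        where
        i≡t : i ≡ t
        i≡t = trans (sym (ℕₚ.+-identityʳ i)) e
        at : ∀ S → ∣ S ∣ ≡ t → ΣL (χ S) ℬ ≡ ι (pos λ')
        at S ∣S∣ = trans (sym (blocks-ΣL S ℬ)) (cong (λ n → ι (pos n)) (balanced S ∣S∣))
      constant (suc d) i e S ∣S∣ = ℚₚ.≤-antisym (cancel (ℚₚ.≤-reflexive both-eq)) (cancel (ℚₚ.≤-reflexive (sym both-eq)))
        where
        i<t : i ℕ.< t
        i<t = subst (suc i ℕ.≤_) (trans (sym (ℕₚ.+-suc i d)) e) (ℕₚ.m≤m+n (suc i) d)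
        ext = extend i i<t (constant d (suc i) (trans (sym (ℕₚ.+-suc i d)) e))
        both-eq : (k′ - ι (pos i)) * ΣL (χ S) ℬ ≡ (k′ - ι (pos i)) * Λ i
        both-eq = trans (ext S ∣S∣) (sym (ext (initial v i) (∣initial∣ (ℕₚ.≤-trans (ℕₚ.<⇒≤ i<t) t≤v))))
        cancel : ∀ {p q} → (k′ - ι (pos i)) * p ≤ (k′ - ι (pos i)) * q → p ≤ q
        cancel = *-cancel≤ (<⇒0<- (ι-mono-< (ℤ.+<+ (ℕₚ.<-≤-trans i<t t≤k))))

    count-constant : ∀ {i} → i ℕ.≤ t → ∀ S → ∣ S ∣ ≡ i → ΣL (χ S) ℬ ≡ Λ i
    count-constant {i} i≤t = constant (t ℕ.∸ i) i (ℕₚ.m+[n∸m]≡n i≤t)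

    Λ-step : ∀ i → i ℕ.< t → (k′ - ι (pos i)) * Λ i ≡ (v′ - ι (pos i)) * Λ (suc i)
    Λ-step i i<t = extend i i<t (count-constant i<t) (initial v i) (∣initial∣ (ℕₚ.≤-trans (ℕₚ.<⇒≤ i<t) t≤v))

    -- Stated for every S inside T, and not just for the empty set, so that the induction on j can
    -- move one point of T into S.
    moment′ : ∀ T j S → S ≼ T → ∣ S ∣ ℕ.+ j ℕ.≤ t → ΣL (λ B → χ S B * fall (meet B T - card S) j) ℬ ≡ fall (card T - card S) j * Λ (∣ S ∣ ℕ.+ j)
    moment′ T zero S S≼T le = trans (ΣL-cong (λ B → ℚₚ.*-identityʳ (χ S B)) ℬ)
      (trans (count-constant (ℕₚ.≤-trans (ℕₚ.≤-reflexive (sym (ℕₚ.+-identityʳ ∣ S ∣))) le) S refl) (trans (cong Λ (sym (ℕₚ.+-identityʳ ∣ S ∣))) (sym (ℚₚ.*-identityˡ _))))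
    moment′ T (suc j) S S≼T le = begin
      ΣL (λ B → χ S B * ((meet B T - card S) * fall (meet B T - card S - 1ℚ) j)) ℬ ≡⟨ ΣL-cong (λ B → trans (sym (ℚₚ.*-assoc (χ S B) _ _)) (cong (_* fall (meet B T - card S - 1ℚ) j) (sym (Σ-new-χ S≼T B)))) ℬ ⟩
      ΣL (λ B → ΣF (λ p → new T S p * χ (ins p S) B) * fall (meet B T - card S - 1ℚ) j) ℬ ≡⟨ ΣL-cong (λ B → sym (ΣF-*ʳ (λ p → new T S p * χ (ins p S) B) (fall (meet B T - card S - 1ℚ) j))) ℬ ⟩
      ΣL (λ B → ΣF (λ p → new T S p * χ (ins p S) B * fall (meet B T - card S - 1ℚ) j)) ℬ ≡⟨ ΣL-ΣF (λ B p → new T S p * χ (ins p S) B * fall (meet B T - card S - 1ℚ) j) ℬ ⟩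
      ΣF (λ p → ΣL (λ B → new T S p * χ (ins p S) B * fall (meet B T - card S - 1ℚ) j) ℬ) ≡⟨ ΣF-cong (λ p → trans (ΣL-cong (λ B → ℚₚ.*-assoc (new T S p) (χ (ins p S) B) _) ℬ)
                                                                                              (ΣL-* (new T S p) (λ B → χ (ins p S) B * fall (meet B T - card S - 1ℚ) j) ℬ)) ⟩
      ΣF (λ p → new T S p * ΣL (λ B → χ (ins p S) B * fall (meet B T - card S - 1ℚ) j) ℬ) ≡⟨ Σ-new-const S≼T _ K inner ⟩
      (card T - card S) * K                                                             ≡⟨ sym (ℚₚ.*-assoc (card T - card S) (fall (card T - card S - 1ℚ) j) _) ⟩
      fall (card T - card S) (suc j) * Λ (∣ S ∣ ℕ.+ suc j)                               ∎
      where
      open ≡-Reasoning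
      K = fall (card T - card S - 1ℚ) j * Λ (∣ S ∣ ℕ.+ suc j)
      shift : ∀ x p → ∣ ins p S ∣ ≡ suc ∣ S ∣ → x - card S - 1ℚ ≡ x - card (ins p S)
      shift x p e = trans (S.solve 2 (λ x c → x S.:- c S.:- S.con 1ℚ S.:= x S.:- (S.con 1ℚ S.:+ c)) refl x (card S))
        (cong (λ e → x - e) (sym (trans (cong (λ n → ι (pos n)) e) (ι-suc ∣ S ∣))))
      inner : ∀ p → ins p S ≼ T → ∣ ins p S ∣ ≡ suc ∣ S ∣ → ΣL (λ B → χ (ins p S) B * fall (meet B T - card S - 1ℚ) j) ℬ ≡ K
      inner p l e = trans (ΣL-cong (λ B → cong (λ x → χ (ins p S) B * fall x j) (shift (meet B T) p e)) ℬ)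
        (trans (moment′ T j (ins p S) l (ℕₚ.≤-trans (ℕₚ.≤-reflexive index) le))
          (cong₂ (λ x n → fall x j * Λ n) (sym (shift (card T) p e)) index))
        where
        index : ∣ ins p S ∣ ℕ.+ j ≡ ∣ S ∣ ℕ.+ suc j
        index = trans (cong (ℕ._+ j) e) (sym (ℕₚ.+-suc ∣ S ∣ j))

    moment : ∀ T → ∣ T ∣ ≡ k → ∀ j → j ℕ.≤ t → ΣL (λ B → fall (k′ - ι (pos (misses B T))) j) ℬ ≡ fall k′ j * Λ j
    moment T ∣T∣ j j≤t = trans (ΣL-cong pointwise ℬ) (trans (moment′ T j (empty v) (empty-≼ T) (ℕₚ.≤-trans (ℕₚ.≤-reflexive (cong (ℕ._+ j) (∣empty∣ v))) j≤t))
        (cong₂ (λ x n → fall x j * Λ n) (trans (less-empty (card T)) (cong (λ n → ι (pos n)) ∣T∣)) (cong (ℕ._+ j) (∣empty∣ v))))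
      where
      less-empty : ∀ x → x - card (empty v) ≡ x
      less-empty x = trans (cong (λ e → x - e) (trans (cong (λ n → ι (pos n)) (∣empty∣ v)) ι-0)) (ℚₚ.+-identityʳ x)
      pointwise : ∀ B → fall (k′ - ι (pos (misses B T))) j ≡ χ (empty v) B * fall (meet B T - card (empty v)) j
      pointwise B = sym (trans (cong₂ _*_ (χ-empty B) (cong (λ x → fall x j) (trans (less-empty (meet B T)) (trans (meet-misses B T) (cong (λ n → ι (pos n) - ι (pos (misses B T))) ∣T∣)))))
        (ℚₚ.*-identityˡ _))

    Λ-zero : Λ 0 ≡ ι (pos (length ℬ))
    Λ-zero = trans (ΣL-cong χ₀ ℬ) (count ℬ)
      where
      χ₀ : ∀ {v} (B : Subset v) → χ (initial v 0) B ≡ 1ℚ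
      χ₀ []      = refl
      χ₀ (_ ∷ B) = χ₀ B
      count : ∀ {A : Set} (xs : List A) → ΣL (λ _ → 1ℚ) xs ≡ ι (pos (length xs))
      count []       = sym ι-0
      count (x ∷ xs) = trans (cong (1ℚ +_) (count xs)) (sym (ι-suc (length xs)))

-- Finite differences, polynomial functions, and the kernel polynomial of each degree.

module ReproducingKernel where
  open Rationals
  open RootWindows using (roots→poly)
  open DesignCounts using (fall; ι-suc; ΣL; ΣL-cong; ΣL-+; ΣL-*)
  open import Data.Nat as ℕ using (ℕ; zero; suc; z≤n)
  import Data.Nat.Properties as ℕₚ
  open import Data.Integer using () renaming (+_ to pos)
  open import Data.Rational as ℚ using (ℚ; 0ℚ; 1ℚ; _+_; _*_; -_; _-_; _<_)
  import Data.Rational.Properties as ℚₚ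
  open import Data.List using (List; []; _∷_; length)
  open import Data.List.Relation.Unary.All using (All; []; _∷_)
  open import Data.List.Relation.Unary.AllPairs using (AllPairs; []; _∷_)
  open import Data.Sum using (inj₁; inj₂)
  open import Data.Product using (_×_; _,_; ∃-syntax)
  open import Relation.Binary.PropositionalEquality

  ν : ℕ → ℚ
  ν n = ι (pos n)

  ν-suc : ∀ n → ν (suc n) ≡ ν n + 1ℚ
  ν-suc n = trans (ι-suc n) (ℚₚ.+-comm 1ℚ (ν n))

  ν-+ : ∀ m n → ν (m ℕ.+ n) ≡ ν m + ν n
  ν-+ m n = ι-+ (pos m) (pos n)

  ν-∸ : ∀ {m n} → n ℕ.≤ m → ν (m ℕ.∸ n) ≡ ν m - ν n
  ν-∸ {m} {n} n≤m = trans (S.solve 2 (λ a b → a S.:= (a S.:+ b) S.:- b) refl (ν (m ℕ.∸ n)) (ν n))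
    (cong (λ x → x - ν n) (trans (sym (ν-+ (m ℕ.∸ n) n)) (cong ν (ℕₚ.m∸n+n≡m n≤m))))

  -‿0 : ∀ x → x - ν 0 ≡ x
  -‿0 x = trans (cong (λ y → x - y) ι-0) (S.solve 1 (λ x → x S.:- S.con 0ℚ S.:= x) refl x)

  fall-+ : ∀ x i j → fall x (i ℕ.+ j) ≡ fall x i * fall (x - ν i) j
  fall-+ x zero    j = trans (cong (λ y → fall y j) (sym (-‿0 x))) (sym (ℚₚ.*-identityˡ _))
  fall-+ x (suc i) j = trans (cong (x *_) (trans (fall-+ (x - 1ℚ) i j) (cong (λ y → fall (x - 1ℚ) i * fall y j)
      (trans (S.solve 2 (λ x n → (x S.:- S.con 1ℚ) S.:- n S.:= x S.:- (S.con 1ℚ S.:+ n)) refl x (ν i)) (cong (λ y → x - y) (sym (ι-suc i)))))))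
    (sym (ℚₚ.*-assoc x _ _))

  fall-snoc : ∀ x j → fall x (suc j) ≡ fall x j * (x - ν j)
  fall-snoc x j = trans (cong (fall x) (ℕₚ.+-comm 1 j)) (trans (fall-+ x j 1) (cong (fall x j *_) (ℚₚ.*-identityʳ _)))

  0<fall : ∀ {x} j → ν j < x → 0ℚ < fall x j
  0<fall zero    _ = ℚₚ.positive⁻¹ 1ℚ
  0<fall {x} (suc j) lt = 0<* (ℚₚ.<-trans (0<ι j) lt)
    (0<fall j (0<-⇒< (subst (0ℚ <_) (trans (cong (λ y → x - y) (ι-suc j)) (S.solve 2 (λ x n → x S.:- (S.con 1ℚ S.:+ n) S.:= (x S.:- S.con 1ℚ) S.:- n) refl x (ν j))) (<⇒0<- lt))))

  -- The alternating binomial sum of f(i), ..., f(i+m), written as an iterated difference. Sums in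
  -- this form are evaluated by degree considerations, without handling binomial coefficients.
  Δ : ℕ → (ℕ → ℚ) → ℕ → ℚ
  Δ zero    f i = f i
  Δ (suc m) f i = Δ m f i - Δ m f (suc i)

  Δ-cong : ∀ m {f g : ℕ → ℚ} i → (∀ j → i ℕ.≤ j → j ℕ.≤ m ℕ.+ i → f j ≡ g j) → Δ m f i ≡ Δ m g i
  Δ-cong zero    i h = h i ℕₚ.≤-refl ℕₚ.≤-refl
  Δ-cong (suc m) i h = cong₂ (λ x y → x - y) (Δ-cong m i λ j i≤j j≤ → h j i≤j (ℕₚ.m≤n⇒m≤1+n j≤))
    (Δ-cong m (suc i) λ j i<j j≤ → h j (ℕₚ.<⇒≤ i<j) (ℕₚ.≤-trans j≤ (ℕₚ.≤-reflexive (ℕₚ.+-suc m i))))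

  Δ-* : ∀ m c f i → Δ m (λ j → c * f j) i ≡ c * Δ m f i
  Δ-* zero    c f i = refl
  Δ-* (suc m) c f i = trans (cong₂ (λ x y → x - y) (Δ-* m c f i) (Δ-* m c f (suc i)))
    (S.solve 3 (λ c x y → c S.:* x S.:- c S.:* y S.:= c S.:* (x S.:- y)) refl c (Δ m f i) (Δ m f (suc i)))

  ΣL-Δ : {A : Set} → ∀ m (f : A → ℕ → ℚ) i xs → ΣL (λ x → Δ m (f x) i) xs ≡ Δ m (λ j → ΣL (λ x → f x j) xs) i
  ΣL-Δ zero    f i xs = refl
  ΣL-Δ (suc m) f i xs = trans (ΣL-cong (λ x → S.solve 2 (λ a b → a S.:- b S.:= a S.:+ (S.:- S.con 1ℚ) S.:* b) refl (Δ m (f x) i) (Δ m (f x) (suc i))) xs)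
    (trans (ΣL-+ (λ x → Δ m (f x) i) (λ x → (- 1ℚ) * Δ m (f x) (suc i)) xs)
    (trans (cong₂ _+_ (ΣL-Δ m f i xs) (trans (ΣL-* (- 1ℚ) (λ x → Δ m (f x) (suc i)) xs) (cong ((- 1ℚ) *_) (ΣL-Δ m f (suc i) xs))))
    (S.solve 2 (λ a b → a S.:+ (S.:- S.con 1ℚ) S.:* b S.:= a S.:- b) refl (Δ m (λ j → ΣL (λ x → f x j) xs) i) (Δ m (λ j → ΣL (λ x → f x j) xs) (suc i)))))

  signed-factorial : ℕ → ℚ
  signed-factorial zero    = 1ℚ
  signed-factorial (suc m) = - (ν (suc m) * signed-factorial m)

  sign : ℕ → ℚ
  sign zero    = 1ℚ
  sign (suc m) = - sign m

  -- The trace that a monic polynomial of degree n leaves in its differences: the n-th one is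
  -- constant, (-1)ⁿ n! with the present sign convention. The Leibniz rule preserves this under
  -- multiplication by linear factors.
  Monic : ℕ → (ℕ → ℚ) → Set
  Monic n f = ∀ i → Δ n f i ≡ signed-factorial n

  private
    Δ-linear : ∀ B f m i → Δ (suc m) (λ j → (B + ν j) * f j) i ≡ (B + ν i) * Δ (suc m) f i - ν (suc m) * Δ m f (suc i)
    Δ-linear B f zero i = trans (cong (λ x → (B + ν i) * f i - (B + x) * f (suc i)) (ν-suc i))
      (trans (S.solve 4 (λ B i f g → (B S.:+ i) S.:* f S.:- (B S.:+ (i S.:+ S.con 1ℚ)) S.:* g S.:= (B S.:+ i) S.:* (f S.:- g) S.:- S.con 1ℚ S.:* g) refl B (ν i) (f i) (f (suc i)))
      (cong (λ x → (B + ν i) * (f i - f (suc i)) - x * f (suc i)) (sym ι-1)))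
    Δ-linear B f (suc m) i = trans (cong₂ (λ x y → x - y) (Δ-linear B f m i) (Δ-linear B f m (suc i)))
      (trans (cong₂ (λ x n → ((B + ν i) * D₀ - n * E₁) - ((B + x) * D₁ - n * E₂)) (ν-suc i) (ν-suc m))
      (trans (S.solve 6 (λ B i m D E₁ E₂ →
         ((B S.:+ i) S.:* D S.:- (m S.:+ S.con 1ℚ) S.:* E₁) S.:- ((B S.:+ (i S.:+ S.con 1ℚ)) S.:* (E₁ S.:- E₂) S.:- (m S.:+ S.con 1ℚ) S.:* E₂)
         S.:= (B S.:+ i) S.:* (D S.:- (E₁ S.:- E₂)) S.:- (m S.:+ S.con 1ℚ S.:+ S.con 1ℚ) S.:* (E₁ S.:- E₂)) refl B (ν i) (ν m) D₀ E₁ E₂)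
      (cong (λ n → (B + ν i) * (D₀ - D₁) - n * D₁) (sym (trans (ν-suc (suc m)) (cong (_+ 1ℚ) (ν-suc m)))))))
      where
      D₀ = Δ (suc m) f i
      D₁ = Δ (suc m) f (suc i)
      E₁ = Δ m f (suc i)
      E₂ = Δ m f (suc (suc i))

  Monic-linear : ∀ {n f} B → Monic n f → Monic (suc n) (λ i → (B + ν i) * f i)
  Monic-linear {n} {f} B h i = trans (Δ-linear B f n i)
    (trans (cong₂ (λ x y → (B + ν i) * x - ν (suc n) * y) (cong₂ (λ x y → x - y) (h i) (h (suc i))) (h (suc i)))
    (S.solve 3 (λ b c n → b S.:* (c S.:- c) S.:- n S.:* c S.:= S.:- (n S.:* c)) refl (B + ν i) (signed-factorial n) (ν (suc n))))

  Monic-cong : ∀ {n f g} → (∀ i → f i ≡ g i) → Monic n f → Monic n g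
  Monic-cong {n} e h i = trans (Δ-cong n i (λ j _ _ → sym (e j))) (h i)

  Monic-fall : ∀ {n f} B j → Monic n f → Monic (j ℕ.+ n) (λ i → fall (B + ν i) j * f i)
  Monic-fall {n} B zero h = Monic-cong {n} (λ i → sym (ℚₚ.*-identityˡ _)) h
  Monic-fall {n} {f} B (suc j) h = Monic-cong {suc (j ℕ.+ n)} (λ i → trans (cong (λ x → (B + ν i) * (fall x j * f i)) (S.solve 2 (λ b i → (b S.:- S.con 1ℚ) S.:+ i S.:= (b S.:+ i) S.:- S.con 1ℚ) refl B (ν i)))
    (sym (ℚₚ.*-assoc (B + ν i) _ _))) (Monic-linear {j ℕ.+ n} B (Monic-fall {n} (B - 1ℚ) j h))

  Δ-last : ∀ m f i → (∀ j → i ℕ.≤ j → j ℕ.< m ℕ.+ i → f j ≡ 0ℚ) → Δ m f i ≡ sign m * f (m ℕ.+ i)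
  Δ-last zero    f i h = sym (ℚₚ.*-identityˡ _)
  Δ-last (suc m) f i h = trans (cong₂ (λ x y → x - y)
      (trans (Δ-last m f i λ j i≤j j< → h j i≤j (ℕₚ.m≤n⇒m≤1+n j<)) (trans (cong (sign m *_) (h (m ℕ.+ i) (ℕₚ.m≤n+m i m) ℕₚ.≤-refl)) (ℚₚ.*-zeroʳ (sign m))))
      (trans (Δ-last m f (suc i) λ j i<j j< → h j (ℕₚ.<⇒≤ i<j) (ℕₚ.≤-trans j< (ℕₚ.≤-reflexive (ℕₚ.+-suc m i)))) (cong (λ n → sign m * f n) (ℕₚ.+-suc m i))))
    (S.solve 2 (λ a b → S.con 0ℚ S.:- a S.:* b S.:= (S.:- a) S.:* b) refl (sign m) (f (suc (m ℕ.+ i))))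

  -- Deg n c f: f is a polynomial function of degree n with leading coefficient c.
  data Deg : ℕ → ℚ → (ℚ → ℚ) → Set where
    const : ∀ {c f} → (∀ X → f X ≡ c) → Deg 0 c f
    step  : ∀ {n c f h} e δ → Deg n c h → (∀ X → f X ≡ e + (X - δ) * h X) → Deg (suc n) c f

  private
    -- A characterisation of polynomials by division with remainder, chosen because it is closed under sums.
    Poly : ℕ → ℚ → (ℚ → ℚ) → Set
    Poly zero    c f = ∀ X → f X ≡ c
    Poly (suc n) c f = ∀ r → ∃[ q ] (Poly n c q × (∀ X → f X ≡ f r + (X - r) * q X))

    Poly-combine : ∀ n {c c′ f f′} t → Poly n c f → Poly n c′ f′ → Poly n (c + t * c′) (λ X → f X + t * f′ X)
    Poly-combine zero    t h h′ X = cong₂ (λ a b → a + t * b) (h X) (h′ X)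
    Poly-combine (suc n) {f = f} {f′} t h h′ r with h r | h′ r
    ... | q , p , e | q′ , p′ , e′ = (λ X → q X + t * q′ X) , Poly-combine n t p p′ , λ X →
      trans (cong₂ (λ a b → a + t * b) (e X) (e′ X))
      (S.solve 6 (λ a b t x q q′ → (a S.:+ x S.:* q) S.:+ t S.:* (b S.:+ x S.:* q′) S.:= (a S.:+ t S.:* b) S.:+ x S.:* (q S.:+ t S.:* q′)) refl (f r) (f′ r) t (X - r) (q X) (q′ X))

    Poly-lift : ∀ n {c f} → Poly n c f → Poly (suc n) 0ℚ f
    Poly-lift zero {f = f} h r = (λ _ → 0ℚ) , (λ _ → refl) , λ X → trans (trans (h X) (sym (h r))) (S.solve 2 (λ a x → a S.:= a S.:+ x S.:* S.con 0ℚ) refl (f r) (X - r))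
    Poly-lift (suc n) h r with h r
    ... | q , p , e = q , Poly-lift n p , e

    Poly-subst : ∀ n {c c′ f} → c ≡ c′ → Poly n c f → Poly n c′ f
    Poly-subst n refl h = h

    Poly-step : ∀ n {c f h} e δ → Poly n c h → (∀ X → f X ≡ e + (X - δ) * h X) → Poly (suc n) c f
    Poly-step zero {h = h} e δ p eq r = h , p , λ X → trans (eq X) (trans (cong (λ y → e + (X - δ) * y) (trans (p X) (sym (p r))))
      (trans (S.solve 5 (λ e X d r h → e S.:+ (X S.:- d) S.:* h S.:= (e S.:+ (r S.:- d) S.:* h) S.:+ (X S.:- r) S.:* h) refl e X δ r (h r))
      (cong₂ (λ a b → a + (X - r) * b) (sym (eq r)) (trans (p r) (sym (p X))))))
    Poly-step (suc n) {c} {f} {h} e δ p eq r with p r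
    ... | q , pq , e′ = (λ X → h X + (r - δ) * q X) , Poly-subst (suc n) (S.solve 2 (λ c t → c S.:+ t S.:* S.con 0ℚ S.:= c) refl c (r - δ)) (Poly-combine (suc n) (r - δ) p (Poly-lift n pq)) , λ X →
      trans (eq X) (trans (S.solve 6 (λ e X d r h hr → e S.:+ (X S.:- d) S.:* h S.:= (e S.:+ (r S.:- d) S.:* hr) S.:+ ((X S.:- r) S.:* h S.:+ (r S.:- d) S.:* (h S.:- hr))) refl e X δ r (h X) (h r))
      (cong₂ _+_ (sym (eq r)) (trans (cong (λ y → (X - r) * h X + (r - δ) * (y - h r)) (e′ X))
      (S.solve 5 (λ x h t g q → x S.:* h S.:+ t S.:* ((g S.:+ x S.:* q) S.:- g) S.:= x S.:* (h S.:+ t S.:* q)) refl (X - r) (h X) (r - δ) (h r) (q X)))))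

    Deg⇒Poly : ∀ {n c f} → Deg n c f → Poly n c f
    Deg⇒Poly (const h)        = h
    Deg⇒Poly {suc n} (step e δ d eq) = Poly-step n e δ (Deg⇒Poly d) eq

  factor-theorem : ∀ {n c f} → Deg n c f → ∀ δs → length δs ≡ n → AllPairs _≢_ δs → All (λ δ → f (ι δ) ≡ 0ℚ) δs → ∀ X → f X ≡ c * roots→poly δs X
  factor-theorem {n} d = go n (Deg⇒Poly d)
    where
    cancel : ∀ {x y} → x ≢ 0ℚ → x * y ≡ 0ℚ → y ≡ 0ℚ
    cancel {x} {y} x≢0 e = trans (sym (ℚₚ.*-identityˡ y)) (trans (cong (_* y) (sym (ℚₚ.*-inverseˡ x))) (trans (ℚₚ.*-assoc (ℚ.1/ x) x y) (trans (cong (ℚ.1/ x *_) e) (ℚₚ.*-zeroʳ (ℚ.1/ x)))))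
      where instance _ = ℚ.≢-nonZero x≢0
    go : ∀ n {c f} → Poly n c f → ∀ δs → length δs ≡ n → AllPairs _≢_ δs → All (λ δ → f (ι δ) ≡ 0ℚ) δs → ∀ X → f X ≡ c * roots→poly δs X
    go zero    {c} p []       _ _ _ X = trans (p X) (sym (ℚₚ.*-identityʳ c))
    go (suc n) {c} {f} p (δ ∷ δs) e (δ≢ ∷ distinct) (z ∷ zs) X with p (ι δ)
    ... | q , pq , eq = begin
      f X                                      ≡⟨ eq X ⟩
      f (ι δ) + (X - ι δ) * q X                ≡⟨ cong₂ (λ a b → a + (X - ι δ) * b) z (go n pq δs (ℕₚ.suc-injective e) distinct (zeros zs δ≢) X) ⟩
      0ℚ + (X - ι δ) * (c * roots→poly δs X)   ≡⟨ S.solve 3 (λ x c r → S.con 0ℚ S.:+ x S.:* (c S.:* r) S.:= c S.:* (x S.:* r)) refl (X - ι δ) c (roots→poly δs X) ⟩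
      c * ((X - ι δ) * roots→poly δs X)        ∎
      where
      open ≡-Reasoning
      zeros : ∀ {δs} → All (λ δ → f (ι δ) ≡ 0ℚ) δs → All (δ ≢_) δs → All (λ δ → q (ι δ) ≡ 0ℚ) δs
      zeros []       []        = []
      zeros {δ′ ∷ _} (z′ ∷ zs) (ne ∷ nes) = cancel {ι δ′ - ι δ} {q (ι δ′)}
        (λ e → ne (sym (ι-injective (trans (S.solve 2 (λ a b → a S.:= (a S.:- b) S.:+ b) refl (ι δ′) (ι δ)) (trans (cong (_+ ι δ) e) (ℚₚ.+-identityˡ (ι δ)))))))
        (trans (S.solve 2 (λ a b → a S.:= (b S.:+ a) S.:- b) refl ((ι δ′ - ι δ) * q (ι δ′)) (f (ι δ))) (trans (cong₂ (λ a b → a - b) (trans (sym (eq (ι δ′))) z′) z) (ℚₚ.+-inverseʳ 0ℚ))) ∷ zeros zs nes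

  Deg-roots : ∀ δs → Deg (length δs) 1ℚ (roots→poly δs)
  Deg-roots []       = const λ _ → refl
  Deg-roots (δ ∷ δs) = step 0ℚ (ι δ) (Deg-roots δs) λ X → sym (ℚₚ.+-identityˡ _)

  -- From here on a design is represented by its list of distances from one block, the relation
  -- between consecutive block counts, and the factorial moments.
  module Moments (ds : List ℚ) (k v : ℚ) (Λ : ℕ → ℚ) (t : ℕ)
                 (Λ-step : ∀ i → i ℕ.< t → (k - ν i) * Λ i ≡ (v - ν i) * Λ (suc i))
                 (moment : ∀ j → j ℕ.≤ t → ΣL (λ d → fall (k - d) j) ds ≡ fall k j * Λ j) where
    w = v - k

    Λ-closed : ∀ n → n ℕ.≤ t → Λ 0 * fall k n ≡ Λ n * fall v n
    Λ-closed zero    _  = refl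
    Λ-closed (suc n) le = begin
      Λ 0 * fall k (suc n)              ≡⟨ trans (cong (Λ 0 *_) (fall-snoc k n)) (sym (ℚₚ.*-assoc (Λ 0) _ _)) ⟩
      Λ 0 * fall k n * (k - ν n)        ≡⟨ cong (_* (k - ν n)) (Λ-closed n (ℕₚ.<⇒≤ le)) ⟩
      Λ n * fall v n * (k - ν n)        ≡⟨ S.solve 3 (λ a b c → a S.:* b S.:* c S.:= (c S.:* a) S.:* b) refl (Λ n) (fall v n) (k - ν n) ⟩
      (k - ν n) * Λ n * fall v n        ≡⟨ cong (_* fall v n) (Λ-step n le) ⟩
      (v - ν n) * Λ (suc n) * fall v n  ≡⟨ S.solve 3 (λ a b c → a S.:* b S.:* c S.:= b S.:* (c S.:* a)) refl (v - ν n) (Λ (suc n)) (fall v n) ⟩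
      Λ (suc n) * (fall v n * (v - ν n)) ≡⟨ cong (Λ (suc n) *_) (sym (fall-snoc v n)) ⟩
      Λ (suc n) * fall v (suc n)        ∎
      where open ≡-Reasoning

    -- Induction on i through d - i = (k - i - j) - (k - d - j), which trades the last factor of
    -- `fall d (suc i)` for a further factor of `fall (k - d)`.
    mixed-moment : ∀ i j → i ℕ.+ j ℕ.≤ t → ΣL (λ d → fall (k - d) j * fall d i) ds ≡ Λ (i ℕ.+ j) * (fall k j * fall w i)
    mixed-moment zero    j le = trans (ΣL-cong (λ d → ℚₚ.*-identityʳ _) ds) (trans (moment j le) (S.solve 2 (λ a b → a S.:* b S.:= b S.:* (a S.:* S.con 1ℚ)) refl (fall k j) (Λ j)))
    mixed-moment (suc i) j le = begin
      ΣL (λ d → fall (k - d) j * fall d (suc i)) ds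
        ≡⟨ ΣL-cong pointwise ds ⟩
      ΣL (λ d → (k - ν n) * (fall (k - d) j * fall d i) + (- 1ℚ) * (fall (k - d) (suc j) * fall d i)) ds
        ≡⟨ trans (ΣL-+ (λ d → (k - ν n) * (fall (k - d) j * fall d i)) (λ d → (- 1ℚ) * (fall (k - d) (suc j) * fall d i)) ds)
             (cong₂ _+_ (ΣL-* (k - ν n) (λ d → fall (k - d) j * fall d i) ds) (ΣL-* (- 1ℚ) (λ d → fall (k - d) (suc j) * fall d i) ds)) ⟩
      (k - ν n) * ΣL (λ d → fall (k - d) j * fall d i) ds + (- 1ℚ) * ΣL (λ d → fall (k - d) (suc j) * fall d i) ds
        ≡⟨ cong₂ (λ a b → (k - ν n) * a + (- 1ℚ) * b) (mixed-moment i j (ℕₚ.<⇒≤ le))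
             (trans (mixed-moment i (suc j) (ℕₚ.≤-trans (ℕₚ.≤-reflexive (ℕₚ.+-suc i j)) le)) (cong₂ (λ a b → Λ a * (b * fall w i)) (ℕₚ.+-suc i j) (fall-snoc k j))) ⟩
      (k - ν n) * (Λ n * (fall k j * fall w i)) + (- 1ℚ) * (Λ (suc n) * (fall k j * (k - ν j) * fall w i))
        ≡⟨ cong (_+ (- 1ℚ) * (Λ (suc n) * (fall k j * (k - ν j) * fall w i))) (trans (sym (ℚₚ.*-assoc (k - ν n) _ _)) (cong (_* (fall k j * fall w i)) (Λ-step n le))) ⟩
      (v - ν n) * Λ (suc n) * (fall k j * fall w i) + (- 1ℚ) * (Λ (suc n) * (fall k j * (k - ν j) * fall w i))
        ≡⟨ cong (λ x → (v - x) * Λ (suc n) * (fall k j * fall w i) + (- 1ℚ) * (Λ (suc n) * (fall k j * (k - ν j) * fall w i))) (ν-+ i j) ⟩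
      (v - (ν i + ν j)) * Λ (suc n) * (fall k j * fall w i) + (- 1ℚ) * (Λ (suc n) * (fall k j * (k - ν j) * fall w i))
        ≡⟨ S.solve 7 (λ v i j l f k g → (v S.:- (i S.:+ j)) S.:* l S.:* (f S.:* g) S.:+ (S.:- S.con 1ℚ) S.:* (l S.:* (f S.:* (k S.:- j) S.:* g))
             S.:= l S.:* (f S.:* (g S.:* ((v S.:- k) S.:- i)))) refl v (ν i) (ν j) (Λ (suc n)) (fall k j) k (fall w i) ⟩
      Λ (suc n) * (fall k j * (fall w i * (w - ν i)))
        ≡⟨ cong (λ x → Λ (suc n) * (fall k j * x)) (sym (fall-snoc w i)) ⟩
      Λ (suc n) * (fall k j * fall w (suc i)) ∎
      where
      open ≡-Reasoning
      n = i ℕ.+ j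
      pointwise : ∀ d → fall (k - d) j * fall d (suc i) ≡ (k - ν n) * (fall (k - d) j * fall d i) + (- 1ℚ) * (fall (k - d) (suc j) * fall d i)
      pointwise d = trans (cong (fall (k - d) j *_) (fall-snoc d i))
        (trans (S.solve 6 (λ k d i j f g → f S.:* (g S.:* (d S.:- i)) S.:= (k S.:- (i S.:+ j)) S.:* (f S.:* g) S.:+ (S.:- S.con 1ℚ) S.:* (f S.:* ((k S.:- d) S.:- j) S.:* g)) refl k d (ν i) (ν j) (fall (k - d) j) (fall d i))
        (cong₂ (λ a b → (k - a) * (fall (k - d) j * fall d i) + (- 1ℚ) * (b * fall d i)) (sym (ν-+ i j)) (sym (fall-snoc (k - d) j))))

    -- For m = s this is (a+1)...(a+i) · (b+1)...(b+i) · (N+i)...(N+s-1).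
    coeff : ℕ → ℕ → ℚ
    coeff m i = fall (k - ν (m ℕ.∸ i)) i * fall (w - ν (m ℕ.∸ i)) i * fall (v - ν m) (m ℕ.∸ i)

    -- The multiple of the reproducing kernel at 0 of the polynomials of degree at most m.
    ŷ : ℕ → ℚ → ℚ
    ŷ m d = Δ m (λ i → coeff m i * fall d (m ℕ.∸ i)) 0

    private
      -- Two descending runs of consecutive numbers are cut and joined again at A - j. Whether the
      -- first run has to be shortened or lengthened for this depends on the order of j and r.
      split : ∀ A i r j → j ℕ.≤ i ℕ.+ r → fall A r * fall (A - ν j + ν i) i ≡ fall A j * fall (A - ν j + ν i) (i ℕ.+ r ℕ.∸ j)
      split A i r j j≤ with ℕₚ.≤-total j r
      ... | inj₁ j≤r = begin
        fall A r * X i                                 ≡⟨ cong (λ n → fall A n * X i) (sym (ℕₚ.m+[n∸m]≡n j≤r)) ⟩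
        fall A (j ℕ.+ u) * X i                         ≡⟨ cong (_* X i) (fall-+ A j u) ⟩
        fall A j * fall (A - ν j) u * X i              ≡⟨ S.solve 3 (λ a b c → a S.:* b S.:* c S.:= a S.:* (c S.:* b)) refl (fall A j) (fall (A - ν j) u) (X i) ⟩
        fall A j * (X i * fall (A - ν j) u)            ≡⟨ cong (λ x → fall A j * (X i * fall x u)) (S.solve 3 (λ a j i → a S.:- j S.:= (a S.:- j S.:+ i) S.:- i) refl A (ν j) (ν i)) ⟩
        fall A j * (X i * fall (A - ν j + ν i - ν i) u) ≡⟨ cong (fall A j *_) (sym (fall-+ (A - ν j + ν i) i u)) ⟩
        fall A j * X (i ℕ.+ u)                         ≡⟨ cong (λ n → fall A j * X n) (sym (ℕₚ.+-∸-assoc i j≤r)) ⟩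
        fall A j * X (i ℕ.+ r ℕ.∸ j)                   ∎
        where
        open ≡-Reasoning
        u = r ℕ.∸ j
        X = fall (A - ν j + ν i)
      ... | inj₂ r≤j = begin
        fall A r * X i                                  ≡⟨ cong (λ n → fall A r * X n) (sym (ℕₚ.m∸n+n≡m u≤i)) ⟩
        fall A r * X (p ℕ.+ u)                          ≡⟨ cong (fall A r *_) (fall-+ (A - ν j + ν i) p u) ⟩
        fall A r * (X p * fall (A - ν j + ν i - ν p) u) ≡⟨ cong (λ x → fall A r * (X p * fall x u)) node ⟩
        fall A r * (X p * fall (A - ν r) u)             ≡⟨ S.solve 3 (λ a b c → a S.:* (b S.:* c) S.:= a S.:* c S.:* b) refl (fall A r) (X p) (fall (A - ν r) u) ⟩
        fall A r * fall (A - ν r) u * X p               ≡⟨ cong (_* X p) (trans (sym (fall-+ A r u)) (cong (fall A) (ℕₚ.m+[n∸m]≡n r≤j))) ⟩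
        fall A j * X p                                  ≡⟨ cong (λ n → fall A j * X n) p≡ ⟩
        fall A j * X (i ℕ.+ r ℕ.∸ j)                    ∎
        where
        open ≡-Reasoning
        u = j ℕ.∸ r
        p = i ℕ.∸ u
        X = fall (A - ν j + ν i)
        u≤i : u ℕ.≤ i
        u≤i = ℕₚ.≤-trans (ℕₚ.∸-monoˡ-≤ r j≤) (ℕₚ.≤-reflexive (ℕₚ.m+n∸n≡m i r))
        p≡ : p ≡ i ℕ.+ r ℕ.∸ j
        p≡ = trans (sym (ℕₚ.[m+n]∸[m+o]≡n∸o r i u)) (cong₂ ℕ._∸_ (ℕₚ.+-comm r i) (ℕₚ.m+[n∸m]≡n r≤j))
        node : A - ν j + ν i - ν p ≡ A - ν r
        node = trans (cong (λ x → A - ν j + ν i - x) (trans (ν-∸ u≤i) (cong (λ x → ν i - x) (ν-∸ r≤j))))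
          (S.solve 4 (λ a j i r → (a S.:- j S.:+ i) S.:- (i S.:- (j S.:- r)) S.:= a S.:- r) refl A (ν j) (ν i) (ν r))

      -- The reason for the choice of `coeff`: after multiplication by `fall v (m + j)` the i-th
      -- term is a constant times a product of j + (m - j) linear factors in i. This is monic of
      -- degree m, so the m-th difference retains only (-1)ᵐ m! and the moment no longer depends on
      -- the shape of the factors.
      summand : ∀ m j i → j ℕ.≤ m → m ℕ.+ j ℕ.≤ t → i ℕ.≤ m →
        fall v (m ℕ.+ j) * (coeff m i * (Λ (m ℕ.∸ i ℕ.+ j) * (fall k j * fall w (m ℕ.∸ i)))) ≡
        (Λ 0 * (fall k m * fall w m) * fall k j * fall (v - ν m) j) * (fall (k - ν m + ν i) j * fall (v - ν m - ν j + ν i) (m ℕ.∸ j))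
      summand m j i j≤m le i≤m = begin
        fall v (m ℕ.+ j) * (fall (k - ν r) i * fall (w - ν r) i * fall A r * (Λ (r ℕ.+ j) * (fall k j * fall w r)))
          ≡⟨ cong (_* (fall (k - ν r) i * fall (w - ν r) i * fall A r * (Λ (r ℕ.+ j) * (fall k j * fall w r)))) v-split ⟩
        fall v (r ℕ.+ j) * X i * (fall (k - ν r) i * fall (w - ν r) i * fall A r * (Λ (r ℕ.+ j) * (fall k j * fall w r)))
          ≡⟨ S.solve 8 (λ V X a b c L f g → V S.:* X S.:* (a S.:* b S.:* c S.:* (L S.:* (f S.:* g))) S.:= (L S.:* V) S.:* (g S.:* b) S.:* (c S.:* X) S.:* a S.:* f) refl
               (fall v (r ℕ.+ j)) (X i) (fall (k - ν r) i) (fall (w - ν r) i) (fall A r) (Λ (r ℕ.+ j)) (fall k j) (fall w r) ⟩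
        (Λ (r ℕ.+ j) * fall v (r ℕ.+ j)) * (fall w r * fall (w - ν r) i) * (fall A r * X i) * fall (k - ν r) i * fall k j
          ≡⟨ cong₂ (λ a b → a * (fall w r * fall (w - ν r) i) * b * fall (k - ν r) i * fall k j)
               (trans (sym (Λ-closed (r ℕ.+ j) (ℕₚ.≤-trans (ℕₚ.+-monoˡ-≤ j (ℕₚ.m∸n≤m m i)) le))) (cong (Λ 0 *_) (fall-+ k r j)))
               (trans (split A i r j (ℕₚ.≤-trans j≤m (ℕₚ.≤-reflexive (sym i+r)))) (cong (λ n → fall A j * X (n ℕ.∸ j)) i+r)) ⟩
        (Λ 0 * (fall k r * fall (k - ν r) j)) * (fall w r * fall (w - ν r) i) * (fall A j * X (m ℕ.∸ j)) * fall (k - ν r) i * fall k j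
          ≡⟨ S.solve 8 (λ L a b c d e f g → (L S.:* (a S.:* b)) S.:* c S.:* (d S.:* e) S.:* f S.:* g S.:= (L S.:* ((a S.:* f) S.:* c) S.:* g S.:* d) S.:* (b S.:* e)) refl
               (Λ 0) (fall k r) (fall (k - ν r) j) (fall w r * fall (w - ν r) i) (fall A j) (X (m ℕ.∸ j)) (fall (k - ν r) i) (fall k j) ⟩
        (Λ 0 * ((fall k r * fall (k - ν r) i) * (fall w r * fall (w - ν r) i)) * fall k j * fall A j) * (fall (k - ν r) j * X (m ℕ.∸ j))
          ≡⟨ cong₂ (λ a b → (Λ 0 * a * fall k j * fall A j) * (fall b j * X (m ℕ.∸ j))) (cong₂ _*_ (join k) (join w))
               (trans (cong (λ x → k - x) (ν-∸ i≤m)) (S.solve 3 (λ k m i → k S.:- (m S.:- i) S.:= k S.:- m S.:+ i) refl k (ν m) (ν i))) ⟩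
        (Λ 0 * (fall k m * fall w m) * fall k j * fall A j) * (fall (k - ν m + ν i) j * X (m ℕ.∸ j)) ∎
        where
        open ≡-Reasoning
        r = m ℕ.∸ i
        A = v - ν m
        X = fall (A - ν j + ν i)
        i+r : i ℕ.+ r ≡ m
        i+r = ℕₚ.m+[n∸m]≡n i≤m
        r+i : r ℕ.+ i ≡ m
        r+i = ℕₚ.m∸n+n≡m i≤m
        join : ∀ x → fall x r * fall (x - ν r) i ≡ fall x m
        join x = trans (sym (fall-+ x r i)) (cong (fall x) r+i)
        v-split : fall v (m ℕ.+ j) ≡ fall v (r ℕ.+ j) * X i
        v-split = trans (cong (fall v) (trans (cong (ℕ._+ j) (sym r+i)) (trans (ℕₚ.+-assoc r i j) (trans (cong (r ℕ.+_) (ℕₚ.+-comm i j)) (sym (ℕₚ.+-assoc r j i))))))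
          (trans (fall-+ v (r ℕ.+ j) i) (cong (λ x → fall v (r ℕ.+ j) * fall x i)
            (trans (cong (λ x → v - x) (trans (ν-+ r j) (cong (_+ ν j) (ν-∸ i≤m)))) (S.solve 4 (λ v m i j → v S.:- ((m S.:- i) S.:+ j) S.:= v S.:- m S.:- j S.:+ i) refl v (ν m) (ν i) (ν j)))))

    κ : ℕ → ℚ
    κ m = Λ 0 * (signed-factorial m * (fall k m * fall w m))

    ŷ-moment : ∀ m j → j ℕ.≤ m → m ℕ.+ j ℕ.≤ t → 0ℚ < fall (v - ν m) j → fall v m * ΣL (λ d → ŷ m d * fall (k - d) j) ds ≡ κ m * fall k j
    ŷ-moment m j j≤m le A>0 = cancel (begin
      fall A j * (fall v m * ΣL (λ d → ŷ m d * fall (k - d) j) ds)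
        ≡⟨ trans (sym (ℚₚ.*-assoc (fall A j) _ _)) (cong₂ _*_ (trans (ℚₚ.*-comm (fall A j) (fall v m)) (sym (fall-+ v m j))) moments) ⟩
      fall v (m ℕ.+ j) * Δ m (λ i → coeff m i * (Λ (m ℕ.∸ i ℕ.+ j) * (fall k j * fall w (m ℕ.∸ i)))) 0
        ≡⟨ sym (Δ-* m (fall v (m ℕ.+ j)) (λ i → coeff m i * (Λ (m ℕ.∸ i ℕ.+ j) * (fall k j * fall w (m ℕ.∸ i)))) 0) ⟩
      Δ m (λ i → fall v (m ℕ.+ j) * (coeff m i * (Λ (m ℕ.∸ i ℕ.+ j) * (fall k j * fall w (m ℕ.∸ i))))) 0
        ≡⟨ Δ-cong m 0 (λ i _ i≤ → summand m j i j≤m le (below i≤)) ⟩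
      Δ m (λ i → (Λ 0 * (fall k m * fall w m) * fall k j * fall A j) * (fall (k - ν m + ν i) j * fall (A - ν j + ν i) (m ℕ.∸ j))) 0
        ≡⟨ Δ-* m (Λ 0 * (fall k m * fall w m) * fall k j * fall A j) (λ i → fall (k - ν m + ν i) j * fall (A - ν j + ν i) (m ℕ.∸ j)) 0 ⟩
      (Λ 0 * (fall k m * fall w m) * fall k j * fall A j) * Δ m (λ i → fall (k - ν m + ν i) j * fall (A - ν j + ν i) (m ℕ.∸ j)) 0
        ≡⟨ cong ((Λ 0 * (fall k m * fall w m) * fall k j * fall A j) *_) (monic 0) ⟩
      (Λ 0 * (fall k m * fall w m) * fall k j * fall A j) * signed-factorial m
        ≡⟨ S.solve 5 (λ l a b c d → (l S.:* a S.:* b S.:* c) S.:* d S.:= c S.:* ((l S.:* (d S.:* a)) S.:* b)) refl (Λ 0) (fall k m * fall w m) (fall k j) (fall A j) (signed-factorial m) ⟩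
      fall A j * (κ m * fall k j) ∎)
      where
      open ≡-Reasoning
      A = v - ν m
      below : ∀ {i} → i ℕ.≤ m ℕ.+ 0 → i ℕ.≤ m
      below i≤ = ℕₚ.≤-trans i≤ (ℕₚ.≤-reflexive (ℕₚ.+-identityʳ m))
      cancel : ∀ {p q} → fall A j * p ≡ fall A j * q → p ≡ q
      cancel e = ℚₚ.≤-antisym (*-cancel≤ A>0 (ℚₚ.≤-reflexive e)) (*-cancel≤ A>0 (ℚₚ.≤-reflexive (sym e)))
      monic : Monic m (λ i → fall (k - ν m + ν i) j * fall (A - ν j + ν i) (m ℕ.∸ j))
      monic = subst (λ n → Monic n (λ i → fall (k - ν m + ν i) j * fall (A - ν j + ν i) (m ℕ.∸ j))) (ℕₚ.m+[n∸m]≡n j≤m)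
        (Monic-fall {m ℕ.∸ j} (k - ν m) j (subst (λ n → Monic n (λ i → fall (A - ν j + ν i) (m ℕ.∸ j))) (ℕₚ.+-identityʳ (m ℕ.∸ j))
          (Monic-cong {m ℕ.∸ j ℕ.+ 0} (λ i → ℚₚ.*-identityʳ _) (Monic-fall {0} {λ _ → 1ℚ} (A - ν j) (m ℕ.∸ j) (λ _ → refl)))))
      moments : ΣL (λ d → ŷ m d * fall (k - d) j) ds ≡ Δ m (λ i → coeff m i * (Λ (m ℕ.∸ i ℕ.+ j) * (fall k j * fall w (m ℕ.∸ i)))) 0
      moments = trans (ΣL-cong (λ d → trans (ℚₚ.*-comm (ŷ m d) (fall (k - d) j)) (sym (Δ-* m (fall (k - d) j) (λ i → coeff m i * fall d (m ℕ.∸ i)) 0))) ds)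
        (trans (ΣL-Δ m (λ d i → fall (k - d) j * (coeff m i * fall d (m ℕ.∸ i))) 0 ds)
        (Δ-cong m 0 λ i _ i≤ → trans (ΣL-cong (λ d → S.solve 3 (λ a b c → a S.:* (b S.:* c) S.:= b S.:* (a S.:* c)) refl (fall (k - d) j) (coeff m i) (fall d (m ℕ.∸ i))) ds)
          (trans (ΣL-* (coeff m i) (λ d → fall (k - d) j * fall d (m ℕ.∸ i)) ds)
          (cong (coeff m i *_) (mixed-moment (m ℕ.∸ i) j (ℕₚ.≤-trans (ℕₚ.+-monoˡ-≤ j (ℕₚ.m∸n≤m m i)) le))))))

    ŷ-0 : ∀ m → ŷ m 0ℚ ≡ sign m * (fall k m * fall w m)
    ŷ-0 m = trans (Δ-last m (λ i → coeff m i * fall 0ℚ (m ℕ.∸ i)) 0 vanish) (cong (sign m *_) (trans (cong f (ℕₚ.+-identityʳ m)) last))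
      where
      f : ℕ → ℚ
      f i = coeff m i * fall 0ℚ (m ℕ.∸ i)
      fall-0 : ∀ n → 0 ℕ.< n → fall 0ℚ n ≡ 0ℚ
      fall-0 (suc n) _ = ℚₚ.*-zeroˡ (fall (0ℚ - 1ℚ) n)
      vanish : ∀ j → 0 ℕ.≤ j → j ℕ.< m ℕ.+ 0 → f j ≡ 0ℚ
      vanish j _ j<m = trans (cong (coeff m j *_) (fall-0 (m ℕ.∸ j) (ℕₚ.m<n⇒0<n∸m (ℕₚ.<-≤-trans j<m (ℕₚ.≤-reflexive (ℕₚ.+-identityʳ m)))))) (ℚₚ.*-zeroʳ (coeff m j))
      last : f m ≡ fall k m * fall w m
      last = trans (cong (λ r → fall (k - ν r) m * fall (w - ν r) m * fall (v - ν m) r * fall 0ℚ r) (ℕₚ.n∸n≡0 m))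
        (trans (cong₂ (λ x y → fall x m * fall y m * 1ℚ * 1ℚ) (-‿0 k) (-‿0 w)) (S.solve 2 (λ a b → a S.:* b S.:* S.con 1ℚ S.:* S.con 1ℚ S.:= a S.:* b) refl (fall k m) (fall w m)))

    module _ (m : ℕ) (2m≤t : m ℕ.+ m ℕ.≤ t) (A>0 : ∀ j → j ℕ.≤ m → 0ℚ < fall (v - ν m) j) where
      private
        -- The moments are known for the falling factorials of k - d, whereas h is built from
        -- factors d - δ. Carrying `fall (k - d) j` along absorbs each such factor, since d - δ = (k
        -- - j - δ) - (k - d - j).
        reproduce′ : ∀ {n c h} → Deg n c h → ∀ j → j ℕ.+ n ℕ.≤ m → fall v m * ΣL (λ d → ŷ m d * (fall (k - d) j * h d)) ds ≡ κ m * (fall k j * h 0ℚ)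
        reproduce′ {c = c} {h} (const e) j le = begin
          fall v m * ΣL (λ d → ŷ m d * (fall (k - d) j * h d)) ds
            ≡⟨ cong (fall v m *_) (trans (ΣL-cong (λ d → trans (cong (λ x → ŷ m d * (fall (k - d) j * x)) (e d)) (S.solve 3 (λ a b c → a S.:* (b S.:* c) S.:= c S.:* (a S.:* b)) refl (ŷ m d) (fall (k - d) j) c)) ds)
                 (ΣL-* c (λ d → ŷ m d * fall (k - d) j) ds)) ⟩
          fall v m * (c * ΣL (λ d → ŷ m d * fall (k - d) j) ds)
            ≡⟨ S.solve 3 (λ a b c → a S.:* (b S.:* c) S.:= b S.:* (a S.:* c)) refl (fall v m) c (ΣL (λ d → ŷ m d * fall (k - d) j) ds) ⟩
          c * (fall v m * ΣL (λ d → ŷ m d * fall (k - d) j) ds)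
            ≡⟨ cong (c *_) (ŷ-moment m j j≤m (ℕₚ.≤-trans (ℕₚ.+-monoʳ-≤ m j≤m) 2m≤t) (A>0 j j≤m)) ⟩
          c * (κ m * fall k j)
            ≡⟨ trans (S.solve 3 (λ a b c → a S.:* (b S.:* c) S.:= b S.:* (c S.:* a)) refl c (κ m) (fall k j)) (cong (λ x → κ m * (fall k j * x)) (sym (e 0ℚ))) ⟩
          κ m * (fall k j * h 0ℚ) ∎
          where
          open ≡-Reasoning
          j≤m : j ℕ.≤ m
          j≤m = ℕₚ.≤-trans (ℕₚ.m≤m+n j 0) le
        reproduce′ {h = f} (step {n} {h = h} e δ D eq) j le = begin
          fall v m * ΣL (λ d → ŷ m d * (fall (k - d) j * f d)) ds
            ≡⟨ cong (fall v m *_) (trans (ΣL-cong expand ds) (trans (ΣL-+ (λ d → e * Φ₁ d + a * Φ₂ d) (λ d → (- 1ℚ) * Φ₃ d) ds)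
                 (cong₂ _+_ (trans (ΣL-+ (λ d → e * Φ₁ d) (λ d → a * Φ₂ d) ds) (cong₂ _+_ (ΣL-* e Φ₁ ds) (ΣL-* a Φ₂ ds))) (ΣL-* (- 1ℚ) Φ₃ ds)))) ⟩
          fall v m * (e * ΣL Φ₁ ds + a * ΣL Φ₂ ds + (- 1ℚ) * ΣL Φ₃ ds)
            ≡⟨ S.solve 6 (λ F e x a y z → F S.:* (e S.:* x S.:+ a S.:* y S.:+ (S.:- S.con 1ℚ) S.:* z) S.:= e S.:* (F S.:* x) S.:+ a S.:* (F S.:* y) S.:+ (S.:- S.con 1ℚ) S.:* (F S.:* z)) refl
                 (fall v m) e (ΣL Φ₁ ds) a (ΣL Φ₂ ds) (ΣL Φ₃ ds) ⟩
          e * (fall v m * ΣL Φ₁ ds) + a * (fall v m * ΣL Φ₂ ds) + (- 1ℚ) * (fall v m * ΣL Φ₃ ds)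
            ≡⟨ cong₂ _+_ (cong₂ (λ x y → e * x + a * y) (reproduce′ (const λ _ → refl) j (ℕₚ.≤-trans (ℕₚ.+-monoʳ-≤ j z≤n) le)) (reproduce′ D j (ℕₚ.≤-trans (ℕₚ.+-monoʳ-≤ j (ℕₚ.n≤1+n n)) le)))
                 (cong ((- 1ℚ) *_) (trans (reproduce′ D (suc j) (ℕₚ.≤-trans (ℕₚ.≤-reflexive (sym (ℕₚ.+-suc j n))) le)) (cong (λ x → κ m * (x * h 0ℚ)) (fall-snoc k j)))) ⟩
          e * (κ m * (fall k j * 1ℚ)) + a * (κ m * (fall k j * h 0ℚ)) + (- 1ℚ) * (κ m * (fall k j * (k - ν j) * h 0ℚ))
            ≡⟨ S.solve 7 (λ e K f k j d h → e S.:* (K S.:* (f S.:* S.con 1ℚ)) S.:+ (k S.:- j S.:- d) S.:* (K S.:* (f S.:* h)) S.:+ (S.:- S.con 1ℚ) S.:* (K S.:* (f S.:* (k S.:- j) S.:* h))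
                 S.:= K S.:* (f S.:* (e S.:+ (S.con 0ℚ S.:- d) S.:* h))) refl e (κ m) (fall k j) k (ν j) δ (h 0ℚ) ⟩
          κ m * (fall k j * (e + (0ℚ - δ) * h 0ℚ))
            ≡⟨ cong (λ x → κ m * (fall k j * x)) (sym (eq 0ℚ)) ⟩
          κ m * (fall k j * f 0ℚ) ∎
          where
          open ≡-Reasoning
          a = k - ν j - δ
          Φ₁ Φ₂ Φ₃ : ℚ → ℚ
          Φ₁ d = ŷ m d * (fall (k - d) j * 1ℚ)
          Φ₂ d = ŷ m d * (fall (k - d) j * h d)
          Φ₃ d = ŷ m d * (fall (k - d) (suc j) * h d)
          expand : ∀ d → ŷ m d * (fall (k - d) j * f d) ≡ e * Φ₁ d + a * Φ₂ d + (- 1ℚ) * Φ₃ d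
          expand d = trans (cong (λ x → ŷ m d * (fall (k - d) j * x)) (eq d))
            (trans (S.solve 8 (λ y f e d δ h k j → y S.:* (f S.:* (e S.:+ (d S.:- δ) S.:* h)) S.:= e S.:* (y S.:* (f S.:* S.con 1ℚ)) S.:+ (k S.:- j S.:- δ) S.:* (y S.:* (f S.:* h)) S.:+ (S.:- S.con 1ℚ) S.:* (y S.:* (f S.:* ((k S.:- d) S.:- j) S.:* h))) refl
              (ŷ m d) (fall (k - d) j) e d δ (h d) k (ν j))
            (cong (λ x → e * Φ₁ d + a * Φ₂ d + (- 1ℚ) * (ŷ m d * (x * h d))) (sym (fall-snoc (k - d) j))))

      reproduce : ∀ {n c h} → Deg n c h → n ℕ.≤ m → fall v m * ΣL (λ d → ŷ m d * h d) ds ≡ κ m * h 0ℚ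
      reproduce {h = h} D n≤m = trans (cong (fall v m *_) (ΣL-cong (λ d → cong (ŷ m d *_) (sym (ℚₚ.*-identityˡ (h d)))) ds)) (trans (reproduce′ D 0 n≤m) (cong (κ m *_) (ℚₚ.*-identityˡ (h 0ℚ))))

-- Expansions in falling factorials, and the divisibility conditions.

module NewtonForm where
  open Rationals
  open Polynomials using (sgn; α; hornerFrom; horner; ℚ-raw)
  open RootWindows using (roots→poly)
  open SmallCase using (rise; pairs; Integral)
  open DesignCounts using (fall; ι-suc)
  open ReproducingKernel
  open import Data.Nat as ℕ using (ℕ; zero; suc; z≤n; s≤s)
  import Data.Nat.Properties as ℕₚ
  open import Data.Nat.Divisibility using (_∣_; divides)
  open import Data.Nat.Combinatorics using (nCk+nC[k+1]≡[n+1]C[k+1]; k>n⇒nCk≡0) renaming (_C_ to binom)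
  open import Data.Integer as ℤ using (ℤ) renaming (+_ to pos)
  import Data.Integer.Properties as ℤₚ
  open import Data.Rational using (ℚ; 0ℚ; 1ℚ; _+_; _*_; -_; _-_; _<_)
  import Data.Rational.Properties as ℚₚ
  import Data.Integer.Solver as ℤSolver
  import Data.Nat.Solver as ℕSolver
  open import Data.List using (List; []; _∷_; length)
  open import Relation.Binary.PropositionalEquality

  module Zₛ = ℤSolver.+-*-Solver
  module Nₛ = ℕSolver.+-*-Solver

  -- Newton's interpolation form with nodes r, r+1, ..., evaluated by Horner's rule. In this basis
  -- both the kernel polynomial and products of X - δ have explicit coefficients.
  newton : ℕ → ℕ → (ℕ → ℚ) → ℚ → ℚ
  newton r zero    c X = c r
  newton r (suc n) c X = c r + (X - ν r) * newton (suc r) n c X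

  newton-Deg : ∀ r n c → Deg n (c (r ℕ.+ n)) (newton r n c)
  newton-Deg r zero    c = subst (λ i → Deg 0 (c i) (newton r 0 c)) (sym (ℕₚ.+-identityʳ r)) (const λ _ → refl)
  newton-Deg r (suc n) c = step (c r) (ν r) (subst (λ i → Deg n (c i) (newton (suc r) n c)) (sym (ℕₚ.+-suc r n)) (newton-Deg (suc r) n c)) λ _ → refl

  newton-* : ∀ t r n c X → newton r n (λ i → t * c i) X ≡ t * newton r n c X
  newton-* t r zero    c X = refl
  newton-* t r (suc n) c X = trans (cong (λ y → t * c r + (X - ν r) * y) (newton-* t (suc r) n c X))
    (S.solve 4 (λ t a x y → t S.:* a S.:+ x S.:* (t S.:* y) S.:= t S.:* (a S.:+ x S.:* y)) refl t (c r) (X - ν r) (newton (suc r) n c X))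

  private
    add-cancel : ∀ x {p q} → x + p ≡ x + q → p ≡ q
    add-cancel x {p} {q} e = trans (S.solve 2 (λ x p → p S.:= (x S.:+ p) S.:- x) refl x p) (trans (cong (λ y → y - x) e) (S.solve 2 (λ x p → (x S.:+ p) S.:- x S.:= p) refl x q))

    cancelˡ : ∀ {x p q} → 0ℚ < x → x * p ≡ x * q → p ≡ q
    cancelˡ x>0 e = ℚₚ.≤-antisym (*-cancel≤ x>0 (ℚₚ.≤-reflexive e)) (*-cancel≤ x>0 (ℚₚ.≤-reflexive (sym e)))

  -- At the first node only the first coefficient survives; once it is cancelled, the next node
  -- isolates the next coefficient.
  newton-unique : ∀ r n c e → (∀ i → newton r n c (ν (r ℕ.+ i)) ≡ newton r n e (ν (r ℕ.+ i))) → ∀ i → i ℕ.≤ n → c (r ℕ.+ i) ≡ e (r ℕ.+ i)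
  newton-unique r zero    c e h zero _ = trans (cong c (ℕₚ.+-identityʳ r)) (trans (h 0) (cong e (sym (ℕₚ.+-identityʳ r))))
  newton-unique r (suc n) c e h = λ where
      zero    _        → trans (cong c (ℕₚ.+-identityʳ r)) (trans head (cong e (sym (ℕₚ.+-identityʳ r))))
      (suc i) (s≤s i≤) → trans (cong c (ℕₚ.+-suc r i)) (trans (newton-unique (suc r) n c e tail i i≤) (cong e (sym (ℕₚ.+-suc r i))))
    where
    at : ∀ c → newton r (suc n) c (ν (r ℕ.+ 0)) ≡ c r
    at c = trans (cong (λ x → c r + x * newton (suc r) n c (ν (r ℕ.+ 0))) (trans (cong (λ i → ν i - ν r) (ℕₚ.+-identityʳ r)) (ℚₚ.+-inverseʳ (ν r))))
      (trans (cong (c r +_) (ℚₚ.*-zeroˡ (newton (suc r) n c (ν (r ℕ.+ 0))))) (ℚₚ.+-identityʳ (c r)))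
    head : c r ≡ e r
    head = trans (sym (at c)) (trans (h 0) (at e))
    tail : ∀ i → newton (suc r) n c (ν (suc r ℕ.+ i)) ≡ newton (suc r) n e (ν (suc r ℕ.+ i))
    tail i = cancelˡ {ν (suc r ℕ.+ i) - ν r} gap (add-cancel (c r) (trans (subst (λ m → newton r (suc n) c (ν m) ≡ newton r (suc n) e (ν m)) (ℕₚ.+-suc r i) (h (suc i))) (cong (_+ (ν (suc r ℕ.+ i) - ν r) * newton (suc r) n e (ν (suc r ℕ.+ i))) (sym head))))
      where
      gap : 0ℚ < ν (suc r ℕ.+ i) - ν r
      gap = <⇒0<- (ι-mono-< (ℤ.+<+ (s≤s (ℕₚ.m≤m+n r i))))

  -- Newton coefficients of the product of the X - δ
  elementary : List ℤ → ℕ → ℤ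
  elementary []       zero    = pos 1
  elementary []       (suc i) = pos 0
  elementary (δ ∷ δs) zero    = (pos 0 ℤ.- δ) ℤ.* elementary δs 0
  elementary (δ ∷ δs) (suc i) = (pos (suc i) ℤ.- δ) ℤ.* elementary δs (suc i) ℤ.+ elementary δs i

  elementary-vanishes : ∀ δs i → length δs ℕ.< i → elementary δs i ≡ pos 0
  elementary-vanishes []       (suc i) _ = refl
  elementary-vanishes (δ ∷ δs) (suc i) (s≤s lt) = trans (cong₂ (λ x y → (pos (suc i) ℤ.- δ) ℤ.* x ℤ.+ y) (elementary-vanishes δs (suc i) (ℕₚ.m≤n⇒m≤1+n lt)) (elementary-vanishes δs i lt))
    (trans (ℤₚ.+-identityʳ _) (ℤₚ.*-zeroʳ (pos (suc i) ℤ.- δ)))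

  newton-trim : ∀ r n c X → c (r ℕ.+ suc n) ≡ 0ℚ → newton r (suc n) c X ≡ newton r n c X
  newton-trim r zero    c X e = trans (cong (λ y → c r + (X - ν r) * y) (trans (cong c (ℕₚ.+-comm 1 r)) e)) (S.solve 2 (λ a x → a S.:+ x S.:* S.con 0ℚ S.:= a) refl (c r) (X - ν r))
  newton-trim r (suc n) c X e = cong (λ y → c r + (X - ν r) * y) (newton-trim (suc r) n c X (trans (cong c (sym (ℕₚ.+-suc r (suc n)))) e))

  newton-elementary : ∀ δs X → roots→poly δs X ≡ newton 0 (length δs) (λ i → ι (elementary δs i)) X
  newton-elementary []       X = sym ι-1
  newton-elementary (δ ∷ δs) X = begin
    (X - ι δ) * roots→poly δs X                     ≡⟨ cong ((X - ι δ) *_) (trans (newton-elementary δs X) (sym (newton-trim 0 (length δs) e X top))) ⟩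
    (X - ι δ) * (e 0 + (X - ν 0) * newton 1 (length δs) e X)
      ≡⟨ S.solve 5 (λ x d z a n → (x S.:- d) S.:* (a S.:+ (x S.:- z) S.:* n) S.:= (z S.:- d) S.:* a S.:+ (x S.:- z) S.:* (a S.:+ (x S.:- d) S.:* n)) refl X (ι δ) (ν 0) (e 0) (newton 1 (length δs) e X) ⟩
    (ν 0 - ι δ) * e 0 + (X - ν 0) * (e 0 + (X - ι δ) * newton 1 (length δs) e X)
      ≡⟨ sym (cong₂ (λ a b → a + (X - ν 0) * b) e′-0 (shifted (length δs) 0 top)) ⟩
    e′ 0 + (X - ν 0) * newton 1 (length δs) e′ X ∎
    where
    open ≡-Reasoning
    e e′ : ℕ → ℚ
    e i = ι (elementary δs i)
    e′ i = ι (elementary (δ ∷ δs) i)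
    top : e (suc (length δs)) ≡ 0ℚ
    top = trans (cong ι (elementary-vanishes δs (suc (length δs)) ℕₚ.≤-refl)) ι-0
    ι-sub : ∀ i → ι (pos i ℤ.- δ) ≡ ν i - ι δ
    ι-sub i = trans (ι-+ (pos i) (ℤ.- δ)) (cong (ν i +_) (ι-neg δ))
    e′-0 : e′ 0 ≡ (ν 0 - ι δ) * e 0
    e′-0 = trans (ι-* (pos 0 ℤ.- δ) (elementary δs 0)) (cong (_* e 0) (ι-sub 0))
    e′-suc : ∀ i → e′ (suc i) ≡ (ν (suc i) - ι δ) * e (suc i) + e i
    e′-suc i = trans (ι-+ ((pos (suc i) ℤ.- δ) ℤ.* elementary δs (suc i)) (elementary δs i)) (cong (_+ e i) (trans (ι-* (pos (suc i) ℤ.- δ) (elementary δs (suc i))) (cong (_* e (suc i)) (ι-sub (suc i)))))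
    shifted : ∀ n r → e (suc r ℕ.+ n) ≡ 0ℚ → newton (suc r) n e′ X ≡ e r + (X - ι δ) * newton (suc r) n e X
    shifted zero    r z = trans (e′-suc r) (trans (cong (λ x → (ν (suc r) - ι δ) * x + e r) z′) (trans (S.solve 3 (λ a b x → x S.:* S.con 0ℚ S.:+ a S.:= a S.:+ b S.:* S.con 0ℚ) refl (e r) (X - ι δ) (ν (suc r) - ι δ)) (cong (λ x → e r + (X - ι δ) * x) (sym z′))))
      where
      z′ : e (suc r) ≡ 0ℚ
      z′ = trans (cong (λ i → e (suc i)) (sym (ℕₚ.+-identityʳ r))) z
    shifted (suc n) r z = trans (cong₂ (λ a b → a + (X - ν (suc r)) * b) (e′-suc r) (shifted n (suc r) (trans (cong e (cong suc (sym (ℕₚ.+-suc r n)))) z)))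
      (S.solve 6 (λ x d z a b n → ((z S.:- d) S.:* b S.:+ a) S.:+ (x S.:- z) S.:* (b S.:+ (x S.:- d) S.:* n) S.:= a S.:+ (x S.:- d) S.:* (b S.:+ (x S.:- z) S.:* n)) refl
        X (ι δ) (ν (suc r)) (e r) (e (suc r)) (newton (suc (suc r)) n e X))

  Σ≤ : ℕ → (ℕ → ℚ) → ℚ
  Σ≤ zero    f = f 0
  Σ≤ (suc n) f = Σ≤ n f + f (suc n)

  Σ≤-cong : ∀ n {f g : ℕ → ℚ} → (∀ i → i ℕ.≤ n → f i ≡ g i) → Σ≤ n f ≡ Σ≤ n g
  Σ≤-cong zero    h = h 0 z≤n
  Σ≤-cong (suc n) h = cong₂ _+_ (Σ≤-cong n λ i i≤n → h i (ℕₚ.m≤n⇒m≤1+n i≤n)) (h (suc n) ℕₚ.≤-refl)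

  altBinomial : ℕ → ℕ → ℚ
  altBinomial m j = ι (sgn ℚ-raw j ℤ.* pos (binom m j))

  altBinomial-0 : ∀ m → altBinomial m 0 ≡ 1ℚ
  altBinomial-0 m = ι-1

  altBinomial-pascal : ∀ m j → altBinomial (suc m) (suc j) ≡ altBinomial m (suc j) - altBinomial m j
  altBinomial-pascal m j = trans (cong ι (trans (cong (λ c → sgn ℚ-raw (suc j) ℤ.* pos c) (sym (nCk+nC[k+1]≡[n+1]C[k+1] m j)))
      (trans (cong (sgn ℚ-raw (suc j) ℤ.*_) (ℤₚ.pos-+ (binom m j) (binom m (suc j))))
      (Zₛ.solve 3 (λ s a b → (Zₛ.:- s) Zₛ.:* (a Zₛ.:+ b) Zₛ.:= (Zₛ.:- s) Zₛ.:* b Zₛ.:+ Zₛ.:- (s Zₛ.:* a)) refl (sgn ℚ-raw j) (pos (binom m j)) (pos (binom m (suc j)))))))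
    (trans (ι-+ _ (ℤ.- (sgn ℚ-raw j ℤ.* pos (binom m j)))) (cong (altBinomial m (suc j) +_) (ι-neg _)))

  Δ-binomial : ∀ m f i → Δ m f i ≡ Σ≤ m (λ j → altBinomial m j * f (j ℕ.+ i))
  Δ-binomial zero    f i = sym (trans (cong (_* f i) (altBinomial-0 0)) (ℚₚ.*-identityˡ (f i)))
  Δ-binomial (suc m) f i = begin
    Δ m f i - Δ m f (suc i)              ≡⟨ cong₂ (λ a b → a - b) (Δ-binomial m f i) (Δ-binomial m f (suc i)) ⟩
    Σ≤ m F - Σ≤ m F′                     ≡⟨ cong (λ x → x - Σ≤ m F′) (sym (trans (cong (Σ≤ m F +_) top) (ℚₚ.+-identityʳ (Σ≤ m F)))) ⟩
    Σ≤ (suc m) F - Σ≤ m F′               ≡⟨ sym (pascal m) ⟩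
    Σ≤ (suc m) (λ j → altBinomial (suc m) j * f (j ℕ.+ i)) ∎
    where
    open ≡-Reasoning
    F F′ : ℕ → ℚ
    F j = altBinomial m j * f (j ℕ.+ i)
    F′ j = altBinomial m j * f (j ℕ.+ suc i)
    top : F (suc m) ≡ 0ℚ
    top = trans (cong (_* f (suc m ℕ.+ i)) (trans (cong (λ c → ι (sgn ℚ-raw (suc m) ℤ.* pos c)) (k>n⇒nCk≡0 (ℕₚ.n<1+n m))) (trans (cong ι (ℤₚ.*-zeroʳ (sgn ℚ-raw (suc m)))) ι-0))) (ℚₚ.*-zeroˡ (f (suc m ℕ.+ i)))
    next : ∀ j → altBinomial (suc m) (suc j) * f (suc j ℕ.+ i) ≡ F (suc j) - F′ j
    next j = trans (cong (_* f (suc j ℕ.+ i)) (altBinomial-pascal m j))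
      (trans (S.solve 3 (λ a b f → (a S.:- b) S.:* f S.:= a S.:* f S.:- b S.:* f) refl (altBinomial m (suc j)) (altBinomial m j) (f (suc j ℕ.+ i)))
      (cong (λ n → F (suc j) - altBinomial m j * f n) (sym (ℕₚ.+-suc j i))))
    pascal : ∀ n → Σ≤ (suc n) (λ j → altBinomial (suc m) j * f (j ℕ.+ i)) ≡ Σ≤ (suc n) F - Σ≤ n F′
    pascal zero    = trans (cong₂ _+_ (cong (_* f i) (trans (altBinomial-0 (suc m)) (sym (altBinomial-0 m)))) (next 0))
      (S.solve 3 (λ a b c → a S.:+ (b S.:- c) S.:= a S.:+ b S.:- c) refl (F 0) (F 1) (F′ 0))
    pascal (suc n) = trans (cong₂ _+_ (pascal n) (next (suc n)))
      (S.solve 4 (λ a b c d → (a S.:- b) S.:+ (c S.:- d) S.:= (a S.:+ c) S.:- (b S.:+ d)) refl (Σ≤ (suc n) F) (Σ≤ n F′) (F (suc (suc n))) (F′ (suc n)))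

  newton-fall : ∀ s (c : ℕ → ℚ) X j r → j ℕ.+ r ≡ s → newton r j (λ i → c (s ℕ.∸ i)) X * fall X r ≡ Σ≤ j (λ i → c i * fall X (s ℕ.∸ i))
  newton-fall s c X zero    r refl = cong (λ i → c i * fall X r) (ℕₚ.n∸n≡0 r)
  newton-fall s c X (suc j) r e = begin
    (c (s ℕ.∸ r) + (X - ν r) * newton (suc r) j c′ X) * fall X r
      ≡⟨ S.solve 4 (λ a x n f → (a S.:+ x S.:* n) S.:* f S.:= n S.:* (f S.:* x) S.:+ a S.:* f) refl (c (s ℕ.∸ r)) (X - ν r) (newton (suc r) j c′ X) (fall X r) ⟩
    newton (suc r) j c′ X * (fall X r * (X - ν r)) + c (s ℕ.∸ r) * fall X r
      ≡⟨ cong₂ _+_ (trans (cong (newton (suc r) j c′ X *_) (sym (fall-snoc X r))) (newton-fall s c X j (suc r) (trans (ℕₚ.+-suc j r) e)))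
           (cong₂ (λ i i′ → c i * fall X i′) (trans (cong (ℕ._∸ r) (sym e)) (ℕₚ.m+n∸n≡m (suc j) r)) (sym (trans (cong (ℕ._∸ suc j) (sym e)) (ℕₚ.m+n∸m≡n (suc j) r)))) ⟩
    Σ≤ j (λ i → c i * fall X (s ℕ.∸ i)) + c (suc j) * fall X (s ℕ.∸ suc j) ∎
    where
    open ≡-Reasoning
    c′ : ℕ → ℚ
    c′ i = c (s ℕ.∸ i)

  rise-+ : ∀ N i j → rise N (i ℕ.+ j) ≡ rise N i ℕ.* rise (N ℕ.+ i) j
  rise-+ N i zero    = trans (cong (rise N) (ℕₚ.+-identityʳ i)) (sym (ℕₚ.*-identityʳ _))
  rise-+ N i (suc j) = trans (cong (rise N) (ℕₚ.+-suc i j)) (trans (cong₂ ℕ._*_ (rise-+ N i j) (sym (ℕₚ.+-assoc N i j))) (ℕₚ.*-assoc (rise N i) _ _))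

  rise>0 : ∀ N j → 0 ℕ.< rise (suc N) j
  rise>0 N zero    = s≤s z≤n
  rise>0 N (suc j) = ℕₚ.*-mono-≤ (rise>0 N j) (s≤s (z≤n {N ℕ.+ j}))

  0<ν : ∀ {n} → 0 ℕ.< n → 0ℚ < ν n
  0<ν {suc n} _ = 0<ι n

  fall-rise : ∀ M r → fall (ν (M ℕ.+ r)) r ≡ ν (rise (suc M) r)
  fall-rise M zero    = sym ι-1
  fall-rise M (suc r) = trans (cong₂ _*_ (cong ν (ℕₚ.+-suc M r)) (trans (cong (λ x → fall x r) (trans (cong (λ x → x - 1ℚ) (trans (cong ν (ℕₚ.+-suc M r)) (ν-suc (M ℕ.+ r)))) (S.solve 1 (λ x → (x S.:+ S.con 1ℚ) S.:- S.con 1ℚ S.:= x) refl (ν (M ℕ.+ r))))) (fall-rise M r)))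
    (trans (ℚₚ.*-comm (ν (suc M ℕ.+ r)) (ν (rise (suc M) r))) (sym (ι-ℕ* (rise (suc M) r) (suc M ℕ.+ r))))

  pairs-rise : ∀ a b i → pairs a b i ≡ rise (suc a) i ℕ.* rise (suc b) i
  pairs-rise a b zero    = refl
  pairs-rise a b (suc i) = trans (cong₂ (λ x y → x ℕ.* y) (pairs-rise a b i) (cong₂ ℕ._*_ (ℕₚ.+-suc a i) (ℕₚ.+-suc b i)))
    (Nₛ.solve 4 (λ x y u w → (x Nₛ.:* y) Nₛ.:* (u Nₛ.:* w) Nₛ.:= (x Nₛ.:* u) Nₛ.:* (y Nₛ.:* w)) refl (rise (suc a) i) (rise (suc b) i) (suc a ℕ.+ i) (suc b ℕ.+ i))

  module Expansion (s a b : ℕ) where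
    N = suc (a ℕ.+ b)

    coefficient : ℕ → ℚ
    coefficient j = altBinomial s j * (ν (pairs a b j) * ν (rise (N ℕ.+ j) (s ℕ.∸ j)))

    polynomial : ℚ → ℚ
    polynomial = newton 0 s (λ i → coefficient (s ℕ.∸ i))

    leading : ℚ
    leading = ν (rise N s)

    leading>0 : 0ℚ < leading
    leading>0 = 0<ν (rise>0 (a ℕ.+ b) s)

    coefficient-0 : coefficient 0 ≡ leading
    coefficient-0 = trans (cong₂ _*_ (altBinomial-0 s) (cong₂ (λ x n → x * ν (rise n s)) ι-1 (ℕₚ.+-identityʳ N))) (S.solve 1 (λ x → S.con 1ℚ S.:* (S.con 1ℚ S.:* x) S.:= x) refl leading)

    polynomial-Deg : Deg s leading polynomial
    polynomial-Deg = subst (λ c → Deg s c polynomial) (trans (cong coefficient (ℕₚ.n∸n≡0 s)) coefficient-0) (newton-Deg 0 s (λ i → coefficient (s ℕ.∸ i)))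

    -- Invariant of the Horner loop: Y collects the terms 0 to j, whose still missing factors N+j,
    -- ..., N+s-1 are supplied by `rise (N + j) r`. The relation NG = Q turns each α into
    -- (a+1+j)(b+1+j).
    hornerFrom-newton : ∀ {G : ℚ} → ν N * G ≡ ν (suc a ℕ.* suc b) → ∀ l p j r Y → j ℕ.+ r ≡ s →
      Y * ν (rise (N ℕ.+ j) r) ≡ l ^ j * newton r j (λ i → coefficient (s ℕ.∸ i)) p →
      hornerFrom ℚ-raw s (ν N) G l (l * p) j r Y (ν (pairs a b j)) (l ^ j) ≡ l ^ s * polynomial p
    hornerFrom-newton NG l p j zero Y e h = trans (sym (trans (cong (Y *_) ι-1) (ℚₚ.*-identityʳ Y)))
      (trans h (cong (λ n → l ^ n * newton 0 n (λ i → coefficient (s ℕ.∸ i)) p) (trans (sym (ℕₚ.+-identityʳ j)) e)))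
    hornerFrom-newton {G} NG l p j (suc r) Y e h = trans (cong (λ A → hornerFrom ℚ-raw s (ν N) G l (l * p) (suc j) r (next A) A (l ^ suc j)) α-pairs)
      (hornerFrom-newton NG l p (suc j) r (next (ν (pairs a b (suc j)))) e′ (begin
        next (ν P′) * ν R
          ≡⟨ cong (λ x → ((ν N + ν j) * (l * p + x * l) * Y + B * (l ^ suc j * ν P′)) * ν R) (ι-neg (pos r)) ⟩
        ((ν N + ν j) * (l * p + (- ν r) * l) * Y + B * (l ^ suc j * ν P′)) * ν R
          ≡⟨ S.solve 9 (λ n l p r Y B L P R → (n S.:* (l S.:* p S.:+ (S.:- r) S.:* l) S.:* Y S.:+ B S.:* (L S.:* P)) S.:* R S.:= l S.:* (p S.:- r) S.:* (Y S.:* (n S.:* R)) S.:+ L S.:* (B S.:* (P S.:* R))) refl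
               (ν N + ν j) l p (ν r) Y B (l ^ suc j) (ν P′) (ν R) ⟩
        l * (p - ν r) * (Y * ((ν N + ν j) * ν R)) + l ^ suc j * (B * (ν P′ * ν R))
          ≡⟨ cong₂ (λ x y → l * (p - ν r) * x + l ^ suc j * y) (trans (cong (Y *_) rise-front) h) (cong (λ n → B * (ν P′ * ν (rise (N ℕ.+ suc j) n))) r≡) ⟩
        l * (p - ν r) * (l ^ j * newton (suc r) j c p) + l ^ suc j * coefficient (suc j)
          ≡⟨ S.solve 5 (λ l x L n c → l S.:* x S.:* (L S.:* n) S.:+ l S.:* L S.:* c S.:= l S.:* L S.:* (c S.:+ x S.:* n)) refl l (p - ν r) (l ^ j) (newton (suc r) j c p) (coefficient (suc j)) ⟩
        l ^ suc j * (coefficient (suc j) + (p - ν r) * newton (suc r) j c p)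
          ≡⟨ cong (λ i → l ^ suc j * (coefficient i + (p - ν r) * newton (suc r) j c p)) sj≡ ⟩
        l ^ suc j * newton r (suc j) c p ∎))
      where
      open ≡-Reasoning
      c : ℕ → ℚ
      c i = coefficient (s ℕ.∸ i)
      P′ = pairs a b (suc j)
      R = rise (N ℕ.+ suc j) r
      B = altBinomial s (suc j)
      next : ℚ → ℚ
      next A = ((ν N + ν j) * (l * p + ι (ℤ.- pos r) * l)) * Y + B * (l * l ^ j * A)
      e′ : suc j ℕ.+ r ≡ s
      e′ = trans (sym (ℕₚ.+-suc j r)) e
      r≡ : r ≡ s ℕ.∸ suc j
      r≡ = sym (trans (cong (ℕ._∸ suc j) (sym e′)) (ℕₚ.m+n∸m≡n (suc j) r))
      sj≡ : suc j ≡ s ℕ.∸ r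
      sj≡ = sym (trans (cong (ℕ._∸ r) (sym e′)) (ℕₚ.m+n∸n≡m (suc j) r))
      rise-front : (ν N + ν j) * ν R ≡ ν (rise (N ℕ.+ j) (suc r))
      rise-front = trans (cong₂ (λ x n → x * ν (rise n r)) (sym (ν-+ N j)) (trans (ℕₚ.+-suc N j) (ℕₚ.+-comm 1 (N ℕ.+ j))))
        (trans (sym (ι-ℕ* (N ℕ.+ j) (rise (N ℕ.+ j ℕ.+ 1) r))) (cong ν (trans (cong (ℕ._* rise (N ℕ.+ j ℕ.+ 1) r) (sym (trans (ℕₚ.*-identityˡ (N ℕ.+ j ℕ.+ 0)) (ℕₚ.+-identityʳ (N ℕ.+ j))))) (sym (rise-+ (N ℕ.+ j) 1 r)))))
      α-pairs : α ℚ-raw (ν N) G j * ν (pairs a b j) ≡ ν (pairs a b (suc j))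
      α-pairs = trans (cong (_* ν (pairs a b j)) (begin
        ν N * (G + ν j) + ν (j ℕ.+ j ℕ.* j)          ≡⟨ cong (_+ ν (j ℕ.+ j ℕ.* j)) (trans (ℚₚ.*-distribˡ-+ (ν N) G (ν j)) (cong₂ _+_ NG (sym (ι-ℕ* N j)))) ⟩
        ν (suc a ℕ.* suc b) + ν (N ℕ.* j) + ν (j ℕ.+ j ℕ.* j) ≡⟨ sym (trans (ν-+ (suc a ℕ.* suc b ℕ.+ N ℕ.* j) (j ℕ.+ j ℕ.* j)) (cong (_+ ν (j ℕ.+ j ℕ.* j)) (ν-+ (suc a ℕ.* suc b) (N ℕ.* j)))) ⟩
        ν (suc a ℕ.* suc b ℕ.+ N ℕ.* j ℕ.+ (j ℕ.+ j ℕ.* j)) ≡⟨ cong ν (Nₛ.solve 3 (λ a b j → (Nₛ.con 1 Nₛ.:+ a) Nₛ.:* (Nₛ.con 1 Nₛ.:+ b) Nₛ.:+ (Nₛ.con 1 Nₛ.:+ (a Nₛ.:+ b)) Nₛ.:* j Nₛ.:+ (j Nₛ.:+ j Nₛ.:* j) Nₛ.:= (a Nₛ.:+ (Nₛ.con 1 Nₛ.:+ j)) Nₛ.:* (b Nₛ.:+ (Nₛ.con 1 Nₛ.:+ j))) refl a b j) ⟩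
        ν ((a ℕ.+ suc j) ℕ.* (b ℕ.+ suc j)) ∎))
        (trans (ℚₚ.*-comm (ν ((a ℕ.+ suc j) ℕ.* (b ℕ.+ suc j))) (ν (pairs a b j))) (sym (ι-ℕ* (pairs a b j) ((a ℕ.+ suc j) ℕ.* (b ℕ.+ suc j)))))

    horner-newton : ∀ {G : ℚ} → ν N * G ≡ ν (suc a ℕ.* suc b) → ∀ l p → horner ℚ-raw s (ν N) G l (l * p) ≡ l ^ s * polynomial p
    horner-newton {G} NG l p = trans (cong (λ x → hornerFrom ℚ-raw s (ν N) G l (l * p) 0 s x x x) ι-1)
      (trans (cong (λ x → hornerFrom ℚ-raw s (ν N) G l (l * p) 0 s 1ℚ x 1ℚ) (sym ι-1))
      (hornerFrom-newton NG l p 0 s 1ℚ refl (trans (ℚₚ.*-identityˡ _) (trans (cong (λ n → ν (rise n s)) (ℕₚ.+-identityʳ N))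
        (sym (trans (ℚₚ.*-identityˡ (coefficient (s ℕ.∸ s))) (trans (cong coefficient (ℕₚ.n∸n≡0 s)) coefficient-0)))))))

    module Split (δs : List ℤ) (degree : length δs ≡ s) (splits : ∀ X → polynomial X ≡ leading * roots→poly δs X) where
      -- In the basis of falling factorials a product of X - δ with integral δ has integral
      -- coefficients. Each coefficient of the kernel polynomial is therefore an integral multiple
      -- of the leading one, N...(N+s-1), and cancelling (N+j)...(N+s-1) leaves the divisibility.
      integral : Integral s a b
      integral j j≤s = divides ℤ.∣ e ∣ (begin
        binom s j ℕ.* pairs a b j                  ≡⟨ sym (trans (ℤₚ.abs-* (sgn ℚ-raw j ℤ.* pos (binom s j)) (pos (pairs a b j)))
                                                         (cong (ℕ._* pairs a b j) (trans (ℤₚ.abs-* (sgn ℚ-raw j) (pos (binom s j))) (trans (cong (ℕ._* binom s j) (∣sgn∣ j)) (ℕₚ.*-identityˡ (binom s j)))))) ⟩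
        ℤ.∣ sgn ℚ-raw j ℤ.* pos (binom s j) ℤ.* pos (pairs a b j) ∣ ≡⟨ cong ℤ.∣_∣ quotient ⟩
        ℤ.∣ e ℤ.* pos (rise N j) ∣                 ≡⟨ ℤₚ.abs-* e (pos (rise N j)) ⟩
        ℤ.∣ e ∣ ℕ.* rise N j                        ∎)
        where
        open ≡-Reasoning
        ∣sgn∣ : ∀ j → ℤ.∣ sgn ℚ-raw j ∣ ≡ 1
        ∣sgn∣ zero    = refl
        ∣sgn∣ (suc j) = trans (ℤₚ.∣-i∣≡∣i∣ (sgn ℚ-raw j)) (∣sgn∣ j)
        e = elementary δs (s ℕ.∸ j)
        expand : ∀ X → leading * roots→poly δs X ≡ newton 0 s (λ i → leading * ι (elementary δs i)) X
        expand X = trans (cong (leading *_) (trans (newton-elementary δs X) (cong (λ n → newton 0 n (λ i → ι (elementary δs i)) X) degree))) (sym (newton-* leading 0 s (λ i → ι (elementary δs i)) X))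
        at : coefficient j ≡ leading * ι e
        at = trans (cong coefficient (sym (ℕₚ.m∸[m∸n]≡n j≤s)))
          (newton-unique 0 s (λ i → coefficient (s ℕ.∸ i)) (λ i → leading * ι (elementary δs i)) (λ i → trans (splits (ν i)) (expand (ν i))) (s ℕ.∸ j) (ℕₚ.m∸n≤m s j))
        R = rise (N ℕ.+ j) (s ℕ.∸ j)
        lead : leading ≡ ν (rise N j) * ν R
        lead = trans (cong ν (trans (cong (rise N) (sym (ℕₚ.m+[n∸m]≡n j≤s))) (rise-+ N j (s ℕ.∸ j)))) (ι-ℕ* (rise N j) R)
        quotient : sgn ℚ-raw j ℤ.* pos (binom s j) ℤ.* pos (pairs a b j) ≡ e ℤ.* pos (rise N j)
        quotient = ι-injective (cancelˡ (0<ν (rise>0 (a ℕ.+ b ℕ.+ j) (s ℕ.∸ j))) (begin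
          ν R * ι (sgn ℚ-raw j ℤ.* pos (binom s j) ℤ.* pos (pairs a b j)) ≡⟨ cong (ν R *_) (ι-* _ (pos (pairs a b j))) ⟩
          ν R * (altBinomial s j * ν (pairs a b j))  ≡⟨ S.solve 3 (λ a b c → a S.:* (b S.:* c) S.:= b S.:* (c S.:* a)) refl (ν R) (altBinomial s j) (ν (pairs a b j)) ⟩
          coefficient j                              ≡⟨ trans at (cong (_* ι e) lead) ⟩
          ν (rise N j) * ν R * ι e                   ≡⟨ S.solve 3 (λ a b c → a S.:* b S.:* c S.:= b S.:* (c S.:* a)) refl (ν (rise N j)) (ν R) (ι e) ⟩
          ν R * (ι e * ν (rise N j))                 ≡⟨ cong (ν R *_) (sym (ι-* e (pos (rise N j)))) ⟩
          ν R * ι (e ℤ.* pos (rise N j))             ∎))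

      form : ∀ {G : ℚ} → ν N * G ≡ ν (suc a ℕ.* suc b) → ∀ l p → horner ℚ-raw s (ν N) G l (l * p) ≡ (leading * l ^ s) * roots→poly δs p
      form NG l p = trans (horner-newton NG l p) (trans (cong (l ^ s *_) (splits p)) (S.solve 3 (λ a b c → a S.:* (b S.:* c) S.:= (b S.:* a) S.:* c) refl (l ^ s) leading (roots→poly δs p)))

-- The polynomial of a tight design splits over the integers.

module TightDesigns where
  open import Defs
  open Rationals
  open Polynomials using (horner; ℚ-raw)
  open RootWindows using (roots→poly)
  open SmallCase using (Integral; pairs; rise)
  open DesignCounts using (fall; ι-suc; ΣL; ΣL-map; ΣL-cong; misses; misses-self; module Counts)
  open ReproducingKernel
  open NewtonForm
  open import Data.Nat as ℕ using (ℕ; zero; suc; z≤n; s≤s)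
  import Data.Nat.Properties as ℕₚ
  open import Data.Nat.Combinatorics using (nCk+nC[k+1]≡[n+1]C[k+1]; k>n⇒nCk≡0) renaming (_C_ to binom)
  open import Data.Integer as ℤ using (ℤ) renaming (+_ to pos)
  import Data.Integer.Properties as ℤₚ
  open import Data.Rational as ℚ using (ℚ; 0ℚ; 1ℚ; _+_; _*_; -_; _-_; _≤_; _<_)
  import Data.Rational.Properties as ℚₚ
  open import Data.Fin.Subset using (Subset; ∣_∣)
  open import Data.List as List using (List; []; _∷_; length; take; deduplicate)
  open import Data.List.Properties using (length-take)
  open import Data.List.Membership.Propositional using (_∈_)
  open import Data.List.Membership.Propositional.Properties using (∈-deduplicate⁺)
  open import Data.List.Relation.Unary.Any using (here; there)
  open import Data.List.Relation.Unary.All as All using (All; []; _∷_)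
  import Data.List.Relation.Unary.All.Properties as Allₚ
  open import Data.List.Relation.Unary.AllPairs using ([]; _∷_)
  import Data.List.Relation.Unary.AllPairs.Properties as AllPairsₚ
  open import Data.List.Relation.Unary.Unique.DecPropositional.Properties ℤ._≟_ using (deduplicate-!)
  open import Data.Sum using (inj₁; inj₂)
  open import Data.Product using (_×_; _,_; ∃-syntax)
  open import Data.Empty using (⊥; ⊥-elim)
  open import Relation.Nullary using (yes; no)
  open import Relation.Binary.PropositionalEquality

  0<⇒≢0 : ∀ {x} → 0ℚ < x → x ≢ 0ℚ
  0<⇒≢0 lt refl = ℚₚ.<-irrefl refl lt

  zero-product : ∀ {x y} → x ≢ 0ℚ → x * y ≡ 0ℚ → y ≡ 0ℚ
  zero-product {x} {y} x≢0 e = trans (sym (ℚₚ.*-identityˡ y)) (trans (cong (_* y) (sym (ℚₚ.*-inverseˡ x))) (trans (ℚₚ.*-assoc (ℚ.1/ x) x y) (trans (cong (ℚ.1/ x *_) e) (ℚₚ.*-zeroʳ (ℚ.1/ x)))))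
    where instance _ = ℚ.≢-nonZero x≢0

  *-≢0 : ∀ {x y} → x ≢ 0ℚ → y ≢ 0ℚ → x * y ≢ 0ℚ
  *-≢0 x≢0 y≢0 e = y≢0 (zero-product x≢0 e)

  neg-≢0 : ∀ {x} → x ≢ 0ℚ → - x ≢ 0ℚ
  neg-≢0 {x} x≢0 e = x≢0 (trans (S.solve 1 (λ x → x S.:= S.:- (S.:- x)) refl x) (cong -_ e))

  *-cancelˡ-≢0 : ∀ {x y z} → x ≢ 0ℚ → x * y ≡ x * z → y ≡ z
  *-cancelˡ-≢0 {x} {y} {z} x≢0 e = trans (S.solve 2 (λ y z → y S.:= z S.:+ (y S.:- z)) refl y z)
    (trans (cong (z +_) (zero-product x≢0 (trans (S.solve 3 (λ x y z → x S.:* (y S.:- z) S.:= x S.:* y S.:- x S.:* z) refl x y z) (trans (cong (λ u → u - x * z) e) (ℚₚ.+-inverseʳ (x * z)))))) (ℚₚ.+-identityʳ z))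

  square≥0 : ∀ x → 0ℚ ≤ x * x
  square≥0 x with ℚₚ.≤-total 0ℚ x
  ... | inj₁ h = 0≤* h h
  ... | inj₂ h = subst (0ℚ ≤_) (S.solve 1 (λ s → (S.con 0ℚ S.:- s) S.:* (S.con 0ℚ S.:- s) S.:= s S.:* s) refl x) (0≤* (≤⇒0≤- h) (≤⇒0≤- h))

  Σ-squares : ∀ {A : Set} (f : A → ℚ) xs → ΣL (λ x → f x * f x) xs ≡ 0ℚ → All (λ x → f x ≡ 0ℚ) xs
  Σ-squares f []       _ = []
  Σ-squares {A} f (x ∷ xs) e with f x ℚₚ.≟ 0ℚ
  ... | yes z = z ∷ Σ-squares f xs (trans (sym (ℚₚ.+-identityˡ _)) (trans (cong (_+ ΣL (λ x → f x * f x) xs) (sym (trans (cong (λ y → y * y) z) (ℚₚ.*-zeroˡ 0ℚ)))) e))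
  ... | no nz = ⊥-elim (ℚₚ.<-irrefl refl (subst (0ℚ <_) e (0<+ (ℚₚ.≰⇒> λ le → *-≢0 nz nz (ℚₚ.≤-antisym le (square≥0 (f x)))) (sum≥0 xs))))
    where
    sum≥0 : ∀ xs → 0ℚ ≤ ΣL (λ x → f x * f x) xs
    sum≥0 []       = ℚₚ.≤-refl
    sum≥0 (x ∷ xs) = 0≤+ (square≥0 (f x)) (sum≥0 xs)

  sign≢0 : ∀ m → sign m ≢ 0ℚ
  sign≢0 zero    = 0<⇒≢0 (ℚₚ.positive⁻¹ 1ℚ)
  sign≢0 (suc m) = neg-≢0 (sign≢0 m)

  signed-factorial≢0 : ∀ m → signed-factorial m ≢ 0ℚ
  signed-factorial≢0 zero    = 0<⇒≢0 (ℚₚ.positive⁻¹ 1ℚ)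
  signed-factorial≢0 (suc m) = neg-≢0 (*-≢0 (0<⇒≢0 (0<ι m)) (signed-factorial≢0 m))

  fall-binomial : ∀ n k → sign k * fall (ν n) k ≡ signed-factorial k * ν (binom n k)
  fall-binomial n zero    = cong (1ℚ *_) (sym ι-1)
  fall-binomial zero (suc k) = trans (trans (cong (sign (suc k) *_) (trans (cong (_* fall (ν 0 - 1ℚ) k) ι-0) (ℚₚ.*-zeroˡ (fall (ν 0 - 1ℚ) k)))) (ℚₚ.*-zeroʳ (sign (suc k))))
    (sym (trans (cong (λ c → signed-factorial (suc k) * ν c) (k>n⇒nCk≡0 {0} {suc k} (s≤s z≤n))) (trans (cong (signed-factorial (suc k) *_) ι-0) (ℚₚ.*-zeroʳ (signed-factorial (suc k))))))
  fall-binomial (suc n) (suc k) = begin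
    - sign k * (ν (suc n) * fall (ν (suc n) - 1ℚ) k)
      ≡⟨ cong (λ x → - sign k * (x * fall (x - 1ℚ) k)) (ν-suc n) ⟩
    - sign k * ((ν n + 1ℚ) * fall (ν n + 1ℚ - 1ℚ) k)
      ≡⟨ cong (λ x → - sign k * ((ν n + 1ℚ) * fall x k)) (S.solve 1 (λ x → (x S.:+ S.con 1ℚ) S.:- S.con 1ℚ S.:= x) refl (ν n)) ⟩
    - sign k * ((ν n + 1ℚ) * fall (ν n) k)
      ≡⟨ S.solve 4 (λ s n k f → S.:- s S.:* ((n S.:+ S.con 1ℚ) S.:* f) S.:= S.:- s S.:* (f S.:* (n S.:- k)) S.:- (k S.:+ S.con 1ℚ) S.:* (s S.:* f)) refl (sign k) (ν n) (ν k) (fall (ν n) k) ⟩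
    - sign k * (fall (ν n) k * (ν n - ν k)) - (ν k + 1ℚ) * (sign k * fall (ν n) k)
      ≡⟨ cong₂ (λ x y → x - y * (sign k * fall (ν n) k)) (trans (cong (- sign k *_) (sym (fall-snoc (ν n) k))) (fall-binomial n (suc k))) (sym (ν-suc k)) ⟩
    signed-factorial (suc k) * ν (binom n (suc k)) - ν (suc k) * (sign k * fall (ν n) k)
      ≡⟨ cong (λ x → signed-factorial (suc k) * ν (binom n (suc k)) - ν (suc k) * x) (fall-binomial n k) ⟩
    signed-factorial (suc k) * ν (binom n (suc k)) - ν (suc k) * (signed-factorial k * ν (binom n k))
      ≡⟨ S.solve 4 (λ a f x y → S.:- (a S.:* f) S.:* x S.:- a S.:* (f S.:* y) S.:= S.:- (a S.:* f) S.:* (y S.:+ x)) refl (ν (suc k)) (signed-factorial k) (ν (binom n (suc k))) (ν (binom n k)) ⟩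
    signed-factorial (suc k) * (ν (binom n k) + ν (binom n (suc k)))
      ≡⟨ cong (signed-factorial (suc k) *_) (trans (sym (ν-+ (binom n k) (binom n (suc k)))) (cong ν (nCk+nC[k+1]≡[n+1]C[k+1] n k))) ⟩
    signed-factorial (suc k) * ν (binom (suc n) (suc k)) ∎
    where open ≡-Reasoning

  binomial>0 : ∀ n k → k ℕ.< n → 0 ℕ.< binom n k
  binomial>0 n k k<n = ℕₚ.n≢0⇒n>0 λ e → *-≢0 (sign≢0 k) (0<⇒≢0 (0<fall k (ι-mono-< (ℤ.+<+ k<n)))) (trans (fall-binomial n k) (trans (cong (λ c → signed-factorial k * ν c) e) (trans (cong (signed-factorial k *_) ι-0) (ℚₚ.*-zeroʳ (signed-factorial k)))))

  binomial-step : ∀ n k → k ℕ.≤ n → binom n k ℕ.* (n ℕ.∸ k) ≡ suc k ℕ.* binom n (suc k)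
  binomial-step n k k≤n = ℤₚ.+-injective (ι-injective (*-cancelˡ-≢0 (signed-factorial≢0 k) (begin
    signed-factorial k * ν (binom n k ℕ.* (n ℕ.∸ k))       ≡⟨ cong (signed-factorial k *_) (trans (ι-ℕ* (binom n k) (n ℕ.∸ k)) (cong (ν (binom n k) *_) (ν-∸ k≤n))) ⟩
    signed-factorial k * (ν (binom n k) * (ν n - ν k))     ≡⟨ trans (sym (ℚₚ.*-assoc (signed-factorial k) _ _)) (cong (_* (ν n - ν k)) (sym (fall-binomial n k))) ⟩
    sign k * fall (ν n) k * (ν n - ν k)                    ≡⟨ trans (ℚₚ.*-assoc (sign k) _ _) (cong (sign k *_) (sym (fall-snoc (ν n) k))) ⟩
    sign k * fall (ν n) (suc k)                            ≡⟨ trans (S.solve 2 (λ a b → a S.:* b S.:= S.:- (S.:- a S.:* b)) refl (sign k) (fall (ν n) (suc k))) (cong -_ (fall-binomial n (suc k))) ⟩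
    - (signed-factorial (suc k) * ν (binom n (suc k)))     ≡⟨ S.solve 3 (λ a f x → S.:- (S.:- (a S.:* f) S.:* x) S.:= f S.:* (a S.:* x)) refl (ν (suc k)) (signed-factorial k) (ν (binom n (suc k))) ⟩
    signed-factorial k * (ν (suc k) * ν (binom n (suc k))) ≡⟨ cong (signed-factorial k *_) (sym (ι-ℕ* (suc k) (binom n (suc k)))) ⟩
    signed-factorial k * ν (suc k ℕ.* binom n (suc k))     ∎)))
    where open ≡-Reasoning

  binomial-increasing : ∀ n k d → 2 ℕ.* (k ℕ.+ suc d) ℕ.< n → binom n k ℕ.< binom n (k ℕ.+ suc d)
  binomial-increasing n k d lt = go d lt
    where
    next : ∀ k → 2 ℕ.* suc k ℕ.< n → binom n k ℕ.< binom n (suc k)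
    next k lt = ℕₚ.*-cancelˡ-< (suc k) (binom n k) (binom n (suc k)) (ℕₚ.<-≤-trans
      (ℕₚ.<-≤-trans (ℕₚ.≤-reflexive (cong suc (ℕₚ.*-comm (suc k) (binom n k)))) (ℕₚ.*-monoʳ-< (binom n k) {{ℕ.>-nonZero (binomial>0 n k k<n)}} gap))
      (ℕₚ.≤-reflexive (binomial-step n k (ℕₚ.<⇒≤ k<n))))
      where
      1+k<n : suc k ℕ.< n
      1+k<n = ℕₚ.≤-<-trans (ℕₚ.m≤n*m (suc k) 2) lt
      k<n : k ℕ.< n
      k<n = ℕₚ.<⇒≤ 1+k<n
      gap : suc k ℕ.< n ℕ.∸ k
      gap = ℕₚ.m+n≤o⇒m≤o∸n (suc (suc k)) (ℕₚ.≤-trans (ℕₚ.≤-trans (ℕₚ.+-monoʳ-≤ (suc (suc k)) (ℕₚ.≤-trans (ℕₚ.n≤1+n k) (ℕₚ.≤-reflexive (sym (ℕₚ.+-identityʳ (suc k)))))) ℕₚ.≤-refl) lt)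
    go : ∀ d → 2 ℕ.* (k ℕ.+ suc d) ℕ.< n → binom n k ℕ.< binom n (k ℕ.+ suc d)
    go zero    lt = subst (λ j → binom n k ℕ.< binom n j) (ℕₚ.+-comm 1 k) (next k (subst (λ j → 2 ℕ.* j ℕ.< n) (ℕₚ.+-comm k 1) lt))
    go (suc d) lt = ℕₚ.<-trans (go d (ℕₚ.≤-<-trans (ℕₚ.*-monoʳ-≤ 2 (ℕₚ.+-monoʳ-≤ k (ℕₚ.n≤1+n (suc d)))) lt))
      (subst (λ j → binom n (k ℕ.+ suc d) ℕ.< binom n j) (sym (ℕₚ.+-suc k (suc d))) (next (k ℕ.+ suc d) (subst (λ j → 2 ℕ.* j ℕ.< n) (ℕₚ.+-suc k (suc d)) lt)))

  Deg-cong : ∀ {n c f g} → (∀ X → g X ≡ f X) → Deg n c f → Deg n c g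
  Deg-cong h (const e)      = const λ X → trans (h X) (e X)
  Deg-cong h (step a δ d e) = step a δ d λ X → trans (h X) (e X)

  roots→poly-vanishes : ∀ δs {δ} → δ ∈ δs → roots→poly δs (ι δ) ≡ 0ℚ
  roots→poly-vanishes (δ ∷ δs) (here refl) = trans (cong (_* roots→poly δs (ι δ)) (ℚₚ.+-inverseʳ (ι δ))) (ℚₚ.*-zeroˡ (roots→poly δs (ι δ)))
  roots→poly-vanishes (δ′ ∷ δs) {δ} (there m) = trans (cong ((ι δ - ι δ′) *_) (roots→poly-vanishes δs m)) (ℚₚ.*-zeroʳ (ι δ - ι δ′))

  roots→poly-0 : ∀ δs → All (λ δ → ι δ ≢ 0ℚ) δs → roots→poly δs 0ℚ ≢ 0ℚ
  roots→poly-0 []       _        = 0<⇒≢0 (ℚₚ.positive⁻¹ 1ℚ)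
  roots→poly-0 (δ ∷ δs) (p ∷ ps) = *-≢0 (λ e → neg-≢0 p (trans (sym (ℚₚ.+-identityˡ (- ι δ))) e)) (roots→poly-0 δs ps)

  module _ {s a b v k λ' : ℕ} {ℬ : List (Subset v)} (k≡ : k ≡ a ℕ.+ s) (v≡ : v ≡ a ℕ.+ b ℕ.+ 2 ℕ.* s) (b>0 : 0 ℕ.< b) (s≤a : s ℕ.≤ a) (s>0 : 0 ℕ.< s)
           (D : IsDesign (2 ℕ.* s) v k λ' ℬ) (blocks : length ℬ ≡ binom v s) where
    open IsDesign D
    open Counts D
    private
      2s<v : 2 ℕ.* s ℕ.< v
      2s<v = ℕₚ.≤-trans (ℕₚ.+-monoˡ-≤ (2 ℕ.* s) (ℕₚ.≤-trans b>0 (ℕₚ.m≤n+m b a))) (ℕₚ.≤-reflexive (sym v≡))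
      s<v : s ℕ.< v
      s<v = ℕₚ.≤-<-trans (ℕₚ.m≤n*m s 2) 2s<v

      module At (B₀ : Subset v) (rest : List (Subset v)) (ℬ≡ : ℬ ≡ B₀ ∷ rest) where
        distance : Subset v → ℤ
        distance B = pos (misses B B₀)
        ds : List ℚ
        ds = List.map (λ B → ι (distance B)) ℬ
        size : ∣ B₀ ∣ ≡ k
        size = All.head (subst (All (λ B → ∣ B ∣ ≡ k)) ℬ≡ blockSize)
        open Moments ds (ν k) (ν v) Λ (2 ℕ.* s) Λ-step (λ j j≤ → trans (ΣL-map (λ B → ι (distance B)) (λ d → fall (ν k - d) j) ℬ) (moment B₀ size j j≤))
        f : ℚ → ℚ
        f = ŷ s
        polynomial≡ : ∀ X → f X ≡ Expansion.polynomial s a b X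
        polynomial≡ X = begin
          Δ s (λ i → coeff s i * fall X (s ℕ.∸ i)) 0
            ≡⟨ Δ-binomial s (λ i → coeff s i * fall X (s ℕ.∸ i)) 0 ⟩
          Σ≤ s (λ j → altBinomial s j * (coeff s (j ℕ.+ 0) * fall X (s ℕ.∸ (j ℕ.+ 0))))
            ≡⟨ Σ≤-cong s (λ j j≤s → trans (cong (λ i → altBinomial s j * (coeff s i * fall X (s ℕ.∸ i))) (ℕₚ.+-identityʳ j)) (trans (sym (ℚₚ.*-assoc (altBinomial s j) _ _)) (cong (λ c → altBinomial s j * c * fall X (s ℕ.∸ j)) (coeff≡ j j≤s)))) ⟩
          Σ≤ s (λ j → Expansion.coefficient s a b j * fall X (s ℕ.∸ j))
            ≡⟨ sym (newton-fall s (Expansion.coefficient s a b) X s 0 (ℕₚ.+-identityʳ s)) ⟩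
          newton 0 s (λ i → Expansion.coefficient s a b (s ℕ.∸ i)) X * 1ℚ
            ≡⟨ ℚₚ.*-identityʳ _ ⟩
          Expansion.polynomial s a b X ∎
          where
          open ≡-Reasoning
          coeff≡ : ∀ j → j ℕ.≤ s → coeff s j ≡ ν (pairs a b j) * ν (rise (suc (a ℕ.+ b) ℕ.+ j) (s ℕ.∸ j))
          coeff≡ j j≤s = cong₂ _*_ (trans (cong₂ (λ x y → fall x j * fall y j) (node a (cong ν k≡)) (node b w≡)) (trans (cong₂ _*_ (fall-rise a j) (fall-rise b j)) (trans (sym (ι-ℕ* (rise (suc a) j) (rise (suc b) j))) (cong ν (sym (pairs-rise a b j))))))
            (trans (cong (λ x → fall x (s ℕ.∸ j)) (trans (sym (ν-∸ (ℕₚ.<⇒≤ s<v))) (cong ν (trans (cong (ℕ._∸ s) (trans v≡ v-split)) (ℕₚ.m+n∸n≡m (a ℕ.+ b ℕ.+ j ℕ.+ (s ℕ.∸ j)) s))))) (fall-rise (a ℕ.+ b ℕ.+ j) (s ℕ.∸ j)))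
            where
            v-split : a ℕ.+ b ℕ.+ 2 ℕ.* s ≡ a ℕ.+ b ℕ.+ j ℕ.+ (s ℕ.∸ j) ℕ.+ s
            v-split = trans (cong (a ℕ.+ b ℕ.+_) (cong (s ℕ.+_) (ℕₚ.+-identityʳ s))) (trans (sym (ℕₚ.+-assoc (a ℕ.+ b) s s)) (cong (ℕ._+ s) (trans (cong (a ℕ.+ b ℕ.+_) (sym (ℕₚ.m+[n∸m]≡n j≤s))) (sym (ℕₚ.+-assoc (a ℕ.+ b) j (s ℕ.∸ j))))))
            w≡ : ν v - ν k ≡ ν (b ℕ.+ s)
            w≡ = trans (cong₂ (λ x y → ν x - ν y) (trans v≡ (Nₛ.solve 3 (λ a b s → a Nₛ.:+ b Nₛ.:+ Nₛ.con 2 Nₛ.:* s Nₛ.:= (b Nₛ.:+ s) Nₛ.:+ (a Nₛ.:+ s)) refl a b s)) k≡) (trans (cong (λ x → x - ν (a ℕ.+ s)) (ν-+ (b ℕ.+ s) (a ℕ.+ s))) (S.solve 2 (λ x y → (x S.:+ y) S.:- y S.:= x) refl (ν (b ℕ.+ s)) (ν (a ℕ.+ s))))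
            node : ∀ c {x} → x ≡ ν (c ℕ.+ s) → x - ν (s ℕ.∸ j) ≡ ν (c ℕ.+ j)
            node c refl = trans (cong₂ (λ x y → x - y) (ν-+ c s) (ν-∸ j≤s)) (trans (S.solve 3 (λ c s j → (c S.:+ s) S.:- (s S.:- j) S.:= c S.:+ j) refl (ν c) (ν s) (ν j)) (sym (ν-+ c j)))

        A>0 : ∀ m j → m ℕ.≤ s → j ℕ.≤ m → 0ℚ < fall (ν v - ν m) j
        A>0 m j m≤s j≤m = 0<fall j (subst (ν j <_) (ν-∸ (ℕₚ.≤-trans m≤s (ℕₚ.<⇒≤ s<v))) (ι-mono-< (ℤ.+<+ (ℕₚ.m+n≤o⇒m≤o∸n (suc j) (ℕₚ.≤-trans (s≤s (ℕₚ.+-mono-≤ (ℕₚ.≤-trans j≤m m≤s) (ℕₚ.≤-trans m≤s (ℕₚ.≤-reflexive (sym (ℕₚ.+-identityʳ s)))))) 2s<v)))))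
        2m≤t : ∀ {m} → m ℕ.≤ s → m ℕ.+ m ℕ.≤ 2 ℕ.* s
        2m≤t m≤s = ℕₚ.+-mono-≤ m≤s (ℕₚ.≤-trans m≤s (ℕₚ.≤-reflexive (sym (ℕₚ.+-identityʳ s))))
        fall-k≢0 : ∀ m → m ℕ.≤ s → fall (ν k) m * fall w m ≢ 0ℚ
        fall-k≢0 m m≤s = *-≢0 (0<⇒≢0 (0<fall m (ι-mono-< (ℤ.+<+ m<k)))) (0<⇒≢0 (0<fall m (subst (ν m <_) (ν-∸ k≤v) (ι-mono-< (ℤ.+<+ m<w)))))
          where
          m<k : m ℕ.< k
          m<k = ℕₚ.≤-<-trans m≤s (ℕₚ.≤-trans (ℕₚ.+-mono-≤ (ℕₚ.≤-trans s>0 s≤a) (ℕₚ.≤-refl {s})) (ℕₚ.≤-reflexive (sym k≡)))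
          m<w : m ℕ.< v ℕ.∸ k
          m<w = ℕₚ.m+n≤o⇒m≤o∸n (suc m) (ℕₚ.≤-trans (ℕₚ.+-mono-≤ (ℕₚ.+-mono-≤ b>0 m≤s) (ℕₚ.≤-reflexive k≡)) (ℕₚ.≤-reflexive (trans (Nₛ.solve 3 (λ a b s → (b Nₛ.:+ s) Nₛ.:+ (a Nₛ.:+ s) Nₛ.:= a Nₛ.:+ b Nₛ.:+ Nₛ.con 2 Nₛ.:* s) refl a b s) (sym v≡))))
        ŷ-0≢0 : ∀ m → m ℕ.≤ s → ŷ m 0ℚ ≢ 0ℚ
        ŷ-0≢0 m m≤s e = *-≢0 (sign≢0 m) (fall-k≢0 m m≤s) (trans (sym (ŷ-0 m)) e)
        fall-v≢0 : ∀ m → m ℕ.≤ s → fall (ν v) m ≢ 0ℚ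
        fall-v≢0 m m≤s = 0<⇒≢0 (0<fall m (ι-mono-< (ℤ.+<+ (ℕₚ.≤-<-trans m≤s s<v))))
        κ≡ : ∀ m → m ℕ.≤ s → κ m * ν (binom v m) ≡ Λ 0 * (fall (ν v) m * ŷ m 0ℚ)
        κ≡ m m≤s = begin
          Λ 0 * (signed-factorial m * (fall (ν k) m * fall w m)) * ν (binom v m)   ≡⟨ S.solve 4 (λ l s f c → l S.:* (s S.:* f) S.:* c S.:= l S.:* ((s S.:* c) S.:* f)) refl (Λ 0) (signed-factorial m) (fall (ν k) m * fall w m) (ν (binom v m)) ⟩
          Λ 0 * ((signed-factorial m * ν (binom v m)) * (fall (ν k) m * fall w m)) ≡⟨ cong (λ x → Λ 0 * (x * (fall (ν k) m * fall w m))) (sym (fall-binomial v m)) ⟩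
          Λ 0 * (sign m * fall (ν v) m * (fall (ν k) m * fall w m))                ≡⟨ S.solve 4 (λ l s f c → l S.:* (s S.:* f S.:* c) S.:= l S.:* (f S.:* (s S.:* c))) refl (Λ 0) (sign m) (fall (ν v) m) (fall (ν k) m * fall w m) ⟩
          Λ 0 * (fall (ν v) m * (sign m * (fall (ν k) m * fall w m)))              ≡⟨ cong (λ x → Λ 0 * (fall (ν v) m * x)) (sym (ŷ-0 m)) ⟩
          Λ 0 * (fall (ν v) m * ŷ m 0ℚ)                                            ∎
          where open ≡-Reasoning
        -- Tightness enters here, as the value C(v,s) of the number of blocks. For m = s the two
        -- binomial coefficients cancel; for m < s they do not, and a g of degree m supported at 0
        -- would force them to agree.
        kernel : ∀ m → m ℕ.≤ s → ∀ {n c g} → Deg n c g → n ℕ.≤ m → ν (binom v m) * ΣL (λ d → ŷ m d * g d) ds ≡ ν (binom v s) * (ŷ m 0ℚ * g 0ℚ)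
        kernel m m≤s {g = g} d n≤m = *-cancelˡ-≢0 (fall-v≢0 m m≤s) (begin
          fall (ν v) m * (ν (binom v m) * Σg)       ≡⟨ S.solve 3 (λ a b c → a S.:* (b S.:* c) S.:= b S.:* (a S.:* c)) refl (fall (ν v) m) (ν (binom v m)) Σg ⟩
          ν (binom v m) * (fall (ν v) m * Σg)       ≡⟨ cong (ν (binom v m) *_) (reproduce m (2m≤t m≤s) (λ j → A>0 m j m≤s) d n≤m) ⟩
          ν (binom v m) * (κ m * g 0ℚ)              ≡⟨ trans (S.solve 3 (λ a b c → a S.:* (b S.:* c) S.:= b S.:* a S.:* c) refl (ν (binom v m)) (κ m) (g 0ℚ)) (cong (_* g 0ℚ) (κ≡ m m≤s)) ⟩
          Λ 0 * (fall (ν v) m * ŷ m 0ℚ) * g 0ℚ      ≡⟨ S.solve 4 (λ a b c d → a S.:* (b S.:* c) S.:* d S.:= b S.:* (a S.:* (c S.:* d))) refl (Λ 0) (fall (ν v) m) (ŷ m 0ℚ) (g 0ℚ) ⟩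
          fall (ν v) m * (Λ 0 * (ŷ m 0ℚ * g 0ℚ))    ≡⟨ cong (λ x → fall (ν v) m * (x * (ŷ m 0ℚ * g 0ℚ))) (trans Λ-zero (cong ν blocks)) ⟩
          fall (ν v) m * (ν (binom v s) * (ŷ m 0ℚ * g 0ℚ)) ∎)
          where
          open ≡-Reasoning
          Σg = ΣL (λ d → ŷ m d * g d) ds
        others : List ℤ
        others = List.map distance rest
        ds-sum : ∀ h → ΣL h ds ≡ h 0ℚ + ΣL (λ δ → h (ι δ)) others
        ds-sum h = trans (cong (λ ℬ → ΣL h (List.map (λ B → ι (distance B)) ℬ)) ℬ≡)
          (cong₂ _+_ (cong h (trans (cong ν (misses-self B₀)) ι-0)) (trans (ΣL-map (λ B → ι (distance B)) h rest) (sym (ΣL-map distance (λ δ → h (ι δ)) rest))))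
        f-Deg : Deg s (Expansion.leading s a b) f
        f-Deg = Deg-cong polynomial≡ (Expansion.polynomial-Deg s a b)
        -- With g = ŷ the sum of all ŷ(d)² equals ŷ(0)², and `B₀` alone already contributes this
        -- amount; the remaining squares add up to 0.
        zeros : All (λ δ → f (ι δ) ≡ 0ℚ) others
        zeros = Σ-squares (λ δ → f (ι δ)) others (trans (S.solve 2 (λ x y → y S.:= (x S.:+ y) S.:- x) refl (f 0ℚ * f 0ℚ) (ΣL (λ δ → f (ι δ) * f (ι δ)) others))
          (trans (cong (λ x → x - f 0ℚ * f 0ℚ) (trans (sym (ds-sum (λ d → f d * f d))) (*-cancelˡ-≢0 (0<⇒≢0 (0<ν (binomial>0 v s s<v))) (kernel s ℕₚ.≤-refl f-Deg ℕₚ.≤-refl)))) (ℚₚ.+-inverseʳ (f 0ℚ * f 0ℚ))))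
        X : List ℤ
        X = deduplicate ℤ._≟_ others
        X-zeros : All (λ δ → f (ι δ) ≡ 0ℚ) X
        X-zeros = Allₚ.deduplicate⁺ ℤ._≟_ zeros
        enough : s ℕ.≤ length X
        enough = ℕₚ.≮⇒≥ λ m<s → absurd (length X) refl m<s
          where
          g = roots→poly X
          g0≢0 : g 0ℚ ≢ 0ℚ
          -- The distance 0 does not occur among the others, since ŷ(0) ≠ 0; in particular no block
          -- is repeated.
          g0≢0 = roots→poly-0 X (All.map (λ {δ} z e → ŷ-0≢0 s ℕₚ.≤-refl (trans (cong f (sym e)) z)) X-zeros)
          absurd : ∀ m → m ≡ length X → m ℕ.< s → ⊥
          absurd m m≡ m<s = ℕₚ.<-irrefl binomials (subst (λ j → binom v m ℕ.< binom v j) s≡ (binomial-increasing v m (s ℕ.∸ suc m) (subst (λ j → 2 ℕ.* j ℕ.< v) (sym s≡) 2s<v)))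
            where
            m≤s = ℕₚ.<⇒≤ m<s
            s≡ : m ℕ.+ suc (s ℕ.∸ suc m) ≡ s
            s≡ = trans (ℕₚ.+-suc m (s ℕ.∸ suc m)) (ℕₚ.m+[n∸m]≡n m<s)
            g-sum : ΣL (λ d → ŷ m d * g d) ds ≡ ŷ m 0ℚ * g 0ℚ
            g-sum = trans (ds-sum (λ d → ŷ m d * g d)) (trans (cong (ŷ m 0ℚ * g 0ℚ +_) (vanish others λ δ∈ → ∈-deduplicate⁺ ℤ._≟_ δ∈)) (ℚₚ.+-identityʳ _))
              where
              vanish : ∀ δs → (∀ {δ} → δ ∈ δs → δ ∈ X) → ΣL (λ δ → ŷ m (ι δ) * g (ι δ)) δs ≡ 0ℚ
              vanish []       _ = refl
              vanish (δ ∷ δs) h = trans (cong₂ _+_ (trans (cong (ŷ m (ι δ) *_) (roots→poly-vanishes X (h (here refl)))) (ℚₚ.*-zeroʳ (ŷ m (ι δ)))) (vanish δs (λ m → h (there m)))) (ℚₚ.+-identityʳ 0ℚ)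
            binomials : binom v m ≡ binom v s
            binomials = ℤₚ.+-injective (ι-injective (*-cancelˡ-≢0 (*-≢0 (ŷ-0≢0 m m≤s) g0≢0) (begin
              (ŷ m 0ℚ * g 0ℚ) * ν (binom v m)                  ≡⟨ trans (ℚₚ.*-comm (ŷ m 0ℚ * g 0ℚ) (ν (binom v m))) (cong (ν (binom v m) *_) (sym g-sum)) ⟩
              ν (binom v m) * ΣL (λ d → ŷ m d * g d) ds        ≡⟨ kernel m m≤s (Deg-roots X) (ℕₚ.≤-reflexive (sym m≡)) ⟩
              ν (binom v s) * (ŷ m 0ℚ * g 0ℚ)                  ≡⟨ ℚₚ.*-comm (ν (binom v s)) (ŷ m 0ℚ * g 0ℚ) ⟩
              (ŷ m 0ℚ * g 0ℚ) * ν (binom v s)                  ∎)))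
              where open ≡-Reasoning
        δs : List ℤ
        δs = take s X
        degree : length δs ≡ s
        degree = trans (length-take s X) (ℕₚ.m≤n⇒m⊓n≡m enough)
        splits : ∀ x → Expansion.polynomial s a b x ≡ Expansion.leading s a b * roots→poly δs x
        splits x = trans (sym (polynomial≡ x)) (factor-theorem f-Deg δs degree (AllPairsₚ.take⁺ s (deduplicate-! others)) (Allₚ.take⁺ s X-zeros) x)

    tight-splits : ∃[ δs ] (length δs ≡ s × (∀ x → Expansion.polynomial s a b x ≡ Expansion.leading s a b * roots→poly δs x))
    tight-splits = nonempty ℬ refl
      where
      nonempty : ∀ ℬ′ → ℬ ≡ ℬ′ → ∃[ δs ] (length δs ≡ s × (∀ x → Expansion.polynomial s a b x ≡ Expansion.leading s a b * roots→poly δs x))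
      nonempty []         e = ⊥-elim (ℕₚ.<-irrefl (trans (cong length (sym e)) blocks) (binomial>0 v s s<v))
      nonempty (B₀ ∷ rest) e = At.δs B₀ rest e , At.degree B₀ rest e , At.splits B₀ rest e

-- Balanced parameters, and the combination of all cases.

module Exclusion where
  open import Defs
  open Rationals
  open Polynomials using (horner; ℚ-raw)
  open Regions
  open SignTests
  open LargeCase
  open RootWindows using (roots→poly)
  open SmallCase
  open ReproducingKernel using (ν; ν-+)
  open NewtonForm using (0<ν; module Expansion)
  open TightDesigns
  open Certificates
  open Searches
  open import Data.Nat as ℕ using (ℕ; zero; suc; z≤n; s≤s)
  import Data.Nat.Properties as ℕₚ
  open import Data.Nat.Divisibility using (_∣_; divides; ∣⇒≤; ∣m+n∣m⇒∣n; ∣n⇒∣m*n; ∣-trans; n∣m*n)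
  open import Data.Nat.Combinatorics using () renaming (_C_ to binom)
  open import Data.Bool using (true)
  import Data.Nat.Solver as ℕSolver
  open import Data.Integer as ℤ using (ℤ; -[1+_]) renaming (+_ to pos)
  open import Data.Rational as ℚ using (ℚ; 0ℚ; 1ℚ; _+_; _*_; -_; _-_; _≤_; _<_)
  import Data.Rational.Properties as ℚₚ
  open import Data.Fin.Subset using (Subset)
  open import Data.List using (List; length)
  open import Data.Product using (_,_; proj₁; proj₂; ∃-syntax)
  open import Data.Sum using (_⊎_; inj₁; inj₂; [_,_]′)
  open import Data.Unit using (tt)
  open import Data.Empty using (⊥; ⊥-elim)
  open import Relation.Nullary using (Dec; yes; no; ¬_)
  open import Relation.Binary.PropositionalEquality

  module Nn = ℕSolver.+-*-Solver

  pairs-swap : ∀ a b j → pairs a b j ≡ pairs b a j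
  pairs-swap a b zero    = refl
  pairs-swap a b (suc j) = cong₂ ℕ._*_ (pairs-swap a b j) (ℕₚ.*-comm (a ℕ.+ suc j) (b ℕ.+ suc j))

  Integral-swap : ∀ {s a b} → Integral s a b → Integral s b a
  Integral-swap {s} {a} {b} int j j≤s = subst₂ (λ n p → rise (suc n) j ∣ binom s j ℕ.* p) (ℕₚ.+-comm a b) (pairs-swap a b j) (int j j≤s)

  IsSmall-swap : ∀ {ϑ₀ a b} → IsSmall ϑ₀ a b → IsSmall ϑ₀ b a
  IsSmall-swap {ϑ₀} {a} {b} = subst₂ (λ n q → q ℕ.* q ℕ.< ϑ₀ ℕ.* (suc n ℕ.* suc n ℕ.* (suc n ℕ.+ 2))) (ℕₚ.+-comm a b) (ℕₚ.*-comm (suc a) (suc b))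

  -- This says |b - a| ≤ 1, because N(N+2) - 4Q = (b-a)² - 1.
  Balanced : ℕ → ℕ → Set
  Balanced a b = suc (a ℕ.+ b) ℕ.* (suc (a ℕ.+ b) ℕ.+ 2) ℕ.≤ 4 ℕ.* (suc a ℕ.* suc b)

  balanced-cases : ∀ {a b} → a ℕ.≤ b → Balanced a b → b ≡ a ⊎ b ≡ suc a
  balanced-cases {a} {b} a≤b bal = go (b ℕ.∸ a) (sym (ℕₚ.m+[n∸m]≡n a≤b))
    where
    go : ∀ d → b ≡ a ℕ.+ d → b ≡ a ⊎ b ≡ suc a
    go 0 e = inj₁ (trans e (ℕₚ.+-identityʳ a))
    go 1 e = inj₂ (trans e (ℕₚ.+-comm a 1))
    go (suc (suc d)) refl = ⊥-elim (ℕₚ.<⇒≱ (ℕₚ.<-≤-trans (ℕₚ.m<m+n (4 ℕ.* (suc a ℕ.* suc b)) {suc d ℕ.* (3 ℕ.+ d)} (s≤s z≤n)) (ℕₚ.≤-reflexive (Nn.solve 2 (λ a d →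
      let b = a Nn.:+ (Nn.con 2 Nn.:+ d); N = Nn.con 1 Nn.:+ (a Nn.:+ b) in
      Nn.con 4 Nn.:* ((Nn.con 1 Nn.:+ a) Nn.:* (Nn.con 1 Nn.:+ b)) Nn.:+ (Nn.con 1 Nn.:+ d) Nn.:* (Nn.con 3 Nn.:+ d) Nn.:= N Nn.:* (N Nn.:+ Nn.con 2)) refl a d))) bal)

  module _ {s ϑ₀ : ℕ} (2≤s : 2 ℕ.≤ s) (bound : 3 ℕ.* binom s 2 ℕ.< 16 ℕ.* ϑ₀ ℕ.∸ 1) (binom>0 : 0 ℕ.< 3 ℕ.* binom s 2) where
    private
      1≤s : 1 ℕ.≤ s
      1≤s = ℕₚ.≤-trans (s≤s z≤n) 2≤s

    -- For b = a one has 4Q = (N+1)², which is 1 modulo N. So N divides 4sQ and hence s, although N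
    -- = 2a + 1 > s.
    equal-⊥ : ∀ a → s ℕ.≤ a → Integral s a a → ⊥
    equal-⊥ a s≤a int = ℕₚ.<⇒≱ (ℕₚ.≤-trans (s≤s s≤a) (s≤s (ℕₚ.m≤m+n a a))) (∣⇒≤ {{ℕ.>-nonZero 1≤s}} N∣s)
      where
      open import Data.Nat.Combinatorics using (nC1≡n)
      N = suc (a ℕ.+ a)
      Q = suc a ℕ.* suc a
      N∣sQ : N ∣ s ℕ.* Q
      N∣sQ = subst₂ _∣_ (trans (ℕₚ.*-identityˡ _) (ℕₚ.+-identityʳ _))
        (cong₂ ℕ._*_ (nC1≡n s) (trans (ℕₚ.*-identityˡ _) (cong₂ ℕ._*_ (ℕₚ.+-comm a 1) (ℕₚ.+-comm a 1)))) (int 1 1≤s)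
      N∣s : N ∣ s
      N∣s = ∣m+n∣m⇒∣n (subst (N ∣_) (Nn.solve 2 (λ s a → let N = Nn.con 1 Nn.:+ (a Nn.:+ a) in
          Nn.con 4 Nn.:* (s Nn.:* ((Nn.con 1 Nn.:+ a) Nn.:* (Nn.con 1 Nn.:+ a))) Nn.:= s Nn.:* (Nn.con 2 Nn.:+ N) Nn.:* N Nn.:+ s) refl s a) (∣n⇒∣m*n 4 N∣sQ))
        (n∣m*n (s ℕ.* (2 ℕ.+ N)))

    -- For b = a + 1 one has ϑ = (a+2)/8, so ϑ ≥ ϑ₀ makes M = N + 1 = 2a + 3 at least 16ϑ₀ - 1. This
    -- is too large for the divisor of 3C(s,2) that the condition for j = 2 makes it.
    adjacent-⊥ : ∀ a → ¬ IsSmall ϑ₀ a (suc a) → Integral s a (suc a) → ⊥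
    adjacent-⊥ a ¬small int = ℕₚ.<⇒≱ bound (ℕₚ.≤-trans M-large (∣⇒≤ {{ℕ.>-nonZero binom>0}} M∣))
      where
      M = 3 ℕ.+ 2 ℕ.* a
      c = binom s 2
      X = (a ℕ.+ 1) ℕ.* (suc a ℕ.+ 1) ℕ.* ((a ℕ.+ 2) ℕ.* (suc a ℕ.+ 2))
      M∣cX : M ∣ c ℕ.* X
      M∣cX = ∣-trans (subst (M ∣_) (Nn.solve 1 (λ a → (Nn.con 2 Nn.:+ Nn.con 2 Nn.:* a) Nn.:* (Nn.con 3 Nn.:+ Nn.con 2 Nn.:* a) Nn.:=
          Nn.con 1 Nn.:* ((Nn.con 1 Nn.:+ (a Nn.:+ (Nn.con 1 Nn.:+ a))) Nn.:+ Nn.con 0) Nn.:* ((Nn.con 1 Nn.:+ (a Nn.:+ (Nn.con 1 Nn.:+ a))) Nn.:+ Nn.con 1)) refl a) (n∣m*n (2 ℕ.+ 2 ℕ.* a)))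
        (subst (λ x → rise (suc (a ℕ.+ suc a)) 2 ∣ c ℕ.* (x ℕ.* ((a ℕ.+ 2) ℕ.* (suc a ℕ.+ 2)))) (ℕₚ.*-identityˡ ((a ℕ.+ 1) ℕ.* (suc a ℕ.+ 1))) (int 2 2≤s))
      K = 8 ℕ.* (a ℕ.* a ℕ.* a) ℕ.+ 52 ℕ.* (a ℕ.* a) ℕ.+ 106 ℕ.* a ℕ.+ 65
      -- 16 X = (M-1)(M+1)²(M+3) is congruent to -3 modulo M
      M∣ : M ∣ 3 ℕ.* c
      M∣ = ∣m+n∣m⇒∣n (divides (K ℕ.* c) (Nn.solve 2 (λ c a → let M = Nn.con 3 Nn.:+ Nn.con 2 Nn.:* a in
          Nn.con 16 Nn.:* (c Nn.:* ((a Nn.:+ Nn.con 1) Nn.:* ((Nn.con 1 Nn.:+ a) Nn.:+ Nn.con 1) Nn.:* ((a Nn.:+ Nn.con 2) Nn.:* ((Nn.con 1 Nn.:+ a) Nn.:+ Nn.con 2)))) Nn.:+ Nn.con 3 Nn.:* c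
          Nn.:= (Nn.con 8 Nn.:* (a Nn.:* a Nn.:* a) Nn.:+ Nn.con 52 Nn.:* (a Nn.:* a) Nn.:+ Nn.con 106 Nn.:* a Nn.:+ Nn.con 65) Nn.:* c Nn.:* M) refl c a)) (∣n⇒∣m*n 16 M∣cX)
      8ϑ₀≤ : 8 ℕ.* ϑ₀ ℕ.≤ 2 ℕ.+ a
      8ϑ₀≤ = ℕₚ.*-cancelˡ-≤ (suc a ℕ.* suc a ℕ.* (2 ℕ.+ a)) (ℕₚ.≤-trans (ℕₚ.≤-reflexive (Nn.solve 2 (λ t a →
            (Nn.con 1 Nn.:+ a) Nn.:* (Nn.con 1 Nn.:+ a) Nn.:* (Nn.con 2 Nn.:+ a) Nn.:* (Nn.con 8 Nn.:* t) Nn.:=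
            let N = Nn.con 1 Nn.:+ (a Nn.:+ (Nn.con 1 Nn.:+ a)) in t Nn.:* (N Nn.:* N Nn.:* (N Nn.:+ Nn.con 2))) refl ϑ₀ a))
          (ℕₚ.≤-trans (ℕₚ.≮⇒≥ ¬small) (ℕₚ.≤-reflexive (Nn.solve 1 (λ a → let Q = (Nn.con 1 Nn.:+ a) Nn.:* (Nn.con 2 Nn.:+ a) in
            Q Nn.:* Q Nn.:= (Nn.con 1 Nn.:+ a) Nn.:* (Nn.con 1 Nn.:+ a) Nn.:* (Nn.con 2 Nn.:+ a) Nn.:* (Nn.con 2 Nn.:+ a)) refl a))))
      M-large : 16 ℕ.* ϑ₀ ℕ.∸ 1 ℕ.≤ M
      M-large = ℕₚ.≤-trans (ℕₚ.∸-monoˡ-≤ 1 (ℕₚ.≤-trans (ℕₚ.≤-reflexive (ℕₚ.*-assoc 2 8 ϑ₀)) (ℕₚ.*-monoʳ-≤ 2 8ϑ₀≤)))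
        (ℕₚ.≤-reflexive (cong (ℕ._∸ 1) (Nn.solve 1 (λ a → Nn.con 2 Nn.:* (Nn.con 2 Nn.:+ a) Nn.:= Nn.con 1 Nn.:+ (Nn.con 3 Nn.:+ Nn.con 2 Nn.:* a)) refl a)))

    balanced-⊥ : ∀ a b → s ℕ.≤ b → a ℕ.≤ b → Integral s a b → ¬ IsSmall ϑ₀ a b → Balanced a b → ⊥
    balanced-⊥ a b s≤b a≤b int large bal with balanced-cases a≤b bal
    ... | inj₁ refl = equal-⊥ a s≤b int
    ... | inj₂ refl = adjacent-⊥ a large int

    sum-integer : ∀ a b → Integral s a b → ∀ {G} → ν (suc (a ℕ.+ b)) * G ≡ ν (suc a ℕ.* suc b) → ∃[ e ] (ν s * G ≡ ν e)
    sum-integer a b int {G} NG with integral-1 s a b 1≤s int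
    ... | divides e eq = e , *-cancelˡ-≢0 (0<⇒≢0 (0<ι (a ℕ.+ b))) (begin
      ν N * (ν s * G)                 ≡⟨ S.solve 3 (λ n s g → n S.:* (s S.:* g) S.:= s S.:* (n S.:* g)) refl (ν N) (ν s) G ⟩
      ν s * (ν N * G)                 ≡⟨ trans (cong (ν s *_) NG) (sym (ι-ℕ* s (suc a ℕ.* suc b))) ⟩
      ν (s ℕ.* (suc a ℕ.* suc b))     ≡⟨ trans (cong ν eq) (trans (ι-ℕ* e N) (ℚₚ.*-comm (ν e) (ν N))) ⟩
      ν N * ν e                       ∎)
      where
      open ≡-Reasoning
      N = suc (a ℕ.+ b)

  -- `large` yields x ≥ 0 and `unbalanced`, that is 4Q < N(N+2), yields z > 0. The region depends on
  -- a and b only through N and Q and so is symmetric in them.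
  module LargeRegion (ϑ₀ a b : ℕ) (large : ¬ IsSmall ϑ₀ a b) (unbalanced : ¬ Balanced a b) where
    private
      N Q : ℕ
      N = suc (a ℕ.+ b)
      Q = suc a ℕ.* suc b
      n q p u : ℚ
      n = ν N
      q = ν Q
      p = n * (n + ν 2)
      u = ν 4 * q
      n>0 : 0ℚ < n
      n>0 = 0<ι (a ℕ.+ b)
      p>0 : 0ℚ < p
      p>0 = 0<* n>0 (0<+ n>0 (0≤ι 2))
      u>0 : 0ℚ < u
      u>0 = 0<* (0<ι 3) (0<ν {Q} (s≤s z≤n))
      n⁻¹ p⁻¹ u⁻¹ ϑ : ℚ
      n⁻¹ = n ⁻¹[ n>0 ]
      p⁻¹ = p ⁻¹[ p>0 ]
      u⁻¹ = u ⁻¹[ u>0 ]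
      ϑ = q * q * (n⁻¹ * p⁻¹)
      p-ℕ : ν (N ℕ.* (N ℕ.+ 2)) ≡ p
      p-ℕ = trans (ι-ℕ* N (N ℕ.+ 2)) (cong (n *_) (ν-+ N 2))
      u<p : u < p
      u<p = subst₂ _<_ (ι-ℕ* 4 Q) p-ℕ (ι-mono-< (ℤ.+<+ (ℕₚ.≰⇒> unbalanced)))
      ϑ₀≤ϑ : ν ϑ₀ ≤ ϑ
      ϑ₀≤ϑ = subst₂ _≤_ (trans (cong (_* (n⁻¹ * p⁻¹)) left) (trans (S.solve 5 (λ t n p i j → t S.:* (n S.:* p) S.:* (i S.:* j) S.:= t S.:* ((n S.:* i) S.:* (p S.:* j))) refl (ν ϑ₀) n p n⁻¹ p⁻¹)
          (trans (cong₂ (λ x y → ν ϑ₀ * (x * y)) (⁻¹-inverse n>0) (⁻¹-inverse p>0)) (ℚₚ.*-identityʳ (ν ϑ₀))))) (cong (_* (n⁻¹ * p⁻¹)) (ι-ℕ* Q Q))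
        (*-mono≤ʳ {r = n⁻¹ * p⁻¹} (ℚₚ.<⇒≤ (0<* (0<⁻¹ n>0) (0<⁻¹ p>0))) (ι-mono-≤ (ℤ.+≤+ (ℕₚ.≮⇒≥ large))))
        where
        left : ν (ϑ₀ ℕ.* (N ℕ.* N ℕ.* (N ℕ.+ 2))) ≡ ν ϑ₀ * (n * p)
        left = trans (ι-ℕ* ϑ₀ (N ℕ.* N ℕ.* (N ℕ.+ 2))) (cong (ν ϑ₀ *_) (trans (cong ν (ℕₚ.*-assoc N N (N ℕ.+ 2))) (trans (ι-ℕ* N (N ℕ.* (N ℕ.+ 2))) (cong (n *_) p-ℕ))))
      z : ℚ
      z = (p - u) * u⁻¹
      1+z : 1ℚ + z ≡ p * u⁻¹
      1+z = trans (cong (_+ z) (sym (⁻¹-inverse u>0))) (S.solve 3 (λ p u i → u S.:* i S.:+ (p S.:- u) S.:* i S.:= p S.:* i) refl p u u⁻¹)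

    region : Region ϑ₀
    region = record
      { x = ϑ - ν ϑ₀
      ; z = z
      ; ρ = (p - u) * p⁻¹
      ; x≥0 = ≤⇒0≤- ϑ₀≤ϑ
      ; z>0 = 0<* (<⇒0<- u<p) (0<⁻¹ u>0)
      ; ρ-def = trans (cong ((p - u) * p⁻¹ *_) 1+z) (trans (S.solve 4 (λ d p i j → d S.:* j S.:* (p S.:* i) S.:= (p S.:* j) S.:* (d S.:* i)) refl (p - u) p u⁻¹ p⁻¹)
          (trans (cong (_* z) (⁻¹-inverse p>0)) (ℚₚ.*-identityˡ z))) }

    private
      ϑ≡ : Region.ϑ region ≡ ϑ
      ϑ≡ = S.solve 2 (λ t x → t S.:+ (x S.:- t) S.:= x) refl (ν ϑ₀) ϑ

    region-G : n * Region.G region ≡ q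
    region-G = begin
      n * (ν 4 * (Region.ϑ region * (1ℚ + z)))   ≡⟨ cong₂ (λ t y → n * (ν 4 * (t * y))) ϑ≡ 1+z ⟩
      n * (ν 4 * (ϑ * (p * u⁻¹)))                ≡⟨ S.solve 7 (λ n f q i j p k → n S.:* (f S.:* (q S.:* q S.:* (i S.:* j) S.:* (p S.:* k))) S.:= (n S.:* i) S.:* (p S.:* j) S.:* ((f S.:* q) S.:* k) S.:* q) refl n (ν 4) q n⁻¹ p⁻¹ p u⁻¹ ⟩
      (n * n⁻¹) * (p * p⁻¹) * (u * u⁻¹) * q      ≡⟨ trans (cong₂ (λ x y → x * y * (u * u⁻¹) * q) (⁻¹-inverse n>0) (⁻¹-inverse p>0)) (cong (λ x → 1ℚ * 1ℚ * x * q) (⁻¹-inverse u>0)) ⟩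
      1ℚ * 1ℚ * 1ℚ * q                           ≡⟨ S.solve 1 (λ q → S.con 1ℚ S.:* S.con 1ℚ S.:* S.con 1ℚ S.:* q S.:= q) refl q ⟩
      q ∎
      where open ≡-Reasoning

    region-N : Region.N region ≡ n
    region-N = begin
      ι -[1+ 1 ] + ν 16 * (Region.ϑ region * ((1ℚ + z) * (1ℚ + z)))  ≡⟨ cong₂ (λ e f → e + f * (Region.ϑ region * ((1ℚ + z) * (1ℚ + z)))) (ι-neg (pos 2)) (ι-ℕ* 4 4) ⟩
      - ν 2 + ν 4 * ν 4 * (Region.ϑ region * ((1ℚ + z) * (1ℚ + z)))  ≡⟨ cong₂ (λ t y → - ν 2 + ν 4 * ν 4 * (t * (y * y))) ϑ≡ 1+z ⟩
      - ν 2 + ν 4 * ν 4 * (ϑ * ((p * u⁻¹) * (p * u⁻¹)))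
        ≡⟨ cong (- ν 2 +_) (S.solve 6 (λ f q i j k p → f S.:* f S.:* (q S.:* q S.:* (i S.:* j) S.:* ((p S.:* k) S.:* (p S.:* k)))
             S.:= ((f S.:* q) S.:* k) S.:* ((f S.:* q) S.:* k) S.:* (p S.:* j) S.:* (i S.:* p)) refl (ν 4) q n⁻¹ p⁻¹ u⁻¹ p) ⟩
      - ν 2 + (u * u⁻¹) * (u * u⁻¹) * (p * p⁻¹) * (n⁻¹ * p)
        ≡⟨ trans (cong₂ (λ x y → - ν 2 + (u * u⁻¹) * (u * u⁻¹) * x * y) (⁻¹-inverse p>0)
             (trans (S.solve 3 (λ n i m → i S.:* (n S.:* m) S.:= (n S.:* i) S.:* m) refl n n⁻¹ (n + ν 2)) (cong (_* (n + ν 2)) (⁻¹-inverse n>0)))) (cong (λ x → - ν 2 + x * x * 1ℚ * (1ℚ * (n + ν 2))) (⁻¹-inverse u>0)) ⟩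
      - ν 2 + 1ℚ * 1ℚ * 1ℚ * (1ℚ * (n + ν 2))   ≡⟨ S.solve 2 (λ n t → S.:- t S.:+ S.con 1ℚ S.:* S.con 1ℚ S.:* S.con 1ℚ S.:* (S.con 1ℚ S.:* (n S.:+ t)) S.:= n) refl n (ν 2) ⟩
      n ∎
      where open ≡-Reasoning

  Excludes : ℕ → ℕ → Set
  Excludes s ϑ₀ = (rg : Region ϑ₀) (δs : List ℤ) (κ : ℚ) → 0ℚ < κ →
    (∀ l p → horner ℚ-raw s (Region.N rg) (Region.G rg) l (l * p) ≡ (κ * l ^ s) * roots→poly δs p) →
    ∀ e → ν s * Region.G rg ≡ ν e → ⊥

  module _ {s ϑ₀ : ℕ} (2≤s : 2 ℕ.≤ s) (C2 : 2 ℕ.* binom s 2 ≡ s ℕ.* (s ℕ.∸ 1)) (bound : 3 ℕ.* binom s 2 ℕ.< 16 ℕ.* ϑ₀ ℕ.∸ 1) (binom>0 : 0 ℕ.< 3 ℕ.* binom s 2)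
           (dense : dense-search s ϑ₀ ≡ true) (sparse : sparse-search s ϑ₀ ≡ true) (excludes : Excludes s ϑ₀) where
    private
      1≤s : 1 ℕ.≤ s
      1≤s = ℕₚ.≤-trans (s≤s z≤n) 2≤s

      small-⊥ : ∀ a b → 1 ℕ.≤ a → a ℕ.≤ b → Integral s a b → IsSmall ϑ₀ a b → ⊥
      small-⊥ a b 1≤a a≤b int small = [ Dense.contradiction s ϑ₀ a b 1≤s a≤b int small dense , Sparse.contradiction s ϑ₀ a b 2≤s C2 1≤a int small sparse ]′
        (ℕₚ.≤-<-connex (suc (a ℕ.+ b)) (8 ℕ.* a))

    splits-⊥ : ∀ a b → s ℕ.≤ a → 1 ℕ.≤ b → ∀ δs → length δs ≡ s → (∀ x → Expansion.polynomial s a b x ≡ Expansion.leading s a b * roots→poly δs x) → ⊥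
    splits-⊥ a b s≤a 1≤b δs degree splits = by-size (suc a ℕ.* suc b ℕ.* (suc a ℕ.* suc b) ℕₚ.<? ϑ₀ ℕ.* (suc (a ℕ.+ b) ℕ.* suc (a ℕ.+ b) ℕ.* (suc (a ℕ.+ b) ℕ.+ 2)))
      where
      open Expansion s a b using (leading; leading>0; module Split)
      open Split δs degree splits
      by-balance : ¬ IsSmall ϑ₀ a b → Dec (Balanced a b) → ⊥
      by-balance large (yes bal) = [ (λ a≤b → balanced-⊥ {s} {ϑ₀} 2≤s bound binom>0 a b (ℕₚ.≤-trans s≤a a≤b) a≤b integral large bal) ,
        (λ b≤a → balanced-⊥ {s} {ϑ₀} 2≤s bound binom>0 b a s≤a b≤a (Integral-swap integral) (λ small → large (IsSmall-swap {ϑ₀} {b} {a} small))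
          (subst₂ (λ n q → suc n ℕ.* (suc n ℕ.+ 2) ℕ.≤ 4 ℕ.* q) (ℕₚ.+-comm a b) (ℕₚ.*-comm (suc a) (suc b)) bal)) ]′ (ℕₚ.≤-total a b)
      by-balance large (no unbalanced) = excludes region δs leading leading>0
        (λ l p → trans (cong (λ n → horner ℚ-raw s n (Region.G region) l (l * p)) region-N) (form region-G l p))
        (proj₁ e) (proj₂ e)
        where
        open LargeRegion ϑ₀ a b large unbalanced
        e = sum-integer {s} {ϑ₀} 2≤s bound binom>0 a b integral region-G
      by-size : Dec (IsSmall ϑ₀ a b) → ⊥
      by-size (yes small) = [ (λ a≤b → small-⊥ a b (ℕₚ.≤-trans 1≤s s≤a) a≤b integral small) ,
        (λ b≤a → small-⊥ b a 1≤b b≤a (Integral-swap integral) (IsSmall-swap {ϑ₀} {a} {b} small)) ]′ (ℕₚ.≤-total a b)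
      by-size (no large) = by-balance large (_ ℕₚ.≤? _)

    no-tight : ∀ v k λ' ℬ → ¬ IsNontrivialTightDesign s v k λ' ℬ
    no-tight v k λ' ℬ (tight , k+s<v) = splits-⊥ a b s≤a b>0 (proj₁ result) (proj₁ (proj₂ result)) (proj₂ (proj₂ result))
      where
      open IsTightDesign tight
      a = k ℕ.∸ s
      b = v ℕ.∸ (k ℕ.+ s)
      s≤k : s ℕ.+ s ℕ.≤ k
      s≤k = ℕₚ.≤-trans (ℕₚ.≤-reflexive (cong (s ℕ.+_) (sym (ℕₚ.+-identityʳ s)))) (IsDesign.t≤k design)
      k≡ : k ≡ a ℕ.+ s
      k≡ = sym (ℕₚ.m∸n+n≡m (ℕₚ.≤-trans (ℕₚ.m≤m+n s s) s≤k))
      s≤a : s ℕ.≤ a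
      s≤a = ℕₚ.m+n≤o⇒m≤o∸n s s≤k
      v≡ : v ≡ a ℕ.+ b ℕ.+ 2 ℕ.* s
      v≡ = trans (sym (ℕₚ.m∸n+n≡m v≥k+s)) (trans (cong (λ k → b ℕ.+ (k ℕ.+ s)) k≡) (Nn.solve 3 (λ a b s → b Nn.:+ (a Nn.:+ s Nn.:+ s) Nn.:= a Nn.:+ b Nn.:+ Nn.con 2 Nn.:* s) refl a b s))
      b>0 : 1 ℕ.≤ b
      b>0 = ℕₚ.m<n⇒0<n∸m k+s<v
      result = tight-splits k≡ v≡ b>0 s≤a 1≤s design numBlocks

  odd-excludes : ∀ {s ϑ₀} → 0 ℕ.< ϑ₀ → OddCert ϑ₀ s → Excludes s ϑ₀
  odd-excludes {s} ϑ₀>0 cert rg δs κ κ>0 form _ _ = Contradiction.odd-⊥ rg ϑ₀>0 s δs κ κ>0 form cert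

  excludes-8 : Excludes 8 25
  excludes-8 rg δs κ κ>0 form _ _ = Contradiction.even-⊥ rg (s≤s z≤n) 8 δs κ κ>0 form cert8 (ℤ.+≤+ (ℕₚ.≤ᵇ⇒≤ 990 1000 tt))

  -- Six times the mean is 15 + 6G: the factor 6 removes the half of 5/2, and 6G is an integer
  -- because N divides 6Q. This is the integrality that `six-⊥` asks for.
  excludes-6 : Excludes 6 30
  excludes-6 rg δs κ κ>0 form e eq = Contradiction.six-⊥ rg (s≤s z≤n) 6 δs κ κ>0 form cert6 refl refl (pos (15 ℕ.+ e)) (begin
    ν 6 * (ν 5 * ℚ.½ + Region.G rg)            ≡⟨ ℚₚ.*-distribˡ-+ (ν 6) (ν 5 * ℚ.½) (Region.G rg) ⟩
    ν 6 * (ν 5 * ℚ.½) + ν 6 * Region.G rg      ≡⟨ cong₂ _+_ (trans (cong (_* (ν 5 * ℚ.½)) (ι-ℕ* 3 2)) (S.solve 4 (λ a b c d → a S.:* b S.:* (c S.:* d) S.:= a S.:* c S.:* (b S.:* d)) refl (ν 3) (ν 2) (ν 5) ℚ.½)) eq ⟩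
    ν 3 * ν 5 * (ν 2 * ℚ.½) + ν e              ≡⟨ cong (_+ ν e) (trans (cong₂ _*_ (sym (ι-ℕ* 3 5)) ι-2½) (ℚₚ.*-identityʳ (ν 15))) ⟩
    ν 15 + ν e                                 ≡⟨ sym (ν-+ 15 e) ⟩
    ν (15 ℕ.+ e)                               ∎)
    where open ≡-Reasoning

-- The five values of s.

open import Defs
open import Data.Nat using (ℕ; zero; suc; _≤_; s≤s; z≤n)
open import Data.Nat.Properties using (<ᵇ⇒<)
open import Data.Fin.Subset using (Subset)
open import Data.List using (List)
open import Data.Unit using (tt)
open import Relation.Nullary using (¬_)
open import Relation.Binary.PropositionalEquality using (refl)
open Certificates
open Searches
open Exclusion

theorem3p6 : (s : ℕ) → 5 ≤ s → s ≤ 9 →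
    (v k λ' : ℕ) (ℬ : List (Subset v)) → ¬ IsNontrivialTightDesign s v k λ' ℬ
-- The two numbers compared in each of these clauses are 3C(s,2) and 16ϑ₀ - 1.
theorem3p6 5 _ _ = no-tight {5} {20} (s≤s (s≤s z≤n)) refl (<ᵇ⇒< 30 319 tt) (s≤s z≤n) dense-5 sparse-5 (odd-excludes (s≤s z≤n) cert5)
theorem3p6 6 _ _ = no-tight {6} {30} (s≤s (s≤s z≤n)) refl (<ᵇ⇒< 45 479 tt) (s≤s z≤n) dense-6 sparse-6 excludes-6
theorem3p6 7 _ _ = no-tight {7} {20} (s≤s (s≤s z≤n)) refl (<ᵇ⇒< 63 319 tt) (s≤s z≤n) dense-7 sparse-7 (odd-excludes (s≤s z≤n) cert7)
theorem3p6 8 _ _ = no-tight {8} {25} (s≤s (s≤s z≤n)) refl (<ᵇ⇒< 84 399 tt) (s≤s z≤n) dense-8 sparse-8 excludes-8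
theorem3p6 9 _ _ = no-tight {9} {20} (s≤s (s≤s z≤n)) refl (<ᵇ⇒< 108 319 tt) (s≤s z≤n) dense-9 sparse-9 (odd-excludes (s≤s z≤n) cert9)
theorem3p6 (suc (suc (suc (suc (suc (suc (suc (suc (suc (suc _)))))))))) _ (s≤s (s≤s (s≤s (s≤s (s≤s (s≤s (s≤s (s≤s (s≤s ())))))))))
theorem3p6 0 ()
theorem3p6 1 (s≤s ())
theorem3p6 2 (s≤s (s≤s ()))
theorem3p6 3 (s≤s (s≤s (s≤s ())))
theorem3p6 4 (s≤s (s≤s (s≤s (s≤s ()))))
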